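{- Let $A=(q,q^4;q^5)_\infty$, $B=(q^2,q^3;q^5)_\infty$, $E_1=(q;q)_\infty$, $E_5=(q^5;q^5)_\infty$ and $S=\sum_{n=-\infty}^{\infty}(-1)^n n\, q^{n(5n+1)/2}$. Then \begin{align*} &\sum_{n\geq0}\big[NB_{3}(1,5,5n)-NB_{3}(4,5,5n)+2NB_{3}(2,5,5n)-2NB_{3}(3,5,5n)\big]q^n\\ &=\frac{B\,E_5}{2A^3}-\frac{B\,E_5^2}{2E_1^5A^3}-5\frac{B\,E_5^2}{E_1^6A^2}\,S+\frac{15q\,B\,E_5^7}{2E_1^6A^3}\Big(4+3q\frac{A^5}{B^5}\Big)-\frac{5q\,E_5^5}{2E_1^6B}. \end{align*}
   Context: Notation: $(a;q)_\infty=\prod_{n\ge0}(1-aq^n)$ and $(a_1,\dots,a_t;q)_\infty=(a_1;q)_\infty\cdots(a_t;q)_\infty$; identities are of formal power series in $q$ (equivalently analytic for $|q|<1$). For $k\ge2$, a $k$-colored partition of $n\ge0$ is a $k$-tuple $\pi=(\pi^{(1)},\dots,\pi^{(k)})$ of ordinary partitions with $|\pi^{(1)}|+\cdots+|\pi^{(k)}|=n$ (written $\pi\vdash n$); $\#(\pi^{(i)})$ is the number of parts of $\pi^{(i)}$, and $\mathrm{crank}_k(\pi)=\#(\pi^{(1)})-\#(\pi^{(2)})$. For $k\ge2$, $j\ge2$, $0\le m\le j-1$, $n\ge0$, $$NB_k(m,j,n)=\sum_{\pi\vdash n,\ \mathrm{crank}_k(\pi)\equiv m \pmod j}\#(\pi^{(1)}).$$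 -}

module Defs where

open import Data.Nat as ℕ using (ℕ; zero; suc; _∸_; _≤?_; NonZero)
open import Data.Integer as ℤ using (ℤ; +_; -[1+_]; _%ℕ_)
open import Data.Rational as ℚ using (ℚ; 0ℚ; 1ℚ; _/_)
open import Data.List using (List; []; _∷_; _++_; map; concatMap; length; upTo; filter; foldr; replicate)
open import Data.Vec using (Vec; []; _∷_)
open import Data.Bool using (Bool; true; false; if_then_else_)
open import Relation.Nullary.Decidable using (does)

partsLe : ℕ → ℕ → List (List ℕ)
partsLe zero    zero    = [] ∷ []
partsLe (suc n) zero    = []
partsLe n       (suc b) =
  concatMap (λ c → map (replicate c (suc b) ++_) (partsLe (n ∸ c ℕ.* suc b) b))
            (filter (λ c → c ℕ.* suc b ≤? n) (upTo (suc n)))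

partitions : ℕ → List (List ℕ)
partitions n = partsLe n n

coloredPartitions : (k : ℕ) → ℕ → List (Vec (List ℕ) k)
coloredPartitions zero    zero    = [] ∷ []
coloredPartitions zero    (suc n) = []
coloredPartitions (suc k) n =
  concatMap (λ i → concatMap (λ π → map (π ∷_) (coloredPartitions k (n ∸ i)))
                             (partitions i))
            (upTo (suc n))

crank : ∀ {k} → Vec (List ℕ) (suc (suc k)) → ℤ
crank (π₁ ∷ π₂ ∷ _) = + length π₁ ℤ.- + length π₂

firstCount : ∀ {k} → Vec (List ℕ) (suc (suc k)) → ℕ
firstCount (π₁ ∷ _) = length π₁

-- NB_k(m,j,n) for k = k' + 2 colours and modulus j (with j ≥ 2 in the paper)
NB : (k' : ℕ) (m j n : ℕ) → .{{NonZero j}} → ℕ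
NB k' m j n =
  foldr ℕ._+_ 0
    (map firstCount
      (filter (λ π → (crank π %ℕ j) ℕ.≟ m) (coloredPartitions (suc (suc k')) n)))

Series : Set
Series = ℕ → ℚ

sumℚ : List ℚ → ℚ
sumℚ = foldr ℚ._+_ 0ℚ

ℕ→ℚ : ℕ → ℚ
ℕ→ℚ n = + n / 1

ℤ→ℚ : ℤ → ℚ
ℤ→ℚ z = z / 1

const : ℚ → Series
const c zero    = c
const c (suc _) = 0ℚ

oneS : Series
oneS = const 1ℚ

_⊕_ : Series → Series → Series
(f ⊕ g) n = f n ℚ.+ g n

_⊖_ : Series → Series → Series
(f ⊖ g) n = f n ℚ.- g n

_·_ : ℚ → Series → Series
(c · f) n = c ℚ.* f n

_⊛_ : Series → Series → Series
(f ⊛ g) n = sumℚ (map (λ i → f i ℚ.* g (n ∸ i)) (upTo (suc n)))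

infixl 6 _⊕_ _⊖_
infixl 7 _⊛_ _·_

qS : Series → Series
qS f zero    = 0ℚ
qS f (suc n) = f n

_^S_ : Series → ℕ → Series
f ^S zero  = oneS
f ^S suc e = f ⊛ (f ^S e)

mono : ℕ → Series
mono e n = if does (n ℕ.≟ e) then 1ℚ else 0ℚ

prodS : List Series → Series
prodS = foldr _⊛_ oneS

-- (q^a ; q^d)_∞ = ∏_{n≥0} (1 - q^{a+dn}), for a ≥ 1, d ≥ 1.
-- Its coefficient of q^N only involves the factors with n ≤ N (their
-- exponents a+dn ≥ n+1), so it is the coefficient of the finite product.
qPoch : ℕ → ℕ → Series
qPoch a d N = prodS (map (λ n → oneS ⊖ mono (a ℕ.+ d ℕ.* n)) (upTo (suc N))) N

-- multiplicative inverse of a series f with constant term 1: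
-- 1/f = Σ_{k≥0} (1 - f)^k, and (1-f)^k has order ≥ k.
invS : Series → Series
invS f N = sumℚ (map (λ k → ((oneS ⊖ f) ^S k) N) (upTo (suc N)))

A : Series
A = qPoch 1 5 ⊛ qPoch 4 5

B : Series
B = qPoch 2 5 ⊛ qPoch 3 5

E₁ : Series
E₁ = qPoch 1 1

E₅ : Series
E₅ = qPoch 5 5

signℤ : ℤ → ℚ
signℤ z = if does (ℤ.∣ z ∣ ℕ.% 2 ℕ.≟ 0) then 1ℚ else ℚ.- 1ℚ

-- S = Σ_{n ∈ ℤ} (-1)^n n q^{n(5n+1)/2}.  Since n(5n+1)/2 ≥ |n|, the
-- coefficient of q^N only involves -N ≤ n ≤ N.
Sterm : ℕ → ℤ → ℚ
Sterm N z = if does (z ℤ.* (+ 5 ℤ.* z ℤ.+ + 1) ℤ.≟ + (2 ℕ.* N))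
              then signℤ z ℚ.* ℤ→ℚ z else 0ℚ

S : Series
S N = sumℚ (map (λ i → Sterm N (+ i)) (upTo (suc N)))
      ℚ.+ sumℚ (map (λ i → Sterm N (-[1+ i ])) (upTo N))

LHS : Series
LHS n = ℕ→ℚ (NB 1 1 5 (5 ℕ.* n)) ℚ.- ℕ→ℚ (NB 1 4 5 (5 ℕ.* n))
        ℚ.+ ℕ→ℚ 2 ℚ.* ℕ→ℚ (NB 1 2 5 (5 ℕ.* n))
        ℚ.- ℕ→ℚ 2 ℚ.* ℕ→ℚ (NB 1 3 5 (5 ℕ.* n))

RHS : Series
RHS =
      (+ 1 / 2) · (B ⊛ E₅ ⊛ invS (A ^S 3))
    ⊖ (+ 1 / 2) · (B ⊛ (E₅ ^S 2) ⊛ invS ((E₁ ^S 5) ⊛ (A ^S 3)))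
    ⊖ (+ 5 / 1) · (B ⊛ (E₅ ^S 2) ⊛ invS ((E₁ ^S 6) ⊛ (A ^S 2)) ⊛ S)
    ⊕ (+ 15 / 2) · (qS (B ⊛ (E₅ ^S 7) ⊛ invS ((E₁ ^S 6) ⊛ (A ^S 3)))
                    ⊛ ((+ 4 / 1) · oneS ⊕ (+ 3 / 1) · qS ((A ^S 5) ⊛ invS (B ^S 5))))
    ⊖ (+ 5 / 2) · qS ((E₅ ^S 5) ⊛ invS ((E₁ ^S 6) ⊛ B))

{-# OPTIONS --safe #-}
module Submission where

-- Weighting a three-coloured partition by (ζ + ζε)^#π¹ ζ^-#π², with ε² = 0 and ζ⁵ = 1, gives a generating
-- function whose ε-part is Σ ζᵏ qᵏⁿ / Θ(ζ), summed over k, n ≥ 1, where Θ(ζ) = (ζq, ζ⁻¹q, q; q)_∞. Jacobi's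
-- triple product dissects Θ(ζ) as b + η′a, with η′ = ζ² + ζ⁻² and a, b supported on one residue class
-- modulo 5 each; multiplying by the conjugate b + ηa makes the denominator rational. The functional ζᵐ ↦ m
-- (|m| ≤ 2) then leaves a combination of two Lambert series L₁, L₂ over b² − ab − a². Differentiating the
-- triple product in ζ expresses Θ(ζ) times a Lambert series as a theta series, and its 5-dissection,
-- separated along ζ − ζ⁻¹ and ζ² − ζ⁻², yields two linear relations F = G = 0 between L₁(q), L₂(q) and
-- L₁(q⁵), L₂(q⁵). Their sections determine the required section of the quotient by elimination; Ramanujan's
-- identity 1/r⁵ − 11 − r⁵ = E₁⁶/(qE₅⁶), needed to simplify, is a consequence of the same relations.

open import Level using (0ℓ)
open import Algebra using (CommutativeRing; CommutativeMonoid; IsCommutativeMonoid; RawRing)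
open import Algebra.Solver.Ring.AlmostCommutativeRing using (fromCommutativeRing; _-Raw-AlmostCommutative⟶_)
import Algebra.Solver.Ring as RingSolver
import Algebra.Properties.Ring as RingProperties
import Algebra.Properties.AbelianGroup as AbelianGroupProperties
import Algebra.Properties.Semiring.Exp as SemiringExp
import Algebra.Properties.Semiring.Mult.TCOptimised as SemiringMult
open import Data.Bool using (true; false; if_then_else_)
open import Data.Empty using (⊥; ⊥-elim)
open import Data.Integer as ℤ using (ℤ; +_; -[1+_]; _%ℕ_)
import Data.Integer.Properties as ℤₚ
import Data.Integer.Solver as ℤSolver
open import Data.List using (List; []; _∷_; map; foldr; upTo; applyUpTo; concatMap; filter; length; replicate; _++_)
open import Data.List.Properties using (length-++; length-replicate)
open import Data.Maybe using (Maybe; just; nothing)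
open import Data.Nat as ℕ using (ℕ; zero; suc; _∸_; _≤_; _<_; z≤n; s≤s)
open import Data.Nat.Divisibility using (_∣_; divides; ∣m+n∣m⇒∣n; n∣m*n; ∣⇒≤)
import Data.Nat.DivMod as DivMod
open import Data.Nat.Primality using (Prime; prime?; euclidsLemma)
import Data.Nat.Properties as ℕₚ
open import Data.Nat.Solver using (module +-*-Solver)
open import Data.Product using (_×_; _,_; proj₁; proj₂)
open import Data.Rational as ℚ using (ℚ; 0ℚ; 1ℚ; _/_)
import Data.Rational.Properties as ℚₚ
import Data.Rational.Unnormalised as ℚᵘ
import Data.Rational.Unnormalised.Properties as ℚᵘₚ
open import Data.Sum using (_⊎_; inj₁; inj₂; [_,_]′)
open import Data.Vec using (Vec; []; _∷_)
open import Relation.Binary.PropositionalEquality as ≡ using (_≡_; _≢_)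
import Relation.Binary.Reasoning.Setoid as SetoidReasoning
open import Relation.Nullary using (Dec; does; yes; no)
open import Relation.Nullary.Decidable using (from-yes; dec-true; dec-false)
import Defs
open import Defs using (partsLe; partitions; coloredPartitions; crank; firstCount; NB; ℕ→ℚ; LHS; RHS)

module IntegerMultiples (R : CommutativeRing 0ℓ 0ℓ) where
  open CommutativeRing R using (_*_; _+_; _-_; _≈_; +-abelianGroup; +-assoc; +-comm; +-cong; +-congʳ; +-congˡ; +-identityʳ; +-identityˡ; -_; -‿cong; -‿inverseʳ; 0#; 1#; Carrier; refl; reflexive; ring; semiring; setoid; sym; trans; zero)
  open RingProperties ring using (-‿distribʳ-*; -‿distribˡ-*)
  open AbelianGroupProperties +-abelianGroup using (⁻¹-∙-comm; ⁻¹-involutive; ε⁻¹≈ε)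
  open SemiringMult semiring using (×-homo-+; ×1-homo-*) renaming (_×_ to _⨯_)
  open SetoidReasoning setoid

  fromℕ : ℕ → Carrier
  fromℕ n = n ⨯ 1#

  fromℤ : ℤ → Carrier
  fromℤ (+ n)    = fromℕ n
  fromℤ -[1+ n ] = - fromℕ (suc n)

  fromℕ-suc : ∀ n → fromℕ (suc n) ≈ 1# + fromℕ n
  fromℕ-suc n = ×-homo-+ 1# 1 n

  fromℕ-+ : ∀ m n → fromℕ (m ℕ.+ n) ≈ fromℕ m + fromℕ n
  fromℕ-+ = ×-homo-+ 1#

  fromℤ-neg : ∀ i → fromℤ (ℤ.- i) ≈ - fromℤ i
  fromℤ-neg (+ zero)    = sym ε⁻¹≈ε
  fromℤ-neg (+ (suc n)) = refl
  fromℤ-neg -[1+ n ]    = sym (⁻¹-involutive _)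

  fromℤ-⊖ : ∀ m n → fromℤ (m ℤ.⊖ n) ≈ fromℕ m - fromℕ n
  fromℤ-⊖ m zero = begin
    fromℤ (m ℤ.⊖ 0)    ≡⟨ ≡.cong fromℤ (ℤₚ.⊖-≥ {m} {0} z≤n) ⟩
    fromℕ m          ≈⟨ +-identityʳ _ ⟨
    fromℕ m + 0#     ≈⟨ +-congˡ ε⁻¹≈ε ⟨
    fromℕ m + - 0#   ∎
  fromℤ-⊖ zero (suc n) = sym (+-identityˡ _)
  fromℤ-⊖ (suc m) (suc n) = begin
    fromℤ (suc m ℤ.⊖ suc n)                    ≡⟨ ≡.cong fromℤ (ℤₚ.[1+m]⊖[1+n]≡m⊖n m n) ⟩
    fromℤ (m ℤ.⊖ n)                            ≈⟨ fromℤ-⊖ m n ⟩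
    fromℕ m - fromℕ n                        ≈⟨ +-congʳ (+-identityˡ _) ⟨
    (0# + fromℕ m) - fromℕ n                 ≈⟨ +-congʳ (+-congʳ (-‿inverseʳ 1#)) ⟨
    ((1# - 1#) + fromℕ m) - fromℕ n          ≈⟨ +-congʳ (+-assoc _ _ _) ⟩
    (1# + (- 1# + fromℕ m)) - fromℕ n        ≈⟨ +-congʳ (+-congˡ (+-comm _ _)) ⟩
    (1# + (fromℕ m + - 1#)) - fromℕ n        ≈⟨ +-congʳ (+-assoc _ _ _) ⟨
    (1# + fromℕ m) + - 1# - fromℕ n          ≈⟨ +-assoc _ _ _ ⟩
    (1# + fromℕ m) + (- 1# - fromℕ n)        ≈⟨ +-congˡ (⁻¹-∙-comm _ _) ⟩
    (1# + fromℕ m) - (1# + fromℕ n)          ≈⟨ +-cong (fromℕ-suc m) (-‿cong (fromℕ-suc n)) ⟨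
    fromℕ (suc m) - fromℕ (suc n)            ∎

  fromℤ-+ : ∀ i j → fromℤ (i ℤ.+ j) ≈ fromℤ i + fromℤ j
  fromℤ-+ (+ m)    (+ n)    = fromℕ-+ m n
  fromℤ-+ (+ m)    -[1+ n ] = fromℤ-⊖ m (suc n)
  fromℤ-+ -[1+ m ] (+ n)    = trans (fromℤ-⊖ n (suc m)) (+-comm _ _)
  fromℤ-+ -[1+ m ] -[1+ n ] = begin
    - fromℕ (suc (suc (m ℕ.+ n)))            ≡⟨ ≡.cong (λ k → - fromℕ (suc k)) (ℕₚ.+-suc m n) ⟨
    - fromℕ (suc m ℕ.+ suc n)                ≈⟨ -‿cong (fromℕ-+ (suc m) (suc n)) ⟩
    - (fromℕ (suc m) + fromℕ (suc n))        ≈⟨ ⁻¹-∙-comm _ _ ⟨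
    - fromℕ (suc m) - fromℕ (suc n)          ∎

  fromℤ-pos* : ∀ m j → fromℤ (+ m ℤ.* j) ≈ fromℕ m * fromℤ j
  fromℤ-pos* m (+ n) = begin
    fromℤ (+ m ℤ.* + n)   ≡⟨ ≡.cong fromℤ (ℤₚ.pos-* m n) ⟨
    fromℕ (m ℕ.* n)       ≈⟨ ×1-homo-* m n ⟩
    fromℕ m * fromℕ n     ∎
  fromℤ-pos* m -[1+ n ] = begin
    fromℤ (+ m ℤ.* (ℤ.- + suc n))   ≡⟨ ≡.cong fromℤ (ℤₚ.neg-distribʳ-* (+ m) (+ suc n)) ⟨
    fromℤ (ℤ.- (+ m ℤ.* + suc n))   ≈⟨ fromℤ-neg (+ m ℤ.* + suc n) ⟩
    - fromℤ (+ m ℤ.* + suc n)       ≈⟨ -‿cong (fromℤ-pos* m (+ suc n)) ⟩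
    - (fromℕ m * fromℕ (suc n))     ≈⟨ -‿distribʳ-* _ _ ⟩
    fromℕ m * - fromℕ (suc n)       ∎

  fromℤ-* : ∀ i j → fromℤ (i ℤ.* j) ≈ fromℤ i * fromℤ j
  fromℤ-* (+ m) j = fromℤ-pos* m j
  fromℤ-* -[1+ m ] j = begin
    fromℤ ((ℤ.- + suc m) ℤ.* j)   ≡⟨ ≡.cong fromℤ (ℤₚ.neg-distribˡ-* (+ suc m) j) ⟨
    fromℤ (ℤ.- (+ suc m ℤ.* j))   ≈⟨ fromℤ-neg (+ suc m ℤ.* j) ⟩
    - fromℤ (+ suc m ℤ.* j)       ≈⟨ -‿cong (fromℤ-pos* (suc m) j) ⟩
    - (fromℕ (suc m) * fromℤ j)   ≈⟨ -‿distribˡ-* _ _ ⟩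
    (- fromℕ (suc m)) * fromℤ j   ∎

  ℤ-rawRing : RawRing 0ℓ 0ℓ
  ℤ-rawRing = record
    { Carrier = ℤ ; _≈_ = _≡_ ; _+_ = ℤ._+_ ; _*_ = ℤ._*_ ; -_ = ℤ.-_ ; 0# = + 0 ; 1# = + 1 }

  ℤ-morphism : ℤ-rawRing -Raw-AlmostCommutative⟶ fromCommutativeRing R
  ℤ-morphism = record
    { ⟦_⟧ = fromℤ ; +-homo = fromℤ-+ ; *-homo = fromℤ-* ; -‿homo = fromℤ-neg
    ; 0-homo = refl ; 1-homo = refl }

  fromℤ-≟ : ∀ i j → Maybe (fromℤ i ≈ fromℤ j)
  fromℤ-≟ i j with i ℤ.≟ j
  ... | yes i≡j = just (reflexive (≡.cong fromℤ i≡j))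
  ... | no  _   = nothing

module IntegerSolver (R : CommutativeRing 0ℓ 0ℓ) where
  open IntegerMultiples R using (fromℤ-≟; ℤ-morphism; ℤ-rawRing)
  open RingSolver ℤ-rawRing (fromCommutativeRing R) ℤ-morphism fromℤ-≟ public
    using (Polynomial; con; solve; _:=_; _:+_; _:*_; _:-_; :-_; _:^_)

foldℕ : {A : Set} → (A → A → A) → A → (ℕ → A) → ℕ → A
foldℕ _∙_ ε f zero    = ε
foldℕ _∙_ ε f (suc n) = f 0 ∙ foldℕ _∙_ ε (λ i → f (suc i)) n

module FiniteFold (M : CommutativeMonoid 0ℓ 0ℓ) where
  open CommutativeMonoid M using (_∙_; _≈_; Carrier; assoc; comm; identityʳ; identityˡ; refl; reflexive; setoid; sym; trans; ε; ∙-cong; ∙-congʳ; ∙-congˡ)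
  open SetoidReasoning setoid

  fold : (ℕ → Carrier) → ℕ → Carrier
  fold = foldℕ _∙_ ε

  fold-cong< : ∀ {f g} n → (∀ i → i < n → f i ≈ g i) → fold f n ≈ fold g n
  fold-cong< zero    f≈g = refl
  fold-cong< (suc n) f≈g = ∙-cong (f≈g 0 (s≤s z≤n)) (fold-cong< n λ i i<n → f≈g (suc i) (s≤s i<n))

  fold-cong : ∀ {f g} n → (∀ i → f i ≈ g i) → fold f n ≈ fold g n
  fold-cong n f≈g = fold-cong< n λ i _ → f≈g i

  interchange : ∀ a b c d → (a ∙ b) ∙ (c ∙ d) ≈ (a ∙ c) ∙ (b ∙ d)
  interchange a b c d = begin
    (a ∙ b) ∙ (c ∙ d)   ≈⟨ assoc a b _ ⟩
    a ∙ (b ∙ (c ∙ d))   ≈⟨ ∙-congˡ (assoc b c d) ⟨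
    a ∙ ((b ∙ c) ∙ d)   ≈⟨ ∙-congˡ (∙-congʳ (comm b c)) ⟩
    a ∙ ((c ∙ b) ∙ d)   ≈⟨ ∙-congˡ (assoc c b d) ⟩
    a ∙ (c ∙ (b ∙ d))   ≈⟨ assoc a c _ ⟨
    (a ∙ c) ∙ (b ∙ d)   ∎

  fold-∙ : ∀ f g n → fold (λ i → f i ∙ g i) n ≈ fold f n ∙ fold g n
  fold-∙ f g zero    = sym (identityˡ ε)
  fold-∙ f g (suc n) = trans (∙-congˡ (fold-∙ _ _ n)) (interchange _ _ _ _)

  fold-ε : ∀ {f} n → (∀ i → i < n → f i ≈ ε) → fold f n ≈ ε
  fold-ε zero    f≈ε = refl
  fold-ε (suc n) f≈ε =
    trans (∙-cong (f≈ε 0 (s≤s z≤n)) (fold-ε n λ i i<n → f≈ε (suc i) (s≤s i<n))) (identityˡ ε)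

  fold-+ : ∀ f m n → fold f (m ℕ.+ n) ≈ fold f m ∙ fold (λ i → f (m ℕ.+ i)) n
  fold-+ f zero    n = sym (identityˡ _)
  fold-+ f (suc m) n = trans (∙-congˡ (fold-+ _ m n)) (sym (assoc _ _ _))

  fold-snoc : ∀ f n → fold f (suc n) ≈ fold f n ∙ f n
  fold-snoc f zero    = comm _ _
  fold-snoc f (suc n) = trans (∙-congˡ (fold-snoc _ n)) (sym (assoc _ _ _))

  fold-extend : ∀ {f} {m n} → m ≤ n → (∀ i → m ≤ i → f i ≈ ε) → fold f n ≈ fold f m
  fold-extend {f} {m} {n} m≤n f≈ε = begin
    fold f n                                           ≡⟨ ≡.cong (fold f) (ℕₚ.m+[n∸m]≡n m≤n) ⟨
    fold f (m ℕ.+ (n ∸ m))                             ≈⟨ fold-+ f m (n ∸ m) ⟩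
    fold f m ∙ fold (λ i → f (m ℕ.+ i)) (n ∸ m)        ≈⟨ ∙-congˡ (fold-ε (n ∸ m) λ i _ → f≈ε _ (ℕₚ.m≤m+n m i)) ⟩
    fold f m ∙ ε                                       ≈⟨ identityʳ _ ⟩
    fold f m                                           ∎

  fold-swap : ∀ (g : ℕ → ℕ → Carrier) m n →
              fold (λ i → fold (g i) n) m ≈ fold (λ j → fold (λ i → g i j) m) n
  fold-swap g zero    n = sym (fold-ε n λ _ _ → refl)
  fold-swap g (suc m) n = trans (∙-congˡ (fold-swap (λ i → g (suc i)) m n)) (sym (fold-∙ _ _ n))

  fold-blocks : ∀ f d n → fold f (n ℕ.* d) ≈ fold (λ r → fold (λ m → f (m ℕ.* d ℕ.+ r)) n) d
  fold-blocks f d n = trans (go f n) (fold-swap _ n d)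
    where
    go : ∀ f n → fold f (n ℕ.* d) ≈ fold (λ m → fold (λ r → f (m ℕ.* d ℕ.+ r)) d) n
    go f zero    = refl
    go f (suc n) = begin
      fold f (d ℕ.+ n ℕ.* d)                              ≈⟨ fold-+ f d (n ℕ.* d) ⟩
      fold f d ∙ fold (λ i → f (d ℕ.+ i)) (n ℕ.* d)       ≈⟨ ∙-congˡ (go (λ i → f (d ℕ.+ i)) n) ⟩
      fold f d ∙ fold (λ m → fold (λ r → f (d ℕ.+ (m ℕ.* d ℕ.+ r))) d) n
        ≈⟨ ∙-congˡ (fold-cong n λ m → fold-cong d λ r →
             reflexive (≡.cong f (≡.sym (ℕₚ.+-assoc d (m ℕ.* d) r)))) ⟩
      fold f d ∙ fold (λ m → fold (λ r → f (suc m ℕ.* d ℕ.+ r)) d) n  ∎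

  foldr-upTo : ∀ f n → foldr _∙_ ε (map f (upTo n)) ≡ fold f n
  foldr-upTo f n = go (λ i → i) n
    where
    go : ∀ g n → foldr _∙_ ε (map f (applyUpTo g n)) ≡ fold (λ i → f (g i)) n
    go g zero    = ≡.refl
    go g (suc n) = ≡.cong (f (g 0) ∙_) (go (λ i → g (suc i)) n)

module FoldHom (M N : CommutativeMonoid 0ℓ 0ℓ) where
  private
    module M = CommutativeMonoid M using (_∙_; Carrier; ε)
    module N = CommutativeMonoid N using (_∙_; _≈_; Carrier; trans; ε; ∙-congˡ)
    module FM = FiniteFold M using (fold)
    module FN = FiniteFold N using (fold)

  fold-homo : (φ : M.Carrier → N.Carrier) → (φ M.ε N.≈ N.ε) →
              (∀ x y → φ (x M.∙ y) N.≈ φ x N.∙ φ y) →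
              ∀ f n → φ (FM.fold f n) N.≈ FN.fold (λ i → φ (f i)) n
  fold-homo φ φ-ε φ-∙ f zero    = φ-ε
  fold-homo φ φ-ε φ-∙ f (suc n) = N.trans (φ-∙ _ _) (N.∙-congˡ (fold-homo φ φ-ε φ-∙ _ n))

-- R[θ]/(θ² − αθ − β), where re and im are the coefficients of 1 and θ.
module QuadraticExtension (R : CommutativeRing 0ℓ 0ℓ) (α β : CommutativeRing.Carrier R) where
  private module R = CommutativeRing R using (_*_; _+_; _-_; _≈_; *-cong; *-congˡ; +-assoc; +-comm; +-cong; +-identityʳ; +-identityˡ; -_; -‿cong; -‿inverseʳ; -‿inverseˡ; 0#; 1#; Carrier; refl; sym; trans)
  open R using (_≈_; _+_; _*_; -_; 0#; 1#)
  open IntegerSolver R using (_:*_; _:+_; _:=_; Polynomial; con; solve)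

  infix 5 _+θ_
  record Carrier : Set where
    no-eta-equality
    constructor _+θ_
    field
      re im : R.Carrier
  open Carrier public

  infix 4 _≋_
  record _≋_ (x y : Carrier) : Set where
    no-eta-equality
    constructor _,_
    field
      re≈ : re x ≈ re y
      im≈ : im x ≈ im y
  open _≋_ public

  private
    _⊞_ _⊠_ : Carrier → Carrier → Carrier
    re (x ⊞ y) = re x + re y
    im (x ⊞ y) = im x + im y
    re (x ⊠ y) = re x * re y + β * (im x * im y)
    im (x ⊠ y) = (re x * im y + im x * re y) + α * (im x * im y)

    neg : Carrier → Carrier
    re (neg x) = - re x
    im (neg x) = - im x

  commutativeRing : CommutativeRing 0ℓ 0ℓ
  commutativeRing = record
    { Carrier = Carrier ; _≈_ = _≋_ ; _+_ = _⊞_ ; _*_ = _⊠_ ; -_ = neg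
    ; 0# = 0# +θ 0# ; 1# = 1# +θ 0#
    ; isCommutativeRing = record
      { isRing = record
        { +-isAbelianGroup = record
          { isGroup = record
            { isMonoid = record
              { isSemigroup = record
                { isMagma = record
                  { isEquivalence = record
                    { refl  = R.refl , R.refl
                    ; sym   = λ p → R.sym (re≈ p) , R.sym (im≈ p)
                    ; trans = λ p q → R.trans (re≈ p) (re≈ q) , R.trans (im≈ p) (im≈ q) }
                  ; ∙-cong = λ p q → R.+-cong (re≈ p) (re≈ q) , R.+-cong (im≈ p) (im≈ q) }
                ; assoc = λ _ _ _ → R.+-assoc _ _ _ , R.+-assoc _ _ _ }
              ; identity = (λ _ → R.+-identityˡ _ , R.+-identityˡ _)
                         , (λ _ → R.+-identityʳ _ , R.+-identityʳ _) }
            ; inverse = (λ _ → R.-‿inverseˡ _ , R.-‿inverseˡ _)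
                      , (λ _ → R.-‿inverseʳ _ , R.-‿inverseʳ _)
            ; ⁻¹-cong = λ p → R.-‿cong (re≈ p) , R.-‿cong (im≈ p) }
          ; comm = λ _ _ → R.+-comm _ _ , R.+-comm _ _ }
        ; *-cong = λ p q →
            R.+-cong (R.*-cong (re≈ p) (re≈ q)) (R.*-congˡ (R.*-cong (im≈ p) (im≈ q))) ,
            R.+-cong (R.+-cong (R.*-cong (re≈ p) (im≈ q)) (R.*-cong (im≈ p) (re≈ q)))
                     (R.*-congˡ (R.*-cong (im≈ p) (im≈ q)))
        ; *-assoc = λ x y z → assoc₁ (re x) (im x) (re y) (im y) (re z) (im z)
                            , assoc₂ (re x) (im x) (re y) (im y) (re z) (im z)
        ; *-identity = (λ x → id₁ (re x) (im x) , id₂ (re x) (im x))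
                     , (λ x → id₃ (re x) (im x) , id₄ (re x) (im x))
        ; distrib = (λ x y z → dist₁ (re x) (im x) (re y) (im y) (re z) (im z)
                             , dist₂ (re x) (im x) (re y) (im y) (re z) (im z))
                  , (λ x y z → dist₃ (re x) (im x) (re y) (im y) (re z) (im z)
                             , dist₄ (re x) (im x) (re y) (im y) (re z) (im z)) }
      ; *-comm = λ x y → comm₁ (re x) (im x) (re y) (im y)
                       , comm₂ (re x) (im x) (re y) (im y) } }
    where
    m₁ m₂ : ∀ {n} → (α β a b c d : Polynomial n) → Polynomial n
    m₁ α β a b c d = a :* c :+ β :* (b :* d)
    m₂ α β a b c d = (a :* d :+ b :* c) :+ α :* (b :* d)
    assoc₁ = λ a b c d e f → solve 8 (λ α β a b c d e f →
      m₁ α β (m₁ α β a b c d) (m₂ α β a b c d) e f := m₁ α β a b (m₁ α β c d e f) (m₂ α β c d e f)) R.refl α β a b c d e f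
    assoc₂ = λ a b c d e f → solve 8 (λ α β a b c d e f →
      m₂ α β (m₁ α β a b c d) (m₂ α β a b c d) e f := m₂ α β a b (m₁ α β c d e f) (m₂ α β c d e f)) R.refl α β a b c d e f
    id₁ = λ a b → solve 4 (λ α β a b → m₁ α β (con (+ 1)) (con (+ 0)) a b := a) R.refl α β a b
    id₂ = λ a b → solve 4 (λ α β a b → m₂ α β (con (+ 1)) (con (+ 0)) a b := b) R.refl α β a b
    id₃ = λ a b → solve 4 (λ α β a b → m₁ α β a b (con (+ 1)) (con (+ 0)) := a) R.refl α β a b
    id₄ = λ a b → solve 4 (λ α β a b → m₂ α β a b (con (+ 1)) (con (+ 0)) := b) R.refl α β a b
    dist₁ = λ a b c d e f → solve 8 (λ α β a b c d e f →
      m₁ α β a b (c :+ e) (d :+ f) := m₁ α β a b c d :+ m₁ α β a b e f) R.refl α β a b c d e f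
    dist₂ = λ a b c d e f → solve 8 (λ α β a b c d e f →
      m₂ α β a b (c :+ e) (d :+ f) := m₂ α β a b c d :+ m₂ α β a b e f) R.refl α β a b c d e f
    dist₃ = λ a b c d e f → solve 8 (λ α β a b c d e f →
      m₁ α β (c :+ e) (d :+ f) a b := m₁ α β c d a b :+ m₁ α β e f a b) R.refl α β a b c d e f
    dist₄ = λ a b c d e f → solve 8 (λ α β a b c d e f →
      m₂ α β (c :+ e) (d :+ f) a b := m₂ α β c d a b :+ m₂ α β e f a b) R.refl α β a b c d e f
    comm₁ = λ a b c d → solve 6 (λ α β a b c d → m₁ α β a b c d := m₁ α β c d a b) R.refl α β a b c d
    comm₂ = λ a b c d → solve 6 (λ α β a b c d → m₂ α β a b c d := m₂ α β c d a b) R.refl α β a b c d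

module PowerSeries (R : CommutativeRing 0ℓ 0ℓ) where
  private
    module R = CommutativeRing R using (_*_; _+_; _-_; _≈_; *-assoc; *-comm; *-cong; *-identityˡ; +-assoc; +-comm; +-commutativeMonoid; +-cong; +-congʳ; +-congˡ; +-identityʳ; +-identityˡ; -_; -‿cong; -‿inverseʳ; -‿inverseˡ; 0#; 1#; Carrier; distribʳ; distribˡ; refl; setoid; sym; trans; zeroʳ; zeroˡ)
    module Σ = FiniteFold R.+-commutativeMonoid using (fold; fold-cong; fold-cong<; fold-ε; fold-∙)
  open R using (_≈_)
  open Σ using (fold; fold-cong; fold-cong<; fold-∙; fold-ε)

  record Series : Set where
    no-eta-equality
    constructor series
    infix 9 _‼_
    field
      _‼_ : ℕ → R.Carrier
  open Series public

  infix 4 _≋_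
  record _≋_ (f g : Series) : Set where
    no-eta-equality
    constructor pointwise
    field
      _at_ : ∀ n → f ‼ n ≈ g ‼ n
  open _≋_ public

  tail : Series → Series
  tail f ‼ n = f ‼ suc n

  const : R.Carrier → Series
  const c ‼ zero  = c
  const c ‼ suc n = R.0#

  infixr 7 _∙_
  _∙_ : R.Carrier → Series → Series
  (c ∙ f) ‼ n = c R.* f ‼ n

  private
    _⊞_ _⊠_ : Series → Series → Series
    (f ⊞ g) ‼ n = f ‼ n R.+ g ‼ n
    (f ⊠ g) ‼ n = fold (λ i → f ‼ i R.* g ‼ (n ∸ i)) (suc n)

    neg : Series → Series
    neg f ‼ n = R.- f ‼ n

    zeroS : Series
    zeroS ‼ n = R.0#

    ⊠-cong : ∀ {f f′ g g′} → f ≋ f′ → g ≋ g′ → (f ⊠ g) ≋ (f′ ⊠ g′)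
    ⊠-cong p q at n = fold-cong (suc n) λ i → R.*-cong (p at i) (q at (n ∸ i))

    ⊠-distribʳ : ∀ h f g → ((f ⊞ g) ⊠ h) ≋ ((f ⊠ h) ⊞ (g ⊠ h))
    ⊠-distribʳ h f g at n = R.trans (fold-cong {g = λ i → f ‼ i R.* h ‼ (n ∸ i) R.+ g ‼ i R.* h ‼ (n ∸ i)} (suc n) λ i → R.distribʳ (h ‼ (n ∸ i)) (f ‼ i) (g ‼ i))
      (fold-∙ (λ i → f ‼ i R.* h ‼ (n ∸ i)) (λ i → g ‼ i R.* h ‼ (n ∸ i)) (suc n))

    ∙-⊠ : ∀ c f g → ((c ∙ f) ⊠ g) ≋ c ∙ (f ⊠ g)
    ∙-⊠ c f g at n = R.sym (R.trans (FoldHom.fold-homo R.+-commutativeMonoid R.+-commutativeMonoid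
       (c R.*_) (R.zeroʳ c) (R.distribˡ c) (λ i → f ‼ i R.* g ‼ (n ∸ i)) (suc n))
       (fold-cong {g = λ i → c R.* f ‼ i R.* g ‼ (n ∸ i)} (suc n) λ i → R.sym (R.*-assoc c _ _)))

    ⊠-snoc : ∀ f g n → (f ⊠ g) ‼ suc n ≈ (f ⊠ tail g) ‼ n R.+ f ‼ suc n R.* g ‼ 0
    ⊠-snoc f g zero    = begin
      f ‼ 0 R.* g ‼ 1 R.+ (f ‼ 1 R.* g ‼ 0 R.+ R.0#)   ≈⟨ R.+-congˡ (R.+-identityʳ _) ⟩
      f ‼ 0 R.* g ‼ 1 R.+ f ‼ 1 R.* g ‼ 0              ≈⟨ R.+-congʳ (R.+-identityʳ _) ⟨
      f ‼ 0 R.* g ‼ 1 R.+ R.0# R.+ f ‼ 1 R.* g ‼ 0     ∎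
      where open SetoidReasoning R.setoid
    ⊠-snoc f g (suc n) = R.trans (R.+-congˡ (⊠-snoc (tail f) g n)) (R.sym (R.+-assoc _ _ _))

    ⊠-comm′ : ∀ f g n → (f ⊠ g) ‼ n ≈ (g ⊠ f) ‼ n
    ⊠-comm′ f g zero    = R.+-congʳ (R.*-comm _ _)
    ⊠-comm′ f g (suc n) = begin
      f ‼ 0 R.* g ‼ suc n R.+ (tail f ⊠ g) ‼ n   ≈⟨ R.+-comm _ _ ⟩
      (tail f ⊠ g) ‼ n R.+ f ‼ 0 R.* g ‼ suc n   ≈⟨ R.+-cong (⊠-comm′ (tail f) g n) (R.*-comm _ _) ⟩
      (g ⊠ tail f) ‼ n R.+ g ‼ suc n R.* f ‼ 0   ≈⟨ ⊠-snoc g f n ⟨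
      (g ⊠ f) ‼ suc n                            ∎
      where open SetoidReasoning R.setoid

    ⊠-comm : ∀ f g → (f ⊠ g) ≋ (g ⊠ f)
    ⊠-comm f g at n = ⊠-comm′ f g n

    ⊠-assoc′ : ∀ f g h n → ((f ⊠ g) ⊠ h) ‼ n ≈ (f ⊠ (g ⊠ h)) ‼ n
    ⊠-assoc′ f g h zero = solve 3 (λ a b c → (a :* b :+ con (+ 0)) :* c :+ con (+ 0)
                                  := a :* (b :* c :+ con (+ 0)) :+ con (+ 0)) R.refl (f ‼ 0) (g ‼ 0) (h ‼ 0)
      where open IntegerSolver R
    ⊠-assoc′ f g h (suc n) = begin
      (f ⊠ g) ‼ 0 R.* h ‼ suc n R.+ (((f ‼ 0 ∙ tail g) ⊞ (tail f ⊠ g)) ⊠ h) ‼ n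
        ≈⟨ R.+-congˡ (⊠-distribʳ h (f ‼ 0 ∙ tail g) (tail f ⊠ g) at n) ⟩
      (f ⊠ g) ‼ 0 R.* h ‼ suc n R.+ (((f ‼ 0 ∙ tail g) ⊠ h) ‼ n R.+ ((tail f ⊠ g) ⊠ h) ‼ n)
        ≈⟨ R.+-congˡ (R.+-cong (∙-⊠ (f ‼ 0) (tail g) h at n) (⊠-assoc′ (tail f) g h n)) ⟩
      (f ⊠ g) ‼ 0 R.* h ‼ suc n R.+ (f ‼ 0 R.* (tail g ⊠ h) ‼ n R.+ (tail f ⊠ (g ⊠ h)) ‼ n)
        ≈⟨ solve 5 (λ a b c s t → (a :* b :+ con (+ 0)) :* c :+ (a :* s :+ t)
                                  := a :* (b :* c :+ s) :+ t) R.refl (f ‼ 0) (g ‼ 0) (h ‼ suc n) _ _ ⟩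
      f ‼ 0 R.* (g ‼ 0 R.* h ‼ suc n R.+ (tail g ⊠ h) ‼ n) R.+ (tail f ⊠ (g ⊠ h)) ‼ n  ∎
      where
      open SetoidReasoning R.setoid
      open IntegerSolver R using (_:*_; _:+_; _:-_; _:=_; :-_; con; solve)

    ⊠-zeroˡ : ∀ f n → (zeroS ⊠ f) ‼ n ≈ R.0#
    ⊠-zeroˡ f n = fold-ε (suc n) λ i _ → R.zeroˡ (f ‼ (n ∸ i))

    const-⊠ : ∀ c f n → (const c ⊠ f) ‼ n ≈ (c ∙ f) ‼ n
    const-⊠ c f zero    = R.+-identityʳ _
    const-⊠ c f (suc n) = R.trans (R.+-congˡ (⊠-zeroˡ f n)) (R.+-identityʳ _)

    ⊠-identityˡ : ∀ f → (const R.1# ⊠ f) ≋ f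
    ⊠-identityˡ f at n = R.trans (const-⊠ _ f n) (R.*-identityˡ _)

  commutativeRing : CommutativeRing 0ℓ 0ℓ
  commutativeRing = record
    { Carrier = Series ; _≈_ = _≋_ ; _+_ = _⊞_ ; _*_ = _⊠_ ; -_ = neg
    ; 0# = zeroS ; 1# = const R.1#
    ; isCommutativeRing = record
      { isRing = record
        { +-isAbelianGroup = record
          { isGroup = record
            { isMonoid = record
              { isSemigroup = record
                { isMagma = record
                  { isEquivalence = record
                    { refl  = pointwise λ _ → R.refl
                    ; sym   = λ p → pointwise λ n → R.sym (p at n)
                    ; trans = λ p q → pointwise λ n → R.trans (p at n) (q at n) }
                  ; ∙-cong = λ p q → pointwise λ n → R.+-cong (p at n) (q at n) }
                ; assoc = λ _ _ _ → pointwise λ _ → R.+-assoc _ _ _ }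
              ; identity = (λ _ → pointwise λ _ → R.+-identityˡ _)
                         , (λ _ → pointwise λ _ → R.+-identityʳ _) }
            ; inverse = (λ _ → pointwise λ _ → R.-‿inverseˡ _)
                      , (λ _ → pointwise λ _ → R.-‿inverseʳ _)
            ; ⁻¹-cong = λ p → pointwise λ n → R.-‿cong (p at n) }
          ; comm = λ _ _ → pointwise λ _ → R.+-comm _ _ }
        ; *-cong = ⊠-cong
        ; *-assoc = λ f g h → pointwise (⊠-assoc′ f g h)
        ; *-identity = ⊠-identityˡ
                     , λ f → pointwise λ n → R.trans (⊠-comm′ f (const R.1#) n) (⊠-identityˡ f at n)
        ; distrib = (λ h f g → pointwise λ n → R.trans (⊠-comm′ h (f ⊞ g) n)
                      (R.trans (⊠-distribʳ h f g at n) (R.+-cong (⊠-comm′ f h n) (⊠-comm′ g h n))))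
                  , ⊠-distribʳ }
      ; *-comm = ⊠-comm } }

  private module S = CommutativeRing commutativeRing using (_*_; _+_; _-_; *-assoc; *-comm; *-commutativeMonoid; *-cong; *-congʳ; *-congˡ; *-identityˡ; *-isCommutativeMonoid; +-commutativeMonoid; +-cong; +-congʳ; +-congˡ; +-isCommutativeMonoid; -_; 0#; 1#; distribˡ; refl; reflexive; semiring; setoid; sym; trans; zeroʳ)
  open S using (_+_; _*_; -_; _-_; 0#; 1#; refl; sym; trans; setoid; +-cong; *-cong; +-congˡ; *-congˡ; +-congʳ; *-congʳ; *-comm; +-commutativeMonoid; *-commutativeMonoid) public
  open SemiringExp S.semiring using (_^_; ^-congˡ) public

  const-neg : ∀ c → const (R.- c) ≋ - const c
  const-neg c = pointwise λ { zero → R.refl ; (suc n) → R.trans (R.sym (R.-‿inverseʳ R.0#)) (R.+-identityˡ _) }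

  const-* : ∀ c f → const c * f ≋ c ∙ f
  const-* c f = pointwise (const-⊠ c f)

  ∙-cong : ∀ {c d f g} → c ≈ d → f ≋ g → c ∙ f ≋ d ∙ g
  ∙-cong p q at n = R.*-cong p (q at n)

  const-cong : ∀ {c d} → c ≈ d → const c ≋ const d
  const-cong p at zero  = p
  const-cong p at suc n = R.refl

  head-* : ∀ f g → (f * g) ‼ 0 ≈ f ‼ 0 R.* g ‼ 0
  head-* f g = R.+-identityʳ _

  shift : Series → Series
  shift f ‼ zero  = R.0#
  shift f ‼ suc n = f ‼ n

  q : Series
  q = shift 1#

  shift-cong : ∀ {f g} → f ≋ g → shift f ≋ shift g
  shift-cong p at zero  = R.refl
  shift-cong p at suc n = p at n

  shift-* : ∀ f g → shift f * g ≋ shift (f * g)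
  shift-* f g at zero  = R.trans (R.+-identityʳ _) (R.zeroˡ _)
  shift-* f g at suc n = R.trans (R.+-congʳ (R.zeroˡ _)) (R.+-identityˡ _)

  q*-shift : ∀ f → q * f ≋ shift f
  q*-shift f = trans (shift-* 1# f) (shift-cong (S.*-identityˡ f))

  q-cancel : ∀ {f g} → q * f ≋ q * g → f ≋ g
  q-cancel {f} {g} p at n =
    R.trans (R.sym (q*-shift f at suc n)) (R.trans (p at suc n) (q*-shift g at suc n))

  shiftBy : ℕ → Series → Series
  shiftBy zero    f = f
  shiftBy (suc e) f = shift (shiftBy e f)

  shiftBy-cong : ∀ e {f g} → f ≋ g → shiftBy e f ≋ shiftBy e g
  shiftBy-cong zero    p = p
  shiftBy-cong (suc e) p = shift-cong (shiftBy-cong e p)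

  shiftBy-* : ∀ e f g → shiftBy e f * g ≋ shiftBy e (f * g)
  shiftBy-* zero    f g = refl
  shiftBy-* (suc e) f g = trans (shift-* _ g) (shift-cong (shiftBy-* e f g))

  shiftBy-+ : ∀ d e f → shiftBy (d ℕ.+ e) f ≋ shiftBy d (shiftBy e f)
  shiftBy-+ zero    e f = refl
  shiftBy-+ (suc d) e f = shift-cong (shiftBy-+ d e f)

  shift-∙ : ∀ c f → c ∙ shift f ≋ shift (c ∙ f)
  shift-∙ c f at zero  = R.zeroʳ c
  shift-∙ c f at suc n = R.refl

  shiftBy-∙ : ∀ e c f → c ∙ shiftBy e f ≋ shiftBy e (c ∙ f)
  shiftBy-∙ zero    c f = refl
  shiftBy-∙ (suc e) c f = trans (shift-∙ c _) (shift-cong (shiftBy-∙ e c f))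

  monomial : R.Carrier → ℕ → Series
  monomial c e ‼ n = shiftBy e (const c) ‼ n

  monomial≋shiftBy : ∀ c e → monomial c e ≋ shiftBy e (const c)
  monomial≋shiftBy c e at n = R.refl

  monomial-cong : ∀ {c d} e → c ≈ d → monomial c e ≋ monomial d e
  monomial-cong e p at n = shiftBy-cong e (const-cong p) at n

  monomial-exp : ∀ c {d e} → d ≡ e → monomial c d ≋ monomial c e
  monomial-exp c ≡.refl = refl

  ∙-const : ∀ c d → c ∙ const d ≋ const (c R.* d)
  ∙-const c d at zero  = R.refl
  ∙-const c d at suc n = R.zeroʳ c

  monomial-*-shiftBy : ∀ c e f → monomial c e * f ≋ shiftBy e (c ∙ f)
  monomial-*-shiftBy c e f =
    trans (*-congʳ (monomial≋shiftBy c e)) (trans (shiftBy-* e _ f) (shiftBy-cong e (const-* c f)))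

  ∙-monomial : ∀ c d n → c ∙ monomial d n ≋ monomial (c R.* d) n
  ∙-monomial c d n at k = trans (shiftBy-∙ n c _) (shiftBy-cong n (∙-const c d)) at k

  monomial-* : ∀ c d m n → monomial c m * monomial d n ≋ monomial (c R.* d) (m ℕ.+ n)
  monomial-* c d m n = trans (monomial-*-shiftBy c m (monomial d n))
    (trans (shiftBy-cong m (trans (∙-monomial c d n) (monomial≋shiftBy _ n)))
      (trans (sym (shiftBy-+ m n (const (c R.* d)))) (sym (monomial≋shiftBy _ (m ℕ.+ n)))))

  monomial-hit : ∀ c e → monomial c e ‼ e ≡ c
  monomial-hit c zero    = ≡.refl
  monomial-hit c (suc e) = monomial-hit c e

  monomial-miss : ∀ c e n → n ≢ e → monomial c e ‼ n ≡ R.0#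
  monomial-miss c zero    zero    n≢e = ⊥-elim (n≢e ≡.refl)
  monomial-miss c zero    (suc n) n≢e = ≡.refl
  monomial-miss c (suc e) zero    n≢e = ≡.refl
  monomial-miss c (suc e) (suc n) n≢e = monomial-miss c e n λ p → n≢e (≡.cong suc p)

  const-0 : const R.0# ≋ 0#
  const-0 at zero  = R.refl
  const-0 at suc n = R.refl

  const-+ : ∀ c d → const c + const d ≋ const (c R.+ d)
  const-+ c d at zero  = R.refl
  const-+ c d at suc n = R.+-identityˡ _

  shift-+ : ∀ f g → shift f + shift g ≋ shift (f + g)
  shift-+ f g at zero  = R.+-identityˡ _
  shift-+ f g at suc n = R.refl

  monomial-+ : ∀ c d e → monomial c e + monomial d e ≋ monomial (c R.+ d) e
  monomial-+ c d zero    = pointwise λ n → const-+ c d at n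
  monomial-+ c d (suc e) = pointwise λ n → trans (shift-+ (shiftBy e (const c)) (shiftBy e (const d)))
    (shift-cong (pointwise λ k → monomial-+ c d e at k)) at n

  record Agree (N : ℕ) (f g : Series) : Set where
    no-eta-equality
    constructor agree
    field
      below : ∀ n → n < N → f ‼ n ≈ g ‼ n
  open Agree public

  agree⇒≋ : ∀ {f g} → (∀ N → Agree N f g) → f ≋ g
  agree⇒≋ p at n = below (p (suc n)) n (ℕₚ.n<1+n n)

  ≋⇒agree : ∀ {N f g} → f ≋ g → Agree N f g
  ≋⇒agree p = agree λ n _ → p at n

  agree-refl : ∀ {N f} → Agree N f f
  agree-refl = ≋⇒agree refl

  agree-sym : ∀ {N f g} → Agree N f g → Agree N g f
  agree-sym p = agree λ n n<N → R.sym (below p n n<N)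

  agree-trans : ∀ {N f g h} → Agree N f g → Agree N g h → Agree N f h
  agree-trans p q = agree λ n n<N → R.trans (below p n n<N) (below q n n<N)

  agree-mono : ∀ {M N f g} → M ≤ N → Agree N f g → Agree M f g
  agree-mono M≤N p = agree λ n n<M → below p n (ℕₚ.≤-trans n<M M≤N)

  agree-+ : ∀ {N f f′ g g′} → Agree N f f′ → Agree N g g′ → Agree N (f + g) (f′ + g′)
  agree-+ p q = agree λ n n<N → R.+-cong (below p n n<N) (below q n n<N)

  agree-neg : ∀ {N f g} → Agree N f g → Agree N (- f) (- g)
  agree-neg p = agree λ n n<N → R.-‿cong (below p n n<N)

  agree-* : ∀ {N f f′ g g′} → Agree N f f′ → Agree N g g′ → Agree N (f * g) (f′ * g′)
  agree-* p q = agree λ n n<N → fold-cong< (suc n) λ i i≤n →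
    R.*-cong (below p i (ℕₚ.≤-trans i≤n n<N)) (below q (n ∸ i) (ℕₚ.≤-<-trans (ℕₚ.m∸n≤m n i) n<N))

  agree-*0 : ∀ {N} f {g} → Agree N g 0# → Agree N (f * g) 0#
  agree-*0 f p = agree-trans (agree-* agree-refl p) (≋⇒agree (S.zeroʳ f))

  agree-shift : ∀ {N f} → Agree N f 0# → Agree (suc N) (shift f) 0#
  agree-shift p = agree λ { zero _ → R.refl ; (suc n) (s≤s n<N) → below p n n<N }

  agree-zero : ∀ {f g} → Agree 0 f g
  agree-zero = agree λ _ ()

  shiftBy-small : ∀ e f → Agree e (shiftBy e f) 0#
  shiftBy-small zero    f = agree-zero
  shiftBy-small (suc e) f = agree-shift (shiftBy-small e f)

  monomial-small : ∀ c {N e} → N ≤ e → Agree N (monomial c e) 0#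
  monomial-small c {e = e} N≤e = agree-trans (≋⇒agree (monomial≋shiftBy c e)) (agree-mono N≤e (shiftBy-small e (const c)))

  -- Limits of partial folds, for families whose k-th member is the unit modulo qᵏ.
  module InfiniteFold
    (_⊛_ : Series → Series → Series) (ε : Series)
    (isCommutativeMonoid : IsCommutativeMonoid _≋_ _⊛_ ε)
    (agree-⊛ : ∀ {N f f′ g g′} → Agree N f f′ → Agree N g g′ → Agree N (f ⊛ g) (f′ ⊛ g′))
    where
    private
      monoid : CommutativeMonoid 0ℓ 0ℓ
      monoid = record { isCommutativeMonoid = isCommutativeMonoid }
    private module M = CommutativeMonoid monoid using (identityʳ; identityˡ)
    module F = FiniteFold monoid using (fold; fold-+; fold-blocks; fold-cong; fold-snoc; fold-swap; fold-ε; fold-∙)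

    Small : (ℕ → Series) → Set
    Small f = ∀ k → Agree k (f k) ε

    ∞ : (ℕ → Series) → Series
    ∞ f ‼ n = F.fold f (suc n) ‼ n

    agree-fold : ∀ {N f g} n → (∀ i → Agree N (f i) (g i)) → Agree N (F.fold f n) (F.fold g n)
    agree-fold zero    p = agree-refl
    agree-fold (suc n) p = agree-⊛ (p 0) (agree-fold n λ i → p (suc i))

    agree-fold-ε : ∀ {N f} n → (∀ i → Agree N (f i) ε) → Agree N (F.fold f n) ε
    agree-fold-ε n p = agree-trans (agree-fold n p) (≋⇒agree (F.fold-ε n λ _ _ → refl))

    fold-agree : ∀ {f} → Small f → ∀ {m n} → m ≤ n → Agree m (F.fold f n) (F.fold f m)
    fold-agree {f} s {m} {n} m≤n = agree-trans
      (≋⇒agree (trans (S.reflexive (≡.cong (F.fold f) (≡.sym (ℕₚ.m+[n∸m]≡n m≤n)))) (F.fold-+ f m (n ∸ m))))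
      (agree-trans (agree-⊛ agree-refl
        (agree-fold-ε (n ∸ m) λ i → agree-mono (ℕₚ.m≤m+n m i) (s (m ℕ.+ i))))
        (≋⇒agree (M.identityʳ _)))

    ∞-agree : ∀ {f} → Small f → ∀ {N n} → N ≤ n → Agree N (∞ f) (F.fold f n)
    ∞-agree s {N} {n} N≤n = agree λ i i<N →
      R.sym (below (fold-agree s (ℕₚ.≤-trans i<N N≤n)) i (ℕₚ.n<1+n i))

    ∞-unique : ∀ {f g} → Small f → (∀ N → Agree N g (F.fold f N)) → g ≋ ∞ f
    ∞-unique s p = agree⇒≋ λ N → agree-trans (p N) (agree-sym (∞-agree s ℕₚ.≤-refl))

    ∞-cong : ∀ {f g} → (∀ k → f k ≋ g k) → ∞ f ≋ ∞ g
    ∞-cong p at n = F.fold-cong (suc n) p at n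

    Small-cong : ∀ {f g} → (∀ k → f k ≋ g k) → Small f → Small g
    Small-cong p s k = agree-trans (≋⇒agree (sym (p k))) (s k)

    Small-⊛ : ∀ {f g} → Small f → Small g → Small (λ k → f k ⊛ g k)
    Small-⊛ s t k = agree-trans (agree-⊛ (s k) (t k)) (≋⇒agree (M.identityˡ ε))

    Small-sub : ∀ {f} (h : ℕ → ℕ) → (∀ k → k ≤ h k) → Small f → Small (λ k → f (h k))
    Small-sub h k≤h s k = agree-mono (k≤h k) (s (h k))

    ∞-⊛ : ∀ {f g} → Small f → Small g → ∞ (λ k → f k ⊛ g k) ≋ ∞ f ⊛ ∞ g
    ∞-⊛ {f} {g} s t = sym (∞-unique (Small-⊛ s t) λ N →
      agree-trans (agree-⊛ (∞-agree s ℕₚ.≤-refl) (∞-agree t ℕₚ.≤-refl)) (≋⇒agree (sym (F.fold-∙ f g N))))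

    ∞-first : ∀ {f} → Small f → ∞ f ≋ f 0 ⊛ ∞ (λ k → f (suc k))
    ∞-first s = agree⇒≋ λ N → agree-trans (∞-agree s (ℕₚ.n≤1+n N))
      (agree-⊛ agree-refl (agree-sym (∞-agree (Small-sub suc ℕₚ.n≤1+n s) ℕₚ.≤-refl)))

    ∞-blocks : ∀ {f} d .{{_ : ℕ.NonZero d}} → Small f → ∞ f ≋ F.fold (λ r → ∞ (λ m → f (m ℕ.* d ℕ.+ r))) d
    ∞-blocks {f} d s = agree⇒≋ λ N → agree-trans (∞-agree s (ℕₚ.m≤m*n N d))
      (agree-trans (≋⇒agree (F.fold-blocks f d N))
        (agree-sym (agree-fold d λ r → ∞-agree (Small-sub (λ m → m ℕ.* d ℕ.+ r)
           (λ m → ℕₚ.≤-trans (ℕₚ.m≤m*n m d) (ℕₚ.m≤m+n _ r)) s) ℕₚ.≤-refl)))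

    ∞-small : ∀ {N f} → (∀ k → Agree N (f k) ε) → Agree N (∞ f) ε
    ∞-small p = agree λ n n<N → below (agree-fold-ε (suc n) p) n n<N

    ∞-swap : ∀ {g : ℕ → ℕ → Series} → (∀ m n → Agree m (g m n) ε) → (∀ m n → Agree n (g m n) ε) →
             ∞ (λ m → ∞ (g m)) ≋ ∞ (λ n → ∞ (λ m → g m n))
    ∞-swap {g} s t = agree⇒≋ λ N → agree-trans (truncate g s t N)
      (agree-trans (≋⇒agree (F.fold-swap g N N)) (agree-sym (truncate (λ n m → g m n) (λ n m → t m n) (λ n m → s m n) N)))
      where
      truncate : ∀ g → (∀ m n → Agree m (g m n) ε) → (∀ m n → Agree n (g m n) ε) → ∀ N →
                 Agree N (∞ (λ m → ∞ (g m))) (F.fold (λ m → F.fold (g m) N) N)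
      truncate g s t N = agree-trans (∞-agree (λ m → ∞-small (s m)) ℕₚ.≤-refl)
        (agree-fold N λ m → ∞-agree (t m) ℕₚ.≤-refl)

  module Sum = InfiniteFold _+_ 0# S.+-isCommutativeMonoid agree-+
  module Prod = InfiniteFold _*_ 1# S.*-isCommutativeMonoid agree-*

  sum∞ prod∞ : (ℕ → Series) → Series
  sum∞  = Sum.∞
  prod∞ = Prod.∞

  fold-coeff : ∀ f m n → Sum.F.fold f m ‼ n ≈ fold (λ k → f k ‼ n) m
  fold-coeff f m n = FoldHom.fold-homo +-commutativeMonoid R.+-commutativeMonoid
    (λ h → h ‼ n) R.refl (λ _ _ → R.refl) f m

  *-fold : ∀ g f m → g * Sum.F.fold f m ≋ Sum.F.fold (λ k → g * f k) m
  *-fold g f m = FoldHom.fold-homo +-commutativeMonoid +-commutativeMonoid (g *_) (S.zeroʳ g) (S.distribˡ g) f m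

  *-sum∞ : ∀ g {f} → Sum.Small f → g * sum∞ f ≋ sum∞ (λ k → g * f k)
  *-sum∞ g {f} s = Sum.∞-unique (λ k → agree-*0 g (s k)) λ N →
    agree-trans (agree-* agree-refl (Sum.∞-agree s ℕₚ.≤-refl)) (≋⇒agree (*-fold g f N))

  inv : Series → Series
  inv f = sum∞ (λ k → (1# - f) ^ k)

  shift-tail : ∀ f → f ‼ 0 ≈ R.0# → f ≋ shift (tail f)
  shift-tail f p at zero  = p
  shift-tail f p at suc n = R.refl

  ^-small : ∀ f → f ‼ 0 ≈ R.0# → Sum.Small (f ^_)
  ^-small f p zero    = agree-zero
  ^-small f p (suc k) = agree-trans
    (≋⇒agree (trans (*-congʳ (shift-tail f p)) (shift-* (tail f) (f ^ k))))
    (agree-shift (agree-*0 (tail f) (^-small f p k)))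

  *-inv : ∀ f → f ‼ 0 ≈ R.1# → f * inv f ≋ 1#
  *-inv f p = agree⇒≋ λ N → agree-trans
    (agree-* agree-refl (Sum.∞-agree small ℕₚ.≤-refl))
    (agree-trans (≋⇒agree (telescope N))
      (agree-trans (agree-+ agree-refl (agree-neg (small N)))
        (≋⇒agree (solve 0 (con (+ 1) :- con (+ 0) := con (+ 1)) refl))))
    where
    open IntegerSolver commutativeRing using (_:*_; _:+_; _:-_; _:=_; :-_; con; solve)
    small : Sum.Small ((1# - f) ^_)
    small = ^-small (1# - f) (R.trans (R.+-congˡ (R.-‿cong p)) (R.-‿inverseʳ _))
    telescope : ∀ N → f * Sum.F.fold ((1# - f) ^_) N ≋ 1# - (1# - f) ^ N
    telescope zero    = solve 1 (λ f → f :* con (+ 0) := con (+ 1) :- con (+ 1)) refl f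
    telescope (suc N) = trans (*-congˡ (Sum.F.fold-snoc _ N)) (trans (S.distribˡ f _ _)
      (trans (+-cong (telescope N) refl)
        (solve 2 (λ f x → (con (+ 1) :- x) :+ f :* x := con (+ 1) :- (con (+ 1) :- f) :* x) refl f _)))

  cancelˡ : ∀ {f g h} → f ‼ 0 ≈ R.1# → f * g ≋ f * h → g ≋ h
  cancelˡ {f} {g} {h} p e = trans (sym (lem g)) (trans (*-congˡ e) (lem h))
    where
    lem : ∀ g → inv f * (f * g) ≋ g
    lem g = trans (sym (S.*-assoc _ _ _)) (trans (*-congʳ (trans (*-comm _ f) (*-inv f p))) (S.*-identityˡ g))

module Antidiagonal (M : CommutativeMonoid 0ℓ 0ℓ) where
  open CommutativeMonoid M using (_∙_; _≈_; Carrier; assoc; identityʳ; refl; sym; trans; ∙-cong; ∙-congˡ)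
  open FiniteFold M using (fold; interchange)

  anti : (ℕ → ℕ → Carrier) → ℕ → Carrier
  anti g zero    = g 0 0
  anti g (suc n) = g 0 (suc n) ∙ anti (λ i j → g (suc i) j) n

  anti-cong : ∀ {g h} n → (∀ i j → g i j ≈ h i j) → anti g n ≈ anti h n
  anti-cong zero    p = p 0 0
  anti-cong (suc n) p = ∙-cong (p 0 (suc n)) (anti-cong n λ i j → p (suc i) j)

  anti-∙ : ∀ g h n → anti (λ i j → g i j ∙ h i j) n ≈ anti g n ∙ anti h n
  anti-∙ g h zero    = refl
  anti-∙ g h (suc n) = trans (∙-congˡ (anti-∙ _ _ n)) (interchange _ _ _ _)

  anti-snoc : ∀ g n → anti g (suc n) ≈ anti (λ i j → g i (suc j)) n ∙ g (suc n) 0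
  anti-snoc g zero    = refl
  anti-snoc g (suc n) = trans (∙-congˡ (anti-snoc (λ i → g (suc i)) n)) (sym (assoc _ _ _))

  anti-fold : ∀ f n → anti (λ i _ → f i) n ≈ fold f (suc n)
  anti-fold f zero    = sym (identityʳ _)
  anti-fold f (suc n) = ∙-congˡ (anti-fold (λ i → f (suc i)) n)

-- A form of the q-binomial theorem symmetric in x and y; the relation xy = Q makes
-- negative powers of x available as powers of y.
module FiniteTripleProduct (S : CommutativeRing 0ℓ 0ℓ) where
  open CommutativeRing S using (_*_; _+_; _-_; _≈_; *-assoc; *-commutativeMonoid; *-cong; *-congʳ; *-congˡ; *-identityʳ; *-identityˡ; +-commutativeMonoid; +-cong; +-congʳ; +-congˡ; +-identityʳ; +-identityˡ; -_; -‿cong; 0#; 1#; Carrier; distribˡ; refl; reflexive; semiring; setoid; sym; trans; zero)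
  open FiniteFold *-commutativeMonoid using (fold; fold-cong; fold-snoc)
  open SemiringExp semiring using (_^_; ^-homo-*)
  open IntegerSolver S using (_:*_; _:+_; _:-_; _:=_; :-_; con; solve)
  open SetoidReasoning setoid
  open Antidiagonal +-commutativeMonoid using (anti; anti-cong; anti-snoc; anti-∙)

  module Base (Q : Carrier) (U : ℕ → Carrier) (U-inverse : ∀ n → fold (λ i → 1# - Q ^ suc i) n * U n ≈ 1#) where
    poch : ℕ → Carrier
    poch = fold (λ i → 1# - Q ^ suc i)

    binomial : ℕ → ℕ → Carrier
    binomial i j = poch (i ℕ.+ j) * (U i * U j)

    U-step : ∀ n → U n ≈ (1# - Q ^ suc n) * U (suc n)
    U-step n = begin
      U n                                                ≈⟨ *-identityʳ _ ⟨
      U n * 1#                                           ≈⟨ *-congˡ (U-inverse (suc n)) ⟨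
      U n * (poch (suc n) * U (suc n))                   ≈⟨ *-congˡ (*-congʳ (fold-snoc _ n)) ⟩
      U n * (poch n * (1# - Q ^ suc n) * U (suc n))      ≈⟨ solve 4 (λ u p f v → u :* (p :* f :* v) := (p :* u) :* (f :* v)) refl _ _ _ _ ⟩
      (poch n * U n) * ((1# - Q ^ suc n) * U (suc n))    ≈⟨ *-congʳ (U-inverse n) ⟩
      1# * ((1# - Q ^ suc n) * U (suc n))                ≈⟨ *-identityˡ _ ⟩
      (1# - Q ^ suc n) * U (suc n)                       ∎

    U-0 : U 0 ≈ 1#
    U-0 = trans (sym (*-identityˡ _)) (U-inverse 0)

    binomial-0ˡ : ∀ j → binomial 0 j ≈ 1#
    binomial-0ˡ j = trans (*-congˡ (trans (*-congʳ U-0) (*-identityˡ _))) (U-inverse j)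

    binomial-0ʳ : ∀ i → binomial i 0 ≈ 1#
    binomial-0ʳ i = trans (*-cong (reflexive (≡.cong poch (ℕₚ.+-identityʳ i)))
      (trans (*-congˡ U-0) (*-identityʳ _))) (U-inverse i)

    pascal : ∀ i j → binomial (suc i) (suc j) ≈ binomial i (suc j) + Q ^ suc i * binomial (suc i) j
    pascal i j = begin
      poch (suc (i ℕ.+ suc j)) * (Ui * Uj)                     ≈⟨ *-congʳ (fold-snoc _ (i ℕ.+ suc j)) ⟩
      P * (1# - Q ^ suc (i ℕ.+ suc j)) * (Ui * Uj)             ≈⟨ *-congʳ (*-congˡ (+-congˡ (-‿cong (^-homo-* Q (suc i) (suc j))))) ⟩
      P * (1# - A * B) * (Ui * Uj)                             ≈⟨ solve 5 (λ p a b u v → p :* (con (+ 1) :- a :* b) :* (u :* v) :=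
                                                                    p :* (((con (+ 1) :- a) :* u) :* v) :+ a :* (p :* (u :* ((con (+ 1) :- b) :* v)))) refl P A B Ui Uj ⟩
      P * (((1# - A) * Ui) * Uj) + A * (P * (Ui * ((1# - B) * Uj)))
        ≈⟨ +-cong (*-congˡ (*-congʳ (U-step i))) (*-congˡ (*-cong (reflexive (≡.cong poch (≡.sym (ℕₚ.+-suc i j)))) (*-congˡ (U-step j)))) ⟨
      P * (U i * Uj) + A * (poch (suc i ℕ.+ j) * (Ui * U j))   ∎
      where
      P  = poch (i ℕ.+ suc j)
      A  = Q ^ suc i
      B  = Q ^ suc j
      Ui = U (suc i)
      Uj = U (suc j)

    pascal-sum : ∀ (t : ℕ → Carrier) n → anti (λ i j → t i * binomial i j) (suc n) ≈
                 anti (λ i j → t (suc i) * binomial i j) n + anti (λ i j → (Q ^ i * t i) * binomial i j) n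
    pascal-sum t n = begin
      anti (λ i j → t i * binomial i j) (suc n)       ≈⟨ anti-cong′ (suc n) (s≤s z≤n) ⟩
      anti (λ i j → P i j + R i j) (suc n)            ≈⟨ anti-∙ P R (suc n) ⟩
      anti P (suc n) + anti R (suc n)                 ≈⟨ +-cong (+-identityˡ _) (trans (anti-snoc R n) (+-identityʳ _)) ⟩
      anti (λ i j → t (suc i) * binomial i j) n + anti (λ i j → (Q ^ i * t i) * binomial i j) n ∎
      where
      P R : ℕ → ℕ → Carrier
      P zero    j = 0#
      P (suc i) j = t (suc i) * binomial i j
      R i zero    = 0#
      R i (suc j) = (Q ^ i * t i) * binomial i j
      entry₀ : ∀ j → t 0 * binomial 0 (suc j) ≈ P 0 (suc j) + R 0 (suc j)
      entry₀ j = trans (*-cong (sym (*-identityˡ _)) (trans (binomial-0ˡ (suc j)) (sym (binomial-0ˡ j)))) (sym (+-identityˡ _))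
      entry : ∀ i j → t (suc i) * binomial (suc i) j ≈ P (suc i) j + R (suc i) j
      entry i zero    = trans (*-congˡ (trans (binomial-0ʳ (suc i)) (sym (binomial-0ʳ i)))) (sym (+-identityʳ _))
      entry i (suc j) = trans (*-congˡ (pascal i j))
        (solve 4 (λ t b c a → t :* (b :+ a :* c) := t :* b :+ (a :* t) :* c) refl _ _ _ _)
      anti-cong′ : ∀ n → 0 < n → anti (λ i j → t i * binomial i j) n ≈ anti (λ i j → P i j + R i j) n
      anti-cong′ (suc n) _ = +-cong (entry₀ n) (anti-cong n entry)

    anti-* : ∀ c g n → c * anti g n ≈ anti (λ i j → c * g i j) n
    anti-* c g zero    = refl
    anti-* c g (suc n) = trans (distribˡ c _ _) (+-congˡ (anti-* c _ n))

    term : Carrier → ℕ → Carrier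
    term x zero    = 1#
    term x (suc n) = - (x * Q ^ n) * term x n

    term-scale : ∀ x n → term (x * Q) n ≈ Q ^ n * term x n
    term-scale x zero    = sym (*-identityˡ _)
    term-scale x (suc n) = trans (*-congˡ (term-scale x n))
      (solve 4 (λ x q r t → (:- ((x :* q) :* r)) :* (r :* t) := (q :* r) :* ((:- (x :* r)) :* t)) refl x Q (Q ^ n) (term x n))

    qBinomial : ∀ x k → fold (λ i → 1# - x * Q ^ i) k ≈ anti (λ i j → term x i * binomial i j) k
    qBinomial x zero    = sym (trans (*-congˡ (binomial-0ˡ 0)) (*-identityˡ _))
    qBinomial x (suc k) = begin
      (1# - x * Q ^ 0) * fold (λ i → 1# - x * Q ^ suc i) k
        ≈⟨ *-cong (+-congˡ (-‿cong (*-identityʳ x))) (fold-cong k λ i → +-congˡ (-‿cong (sym (*-assoc x Q _)))) ⟩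
      (1# - x) * fold (λ i → 1# - (x * Q) * Q ^ i) k
        ≈⟨ *-congˡ (qBinomial (x * Q) k) ⟩
      (1# - x) * anti (λ i j → term (x * Q) i * binomial i j) k
        ≈⟨ anti-* _ _ k ⟩
      anti (λ i j → (1# - x) * (term (x * Q) i * binomial i j)) k
        ≈⟨ anti-cong k (λ i j → trans (*-congˡ (*-congʳ (term-scale x i)))
             (solve 4 (λ x r t b → (con (+ 1) :- x) :* ((r :* t) :* b) := ((:- (x :* r)) :* t) :* b :+ (r :* t) :* b) refl x (Q ^ i) (term x i) _)) ⟩
      anti (λ i j → term x (suc i) * binomial i j + (Q ^ i * term x i) * binomial i j) k
        ≈⟨ anti-∙ _ _ k ⟩
      anti (λ i j → term x (suc i) * binomial i j) k + anti (λ i j → (Q ^ i * term x i) * binomial i j) k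
        ≈⟨ pascal-sum (term x) k ⟨
      anti (λ i j → term x i * binomial i j) (suc k) ∎

    -- theta i l is the term of index i − l of the bilateral theta series.
    module _ (x y : Carrier) (xy≈Q : x * y ≈ Q) where

      theta : ℕ → ℕ → Carrier
      theta zero    l       = term y l
      theta (suc i) zero    = term x (suc i)
      theta (suc i) (suc l) = theta i l

      theta-0 : ∀ i → theta i 0 ≡ term x i
      theta-0 zero    = ≡.refl
      theta-0 (suc i) = ≡.refl

      theta-step : ∀ i l → - (y * Q ^ l) * theta i l ≈ Q ^ i * theta i (suc l)
      theta-step zero    l       = sym (*-identityˡ _)
      theta-step (suc i) zero    = begin
        - (y * 1#) * (- (x * Q ^ i) * term x i)   ≈⟨ solve 4 (λ x y r t → (:- (y :* con (+ 1))) :* ((:- (x :* r)) :* t) := ((x :* y) :* r) :* t) refl x y _ _ ⟩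
        ((x * y) * Q ^ i) * term x i              ≈⟨ *-cong (*-congʳ xy≈Q) (reflexive (≡.sym (theta-0 i))) ⟩
        Q ^ suc i * theta i 0                     ∎
      theta-step (suc i) (suc l) = begin
        - (y * (Q * Q ^ l)) * theta i l   ≈⟨ solve 4 (λ y q r t → (:- (y :* (q :* r))) :* t := q :* ((:- (y :* r)) :* t)) refl y Q _ _ ⟩
        Q * (- (y * Q ^ l) * theta i l)   ≈⟨ *-congˡ (theta-step i l) ⟩
        Q * (Q ^ i * theta i (suc l))     ≈⟨ *-assoc _ _ _ ⟨
        Q ^ suc i * theta i (suc l)       ∎

      tripleProduct : ∀ k l → fold (λ i → 1# - x * Q ^ i) k * fold (λ i → 1# - y * Q ^ i) l ≈
                              anti (λ i j → theta i l * binomial i j) (l ℕ.+ k)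
      tripleProduct k zero    = trans (*-identityʳ _) (trans (qBinomial x k)
        (anti-cong k λ i j → *-congʳ (reflexive (≡.sym (theta-0 i)))))
      tripleProduct k (suc l) = begin
        fold (λ i → 1# - x * Q ^ i) k * fold (λ i → 1# - y * Q ^ i) (suc l)
          ≈⟨ *-congˡ (fold-snoc _ l) ⟩
        fold (λ i → 1# - x * Q ^ i) k * (fold (λ i → 1# - y * Q ^ i) l * (1# - y * Q ^ l))
          ≈⟨ solve 3 (λ a b c → a :* (b :* c) := c :* (a :* b)) refl _ _ _ ⟩
        (1# - y * Q ^ l) * (fold (λ i → 1# - x * Q ^ i) k * fold (λ i → 1# - y * Q ^ i) l)
          ≈⟨ *-congˡ (tripleProduct k l) ⟩
        (1# - y * Q ^ l) * anti (λ i j → theta i l * binomial i j) (l ℕ.+ k)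
          ≈⟨ anti-* _ _ (l ℕ.+ k) ⟩
        anti (λ i j → (1# - y * Q ^ l) * (theta i l * binomial i j)) (l ℕ.+ k)
          ≈⟨ anti-cong (l ℕ.+ k) (λ i j → trans
               (solve 3 (λ z t b → (con (+ 1) :- z) :* (t :* b) := t :* b :+ ((:- z) :* t) :* b) refl _ _ _)
               (+-congˡ (*-congʳ (theta-step i l)))) ⟩
        anti (λ i j → theta i l * binomial i j + (Q ^ i * theta i (suc l)) * binomial i j) (l ℕ.+ k)
          ≈⟨ anti-∙ _ _ (l ℕ.+ k) ⟩
        anti (λ i j → theta i l * binomial i j) (l ℕ.+ k) + anti (λ i j → (Q ^ i * theta i (suc l)) * binomial i j) (l ℕ.+ k)
          ≈⟨ pascal-sum (λ i → theta i (suc l)) (l ℕ.+ k) ⟨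
        anti (λ i j → theta i (suc l) * binomial i j) (suc l ℕ.+ k) ∎

      module Plus = FiniteFold +-commutativeMonoid using (fold; fold-cong; fold-snoc)
      open Plus using () renaming (fold to fold₊)

      sum-theta : ∀ l k → fold₊ (λ i → theta i l) (l ℕ.+ suc k) ≈
                          fold₊ (λ n → term y (suc n)) l + fold₊ (term x) (suc k)
      sum-theta zero    k = trans (Plus.fold-cong (suc k) λ i → reflexive (theta-0 i)) (sym (+-identityˡ _))
      sum-theta (suc l) k = begin
        term y (suc l) + fold₊ (λ i → theta i l) (l ℕ.+ suc k)
          ≈⟨ +-congˡ (sum-theta l k) ⟩
        term y (suc l) + (fold₊ (λ n → term y (suc n)) l + fold₊ (term x) (suc k))
          ≈⟨ solve 3 (λ a b c → a :+ (b :+ c) := (b :+ a) :+ c) refl _ _ _ ⟩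
        (fold₊ (λ n → term y (suc n)) l + term y (suc l)) + fold₊ (term x) (suc k)
          ≈⟨ +-congʳ (Plus.fold-snoc _ l) ⟨
        fold₊ (λ n → term y (suc n)) (suc l) + fold₊ (term x) (suc k) ∎

tri : ℕ → ℕ
tri zero    = 0
tri (suc n) = n ℕ.+ tri n

module TripleProduct (K : CommutativeRing 0ℓ 0ℓ) where
  open PowerSeries K using (module Prod; module Sum; _*_; _+_; _-_; _^_; _at_; _‼_; _≋_; *-comm; *-cong; *-congʳ; *-congˡ; *-inv; +-commutativeMonoid; +-congˡ; -_; 0#; 1#; Agree; Series; agree-*; agree-*0; agree-+; agree-mono; agree-neg; agree-refl; agree-sym; agree-trans; agree-zero; agree⇒≋; below; commutativeRing; const; const-*; head-*; inv; monomial; monomial-*; monomial-cong; monomial-exp; monomial-small; monomial≋shiftBy; prod∞; refl; sum∞; sym; trans; ∙-monomial; ≋⇒agree)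
  private
    module K = CommutativeRing K using (_*_; _-_; _≈_; *-cong; *-identityʳ; *-identityˡ; -_; -‿cong; 1#; Carrier; refl; ring; semiring; sym; trans)
    module S = CommutativeRing commutativeRing using (*-identityʳ; *-identityˡ; +-comm; -‿cong; reflexive)
  open SemiringExp K.semiring using () renaming (_^_ to _^ᴷ_)
  open IntegerSolver commutativeRing using (_:*_; _:-_; _:=_; :-_; con; solve)
  open RingProperties K.ring using (-‿distribˡ-*)

  -‿monomial : ∀ c e → - monomial c e ≋ monomial (K.- c) e
  -‿monomial c e = trans (solve 1 (λ x → :- x := con -[1+ 0 ] :* x) refl _)
    (trans (*-congʳ -1≋) (trans (const-* (K.- K.1#) _) (trans (∙-monomial _ c e)
      (monomial-cong e (K.trans (K.sym (-‿distribˡ-* _ _)) (K.-‿cong (K.*-identityˡ c)))))))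
    where
    -1≋ : - 1# ≋ const (K.- K.1#)
    -1≋ at zero  = K.refl
    -1≋ at suc n = L.solve 0 (L.:- L.con (+ 0) L.:= L.con (+ 0)) K.refl
      where module L = IntegerSolver K

  monomial-^ : ∀ d n → monomial K.1# d ^ n ≋ monomial K.1# (d ℕ.* n)
  monomial-^ d zero    = trans (sym (monomial≋shiftBy K.1# 0)) (monomial-exp K.1# (≡.sym (ℕₚ.*-zeroʳ d)))
  monomial-^ d (suc n) = trans (*-congˡ (monomial-^ d n)) (trans (monomial-* _ _ d _)
    (trans (monomial-cong _ (K.*-identityˡ _)) (monomial-exp K.1# (≡.sym (ℕₚ.*-suc d n)))))

  qFactor : K.Carrier → ℕ → ℕ → ℕ → Series
  qFactor X a d n = 1# - monomial X (a ℕ.+ d ℕ.* n)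

  qProd : K.Carrier → ℕ → ℕ → Series
  qProd X a d = prod∞ (qFactor X a d)

  1-small : ∀ {N f} → Agree N f 0# → Agree N (1# - f) 1#
  1-small s = agree-trans (agree-+ agree-refl (agree-neg s)) (≋⇒agree (solve 0 (con (+ 1) :- con (+ 0) := con (+ 1)) refl))

  n≤a+dn : ∀ a d .{{_ : ℕ.NonZero d}} n → n ≤ a ℕ.+ d ℕ.* n
  n≤a+dn a d n = ℕₚ.≤-trans (ℕₚ.m≤n*m n d) (ℕₚ.m≤n+m _ a)

  qFactor-small : ∀ X a d .{{_ : ℕ.NonZero d}} → Prod.Small (qFactor X a d)
  qFactor-small X a d n = 1-small (monomial-small X (n≤a+dn a d n))

  thetaTerm : K.Carrier → ℕ → ℕ → ℕ → Series
  thetaTerm X a d n = monomial ((K.- X) ^ᴷ n) (d ℕ.* tri n ℕ.+ a ℕ.* n)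

  thetaTerm-small : ∀ X a d .{{_ : ℕ.NonZero a}} → Sum.Small (thetaTerm X a d)
  thetaTerm-small X a d n = monomial-small _ (n≤a+dn (d ℕ.* tri n) a n)

  thetaTerm-suc-small : ∀ X a d .{{_ : ℕ.NonZero d}} → Sum.Small (λ n → thetaTerm X a d (suc n))
  thetaTerm-suc-small X a d n = monomial-small _
    (ℕₚ.≤-trans (ℕₚ.≤-trans (ℕₚ.m≤m+n n (tri n)) (ℕₚ.m≤n*m _ d)) (ℕₚ.m≤m+n _ _))

  module _ (X Y : K.Carrier) (XY≈1 : X K.* Y K.≈ K.1#) (a b d : ℕ) (a+b≡d : a ℕ.+ b ≡ d)
           {{_ : ℕ.NonZero a}} {{_ : ℕ.NonZero d}} where
    private
      x y Q : Series
      x = monomial X a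
      y = monomial Y b
      Q = monomial K.1# d

      xy≋Q : x * y ≋ Q
      xy≋Q = trans (monomial-* X Y a b) (trans (monomial-cong _ XY≈1) (monomial-exp K.1# a+b≡d))

      pochQ : ℕ → Series
      pochQ = Prod.F.fold (λ i → 1# - Q ^ suc i)

      Q-factor : ∀ i → 1# - Q ^ suc i ≋ qFactor K.1# d d i
      Q-factor i = +-congˡ (S.-‿cong (trans (monomial-^ d (suc i)) (monomial-exp K.1# (ℕₚ.*-suc d i))))

      factor : ∀ Z e i → 1# - monomial Z e * Q ^ i ≋ qFactor Z e d i
      factor Z e i = +-congˡ (S.-‿cong (trans (*-congˡ (monomial-^ d i))
        (trans (monomial-* Z _ e _) (monomial-cong _ (K.*-identityʳ Z)))))

      pochQ-small : Prod.Small (λ i → 1# - Q ^ suc i)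
      pochQ-small = Prod.Small-cong (λ k → sym (Q-factor k)) (qFactor-small K.1# d d)

      pochQ-head : ∀ n → pochQ n ‼ 0 K.≈ K.1#
      pochQ-head zero    = K.refl
      pochQ-head (suc n) = K.trans (Prod.F.fold-snoc _ n at 0) (K.trans (head-* (pochQ n) (1# - Q ^ suc n))
        (K.trans (K.*-cong (pochQ-head n) (below (1-small (agree-trans
          (≋⇒agree (trans (monomial-^ d (suc n)) (monomial-exp K.1# (ℕₚ.*-suc d n))))
          (monomial-small K.1# {1} (ℕₚ.≤-trans (ℕ.>-nonZero⁻¹ d) (ℕₚ.m≤m+n d _))))) 0 (s≤s z≤n)))
        (K.*-identityˡ _)))

      U : ℕ → Series
      U n = inv (pochQ n)

      module FTP = FiniteTripleProduct commutativeRing using (module Base)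
      open FTP.Base Q U (λ n → *-inv (pochQ n) (pochQ-head n))
      open Antidiagonal +-commutativeMonoid using (anti; anti-fold)

      term≋ : ∀ Z e n → term (monomial Z e) n ≋ thetaTerm Z e d n
      term≋ Z e zero    = trans (sym (monomial≋shiftBy K.1# 0)) (monomial-exp K.1# (≡.sym (≡.cong₂ ℕ._+_ (ℕₚ.*-zeroʳ d) (ℕₚ.*-zeroʳ e))))
      term≋ Z e (suc n) = trans (*-cong
        (trans (S.-‿cong (trans (*-congˡ (monomial-^ d n)) (trans (monomial-* Z _ e _) (monomial-cong _ (K.*-identityʳ Z)))))
               (-‿monomial Z _)) (term≋ Z e n))
        (trans (monomial-* _ _ (e ℕ.+ d ℕ.* n) _) (monomial-exp _
          (N.solve 4 (λ e d n t → (e N.:+ d N.:* n) N.:+ (d N.:* t N.:+ e N.:* n) N.:= d N.:* (n N.:+ t) N.:+ e N.:* (N.con 1 N.:+ n)) ≡.refl e d n (tri n))))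
        where module N = +-*-Solver

      small⁺ : Sum.Small (term x)
      small⁺ = Sum.Small-cong (λ n → sym (term≋ X a n)) (thetaTerm-small X a d)

      small⁻ : Sum.Small (λ n → term y (suc n))
      small⁻ = Sum.Small-cong (λ n → sym (term≋ Y b (suc n))) (thetaTerm-suc-small Y b d)

      θ : ℕ → ℕ → Series
      θ = theta x y xy≋Q

      θ-small⁻ : ∀ N i l → i ℕ.+ N < l → Agree N (θ i l) 0#
      θ-small⁻ N zero    (suc l) (s≤s N≤l) = agree-mono N≤l (small⁻ l)
      θ-small⁻ N (suc i) (suc l) (s≤s p)   = θ-small⁻ N i l p

      θ-small⁺ : ∀ N i l → l ℕ.+ N ≤ i → Agree N (θ i l) 0#
      θ-small⁺ .0 zero zero z≤n = agree-zero
      θ-small⁺ N (suc i) zero    p       = agree-mono p (small⁺ (suc i))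
      θ-small⁺ N (suc i) (suc l) (s≤s p) = θ-small⁺ N i l p

      anti-agree : ∀ {N} {g h : ℕ → ℕ → Series} n → (∀ i j → i ℕ.+ j ≡ n → Agree N (g i j) (h i j)) → Agree N (anti g n) (anti h n)
      anti-agree zero    p = p 0 0 ≡.refl
      anti-agree (suc n) p = agree-+ (p 0 (suc n) ≡.refl) (anti-agree n λ i j e → p (suc i) j (≡.cong suc e))

      binomial-agree : ∀ N i j → N ≤ i → N ≤ j → Agree N (binomial i j * pochQ (N ℕ.+ N)) 1#
      binomial-agree N i j N≤i N≤j = agree-trans
        (≋⇒agree (solve 4 (λ p u v r → (p :* (u :* v)) :* r := (p :* u) :* (r :* v)) refl _ _ _ _))
        (agree-trans (agree-* (agree-* (close (ℕₚ.≤-trans N≤i (ℕₚ.m≤m+n i j)) N≤i) agree-refl)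
                              (agree-* (close (ℕₚ.m≤m+n N N) N≤j) agree-refl))
          (≋⇒agree (trans (*-cong (*-inv (pochQ i) (pochQ-head i)) (*-inv (pochQ j) (pochQ-head j))) (S.*-identityˡ 1#))))
        where
        close : ∀ {m n} → N ≤ m → N ≤ n → Agree N (pochQ m) (pochQ n)
        close N≤m N≤n = agree-trans (Prod.fold-agree pochQ-small N≤m) (agree-sym (Prod.fold-agree pochQ-small N≤n))

      vanish : ∀ {N p t b} → Agree N t 0# → Agree N (p * (t * b)) t
      vanish s = agree-trans (≋⇒agree (solve 3 (λ p t b → p :* (t :* b) := (p :* b) :* t) refl _ _ _))
        (agree-trans (agree-*0 _ s) (agree-sym s))

      reorder : ∀ p t b → p * (t * b) ≋ t * (b * p)
      reorder = solve 3 (λ p t b → p :* (t :* b) := t :* (b :* p)) refl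

      summand-agree : ∀ N i j → i ℕ.+ j ≡ (N ℕ.+ N) ℕ.+ (N ℕ.+ N) →
        Agree N (pochQ (N ℕ.+ N) * (θ i (N ℕ.+ N) * binomial i j)) (θ i (N ℕ.+ N))
      summand-agree N i j e = [ large , small ]′ (ℕₚ.≤-<-connex N i)
        where
        small : i < N → _
        small i<N = vanish (θ-small⁻ N i (N ℕ.+ N) (ℕₚ.+-monoˡ-< N i<N))
        large : N ≤ i → _
        large N≤i = [ both , (λ j<N → vanish (θ-small⁺ N i (N ℕ.+ N) (ℕₚ.+-cancelʳ-≤ N _ _ (ℕₚ.≤-trans
            (ℕₚ.≤-reflexive (≡.trans (ℕₚ.+-assoc (N ℕ.+ N) N N) (≡.sym e)))
            (ℕₚ.+-monoʳ-≤ i (ℕₚ.<⇒≤ j<N)))))) ]′ (ℕₚ.≤-<-connex N j)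
          where
          both : N ≤ j → _
          both N≤j = agree-trans (≋⇒agree (reorder (pochQ (N ℕ.+ N)) (θ i (N ℕ.+ N)) (binomial i j)))
            (agree-trans (agree-* agree-refl (binomial-agree N i j N≤i N≤j)) (≋⇒agree (S.*-identityʳ _)))

    jacobiTripleProduct :
      qProd X a d * qProd Y b d * qProd K.1# d d ≋
      sum∞ (thetaTerm X a d) + sum∞ (λ n → thetaTerm Y b d (suc n))
    jacobiTripleProduct = agree⇒≋ λ N → let M = N ℕ.+ N in
      agree-trans (agree-* (agree-* (Prod.∞-agree (qFactor-small X a d) {N} {M} (ℕₚ.m≤m+n N N))
                                    (Prod.∞-agree (qFactor-small Y b d) {N} {M} (ℕₚ.m≤m+n N N)))
                           (Prod.∞-agree (qFactor-small K.1# d d) {N} {M} (ℕₚ.m≤m+n N N)))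
      (agree-trans (≋⇒agree (finite M))
      (agree-trans (anti-agree (M ℕ.+ M) (summand-agree N))
      (agree-trans (≋⇒agree (trans (anti-fold (λ i → θ i M) (M ℕ.+ M))
        (trans (S.reflexive (≡.cong (Sum.F.fold (λ i → θ i M)) (≡.sym (ℕₚ.+-suc M M))))
        (trans (sum-theta x y xy≋Q M M) (S.+-comm _ _)))))
      (agree-+ (agree-trans (agree-sym (Sum.∞-agree small⁺ (ℕₚ.≤-trans (ℕₚ.m≤m+n N N) (ℕₚ.n≤1+n M)))) (≋⇒agree (Sum.∞-cong (term≋ X a))))
               (agree-trans (agree-sym (Sum.∞-agree small⁻ (ℕₚ.m≤m+n N N))) (≋⇒agree (Sum.∞-cong λ n → term≋ Y b (suc n))))))))
      where
      finite : ∀ M → Prod.F.fold (qFactor X a d) M * Prod.F.fold (qFactor Y b d) M * Prod.F.fold (qFactor K.1# d d) M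
               ≋ anti (λ i j → pochQ M * (θ i M * binomial i j)) (M ℕ.+ M)
      finite M = trans (*-cong (*-cong (Prod.F.fold-cong M λ i → sym (factor X a i)) (Prod.F.fold-cong M λ i → sym (factor Y b i)))
                               (Prod.F.fold-cong M λ i → sym (Q-factor i)))
        (trans (*-comm _ _) (trans (*-congˡ (tripleProduct x y xy≋Q M M)) (anti-* (pochQ M) _ (M ℕ.+ M))))

module QuinticSections (R : CommutativeRing 0ℓ 0ℓ) where
  open PowerSeries R using (module Prod; module Sum; _*_; _+_; _-_; _at_; _‼_; _∙_; _≋_; *-commutativeMonoid; *-congʳ; *-congˡ; +-commutativeMonoid; +-cong; -_; 0#; 1#; Agree; Series; agree; agree-trans; below; commutativeRing; const; const-*; const-0; monomial; monomial-miss; monomial≋shiftBy; pointwise; prod∞; shift; shift-cong; shiftBy; shiftBy-*; shiftBy-cong; shiftBy-small; sum∞; sym; tail; trans; ≋⇒agree)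
  private
    module R = CommutativeRing R using (_*_; _+_; _≈_; +-cong; +-congˡ; +-identityʳ; +-identityˡ; 0#; 1#; refl; reflexive; sym; trans; zeroʳ)
    module S = CommutativeRing commutativeRing using (*-identityʳ; +-abelianGroup; -‿inverseˡ; distribʳ)
  open R using (_≈_)

  -- f(q) ↦ f(q⁵)
  V : Series → Series
  V f ‼ 0 = f ‼ 0
  V f ‼ 1 = R.0#
  V f ‼ 2 = R.0#
  V f ‼ 3 = R.0#
  V f ‼ 4 = R.0#
  V f ‼ suc (suc (suc (suc (suc n)))) = V (tail f) ‼ n

  V-cong′ : ∀ {f g} → f ≋ g → ∀ n → V f ‼ n ≈ V g ‼ n
  V-cong′ p 0 = p at 0
  V-cong′ p 1 = R.refl
  V-cong′ p 2 = R.refl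
  V-cong′ p 3 = R.refl
  V-cong′ p 4 = R.refl
  V-cong′ p (suc (suc (suc (suc (suc n))))) = V-cong′ (pointwise λ k → p at suc k) n

  V-cong : ∀ {f g} → f ≋ g → V f ≋ V g
  V-cong p = pointwise (V-cong′ p)

  V-+ : ∀ f g → V (f + g) ≋ V f + V g
  V-+ f g = pointwise (go f g)
    where
    go : ∀ f g n → V (f + g) ‼ n ≈ V f ‼ n R.+ V g ‼ n
    go f g 0 = R.refl
    go f g 1 = R.sym (R.+-identityˡ _)
    go f g 2 = R.sym (R.+-identityˡ _)
    go f g 3 = R.sym (R.+-identityˡ _)
    go f g 4 = R.sym (R.+-identityˡ _)
    go f g (suc (suc (suc (suc (suc n))))) =
      R.trans (V-cong′ (pointwise λ k → R.refl) n) (go (tail f) (tail g) n)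

  V-∙ : ∀ c f → V (c ∙ f) ≋ c ∙ V f
  V-∙ c f = pointwise (go c f)
    where
    go : ∀ c f n → V (c ∙ f) ‼ n ≈ c R.* V f ‼ n
    go c f 0 = R.refl
    go c f 1 = R.sym (R.zeroʳ c)
    go c f 2 = R.sym (R.zeroʳ c)
    go c f 3 = R.sym (R.zeroʳ c)
    go c f 4 = R.sym (R.zeroʳ c)
    go c f (suc (suc (suc (suc (suc n))))) = R.trans (V-cong′ (pointwise λ k → R.refl) n) (go c (tail f) n)

  V-const : ∀ c → V (const c) ≋ const c
  V-const c = pointwise λ { 0 → R.refl ; 1 → R.refl ; 2 → R.refl ; 3 → R.refl ; 4 → R.refl
                          ; (suc (suc (suc (suc (suc n))))) → go n }
    where
    go : ∀ n → V (tail (const c)) ‼ n ≈ R.0#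
    go n = R.trans (V-cong′ {g = 0#} (pointwise λ k → R.refl) n) (zero-V n)
      where
      zero-V : ∀ n → V 0# ‼ n ≈ R.0#
      zero-V 0 = R.refl
      zero-V 1 = R.refl
      zero-V 2 = R.refl
      zero-V 3 = R.refl
      zero-V 4 = R.refl
      zero-V (suc (suc (suc (suc (suc n))))) = R.trans (V-cong′ {g = 0#} (pointwise λ k → R.refl) n) (zero-V n)

  V-0 : V 0# ≋ 0#
  V-0 = trans (V-cong (sym const-0)) (trans (V-const R.0#) const-0)

  V-unfold : ∀ f → V f ≋ const (f ‼ 0) + shiftBy 5 (V (tail f))
  V-unfold f = pointwise λ
    { 0 → R.sym (R.+-identityʳ _) ; 1 → R.sym (R.+-identityˡ _) ; 2 → R.sym (R.+-identityˡ _)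
    ; 3 → R.sym (R.+-identityˡ _) ; 4 → R.sym (R.+-identityˡ _)
    ; (suc (suc (suc (suc (suc n))))) → R.sym (R.+-identityˡ _) }

  V*-unfold : ∀ f g → V f * g ≋ f ‼ 0 ∙ g + shiftBy 5 (V (tail f) * g)
  V*-unfold f g = trans (*-congʳ (V-unfold f)) (trans (S.distribʳ g _ _)
    (+-cong (const-* _ g) (shiftBy-* 5 (V (tail f)) g)))

  V-* : ∀ f g → V (f * g) ≋ V f * V g
  V-* f g = pointwise λ n → R.trans (go f g n) (R.sym (V*-unfold f (V g) at n))
    where
    low : ∀ {x} → x ≈ R.0# → R.0# ≈ f ‼ 0 R.* R.0# R.+ x
    low p = R.sym (R.trans (R.+-cong (R.zeroʳ _) p) (R.+-identityˡ _))
    go : ∀ f g n → V (f * g) ‼ n ≈ (f ‼ 0 ∙ V g + shiftBy 5 (V (tail f) * V g)) ‼ n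
    go f g 0 = R.refl
    go f g 1 = R.sym (R.trans (R.+-identityʳ _) (R.zeroʳ _))
    go f g 2 = R.sym (R.trans (R.+-identityʳ _) (R.zeroʳ _))
    go f g 3 = R.sym (R.trans (R.+-identityʳ _) (R.zeroʳ _))
    go f g 4 = R.sym (R.trans (R.+-identityʳ _) (R.zeroʳ _))
    go f g (suc (suc (suc (suc (suc n))))) = R.trans
      (V-cong′ {g = f ‼ 0 ∙ tail g + tail f * g} (pointwise λ k → R.refl) n)
      (R.trans (V-+ _ _ at n) (R.+-cong (V-∙ (f ‼ 0) (tail g) at n)
        (R.trans (go (tail f) g n) (R.sym (V*-unfold (tail f) (V g) at n)))))

  V-neg : ∀ f → V (- f) ≋ - V f
  V-neg f = AG.inverseˡ-unique _ _ (trans (sym (V-+ (- f) f)) (trans (V-cong (S.-‿inverseˡ f)) V-0))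
    where module AG = AbelianGroupProperties S.+-abelianGroup

  V-1 : V 1# ≋ 1#
  V-1 = V-const R.1#

  V-agree′ : ∀ {N f g} → Agree N f g → ∀ n → n < N → V f ‼ n ≈ V g ‼ n
  V-agree′ {suc N} p 0 _ = below p 0 (s≤s z≤n)
  V-agree′ p 1 _ = R.refl
  V-agree′ p 2 _ = R.refl
  V-agree′ p 3 _ = R.refl
  V-agree′ p 4 _ = R.refl
  V-agree′ {suc N} p (suc (suc (suc (suc (suc n))))) (s≤s n<N) =
    V-agree′ {N} (agree λ k k<N → below p (suc k) (s≤s k<N)) n (ℕₚ.≤-trans (ℕₚ.m≤n+m (suc n) 4) n<N)

  V-agree : ∀ {N f g} → Agree N f g → Agree N (V f) (V g)
  V-agree p = agree (V-agree′ p)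

  V-shift : ∀ f → V (shift f) ≋ shiftBy 5 (V f)
  V-shift f = pointwise λ
    { 0 → R.refl ; 1 → R.refl ; 2 → R.refl ; 3 → R.refl ; 4 → R.refl
    ; (suc (suc (suc (suc (suc n))))) → V-cong′ (pointwise λ k → R.refl) n }

  V-monomial : ∀ c e → V (monomial c e) ≋ monomial c (e ℕ.* 5)
  V-monomial c e = trans (V-cong (monomial≋shiftBy c e)) (trans (go e) (sym (monomial≋shiftBy c (e ℕ.* 5))))
    where
    go : ∀ e → V (shiftBy e (const c)) ≋ shiftBy (e ℕ.* 5) (const c)
    go zero    = V-const c
    go (suc e) = trans (V-shift _) (shiftBy-cong 5 (go e))

  V-sum∞ : ∀ {f} → Sum.Small f → V (sum∞ f) ≋ sum∞ (λ k → V (f k))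
  V-sum∞ {f} s = Sum.∞-unique (λ k → agree-trans (V-agree (s k)) (≋⇒agree V-0)) λ N →
    agree-trans (V-agree (Sum.∞-agree s ℕₚ.≤-refl))
      (≋⇒agree (FoldHom.fold-homo +-commutativeMonoid +-commutativeMonoid V V-0 V-+ f N))

  V-prod∞ : ∀ {f} → Prod.Small f → V (prod∞ f) ≋ prod∞ (λ k → V (f k))
  V-prod∞ {f} s = Prod.∞-unique (λ k → agree-trans (V-agree (s k)) (≋⇒agree V-1)) λ N →
    agree-trans (V-agree (Prod.∞-agree s ℕₚ.≤-refl))
      (≋⇒agree (FoldHom.fold-homo *-commutativeMonoid *-commutativeMonoid V V-1 V-* f N))

  U : ℕ → Series → Series
  U r f ‼ n = f ‼ (n ℕ.* 5 ℕ.+ r)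

  U-cong : ∀ r {f g} → f ≋ g → U r f ≋ U r g
  U-cong r p at n = p at (n ℕ.* 5 ℕ.+ r)

  U-+ : ∀ r f g → U r (f + g) ≋ U r f + U r g
  U-+ r f g = pointwise λ _ → R.refl

  U-V* : ∀ {r} → r < 5 → ∀ g f → U r (V g * f) ≋ g * U r f
  U-V* {r} r<5 g f = pointwise (go g f)
    where
    low : ∀ {r} → r < 5 → ∀ h → shiftBy 5 h ‼ r ≈ R.0#
    low {r} r<5 h = below (shiftBy-small 5 h) r r<5
    go : ∀ g f n → (V g * f) ‼ (n ℕ.* 5 ℕ.+ r) ≈ (g * U r f) ‼ n
    go g f zero    = R.trans (V*-unfold g f at r) (R.+-congˡ (low r<5 _))
    go g f (suc n) = R.trans (V*-unfold g f at (5 ℕ.+ (n ℕ.* 5 ℕ.+ r)))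
      (R.+-congˡ (go (tail g) f n))

  U-V : ∀ g → U 0 (V g) ≋ g
  U-V g = trans (U-cong 0 (sym (S.*-identityʳ _))) (trans (U-V* (s≤s z≤n) g 1#)
    (trans (*-congˡ U-1) (S.*-identityʳ g)))
    where
    U-1 : U 0 1# ≋ 1#
    U-1 at zero  = R.refl
    U-1 at suc n = R.refl

  V-injective : ∀ {f g} → V f ≋ V g → f ≋ g
  V-injective p = trans (sym (U-V _)) (trans (U-cong 0 p) (U-V _))

  U-shift : ∀ r f → U (suc r) (shift f) ≋ U r f
  U-shift r f at n = R.reflexive (≡.cong (shift f ‼_) (ℕₚ.+-suc (n ℕ.* 5) r))

  U-shift-0 : ∀ f → U 0 (shift f) ≋ shift (U 4 f)
  U-shift-0 f at zero  = R.refl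
  U-shift-0 f at suc n = R.reflexive (≡.cong (f ‼_) (ℕₚ.+-comm 4 (n ℕ.* 5 ℕ.+ 0) ▸ lem n))
    where
    _▸_ : ∀ {a b c : ℕ} → a ≡ b → b ≡ c → a ≡ c
    _▸_ = ≡.trans
    lem : ∀ n → n ℕ.* 5 ℕ.+ 0 ℕ.+ 4 ≡ n ℕ.* 5 ℕ.+ 4
    lem n = ≡.cong (ℕ._+ 4) (ℕₚ.+-identityʳ (n ℕ.* 5))

  sections : ∀ f → f ≋ V (U 0 f) + shift (V (U 1 f) + shift (V (U 2 f) + shift (V (U 3 f) + shift (V (U 4 f)))))
  sections f = pointwise (go f)
    where
    g : Series → Series
    g f = V (U 0 f) + shift (V (U 1 f) + shift (V (U 2 f) + shift (V (U 3 f) + shift (V (U 4 f)))))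
    drop₅ : Series → Series
    drop₅ f ‼ n = f ‼ (5 ℕ.+ n)
    go : ∀ f n → f ‼ n ≈ g f ‼ n
    go f 0 = R.sym (R.+-identityʳ _)
    go f 1 = R.sym (R.trans (R.+-identityˡ _) (R.+-identityʳ _))
    go f 2 = R.sym (R.trans (R.+-identityˡ _) (R.trans (R.+-identityˡ _) (R.+-identityʳ _)))
    go f 3 = R.sym (R.trans (R.+-identityˡ _) (R.trans (R.+-identityˡ _) (R.trans (R.+-identityˡ _) (R.+-identityʳ _))))
    go f 4 = R.sym (R.trans (R.+-identityˡ _) (R.trans (R.+-identityˡ _) (R.trans (R.+-identityˡ _) (R.+-identityˡ _))))
    go f (suc (suc (suc (suc (suc n))))) = R.trans (go (drop₅ f) n) (R.trans (step n) (lift n))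
      where
      open IntegerSolver R using (_:+_; _:=_; Polynomial; con; solve)
      o : ∀ {n} → Polynomial n
      o = con (+ 0)
      Vd : ∀ r → V (U r (drop₅ f)) ≋ V (tail (U r f))
      Vd r = V-cong (pointwise λ k → R.refl)
      G : Series
      G = V (tail (U 0 f)) + shift (V (tail (U 1 f)) + shift (V (tail (U 2 f)) + shift (V (tail (U 3 f)) + shift (V (tail (U 4 f))))))
      step : ∀ n → g (drop₅ f) ‼ n ≈ G ‼ n
      step n = +-cong (Vd 0) (shift-cong (+-cong (Vd 1) (shift-cong (+-cong (Vd 2)
        (shift-cong (+-cong (Vd 3) (shift-cong (Vd 4)))))))) at n
      lift : ∀ n → G ‼ n ≈ g f ‼ (5 ℕ.+ n)
      lift 0 = solve 1 (λ a → a :+ o := a :+ (o :+ (o :+ (o :+ o)))) R.refl _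
      lift 1 = solve 2 (λ a b → a :+ (b :+ o) := a :+ (b :+ (o :+ (o :+ o)))) R.refl _ _
      lift 2 = solve 3 (λ a b c → a :+ (b :+ (c :+ o)) := a :+ (b :+ (c :+ (o :+ o)))) R.refl _ _ _
      lift 3 = R.refl
      lift (suc (suc (suc (suc n)))) = R.refl

  U-agree : ∀ {N f g} → Agree (N ℕ.* 5) f g → Agree N (U 0 f) (U 0 g)
  U-agree {N} p = agree λ n n<N → below p _ (ℕₚ.≤-trans (ℕₚ.≤-reflexive (≡.cong suc (ℕₚ.+-identityʳ _)))
    (ℕₚ.*-monoˡ-< 5 n<N))

  U-sum∞ : ∀ {f} → Sum.Small f → Sum.Small (λ k → U 0 (f k)) → U 0 (sum∞ f) ≋ sum∞ (λ k → U 0 (f k))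
  U-sum∞ {f} s t = Sum.∞-unique t λ N → agree-trans (U-agree (Sum.∞-agree s ℕₚ.≤-refl))
    (agree-trans (≋⇒agree (FoldHom.fold-homo +-commutativeMonoid +-commutativeMonoid (U 0) (pointwise λ _ → R.refl) (U-+ 0) f (N ℕ.* 5)))
      (Sum.fold-agree t (ℕₚ.m≤m*n N 5)))

  U-monomial-5 : ∀ c e → U 0 (monomial c (e ℕ.* 5)) ≋ monomial c e
  U-monomial-5 c e = trans (U-cong 0 (sym (V-monomial c e))) (U-V (monomial c e))

  U-monomial-∤ : ∀ c e → (5 ∣ e → ⊥) → U 0 (monomial c e) ≋ 0#
  U-monomial-∤ c e 5∤e at n = R.reflexive (monomial-miss c e _ λ p →
    5∤e (divides n (≡.trans (≡.sym p) (ℕₚ.+-identityʳ _))))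

module QuadraticSeries (R : CommutativeRing 0ℓ 0ℓ) (α β : CommutativeRing.Carrier R) where
  private module R = CommutativeRing R using (_*_; _+_; _≈_; +-commutativeMonoid; +-cong; +-congˡ; 0#; distribˡ; refl; sym; trans; zeroʳ)
  module K = QuadraticExtension R α β using (_+θ_; _,_; Carrier; commutativeRing; im; im≈; re; re≈)
  module L = PowerSeries K.commutativeRing using (module Prod; _*_; _+_; _-_; _at_; _‼_; _≋_; *-commutativeMonoid; *-congʳ; +-commutativeMonoid; +-congˡ; -_; 1#; Series; commutativeRing; const; monomial; monomial≋shiftBy; pointwise; sum∞; trans)
  private
    module KR = CommutativeRing K.commutativeRing using (_*_; _+_; +-commutativeMonoid; 0#)
  open PowerSeries R using (_*_; _+_; _-_; _at_; _‼_; _∙_; _≋_; +-commutativeMonoid; -_; Series; commutativeRing; const; monomial; pointwise; q; sum∞)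
  open K using (_+θ_; re; im; re≈; im≈)

  reS imS : L.Series → Series
  reS f ‼ n = re (f L.‼ n)
  imS f ‼ n = im (f L.‼ n)

  reS-cong : ∀ {f g} → f L.≋ g → reS f ≋ reS g
  reS-cong p at n = re≈ (p L.at n)

  imS-cong : ∀ {f g} → f L.≋ g → imS f ≋ imS g
  imS-cong p at n = im≈ (p L.at n)

  ext : ∀ {f g} → reS f ≋ reS g → imS f ≋ imS g → f L.≋ g
  ext p q = L.pointwise λ n → (p at n) K., (q at n)

  reS-+ : ∀ f g → reS (f L.+ g) ≋ reS f + reS g
  reS-+ f g = pointwise λ _ → R.refl

  imS-+ : ∀ f g → imS (f L.+ g) ≋ imS f + imS g
  imS-+ f g = pointwise λ _ → R.refl

  reS-- : ∀ f g → reS (f L.- g) ≋ reS f - reS g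
  reS-- f g = pointwise λ _ → R.refl

  imS-- : ∀ f g → imS (f L.- g) ≋ imS f - imS g
  imS-- f g = pointwise λ _ → R.refl

  private
    module FR = FiniteFold R.+-commutativeMonoid using (fold-∙)

    re-fold : ∀ f n → re (foldℕ KR._+_ KR.0# f n) R.≈ foldℕ R._+_ R.0# (λ i → re (f i)) n
    re-fold = FoldHom.fold-homo KR.+-commutativeMonoid R.+-commutativeMonoid re R.refl (λ _ _ → R.refl)

    im-fold : ∀ f n → im (foldℕ KR._+_ KR.0# f n) R.≈ foldℕ R._+_ R.0# (λ i → im (f i)) n
    im-fold = FoldHom.fold-homo KR.+-commutativeMonoid R.+-commutativeMonoid im R.refl (λ _ _ → R.refl)

    fold-* : ∀ c f n → foldℕ R._+_ R.0# (λ i → c R.* f i) n R.≈ c R.* foldℕ R._+_ R.0# f n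
    fold-* c f n = R.sym (FoldHom.fold-homo R.+-commutativeMonoid R.+-commutativeMonoid (c R.*_) (R.zeroʳ c) (R.distribˡ c) f n)

  reS-* : ∀ f g → reS (f L.* g) ≋ reS f * reS g + β ∙ (imS f * imS g)
  reS-* f g at n = R.trans (re-fold (λ i → f L.‼ i KR.* g L.‼ (n ∸ i)) (suc n))
    (R.trans (FR.fold-∙ (λ i → reS f ‼ i R.* reS g ‼ (n ∸ i)) (λ i → β R.* (imS f ‼ i R.* imS g ‼ (n ∸ i))) (suc n))
      (R.+-congˡ (fold-* β (λ i → imS f ‼ i R.* imS g ‼ (n ∸ i)) (suc n))))

  imS-* : ∀ f g → imS (f L.* g) ≋ (reS f * imS g + imS f * reS g) + α ∙ (imS f * imS g)
  imS-* f g at n = R.trans (im-fold (λ i → f L.‼ i KR.* g L.‼ (n ∸ i)) (suc n))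
    (R.trans (FR.fold-∙ (λ i → reS f ‼ i R.* imS g ‼ (n ∸ i) R.+ imS f ‼ i R.* reS g ‼ (n ∸ i))
                        (λ i → α R.* (imS f ‼ i R.* imS g ‼ (n ∸ i))) (suc n))
      (R.+-cong (FR.fold-∙ (λ i → reS f ‼ i R.* imS g ‼ (n ∸ i)) (λ i → imS f ‼ i R.* reS g ‼ (n ∸ i)) (suc n))
                (fold-* α (λ i → imS f ‼ i R.* imS g ‼ (n ∸ i)) (suc n))))

  reS-const : ∀ X → reS (L.const X) ≋ const (re X)
  reS-const X = pointwise λ { zero → R.refl ; (suc n) → R.refl }

  imS-const : ∀ X → imS (L.const X) ≋ const (im X)
  imS-const X = pointwise λ { zero → R.refl ; (suc n) → R.refl }

  reS-monomial : ∀ X e → reS (L.monomial X e) ≋ monomial (re X) e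
  reS-monomial X e = pointwise (go e)
    where
    go : ∀ e n → re (L.monomial X e L.‼ n) R.≈ monomial (re X) e ‼ n
    go zero    zero    = R.refl
    go zero    (suc n) = R.refl
    go (suc e) zero    = R.refl
    go (suc e) (suc n) = go e n

  imS-monomial : ∀ X e → imS (L.monomial X e) ≋ monomial (im X) e
  imS-monomial X e = pointwise (go e)
    where
    go : ∀ e n → im (L.monomial X e L.‼ n) R.≈ monomial (im X) e ‼ n
    go zero    zero    = R.refl
    go zero    (suc n) = R.refl
    go (suc e) zero    = R.refl
    go (suc e) (suc n) = go e n

  reS-sum∞ : ∀ f → reS (L.sum∞ f) ≋ sum∞ (λ k → reS (f k))
  reS-sum∞ f at n = FoldHom.fold-homo L.+-commutativeMonoid +-commutativeMonoid reS
    (pointwise λ _ → R.refl) reS-+ f (suc n) at n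

  imS-sum∞ : ∀ f → imS (L.sum∞ f) ≋ sum∞ (λ k → imS (f k))
  imS-sum∞ f at n = FoldHom.fold-homo L.+-commutativeMonoid +-commutativeMonoid imS
    (pointwise λ _ → R.refl) imS-+ f (suc n) at n

module Lambert (K : CommutativeRing 0ℓ 0ℓ) where
  open PowerSeries K using (module Sum; _*_; _+_; _-_; _^_; _≋_; *-sum∞; +-cong; -_; 0#; 1#; Agree; Series; agree-mono; commutativeRing; monomial; monomial-*; monomial-cong; monomial-exp; monomial-small; refl; sum∞; sym; trans)
  open TripleProduct K using (n≤a+dn)
  open SemiringExp (CommutativeRing.semiring K) using () renaming (_^_ to _^ᴷ_)
  private
    module K = CommutativeRing K using (*-identityʳ; Carrier)
  open IntegerSolver commutativeRing using (_:*_; _:+_; _:-_; _:=_; :-_; con; solve)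

  geoTerm : K.Carrier → ℕ → ℕ → Series
  geoTerm x e k = monomial (x ^ᴷ suc k) (e ℕ.* suc k)

  geoTerm-small : ∀ x e → .{{ℕ.NonZero e}} → Sum.Small (geoTerm x e)
  geoTerm-small x e k = monomial-small _ (ℕₚ.≤-trans (ℕₚ.n≤1+n k) (ℕₚ.m≤n*m (suc k) e))

  geoTerm-small′ : ∀ x e k → Agree e (geoTerm x e k) 0#
  geoTerm-small′ x e k = monomial-small _ (ℕₚ.m≤m*n e (suc k))

  geometric : K.Carrier → ℕ → Series
  geometric x e = sum∞ (geoTerm x e)

  geometric-* : ∀ x e → .{{ℕ.NonZero e}} → (1# - monomial x e) * geometric x e ≋ monomial x e
  geometric-* x e = trans (solve 2 (λ m g → (con (+ 1) :- m) :* g := g :- m :* g) refl (monomial x e) (geometric x e))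
    (trans (+-cong step refl) (solve 2 (λ m s → (m :+ s) :- s := m) refl (monomial x e) (monomial x e * geometric x e)))
    where
    step : geometric x e ≋ monomial x e + monomial x e * geometric x e
    step = trans (Sum.∞-first (geoTerm-small x e)) (+-cong
      (trans (monomial-cong _ (K.*-identityʳ x)) (monomial-exp x (ℕₚ.*-identityʳ e)))
      (sym (trans (*-sum∞ (monomial x e) (geoTerm-small x e)) (Sum.∞-cong λ k →
        trans (monomial-* x _ e _) (monomial-exp _ (≡.sym (ℕₚ.*-suc e (suc k))))))))

  -- Σₙ Σₖ xᵏ q^{k(a+dn)}, k ≥ 1: minus the logarithmic derivative of qProd x a d in x.
  lambert : K.Carrier → ℕ → ℕ → Series
  lambert x a d = sum∞ (λ n → geometric x (a ℕ.+ d ℕ.* n))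

  module _ (x : K.Carrier) (a d : ℕ) .{{_ : ℕ.NonZero a}} .{{_ : ℕ.NonZero d}} where
    lambert-small : Sum.Small (λ n → geometric x (a ℕ.+ d ℕ.* n))
    lambert-small n = agree-mono (n≤a+dn a d n) (Sum.∞-small (geoTerm-small′ x (a ℕ.+ d ℕ.* n)))

module DualSeries (K : CommutativeRing 0ℓ 0ℓ) where
  open PowerSeries K using (module Prod; module Sum; _*_; _+_; _-_; _at_; _∙_; _≋_; *-commutativeMonoid; *-cong; *-congˡ; +-cong; +-congˡ; -_; 0#; 1#; Series; agree-*; agree-neg; agree-refl; agree-sym; below; commutativeRing; const; const-*; const-0; monomial; monomial-cong; q; refl; sym; trans; ∙-monomial)
  open TripleProduct K using (qFactor; qFactor-small; qProd)
  open Lambert K using (geometric; geometric-*; lambert; lambert-small)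
  private
    module K = CommutativeRing K using (_*_; _≈_; 0#; Carrier; trans; zeroˡ)
    module S = CommutativeRing commutativeRing using (+-identityʳ; +-identityˡ; -‿cong)
  open IntegerSolver commutativeRing using (_:*_; _:+_; _:-_; _:=_; :-_; con; solve)

  private
    module QS = QuadraticSeries K K.0# K.0# using (module K; module L; imS; imS-*; imS--; imS-cong; imS-const; imS-monomial; reS; reS-*; reS--; reS-cong; reS-const; reS-monomial)
  open QS using (reS; imS; reS-*; imS-*; reS-monomial; imS-monomial; reS-cong; imS-cong)
  module D = QS.K
  module L = QS.L
  module DR = CommutativeRing D.commutativeRing using (_*_; _-_; _≈_; *-congˡ; *-identityʳ; *-identityˡ; +-commutativeMonoid; -_; 1#; refl; semiring; trans)
  module LT = TripleProduct D.commutativeRing using (jacobiTripleProduct; qFactor; qFactor-small; qProd; thetaTerm)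

  0∙ : ∀ f → K.0# ∙ f ≋ 0#
  0∙ f at n = K.zeroˡ _

  reS-*D : ∀ f g → reS (f L.* g) ≋ reS f * reS g
  reS-*D f g = trans (reS-* f g) (trans (+-congˡ (0∙ _)) (S.+-identityʳ _))

  imS-*D : ∀ f g → imS (f L.* g) ≋ reS f * imS g + imS f * reS g
  imS-*D f g = trans (imS-* f g) (trans (+-congˡ (0∙ _)) (S.+-identityʳ _))

  reS-fold : ∀ F n → reS (L.Prod.F.fold F n) ≋ Prod.F.fold (λ i → reS (F i)) n
  reS-fold = FoldHom.fold-homo L.*-commutativeMonoid *-commutativeMonoid reS (QS.reS-const _) reS-*D

  imS-fold : ∀ c {F : ℕ → L.Series} {m g : ℕ → Series} → (∀ i → reS (F i) ≋ 1# - m i) → (∀ i → imS (F i) ≋ - (c * m i)) →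
             (∀ i → (1# - m i) * g i ≋ m i) → ∀ n →
             imS (L.Prod.F.fold F n) ≋ - (c * (Prod.F.fold (λ i → 1# - m i) n * Sum.F.fold g n))
  imS-fold c {F} {m} {g} p q r zero = trans (trans (QS.imS-const _) const-0)
    (solve 1 (λ c → con (+ 0) := :- (c :* (con (+ 1) :* con (+ 0)))) refl c)
  imS-fold c {F} {m} {g} p q r (suc n) = trans (imS-*D (F 0) rest)
    (trans (+-cong (*-cong (p 0) (imS-fold c (λ i → p (suc i)) (λ i → q (suc i)) (λ i → r (suc i)) n))
                   (*-cong (trans (q 0) (S.-‿cong (*-congˡ (sym (r 0)))))
                           (trans (reS-fold _ n) (Prod.F.fold-cong n λ i → p (suc i)))))
      (solve 5 (λ c m P L g → (con (+ 1) :- m) :* (:- (c :* (P :* L))) :+ (:- (c :* ((con (+ 1) :- m) :* g))) :* P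
                 := :- (c :* (((con (+ 1) :- m) :* P) :* (g :+ L)))) refl c (m 0) P Λ (g 0)))
    where
    rest = L.Prod.F.fold (λ i → F (suc i)) n
    P = Prod.F.fold (λ i → 1# - m (suc i)) n
    Λ = Sum.F.fold (λ i → g (suc i)) n

  module _ (X : D.Carrier) (x s : K.Carrier) (re-X : D.re X K.≈ x) (im-X : D.im X K.≈ s K.* x)
           (a d : ℕ) .{{a≢0 : ℕ.NonZero a}} .{{_ : ℕ.NonZero d}} where
    private
      re-factor : ∀ n → reS (LT.qFactor X a d n) ≋ qFactor x a d n
      re-factor n = trans (QS.reS-- L.1# _) (+-cong (QS.reS-const _)
        (S.-‿cong (trans (reS-monomial X (a ℕ.+ d ℕ.* n)) (monomial-cong _ re-X))))

      im-factor : ∀ n → imS (LT.qFactor X a d n) ≋ - (const s * monomial x (a ℕ.+ d ℕ.* n))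
      im-factor n = trans (QS.imS-- L.1# _) (trans (+-cong (trans (QS.imS-const _) const-0)
        (S.-‿cong (trans (imS-monomial X (a ℕ.+ d ℕ.* n)) (trans (monomial-cong _ im-X)
          (sym (trans (const-* s _) (∙-monomial s x (a ℕ.+ d ℕ.* n)))))))) (S.+-identityˡ _))

      nonZero : ∀ n → ℕ.NonZero (a ℕ.+ d ℕ.* n)
      nonZero n = ℕ.>-nonZero (ℕₚ.≤-trans (ℕ.>-nonZero⁻¹ a) (ℕₚ.m≤m+n a _))

    reS-qProd : reS (LT.qProd X a d) ≋ qProd x a d
    reS-qProd at n = trans (reS-fold (LT.qFactor X a d) (suc n)) (Prod.F.fold-cong (suc n) re-factor) at n

    imS-qProd : imS (LT.qProd X a d) ≋ - (const s * (qProd x a d * lambert x a d))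
    imS-qProd at n = K.trans
      (imS-fold (const s) {F = LT.qFactor X a d} {m = λ i → monomial x (a ℕ.+ d ℕ.* i)} {g = λ i → geometric x (a ℕ.+ d ℕ.* i)} re-factor im-factor
        (λ i → geometric-* x (a ℕ.+ d ℕ.* i) {{nonZero i}}) (suc n) at n)
      (below (agree-neg (agree-* (agree-refl {f = const s}) (agree-*
        (agree-sym (Prod.∞-agree (qFactor-small x a d) ℕₚ.≤-refl))
        (agree-sym (Sum.∞-agree (lambert-small x a d) ℕₚ.≤-refl))))) n (ℕₚ.n<1+n n))

module DifferentiatedTripleProduct (K : CommutativeRing 0ℓ 0ℓ) where
  open PowerSeries K using (const-neg; module Sum; _*_; _+_; _-_; _^_; _at_; _≋_; *-cong; *-congʳ; *-congˡ; +-commutativeMonoid; +-cong; -_; 0#; 1#; Series; commutativeRing; const; const-0; monomial; monomial-+; monomial-cong; monomial-exp; monomial-small; pointwise; q; refl; sum∞; sym; trans)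
  open TripleProduct K using (-‿monomial; qProd; thetaTerm)
  open Lambert K using (lambert)
  open DualSeries K using (module D; module DR; module L; module LT; imS-*D; imS-qProd; reS-*D; reS-qProd)
  open IntegerMultiples K using (fromℕ; fromℕ-suc)
  open SemiringExp (CommutativeRing.semiring K) using () renaming (_^_ to _^ᴷ_)
  private
    module K = CommutativeRing K using (_*_; _+_; _-_; _≈_; *-cong; *-congʳ; *-congˡ; *-identityˡ; +-cong; +-identityʳ; -_; -‿cong; 0#; 1#; Carrier; refl; sym; trans; zeroˡ)
    module S = CommutativeRing commutativeRing using (*-identityˡ; -‿cong; zeroˡ)
    module QS = QuadraticSeries K K.0# K.0# using (imS; imS-+; imS--; imS-cong; imS-const; imS-monomial; imS-sum∞; reS; reS-+; reS--; reS-cong; reS-const; reS-monomial; reS-sum∞)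
    module DExp = SemiringExp DR.semiring using (_^_)
    module CS = IntegerSolver K using (_:*_; _:+_; _:-_; _:=_; :-_; con; solve)
  open QS using (reS; imS)
  open D using (_+θ_; re; im)
  open IntegerSolver commutativeRing using (_:*_; _:+_; _:-_; _:=_; :-_; con; solve)

  private
    re-^ : ∀ {X x} → re X K.≈ x → ∀ n → re ((DR.- X) DExp.^ n) K.≈ (K.- x) ^ᴷ n
    re-^ p zero    = K.refl
    re-^ {X} {x} p (suc n) = K.trans (K.+-cong (K.*-cong (K.-‿cong p) (re-^ {X} p n)) (K.zeroˡ _)) (K.+-identityʳ _)

    im-^ : ∀ {X x} s → re X K.≈ x → im X K.≈ s K.* x → ∀ n →
           im ((DR.- X) DExp.^ n) K.≈ s K.* (fromℕ n K.* (K.- x) ^ᴷ n)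
    im-^ s p q zero = CS.solve 1 (λ s → CS.con (+ 0) CS.:= s CS.:* (CS.con (+ 0) CS.:* CS.con (+ 1))) K.refl s
    im-^ {X} {x} s p q (suc n) = K.trans
      (K.+-cong (K.+-cong (K.*-cong (K.-‿cong p) (im-^ {X} s p q n))
                          (K.*-cong (K.-‿cong q) (re-^ {X} p n))) (K.zeroˡ _))
      (K.trans (CS.solve 4 (λ s x n p → ((CS.:- x) CS.:* (s CS.:* (n CS.:* p)) CS.:+ (CS.:- (s CS.:* x)) CS.:* p) CS.:+ CS.con (+ 0)
                 CS.:= s CS.:* ((CS.con (+ 1) CS.:+ n) CS.:* ((CS.:- x) CS.:* p))) K.refl s x (fromℕ n) ((K.- x) ^ᴷ n))
        (K.*-congˡ (K.*-congʳ (K.sym (fromℕ-suc n)))))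

  module _ (z z′ : K.Carrier) (zz′≈1 : z K.* z′ K.≈ K.1#) where
    private
      Z Z′ : D.Carrier
      Z  = z +θ z
      Z′ = z′ +θ (K.- z′)

      ZZ′≈1 : Z DR.* Z′ DR.≈ DR.1#
      ZZ′≈1 = K.trans (K.+-cong zz′≈1 (K.zeroˡ _)) (K.+-identityʳ _) D.,
              K.trans (K.+-cong (CS.solve 2 (λ z w → z CS.:* (CS.:- w) CS.:+ z CS.:* w CS.:= CS.con (+ 0)) K.refl z z′) (K.zeroˡ _)) (K.+-identityʳ _)

      im-Z : im Z K.≈ K.1# K.* z
      im-Z = K.sym (K.*-identityˡ z)

      im-Z′ : im Z′ K.≈ (K.- K.1#) K.* z′
      im-Z′ = CS.solve 1 (λ w → CS.:- w CS.:= (CS.:- CS.con (+ 1)) CS.:* w) K.refl z′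

    term⁺ term⁻ : ℕ → ℕ → ℕ → Series
    term⁺ a d n = monomial (fromℕ n K.* (K.- z) ^ᴷ n) (d ℕ.* tri n ℕ.+ a ℕ.* n)
    term⁻ b d n = monomial (fromℕ n K.* (K.- z′) ^ᴷ n) (d ℕ.* tri n ℕ.+ b ℕ.* n)

    private
      re-theta⁺ : ∀ a d n → reS (LT.thetaTerm Z a d n) ≋ thetaTerm z a d n
      re-theta⁺ a d n = trans (QS.reS-monomial _ _) (monomial-cong _ (re-^ {Z} K.refl n))

      re-theta⁻ : ∀ a d n → reS (LT.thetaTerm Z′ a d n) ≋ thetaTerm z′ a d n
      re-theta⁻ a d n = trans (QS.reS-monomial _ _) (monomial-cong _ (re-^ {Z′} K.refl n))

      im-theta⁺ : ∀ a d n → imS (LT.thetaTerm Z a d n) ≋ term⁺ a d n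
      im-theta⁺ a d n = trans (QS.imS-monomial _ _) (monomial-cong _
        (K.trans (im-^ {Z} K.1# K.refl im-Z n) (K.*-identityˡ _)))

      im-theta⁻ : ∀ a d n → imS (LT.thetaTerm Z′ a d n) ≋ - term⁻ a d n
      im-theta⁻ a d n = trans (QS.imS-monomial _ _) (trans (monomial-cong _
        (K.trans (im-^ {Z′} (K.- K.1#) K.refl im-Z′ n)
          (CS.solve 1 (λ w → (CS.:- CS.con (+ 1)) CS.:* w CS.:= CS.:- w) K.refl _))) (sym (-‿monomial _ _)))

      reE : ∀ d .{{_ : ℕ.NonZero d}} → reS (LT.qProd DR.1# d d) ≋ qProd K.1# d d
      reE d = reS-qProd DR.1# K.1# K.0# K.refl (K.sym (K.zeroˡ _)) d d

      imE : ∀ d .{{_ : ℕ.NonZero d}} → imS (LT.qProd DR.1# d d) ≋ 0#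
      imE d = trans (imS-qProd DR.1# K.1# K.0# K.refl (K.sym (K.zeroˡ _)) d d)
        (trans (S.-‿cong (trans (*-congʳ const-0) (S.zeroˡ _))) (solve 0 (:- con (+ 0) := con (+ 0)) refl))

      re⁺ : ∀ a d .{{_ : ℕ.NonZero a}} .{{_ : ℕ.NonZero d}} → reS (LT.qProd Z a d) ≋ qProd z a d
      re⁺ a d = reS-qProd Z z K.1# K.refl im-Z a d

      im⁺ : ∀ a d .{{_ : ℕ.NonZero a}} .{{_ : ℕ.NonZero d}} → imS (LT.qProd Z a d) ≋ - (qProd z a d * lambert z a d)
      im⁺ a d = trans (imS-qProd Z z K.1# K.refl im-Z a d) (S.-‿cong (S.*-identityˡ _))

      re⁻ : ∀ a d .{{_ : ℕ.NonZero a}} .{{_ : ℕ.NonZero d}} → reS (LT.qProd Z′ a d) ≋ qProd z′ a d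
      re⁻ a d = reS-qProd Z′ z′ (K.- K.1#) K.refl im-Z′ a d

      im⁻ : ∀ a d .{{_ : ℕ.NonZero a}} .{{_ : ℕ.NonZero d}} → imS (LT.qProd Z′ a d) ≋ qProd z′ a d * lambert z′ a d
      im⁻ a d = trans (imS-qProd Z′ z′ (K.- K.1#) K.refl im-Z′ a d)
        (trans (S.-‿cong (*-congʳ (const-neg K.1#))) (solve 1 (λ w → :- ((:- con (+ 1)) :* w) := w) refl _))

    module _ (a b d : ℕ) (a+b≡d : a ℕ.+ b ≡ d) {{_ : ℕ.NonZero a}} {{_ : ℕ.NonZero b}} {{_ : ℕ.NonZero d}} where
      differentiatedTripleProduct :
        (qProd z a d * qProd z′ b d * qProd K.1# d d) * (lambert z′ b d - lambert z a d) ≋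
        sum∞ (term⁺ a d) - sum∞ (λ n → term⁻ b d (suc n))
      differentiatedTripleProduct = trans (sym left) (trans (QS.imS-cong (LT.jacobiTripleProduct Z Z′ ZZ′≈1 a b d a+b≡d)) right)
        where
        right : imS (L.sum∞ (LT.thetaTerm Z a d) L.+ L.sum∞ (λ n → LT.thetaTerm Z′ b d (suc n))) ≋
                sum∞ (term⁺ a d) - sum∞ (λ n → term⁻ b d (suc n))
        right = trans (QS.imS-+ _ _) (+-cong (trans (QS.imS-sum∞ _) (Sum.∞-cong (im-theta⁺ a d)))
          (trans (QS.imS-sum∞ _) (trans (Sum.∞-cong λ n → im-theta⁻ b d (suc n)) (sum∞-neg _))))
          where
          sum∞-neg : ∀ f → sum∞ (λ k → - f k) ≋ - sum∞ f
          sum∞-neg f at n = K.sym (FoldHom.fold-homo +-commutativeMonoid +-commutativeMonoid (-_)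
            (solve 0 (:- con (+ 0) := con (+ 0)) refl) (λ x y → solve 2 (λ x y → :- (x :+ y) := :- x :+ :- y) refl x y) f (suc n) at n)
        left : imS (LT.qProd Z a d L.* LT.qProd Z′ b d L.* LT.qProd DR.1# d d) ≋
               (qProd z a d * qProd z′ b d * qProd K.1# d d) * (lambert z′ b d - lambert z a d)
        left = trans (imS-*D _ _) (trans (+-cong (*-congˡ (imE d))
            (*-cong (trans (imS-*D _ _) (+-cong (*-cong (re⁺ a d) (im⁻ b d)) (*-cong (im⁺ a d) (re⁻ b d)))) (reE d)))
          (solve 6 (λ w p l p′ l′ e → w :* con (+ 0) :+ (p :* (p′ :* l′) :+ (:- (p :* l)) :* p′) :* e
             := (p :* p′ :* e) :* (l′ :- l)) refl _ (qProd z a d) (lambert z a d) (qProd z′ b d) (lambert z′ b d) (qProd K.1# d d)))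

    Θ : Series
    Θ = qProd z 1 1 * qProd z′ 1 1 * qProd K.1# 1 1

    private
      tri-exp⁺ : ∀ n → 1 ℕ.* tri n ℕ.+ 1 ℕ.* n ≡ tri (suc n)
      tri-exp⁺ n = ≡.trans (≡.cong₂ ℕ._+_ (ℕₚ.*-identityˡ (tri n)) (ℕₚ.*-identityˡ n)) (ℕₚ.+-comm (tri n) n)

      tri-exp⁻ : ∀ n → 1 ℕ.* tri (suc n) ℕ.+ 0 ℕ.* suc n ≡ tri (suc n)
      tri-exp⁻ n = ≡.trans (ℕₚ.+-identityʳ _) (ℕₚ.*-identityˡ _)

      product : LT.qProd Z 1 1 L.* LT.qProd Z′ 0 1 L.* LT.qProd DR.1# 1 1 L.≋
                L.sum∞ (LT.thetaTerm Z 1 1) L.+ L.sum∞ (λ n → LT.thetaTerm Z′ 0 1 (suc n))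
      product = LT.jacobiTripleProduct Z Z′ ZZ′≈1 1 0 1 ≡.refl

      first : LT.qProd Z′ 0 1 L.≋ (L.1# L.- L.const Z′) L.* LT.qProd Z′ 1 1
      first = L.trans (L.Prod.∞-first (LT.qFactor-small Z′ 0 1))
        (L.*-congʳ (L.+-congˡ (CommutativeRing.-‿cong L.commutativeRing (L.monomial≋shiftBy Z′ 0))))

      re-first : reS (LT.qProd Z′ 0 1) ≋ (1# - const z′) * qProd z′ 1 1
      re-first = trans (QS.reS-cong first) (trans (reS-*D _ _)
        (*-cong (trans (QS.reS-- _ _) (+-cong (QS.reS-const _) (S.-‿cong (QS.reS-const _)))) (re⁻ 1 1)))

      im-first : imS (LT.qProd Z′ 0 1) ≋ const z′ * qProd z′ 1 1 + (1# - const z′) * (qProd z′ 1 1 * lambert z′ 1 1)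
      im-first = trans (QS.imS-cong first) (trans (imS-*D _ _) (trans
        (+-cong (*-cong (trans (QS.reS-- _ _) (+-cong (QS.reS-const _) (S.-‿cong (QS.reS-const _)))) (im⁻ 1 1))
                (*-cong (trans (QS.imS-- _ _) (+-cong (trans (QS.imS-const _) const-0)
                  (S.-‿cong (trans (QS.imS-const _) (const-neg z′))))) (re⁻ 1 1)))
        (solve 3 (λ c p l → (con (+ 1) :- c) :* (p :* l) :+ (con (+ 0) :- (:- c)) :* p
           := c :* p :+ (con (+ 1) :- c) :* (p :* l)) refl (const z′) (qProd z′ 1 1) (lambert z′ 1 1))))

      tri-small : ∀ (c : ℕ → K.Carrier) → Sum.Small (λ n → monomial (c n) (tri (suc n)))
      tri-small c n = monomial-small _ (ℕₚ.m≤m+n n (tri n))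

    Θ-sum : (1# - const z′) * Θ ≋ sum∞ (λ n → monomial ((K.- z) ^ᴷ n K.+ (K.- z′) ^ᴷ suc n) (tri (suc n)))
    Θ-sum = trans (sym left) (trans (QS.reS-cong product) (trans (trans (QS.reS-+ _ _)
        (+-cong (trans (QS.reS-sum∞ _) (Sum.∞-cong λ n → trans (re-theta⁺ 1 1 n) (monomial-exp _ (tri-exp⁺ n))))
                (trans (QS.reS-sum∞ _) (Sum.∞-cong λ n → trans (re-theta⁻ 0 1 (suc n)) (monomial-exp _ (tri-exp⁻ n))))))
        (trans (sym (Sum.∞-⊛ (tri-small _) (tri-small _))) (Sum.∞-cong λ n → monomial-+ _ _ (tri (suc n))))))
      where
      left : reS (LT.qProd Z 1 1 L.* LT.qProd Z′ 0 1 L.* LT.qProd DR.1# 1 1) ≋ (1# - const z′) * Θ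
      left = trans (reS-*D _ _) (trans (*-cong (trans (reS-*D _ _) (*-cong (re⁺ 1 1) re-first)) (reE 1))
        (solve 4 (λ p c p′ e → (p :* (c :* p′)) :* e := c :* ((p :* p′) :* e)) refl (qProd z 1 1) (1# - const z′) (qProd z′ 1 1) (qProd K.1# 1 1)))

    Θ′-sum : const z′ * Θ + (1# - const z′) * (Θ * (lambert z′ 1 1 - lambert z 1 1)) ≋
             sum∞ (λ n → monomial (fromℕ n K.* (K.- z) ^ᴷ n K.- fromℕ (suc n) K.* (K.- z′) ^ᴷ suc n) (tri (suc n)))
    Θ′-sum = trans (sym left) (trans (QS.imS-cong product) (trans (trans (QS.imS-+ _ _)
        (+-cong (trans (QS.imS-sum∞ _) (Sum.∞-cong λ n → trans (im-theta⁺ 1 1 n) (monomial-exp _ (tri-exp⁺ n))))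
                (trans (QS.imS-sum∞ _) (Sum.∞-cong λ n → trans (im-theta⁻ 0 1 (suc n))
                  (trans (-‿monomial _ _) (monomial-exp _ (tri-exp⁻ n)))))))
        (trans (sym (Sum.∞-⊛ (tri-small _) (tri-small _))) (Sum.∞-cong λ n → monomial-+ _ _ (tri (suc n))))))
      where
      left : imS (LT.qProd Z 1 1 L.* LT.qProd Z′ 0 1 L.* LT.qProd DR.1# 1 1) ≋
             const z′ * Θ + (1# - const z′) * (Θ * (lambert z′ 1 1 - lambert z 1 1))
      left = trans (imS-*D _ _) (trans (+-cong (*-congˡ (imE 1))
          (*-cong (trans (imS-*D _ _) (+-cong (*-cong (re⁺ 1 1) im-first) (*-cong (im⁺ 1 1) re-first))) (reE 1)))
        (solve 7 (λ w p l p′ l′ e c → w :* con (+ 0) :+ (p :* (c :* p′ :+ (con (+ 1) :- c) :* (p′ :* l′)) :+ (:- (p :* l)) :* ((con (+ 1) :- c) :* p′)) :* e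
           := c :* (p :* p′ :* e) :+ (con (+ 1) :- c) :* ((p :* p′ :* e) :* (l′ :- l)))
           refl _ (qProd z 1 1) (lambert z 1 1) (qProd z′ 1 1) (lambert z′ 1 1) (qProd K.1# 1 1) (const z′)))

tri-5 : ∀ m → tri (m ℕ.* 5) ≡ 25 ℕ.* tri m ℕ.+ 10 ℕ.* m
tri-5 zero    = ≡.refl
tri-5 (suc m) = ≡.trans (≡.cong (λ t → 4 ℕ.+ k ℕ.+ (3 ℕ.+ k ℕ.+ (2 ℕ.+ k ℕ.+ (1 ℕ.+ k ℕ.+ (k ℕ.+ t))))) (tri-5 m))
  (solve 2 (λ m t → con 4 :+ m :* con 5 :+ (con 3 :+ m :* con 5 :+ (con 2 :+ m :* con 5 :+ (con 1 :+ m :* con 5 :+ (m :* con 5 :+ (con 25 :* t :+ con 10 :* m)))))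
     := con 25 :* (m :+ t) :+ con 10 :* (con 1 :+ m)) ≡.refl m (tri m))
  where
  open +-*-Solver
  k = m ℕ.* 5

module _ where
  open +-*-Solver
  private
    at : ∀ r m → tri (suc (m ℕ.* 5 ℕ.+ r)) ≡ tri (suc (r ℕ.+ m ℕ.* 5))
    at r m = ≡.cong (λ k → tri (suc k)) (ℕₚ.+-comm (m ℕ.* 5) r)

  tri-exp₀ : ∀ m → tri (suc (m ℕ.* 5 ℕ.+ 0)) ≡ 0 ℕ.+ (5 ℕ.* tri m ℕ.+ 3 ℕ.* m) ℕ.* 5
  tri-exp₀ m = ≡.trans (at 0 m) (≡.trans (≡.cong (m ℕ.* 5 ℕ.+_) (tri-5 m))
    (solve 2 (λ m t → m :* con 5 :+ (con 25 :* t :+ con 10 :* m) := (con 5 :* t :+ con 3 :* m) :* con 5) ≡.refl m (tri m)))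

  tri-exp₁ : ∀ m → tri (suc (m ℕ.* 5 ℕ.+ 1)) ≡ 1 ℕ.+ (5 ℕ.* tri m ℕ.+ 4 ℕ.* m) ℕ.* 5
  tri-exp₁ m = ≡.trans (at 1 m) (≡.trans (≡.cong (λ t → 1 ℕ.+ m ℕ.* 5 ℕ.+ (m ℕ.* 5 ℕ.+ t)) (tri-5 m))
    (solve 2 (λ m t → con 1 :+ m :* con 5 :+ (m :* con 5 :+ (con 25 :* t :+ con 10 :* m)) := con 1 :+ (con 5 :* t :+ con 4 :* m) :* con 5) ≡.refl m (tri m)))

  tri-exp₂ : ∀ m → tri (suc (m ℕ.* 5 ℕ.+ 2)) ≡ 3 ℕ.+ (tri (suc m) ℕ.* 5) ℕ.* 5
  tri-exp₂ m = ≡.trans (at 2 m) (≡.trans (≡.cong (λ t → 2 ℕ.+ m ℕ.* 5 ℕ.+ (1 ℕ.+ m ℕ.* 5 ℕ.+ (m ℕ.* 5 ℕ.+ t))) (tri-5 m))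
    (solve 2 (λ m t → con 2 :+ m :* con 5 :+ (con 1 :+ m :* con 5 :+ (m :* con 5 :+ (con 25 :* t :+ con 10 :* m)))
       := con 3 :+ (m :+ t) :* con 5 :* con 5) ≡.refl m (tri m)))

  tri-exp₃ : ∀ m → tri (suc (m ℕ.* 5 ℕ.+ 3)) ≡ 1 ℕ.+ (5 ℕ.* tri (suc m) ℕ.+ 1 ℕ.* suc m) ℕ.* 5
  tri-exp₃ m = ≡.trans (at 3 m) (≡.trans (≡.cong (λ t → 3 ℕ.+ m ℕ.* 5 ℕ.+ (2 ℕ.+ m ℕ.* 5 ℕ.+ (1 ℕ.+ m ℕ.* 5 ℕ.+ (m ℕ.* 5 ℕ.+ t)))) (tri-5 m))
    (solve 2 (λ m t → con 3 :+ m :* con 5 :+ (con 2 :+ m :* con 5 :+ (con 1 :+ m :* con 5 :+ (m :* con 5 :+ (con 25 :* t :+ con 10 :* m))))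
       := con 1 :+ (con 5 :* (m :+ t) :+ con 1 :* (con 1 :+ m)) :* con 5) ≡.refl m (tri m)))

  tri-exp₄ : ∀ m → tri (suc (m ℕ.* 5 ℕ.+ 4)) ≡ 0 ℕ.+ (5 ℕ.* tri (suc m) ℕ.+ 2 ℕ.* suc m) ℕ.* 5
  tri-exp₄ m = ≡.trans (at 4 m) (≡.trans (≡.cong (λ t → 4 ℕ.+ m ℕ.* 5 ℕ.+ (3 ℕ.+ m ℕ.* 5 ℕ.+ (2 ℕ.+ m ℕ.* 5 ℕ.+ (1 ℕ.+ m ℕ.* 5 ℕ.+ (m ℕ.* 5 ℕ.+ t))))) (tri-5 m))
    (solve 2 (λ m t → con 4 :+ m :* con 5 :+ (con 3 :+ m :* con 5 :+ (con 2 :+ m :* con 5 :+ (con 1 :+ m :* con 5 :+ (m :* con 5 :+ (con 25 :* t :+ con 10 :* m)))))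
       := (con 5 :* (m :+ t) :+ con 2 :* (con 1 :+ m)) :* con 5) ≡.refl m (tri m)))

module FifthRootRelations (K : CommutativeRing 0ℓ 0ℓ) where
  private
    module K = CommutativeRing K using (_*_; _+_; _-_; _≈_; *-assoc; *-comm; *-congʳ; *-identityˡ; +-cong; +-congʳ; +-congˡ; -_; -‿inverseʳ; 0#; 1#; Carrier; refl; sym; trans; zeroˡ)
    module CS = IntegerSolver K
  open IntegerMultiples K using (fromℤ)

  module At (z z′ : K.Carrier) (zz′≈1 : z K.* z′ K.≈ K.1#) (z′³≈z² : z′ K.* (z′ K.* z′) K.≈ z K.* z)
            (cyclotomic : K.1# K.+ z K.+ z′ K.+ z K.* z K.+ z′ K.* z′ K.≈ K.0#) where

    η′ s₁ s₂ : K.Carrier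
    η′ = z K.* z K.+ z′ K.* z′
    s₁ = z K.- z′
    s₂ = z K.* z K.- z′ K.* z′

    -- Coefficients read off from the blocks of Θ′-sum.
    u₀ u₁ u₂ v₁ : K.Carrier
    u₀ = fromℤ (+ 5) K.* (K.1# K.+ z′)
    u₁ = K.- (fromℤ (+ 5) K.* (z K.+ z′ K.* z′))
    u₂ = fromℤ (+ 5) K.* (z K.* z)
    v₁ = K.- (z K.+ fromℤ (+ 2) K.* (z′ K.* z′))

    private
      relation : ∀ {r} α β γ δ → r K.+ ((z K.* z′ K.- K.1#) K.* α K.+ ((z′ K.* (z K.* z) K.- z) K.* β K.+
                 ((z′ K.* (z′ K.* z′) K.- z K.* z) K.* γ K.+ (K.1# K.+ z K.+ z′ K.+ z K.* z K.+ z′ K.* z′) K.* δ))) K.≈ r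
      relation {r} α β γ δ = K.trans (K.+-congˡ (K.+-cong (null zz′≈1 α) (K.+-cong (null z′z²≈z β) (K.+-cong (null z′³≈z² γ)
          (K.trans (K.*-congʳ cyclotomic) (K.zeroˡ δ))))))
        (CS.solve 1 (λ r → r CS.:+ (CS.con (+ 0) CS.:+ (CS.con (+ 0) CS.:+ (CS.con (+ 0) CS.:+ CS.con (+ 0)))) CS.:= r) K.refl r)
        where
        null : ∀ {x y} → x K.≈ y → ∀ α → (x K.- y) K.* α K.≈ K.0#
        null {x} {y} p α = K.trans (K.*-congʳ (K.trans (K.+-congʳ p) (K.-‿inverseʳ y))) (K.zeroˡ α)
        z′z²≈z : z′ K.* (z K.* z) K.≈ z
        z′z²≈z = K.trans (K.sym (K.*-assoc _ _ _)) (K.trans (K.*-congʳ (K.trans (K.*-comm z′ z) zz′≈1)) (K.*-identityˡ z))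

      open CS hiding (con)

      con neg : ∀ {n} → ℕ → Polynomial n
      con k = CS.con (+ k)
      neg k = CS.con (ℤ.- (+ k))

      rel : ∀ {n} → (z t α β γ δ : Polynomial n) → Polynomial n
      rel z t α β γ δ = (z :* t :- con 1) :* α :+ ((t :* (z :* z) :- z) :* β :+
        ((t :* (t :* t) :- z :* z) :* γ :+ (con 1 :+ z :+ t :+ z :* z :+ t :* t) :* δ))

    η′-rel : (K.1# K.- z′) K.* η′ K.≈ z′ K.* z′ K.- z
    η′-rel = K.trans (solve 2 (λ z t → (con 1 :- t) :* (z :* z :+ t :* t) :=
        (t :* t :- z) :+ rel z t (con 0) (neg 1) (neg 1) (con 0)) K.refl z z′)
      (relation (fromℤ (+ 0)) (fromℤ -[1+ 0 ]) (fromℤ -[1+ 0 ]) (fromℤ (+ 0)))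

    u₀-rel : (K.1# K.- z′) K.* (fromℤ (+ 3) K.* s₁ K.+ s₂) K.≈ K.- u₀
    u₀-rel = K.trans (solve 2 (λ z t → (con 1 :- t) :* (con 3 :* (z :- t) :+ (z :* z :- t :* t)) :=
        (:- (con 5 :* (con 1 :+ t))) :+ rel z t (neg 3) (neg 1) (con 1) (con 2)) K.refl z z′)
      (relation (fromℤ -[1+ 2 ]) (fromℤ -[1+ 0 ]) (fromℤ (+ 1)) (fromℤ (+ 2)))

    u₁-rel : (K.1# K.- z′) K.* (fromℤ (+ 2) K.* s₁ K.- s₂) K.≈ K.- u₁
    u₁-rel = K.trans (solve 2 (λ z t → (con 1 :- t) :* (con 2 :* (z :- t) :- (z :* z :- t :* t)) :=
        (:- (:- (con 5 :* (z :+ t :* t)))) :+ rel z t (neg 2) (con 1) (neg 1) (neg 2)) K.refl z z′)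
      (relation (fromℤ -[1+ 1 ]) (fromℤ (+ 1)) (fromℤ -[1+ 0 ]) (fromℤ -[1+ 1 ]))

    v₁-rel : (K.1# K.- z′) K.* s₁ K.≈ z′ K.* η′ K.- v₁
    v₁-rel = K.trans (solve 2 (λ z t → (con 1 :- t) :* (z :- t) :=
        (t :* (z :* z :+ t :* t) :- :- (z :+ con 2 :* (t :* t))) :+ rel z t (neg 1) (neg 1) (neg 1) (neg 1)) K.refl z z′)
      (relation (fromℤ -[1+ 0 ]) (fromℤ -[1+ 0 ]) (fromℤ -[1+ 0 ]) (fromℤ -[1+ 0 ]))

    u₂-rel : (K.1# K.- z′) K.* (s₁ K.+ fromℤ (+ 2) K.* s₂) K.≈ u₂
    u₂-rel = K.trans (solve 2 (λ z t → (con 1 :- t) :* ((z :- t) :+ con 2 :* (z :* z :- t :* t)) :=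
        (con 5 :* (z :* z)) :+ rel z t (neg 1) (neg 2) (con 2) (neg 1)) K.refl z z′)
      (relation (fromℤ -[1+ 0 ]) (fromℤ -[1+ 1 ]) (fromℤ (+ 2)) (fromℤ -[1+ 0 ]))

module ThetaDissection (K : CommutativeRing 0ℓ 0ℓ) where
  open PowerSeries K using (const-neg; module Prod; module Sum; _*_; _+_; _-_; _^_; _≋_; *-cong; *-congʳ; *-congˡ; *-sum∞; +-cong; +-congʳ; +-congˡ; -_; 0#; 1#; Agree; Series; agree-*0; agree-mono; commutativeRing; const; const-*; const-+; const-0; const-cong; monomial; monomial-*; monomial-+; monomial-cong; monomial-exp; monomial-small; monomial≋shiftBy; q; q*-shift; refl; setoid; shift-cong; sum∞; sym; trans; ∙-const; ∙-monomial)
  open TripleProduct K using (jacobiTripleProduct; monomial-^; n≤a+dn; qFactor; qFactor-small; qProd)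
  open QuinticSections K using (V; V-*; V-+; V-cong; V-monomial; V-neg; V-sum∞)
  open Lambert K using (lambert; geoTerm; geoTerm-small; geoTerm-small′)
  open DifferentiatedTripleProduct K using (differentiatedTripleProduct; Θ; Θ-sum; Θ′-sum)
  open IntegerMultiples K using (fromℕ; fromℕ-suc; fromℕ-+; fromℤ)
  open SemiringExp (CommutativeRing.semiring K) using () renaming (_^_ to _^ᴷ_)
  private
    module K = CommutativeRing K using (_*_; _+_; _-_; _≈_; *-assoc; *-comm; *-cong; *-congʳ; *-congˡ; *-identityʳ; *-identityˡ; +-cong; +-congʳ; +-congˡ; +-identityˡ; -_; -‿cong; 0#; 1#; Carrier; refl; reflexive; sym; trans)
    module S = CommutativeRing commutativeRing using (*-assoc; *-identityʳ; *-identityˡ; +-identityʳ; -‿cong; -‿inverseʳ; distribˡ)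
    module CS = IntegerSolver K
    module FR = FifthRootRelations K using (module At)
  open IntegerSolver commutativeRing using (_:*_; _:+_; _:-_; _:=_; :-_; con; solve)

  PA PB PE L₁ L₂ : Series
  PA = qProd K.1# 4 5 * qProd K.1# 1 5 * qProd K.1# 5 5
  PB = qProd K.1# 3 5 * qProd K.1# 2 5 * qProd K.1# 5 5
  PE = qProd K.1# 1 1
  L₁ = lambert K.1# 1 5 - lambert K.1# 4 5
  L₂ = lambert K.1# 2 5 - lambert K.1# 3 5

  a b q³E : Series
  a = q * V PA
  b = V PB
  q³E = q ^ 3 * V (V (PE * PE * PE))

  -- The two linear relations obtained by separating s₁ and s₂ in Θ′-dissection are F = 0 and G = 0.
  F G : Series
  F = b * L₁ - a * (L₁ + L₂) - (b * V L₂ + b * V L₂ + b * V L₂) - (a * V L₁ + a * V L₁) - a + q³E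
  G = b * L₂ - a * L₁ - b * V L₂ + a * V L₁ + (q³E + q³E)

  private
    w : ℕ → K.Carrier
    w m = (K.- K.1#) ^ᴷ m

    mono : (ℕ → K.Carrier) → (ℕ → ℕ) → Series
    mono c e = sum∞ (λ m → monomial (c m) (e m))

    block : ∀ r {c x e e′} u → (∀ m → c m K.≈ u K.* x m) → (∀ m → e′ m ≡ r ℕ.+ e m ℕ.* 5) → (∀ m → m ≤ e m) →
            mono c e′ ≋ monomial K.1# r * (const u * V (mono x e))
    block r {c} {x} {e} {e′} u c≈ e≡ m≤e = sym (trans
      (*-congˡ (trans (*-congˡ (trans (V-sum∞ small) (Sum.∞-cong λ m → V-monomial (x m) (e m)))) (*-sum∞ (const u) small₅)))
      (trans (*-sum∞ (monomial K.1# r) (λ m → agree-*0 (const u) (small₅ m))) (Sum.∞-cong λ m →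
        trans (*-congˡ (trans (const-* u _) (∙-monomial u (x m) (e m ℕ.* 5))))
        (trans (monomial-* K.1# _ r (e m ℕ.* 5)) (trans (monomial-cong _ (K.trans (K.*-identityˡ _) (K.sym (c≈ m))))
          (monomial-exp (c m) (≡.sym (e≡ m))))))))
      where
      small : Sum.Small (λ m → monomial (x m) (e m))
      small m = monomial-small _ (m≤e m)
      small₅ : Sum.Small (λ m → monomial (x m) (e m ℕ.* 5))
      small₅ m = monomial-small _ (ℕₚ.≤-trans (m≤e m) (ℕₚ.m≤m*n (e m) 5))

    block₂ : ∀ r {c x y e e′} u v → (∀ m → c m K.≈ u K.* x m K.+ v K.* y m) → (∀ m → e′ m ≡ r ℕ.+ e m ℕ.* 5) → (∀ m → m ≤ e m) →
             mono c e′ ≋ monomial K.1# r * (const u * V (mono x e) + const v * V (mono y e))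
    block₂ r {c} {x} {y} {e} {e′} u v c≈ e≡ m≤e = trans
      (Sum.∞-cong λ m → trans (monomial-cong (e′ m) (c≈ m)) (sym (monomial-+ _ _ (e′ m))))
      (trans (Sum.∞-⊛ (small _) (small _)) (trans (+-cong (block r u (λ _ → K.refl) e≡ m≤e) (block r v (λ _ → K.refl) e≡ m≤e))
        (sym (S.distribˡ _ _ _))))
      where
      small : ∀ (d : ℕ → K.Carrier) → Sum.Small (λ m → monomial (d m) (e′ m))
      small d m = monomial-small _ (≡.subst (m ≤_) (≡.sym (e≡ m))
        (ℕₚ.≤-trans (m≤e m) (ℕₚ.≤-trans (ℕₚ.m≤m*n (e m) 5) (ℕₚ.m≤n+m _ r))))

    e⁺ : ℕ → ℕ → ℕ
    e⁺ a n = 5 ℕ.* tri n ℕ.+ a ℕ.* n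

    e⁺-≥ : ∀ a .{{_ : ℕ.NonZero a}} m → m ≤ e⁺ a m
    e⁺-≥ a m = ℕₚ.≤-trans (ℕₚ.m≤n*m m a) (ℕₚ.m≤n+m _ _)

    e⁻-≥ : ∀ a .{{_ : ℕ.NonZero a}} m → m ≤ e⁺ a (suc m)
    e⁻-≥ a m = ℕₚ.≤-trans (ℕₚ.n≤1+n m) (e⁺-≥ a (suc m))

    nw : ℕ → K.Carrier
    nw m = fromℕ m K.* w m

    PA-sum : PA ≋ mono w (e⁺ 4) + mono (λ m → w (suc m)) (λ m → e⁺ 1 (suc m))
    PA-sum = jacobiTripleProduct K.1# K.1# (K.*-identityˡ _) 4 1 5 ≡.refl

    PB-sum : PB ≋ mono w (e⁺ 3) + mono (λ m → w (suc m)) (λ m → e⁺ 2 (suc m))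
    PB-sum = jacobiTripleProduct K.1# K.1# (K.*-identityˡ _) 3 2 5 ≡.refl

    PA-L₁ : PA * L₁ ≋ mono nw (e⁺ 4) - mono (λ m → nw (suc m)) (λ m → e⁺ 1 (suc m))
    PA-L₁ = differentiatedTripleProduct K.1# K.1# (K.*-identityˡ _) 4 1 5 ≡.refl

    γ : ℕ → K.Carrier
    γ m = fromℕ m K.* w m K.- fromℕ (suc m) K.* w (suc m)

  PB-L₂ : PB * L₂ ≋ mono nw (e⁺ 3) - mono (λ m → nw (suc m)) (λ m → e⁺ 2 (suc m))
  PB-L₂ = differentiatedTripleProduct K.1# K.1# (K.*-identityˡ _) 3 2 5 ≡.refl

  private
    PE³ : PE * PE * PE ≋ mono γ (λ m → tri (suc m))
    PE³ = trans (solve 2 (λ x l → x := con (+ 1) :* x :+ (con (+ 1) :- con (+ 1)) :* (x :* l)) refl _ _)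
      (Θ′-sum K.1# K.1# (K.*-identityˡ _))

    q^ : ∀ r → monomial K.1# r ≋ q ^ r
    q^ zero    = monomial≋shiftBy K.1# 0
    q^ (suc r) = trans (trans (monomial≋shiftBy K.1# (suc r)) (shift-cong (sym (monomial≋shiftBy K.1# r))))
      (trans (shift-cong (q^ r)) (sym (q*-shift (q ^ r))))

  lambert-sections : ∀ x → x K.* (x K.* (x K.* (x K.* x))) K.≈ K.1# →
    lambert x 1 1 ≋ Sum.F.fold (λ r → const (x ^ᴷ suc r) * lambert K.1# (suc r) 5) 5
  lambert-sections x x⁵≈1 = trans (Sum.∞-swap {g = g} (λ m n → small m n) (λ m n → small′ m n))
    (trans (Sum.∞-blocks 5 (λ n → Sum.∞-small (λ m → small′ m n))) (Sum.F.fold-cong 5 λ r → trans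
      (Sum.∞-cong λ m → trans (Sum.∞-cong λ n → trans (monomial-cong _ (coeff r m n)) (monomial-exp _ (exponent r m n)))
        (trans (Sum.∞-cong λ n → sym (trans (const-* _ _) (∙-monomial _ _ _))) (sym (*-sum∞ _ (geoTerm-small K.1# (suc r ℕ.+ 5 ℕ.* m))))))
      (sym (*-sum∞ _ (Lambert.lambert-small K K.1# (suc r) 5)))))
    where
    g : ℕ → ℕ → Series
    g n k = geoTerm x (1 ℕ.+ 1 ℕ.* n) k
    small : ∀ n k → Agree n (g n k) 0#
    small n k = agree-mono (n≤a+dn 1 1 n) (geoTerm-small′ x (1 ℕ.+ 1 ℕ.* n) k)
    small′ : ∀ n k → Agree k (g n k) 0#
    small′ n k = geoTerm-small x (1 ℕ.+ 1 ℕ.* n) k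
    1^ : ∀ n → K.1# ^ᴷ n K.≈ K.1#
    1^ zero    = K.refl
    1^ (suc n) = K.trans (K.*-identityˡ _) (1^ n)
    x^ : ∀ r m → x ^ᴷ (m ℕ.* 5 ℕ.+ r) K.≈ x ^ᴷ r
    x^ r zero    = K.refl
    x^ r (suc m) = K.trans (CS.solve 2 (λ x y → x CS.:* (x CS.:* (x CS.:* (x CS.:* (x CS.:* y)))) CS.:= (x CS.:* (x CS.:* (x CS.:* (x CS.:* x)))) CS.:* y) K.refl x _)
      (K.trans (K.*-cong x⁵≈1 (x^ r m)) (K.*-identityˡ _))
    coeff : ∀ r m n → x ^ᴷ suc (m ℕ.* 5 ℕ.+ r) K.≈ x ^ᴷ suc r K.* K.1# ^ᴷ suc n
    coeff r m n = K.trans (K.*-congˡ (x^ r m)) (K.sym (K.trans (K.*-congˡ (1^ (suc n))) (K.*-identityʳ _)))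
    exponent : ∀ r m n → (1 ℕ.+ 1 ℕ.* n) ℕ.* suc (m ℕ.* 5 ℕ.+ r) ≡ (suc r ℕ.+ 5 ℕ.* m) ℕ.* suc n
    exponent = N.solve 3 (λ r m n → (N.con 1 N.:+ N.con 1 N.:* n) N.:* (N.con 1 N.:+ (m N.:* N.con 5 N.:+ r))
                 N.:= (N.con 1 N.:+ r N.:+ N.con 5 N.:* m) N.:* (N.con 1 N.:+ n)) ≡.refl
      where module N = +-*-Solver

  lambert-root : ∀ {x y₃ y₄} → x K.* (x K.* x) K.≈ y₃ → x K.* (x K.* (x K.* x)) K.≈ y₄ → x K.* (x K.* (x K.* (x K.* x))) K.≈ K.1# →
    lambert x 1 1 ≋ const x * lambert K.1# 1 5 + (const (x K.* x) * lambert K.1# 2 5 +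
                    (const y₃ * lambert K.1# 3 5 + (const y₄ * lambert K.1# 4 5 + lambert K.1# 5 5)))
  lambert-root {x} p r s = trans (lambert-sections x s) (+-cong (*-congʳ (const-cong x¹))
    (+-cong (*-congʳ (const-cong x²)) (+-cong (*-congʳ (const-cong (K.trans (K.*-congˡ x²) p)))
    (+-cong (*-congʳ (const-cong (K.trans (K.*-congˡ (K.*-congˡ x²)) r)))
    (trans (S.+-identityʳ _) (trans (*-congʳ (const-cong (K.trans (K.*-congˡ (K.*-congˡ (K.*-congˡ x²))) s))) (S.*-identityˡ _)))))))
    where
    x¹ : x K.* K.1# K.≈ x
    x¹ = K.*-identityʳ x
    x² : x K.* (x K.* K.1#) K.≈ x K.* x
    x² = K.*-congˡ x¹

  module FifthRoot (z z′ u : K.Carrier) (zz′≈1 : z K.* z′ K.≈ K.1#) (z′³≈z² : z′ K.* (z′ K.* z′) K.≈ z K.* z)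
                   (cyclotomic : K.1# K.+ z K.+ z′ K.+ z K.* z K.+ z′ K.* z′ K.≈ K.0#)
                   (unit : u K.* (K.1# K.- z′) K.≈ K.1#) where

    open FR.At z z′ zz′≈1 z′³≈z² cyclotomic public

    private
      z³≈z′² : z K.* (z K.* z) K.≈ z′ K.* z′
      z³≈z′² = K.trans (K.*-congˡ (K.sym z′³≈z²)) (K.trans
        (CS.solve 2 (λ z t → z CS.:* (t CS.:* (t CS.:* t)) CS.:= (z CS.:* t) CS.:* (t CS.:* t)) K.refl z z′)
        (K.trans (K.*-congʳ zz′≈1) (K.*-identityˡ _)))

      z⁴ : ∀ {x y} → x K.* y K.≈ K.1# → x K.* (x K.* x) K.≈ y K.* y → x K.* (x K.* (x K.* x)) K.≈ y
      z⁴ {x} {y} p r = K.trans (K.*-congˡ r) (K.trans (K.sym (K.*-assoc x y y)) (K.trans (K.*-congʳ p) (K.*-identityˡ y)))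

      z⁵ : ∀ {x y} → x K.* y K.≈ K.1# → x K.* (x K.* x) K.≈ y K.* y → x K.* (x K.* (x K.* (x K.* x))) K.≈ K.1#
      z⁵ p r = K.trans (K.*-congˡ (z⁴ p r)) p

      z′z≈1 : z′ K.* z K.≈ K.1#
      z′z≈1 = K.trans (K.*-comm _ _) zz′≈1

      -^ : ∀ {x} → x K.* (x K.* (x K.* (x K.* x))) K.≈ K.1# → ∀ r m → (K.- x) ^ᴷ (m ℕ.* 5 ℕ.+ r) K.≈ w m K.* (K.- x) ^ᴷ r
      -^ p r zero = K.sym (K.*-identityˡ _)
      -^ {x} p r (suc m) = K.trans
        (CS.solve 2 (λ x y → (CS.:- x) CS.:* ((CS.:- x) CS.:* ((CS.:- x) CS.:* ((CS.:- x) CS.:* ((CS.:- x) CS.:* y))))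
           CS.:= (CS.:- (x CS.:* (x CS.:* (x CS.:* (x CS.:* x))))) CS.:* y) K.refl x ((K.- x) ^ᴷ (m ℕ.* 5 ℕ.+ r)))
        (K.trans (K.*-cong (K.-‿cong p) (-^ p r m)) (K.sym (K.*-assoc _ _ _)))

    z⁵≈1 : z K.* (z K.* (z K.* (z K.* z))) K.≈ K.1#
    z⁵≈1 = z⁵ zz′≈1 z³≈z′²

    z′⁵≈1 : z′ K.* (z′ K.* (z′ K.* (z′ K.* z′))) K.≈ K.1#
    z′⁵≈1 = z⁵ z′z≈1 z′³≈z²

    private
      -- (−z)ʳ and (−z′)ʳ⁺¹ in terms of 1, z, z², z′, z′².
      p₀ : ∀ m → (K.- z) ^ᴷ (m ℕ.* 5 ℕ.+ 0) K.≈ w m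
      p₀ m = K.trans (-^ z⁵≈1 0 m) (K.*-identityʳ _)
      p₁ : ∀ m → (K.- z) ^ᴷ (m ℕ.* 5 ℕ.+ 1) K.≈ w m K.* (K.- z)
      p₁ m = K.trans (-^ z⁵≈1 1 m) (K.*-congˡ (K.*-identityʳ _))
      p₂ : ∀ m → (K.- z) ^ᴷ (m ℕ.* 5 ℕ.+ 2) K.≈ w m K.* (z K.* z)
      p₂ m = K.trans (-^ z⁵≈1 2 m) (K.*-congˡ (CS.solve 1 (λ z → (CS.:- z) CS.:* ((CS.:- z) CS.:* CS.con (+ 1)) CS.:= z CS.:* z) K.refl z))
      cube : ∀ {x y} → x K.* (x K.* x) K.≈ y → (K.- x) ^ᴷ 3 K.≈ K.- y
      cube {x} p = K.trans (CS.solve 1 (λ z → (CS.:- z) CS.:* ((CS.:- z) CS.:* ((CS.:- z) CS.:* CS.con (+ 1))) CS.:= CS.:- (z CS.:* (z CS.:* z))) K.refl x) (K.-‿cong p)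
      fourth : ∀ {x y} → x K.* (x K.* (x K.* x)) K.≈ y → (K.- x) ^ᴷ 4 K.≈ y
      fourth {x} p = K.trans (CS.solve 1 (λ z → (CS.:- z) CS.:* ((CS.:- z) CS.:* ((CS.:- z) CS.:* ((CS.:- z) CS.:* CS.con (+ 1)))) CS.:= z CS.:* (z CS.:* (z CS.:* z))) K.refl x) p
      p₃ : ∀ m → (K.- z) ^ᴷ (m ℕ.* 5 ℕ.+ 3) K.≈ w m K.* (K.- (z′ K.* z′))
      p₃ m = K.trans (-^ z⁵≈1 3 m) (K.*-congˡ (cube z³≈z′²))
      p₄ : ∀ m → (K.- z) ^ᴷ (m ℕ.* 5 ℕ.+ 4) K.≈ w m K.* z′
      p₄ m = K.trans (-^ z⁵≈1 4 m) (K.*-congˡ (fourth (z⁴ zz′≈1 z³≈z′²)))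
      p′ : ∀ r m → (K.- z′) ^ᴷ suc (m ℕ.* 5 ℕ.+ r) K.≈ w m K.* (K.- z′) ^ᴷ suc r
      p′ r m = K.trans (K.reflexive (≡.cong ((K.- z′) ^ᴷ_) (≡.sym (ℕₚ.+-suc (m ℕ.* 5) r)))) (-^ z′⁵≈1 (suc r) m)
      p′₀ : ∀ m → (K.- z′) ^ᴷ suc (m ℕ.* 5 ℕ.+ 0) K.≈ w m K.* (K.- z′)
      p′₀ m = K.trans (p′ 0 m) (K.*-congˡ (K.*-identityʳ _))
      p′₁ : ∀ m → (K.- z′) ^ᴷ suc (m ℕ.* 5 ℕ.+ 1) K.≈ w m K.* (z′ K.* z′)
      p′₁ m = K.trans (p′ 1 m) (K.*-congˡ (CS.solve 1 (λ z → (CS.:- z) CS.:* ((CS.:- z) CS.:* CS.con (+ 1)) CS.:= z CS.:* z) K.refl z′))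
      p′₂ : ∀ m → (K.- z′) ^ᴷ suc (m ℕ.* 5 ℕ.+ 2) K.≈ w m K.* (K.- (z K.* z))
      p′₂ m = K.trans (p′ 2 m) (K.*-congˡ (cube z′³≈z²))
      p′₃ : ∀ m → (K.- z′) ^ᴷ suc (m ℕ.* 5 ℕ.+ 3) K.≈ w m K.* z
      p′₃ m = K.trans (p′ 3 m) (K.*-congˡ (fourth (z⁴ z′z≈1 z′³≈z²)))
      p′₄ : ∀ m → (K.- z′) ^ᴷ suc (m ℕ.* 5 ℕ.+ 4) K.≈ w m K.* (K.- K.1#)
      p′₄ m = K.trans (p′ 4 m) (K.*-congˡ (K.trans
        (CS.solve 1 (λ x → (CS.:- x) CS.:* ((CS.:- x) CS.:* ((CS.:- x) CS.:* ((CS.:- x) CS.:* ((CS.:- x) CS.:* CS.con (+ 1)))))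
           CS.:= CS.:- (x CS.:* (x CS.:* (x CS.:* (x CS.:* x))))) K.refl z′) (K.-‿cong z′⁵≈1)))

      n₅ : ∀ r m → fromℕ (m ℕ.* 5 ℕ.+ r) K.≈ fromℤ (+ 5) K.* fromℕ m K.+ fromℕ r
      n₅ r zero = CS.solve 1 (λ r → r CS.:= CS.con (+ 5) CS.:* CS.con (+ 0) CS.:+ r) K.refl (fromℕ r)
      n₅ r (suc m) = K.trans (fromℕ-+ 5 (m ℕ.* 5 ℕ.+ r)) (K.trans (K.+-congˡ (n₅ r m)) (K.trans
        (CS.solve 2 (λ m r → CS.con (+ 5) CS.:+ (CS.con (+ 5) CS.:* m CS.:+ r) CS.:= CS.con (+ 5) CS.:* (CS.con (+ 1) CS.:+ m) CS.:+ r) K.refl (fromℕ m) (fromℕ r))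
        (K.+-congʳ (K.*-congˡ (K.sym (fromℕ-suc m))))))

      n₅suc : ∀ r m → fromℕ (suc (m ℕ.* 5 ℕ.+ r)) K.≈ fromℤ (+ 5) K.* fromℕ m K.+ fromℕ (suc r)
      n₅suc r m = K.trans (K.reflexive (≡.cong fromℕ (≡.sym (ℕₚ.+-suc (m ℕ.* 5) r)))) (n₅ (suc r) m)

      blocks : ∀ (c : ℕ → K.Carrier) → mono c (λ n → tri (suc n)) ≋
               Sum.F.fold (λ r → mono (λ m → c (m ℕ.* 5 ℕ.+ r)) (λ m → tri (suc (m ℕ.* 5 ℕ.+ r)))) 5
      blocks c = Sum.∞-blocks 5 (λ n → monomial-small _ (ℕₚ.m≤m+n n (tri n)))

    private
      VPA : V PA ≋ V (mono w (e⁺ 4)) + V (mono (λ m → w (suc m)) (λ m → e⁺ 1 (suc m)))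
      VPA = trans (V-cong PA-sum) (V-+ _ _)

      VPB : V PB ≋ V (mono w (e⁺ 3)) + V (mono (λ m → w (suc m)) (λ m → e⁺ 2 (suc m)))
      VPB = trans (V-cong PB-sum) (V-+ _ _)

      q¹ : monomial K.1# 1 ≋ q
      q¹ = trans (q^ 1) (S.*-identityʳ q)

      q⁰ : monomial K.1# 0 ≋ 1#
      q⁰ = q^ 0

    Θ-dissection₀ : (1# - const z′) * Θ z z′ zz′≈1 ≋ const (K.1# K.- z′) * b + const (z′ K.* z′ K.- z) * a
    Θ-dissection₀ = trans (Θ-sum z z′ zz′≈1) (trans (blocks _) (trans
      (+-cong (block 0 {x = w} (K.1# K.- z′) (λ m → K.trans (K.+-cong (p₀ m) (p′₀ m))
                (CS.solve 2 (λ w t → w CS.:+ w CS.:* (CS.:- t) CS.:= (CS.con (+ 1) CS.:- t) CS.:* w) K.refl (w m) z′)) tri-exp₀ (e⁺-≥ 3))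
      (+-cong (block 1 {x = w} (z′ K.* z′ K.- z) (λ m → K.trans (K.+-cong (p₁ m) (p′₁ m))
                (CS.solve 3 (λ w z t → w CS.:* (CS.:- z) CS.:+ w CS.:* (t CS.:* t) CS.:= (t CS.:* t CS.:- z) CS.:* w) K.refl (w m) z z′)) tri-exp₁ (e⁺-≥ 4))
      (+-cong (block 3 {x = w} {e = λ m → tri (suc m) ℕ.* 5} K.0# (λ m → K.trans (K.+-cong (p₂ m) (p′₂ m))
                (CS.solve 2 (λ w z → w CS.:* (z CS.:* z) CS.:+ w CS.:* (CS.:- (z CS.:* z)) CS.:= CS.con (+ 0) CS.:* w) K.refl (w m) z)) tri-exp₂
                (λ m → ℕₚ.≤-trans (ℕₚ.m≤m+n m _) (ℕₚ.m≤m*n (tri (suc m)) 5)))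
      (+-cong (block 1 {x = λ m → w (suc m)} (z′ K.* z′ K.- z) (λ m → K.trans (K.+-cong (p₃ m) (p′₃ m))
                (CS.solve 3 (λ w z t → w CS.:* (CS.:- (t CS.:* t)) CS.:+ w CS.:* z CS.:= (t CS.:* t CS.:- z) CS.:* ((CS.:- CS.con (+ 1)) CS.:* w)) K.refl (w m) z z′)) tri-exp₃ (e⁻-≥ 1))
      (+-cong (block 0 {x = λ m → w (suc m)} (K.1# K.- z′) (λ m → K.trans (K.+-cong (p₄ m) (p′₄ m))
                (CS.solve 2 (λ w t → w CS.:* t CS.:+ w CS.:* (CS.:- CS.con (+ 1)) CS.:= (CS.con (+ 1) CS.:- t) CS.:* ((CS.:- CS.con (+ 1)) CS.:* w)) K.refl (w m) z′)) tri-exp₄ (e⁻-≥ 2))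
       refl)))))
      (trans (+-cong (*-congʳ q⁰) (+-cong (*-congʳ q¹) (+-cong (*-congˡ (*-congʳ const-0)) (+-cong (*-congʳ q¹) (+-cong (*-congʳ q⁰) refl)))))
      (trans (solve 9 (λ c d x y x′ y′ q s t → con (+ 1) :* (c :* x) :+ (q :* (d :* y) :+ (s :* (con (+ 0) :* t) :+ (q :* (d :* y′) :+ (con (+ 1) :* (c :* x′) :+ con (+ 0)))))
         := c :* (x :+ x′) :+ d :* (q :* (y :+ y′))) refl
           (const (K.1# K.- z′)) (const (z′ K.* z′ K.- z)) (V (mono w (e⁺ 3))) (V (mono w (e⁺ 4))) (V (mono (λ m → w (suc m)) (λ m → e⁺ 2 (suc m))))
           (V (mono (λ m → w (suc m)) (λ m → e⁺ 1 (suc m)))) q _ _)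
      (+-cong (*-congˡ (sym VPB)) (*-congˡ (*-congˡ (sym VPA))))))))

    open SetoidReasoning setoid

    const-*-const : ∀ x y → const x * const y ≋ const (x K.* y)
    const-*-const x y = trans (const-* x (const y)) (∙-const x y)

    const-sub : ∀ x y → const (x K.- y) ≋ const x - const y
    const-sub x y = trans (sym (const-+ x (K.- y))) (+-congˡ (const-neg y))

    private
      cancel-unit : ∀ {f g} → const (K.1# K.- z′) * f ≋ const (K.1# K.- z′) * g → f ≋ g
      cancel-unit {f} {g} p = trans (sym (undo f)) (trans (*-congˡ p) (undo g))
        where
        undo : ∀ f → const u * (const (K.1# K.- z′) * f) ≋ f
        undo f = trans (sym (S.*-assoc _ _ _)) (trans (*-congʳ (trans (const-*-const u _) (const-cong unit))) (S.*-identityˡ f))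

    Θ-dissection : Θ z z′ zz′≈1 ≋ b + const η′ * a
    Θ-dissection = cancel-unit (begin
      const (K.1# K.- z′) * Θ z z′ zz′≈1                                ≈⟨ *-congʳ (const-sub K.1# z′) ⟩
      (1# - const z′) * Θ z z′ zz′≈1                                    ≈⟨ Θ-dissection₀ ⟩
      const (K.1# K.- z′) * b + const (z′ K.* z′ K.- z) * a             ≈⟨ +-congˡ (*-congʳ (trans (const-*-const _ η′) (const-cong η′-rel))) ⟨
      const (K.1# K.- z′) * b + (const (K.1# K.- z′) * const η′) * a    ≈⟨ solve 4 (λ c b h a → c :* b :+ (c :* h) :* a := c :* (b :+ h :* a)) refl _ b (const η′) a ⟩
      const (K.1# K.- z′) * (b + const η′ * a)                          ∎)

    private
      N : ℕ → K.Carrier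
      N = fromℕ

      Θ′-dissection₀ : const z′ * Θ z z′ zz′≈1 + (1# - const z′) * (Θ z z′ zz′≈1 * (lambert z′ 1 1 - lambert z 1 1)) ≋
        (const u₀ * (b * V L₂) + const z′ * b) + ((const u₁ * (a * V L₁) + const v₁ * a) + const u₂ * q³E)
      Θ′-dissection₀ = trans (Θ′-sum z z′ zz′≈1) (trans (blocks _) (trans
        (+-cong (block₂ 0 {x = nw} {y = w} u₀ z′ (λ m → K.trans (K.+-cong (K.*-cong (n₅ 0 m) (p₀ m)) (K.-‿cong (K.*-cong (n₅suc 0 m) (p′₀ m))))
                  (CS.solve 3 (λ n w t → (CS.con (+ 5) CS.:* n CS.:+ CS.con (+ 0)) CS.:* w CS.:- (CS.con (+ 5) CS.:* n CS.:+ CS.con (+ 1)) CS.:* (w CS.:* (CS.:- t))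
                     CS.:= (CS.con (+ 5) CS.:* (CS.con (+ 1) CS.:+ t)) CS.:* (n CS.:* w) CS.:+ t CS.:* w) K.refl (N m) (w m) z′)) tri-exp₀ (e⁺-≥ 3))
        (+-cong (block₂ 1 {x = nw} {y = w} u₁ v₁ (λ m → K.trans (K.+-cong (K.*-cong (n₅ 1 m) (p₁ m)) (K.-‿cong (K.*-cong (n₅suc 1 m) (p′₁ m))))
                  (CS.solve 4 (λ n w z t → (CS.con (+ 5) CS.:* n CS.:+ CS.con (+ 1)) CS.:* (w CS.:* (CS.:- z)) CS.:- (CS.con (+ 5) CS.:* n CS.:+ CS.con (+ 2)) CS.:* (w CS.:* (t CS.:* t))
                     CS.:= (CS.:- (CS.con (+ 5) CS.:* (z CS.:+ t CS.:* t))) CS.:* (n CS.:* w) CS.:+ (CS.:- (z CS.:+ CS.con (+ 2) CS.:* (t CS.:* t))) CS.:* w) K.refl (N m) (w m) z z′)) tri-exp₁ (e⁺-≥ 4))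
        (+-cong (block 3 {x = γ} {e = λ m → tri (suc m) ℕ.* 5} u₂ (λ m → K.trans (K.+-cong (K.*-cong (n₅ 2 m) (p₂ m)) (K.-‿cong (K.*-cong (n₅suc 2 m) (p′₂ m))))
                  (K.trans (CS.solve 3 (λ n w z → (CS.con (+ 5) CS.:* n CS.:+ CS.con (+ 2)) CS.:* (w CS.:* (z CS.:* z)) CS.:- (CS.con (+ 5) CS.:* n CS.:+ CS.con (+ 3)) CS.:* (w CS.:* (CS.:- (z CS.:* z)))
                     CS.:= (CS.con (+ 5) CS.:* (z CS.:* z)) CS.:* (n CS.:* w CS.:- (CS.con (+ 1) CS.:+ n) CS.:* ((CS.:- CS.con (+ 1)) CS.:* w))) K.refl (N m) (w m) z)
                   (K.*-congˡ (K.+-congˡ (K.-‿cong (K.*-congʳ (K.sym (fromℕ-suc m)))))))) tri-exp₂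
                  (λ m → ℕₚ.≤-trans (ℕₚ.m≤m+n m _) (ℕₚ.m≤m*n (tri (suc m)) 5)))
        (+-cong (block₂ 1 {x = λ m → nw (suc m)} {y = λ m → w (suc m)} (K.- u₁) v₁ (λ m → K.trans (K.+-cong (K.*-cong (n₅ 3 m) (p₃ m)) (K.-‿cong (K.*-cong (n₅suc 3 m) (p′₃ m))))
                  (K.trans (CS.solve 4 (λ n w z t → (CS.con (+ 5) CS.:* n CS.:+ CS.con (+ 3)) CS.:* (w CS.:* (CS.:- (t CS.:* t))) CS.:- (CS.con (+ 5) CS.:* n CS.:+ CS.con (+ 4)) CS.:* (w CS.:* z)
                     CS.:= (CS.:- (CS.:- (CS.con (+ 5) CS.:* (z CS.:+ t CS.:* t)))) CS.:* ((CS.con (+ 1) CS.:+ n) CS.:* ((CS.:- CS.con (+ 1)) CS.:* w))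
                       CS.:+ (CS.:- (z CS.:+ CS.con (+ 2) CS.:* (t CS.:* t))) CS.:* ((CS.:- CS.con (+ 1)) CS.:* w)) K.refl (N m) (w m) z z′)
                   (K.+-congʳ (K.*-congˡ (K.*-congʳ (K.sym (fromℕ-suc m))))))) tri-exp₃ (e⁻-≥ 1))
        (+-cong (block₂ 0 {x = λ m → nw (suc m)} {y = λ m → w (suc m)} (K.- u₀) z′ (λ m → K.trans (K.+-cong (K.*-cong (n₅ 4 m) (p₄ m)) (K.-‿cong (K.*-cong (n₅suc 4 m) (p′₄ m))))
                  (K.trans (CS.solve 3 (λ n w t → (CS.con (+ 5) CS.:* n CS.:+ CS.con (+ 4)) CS.:* (w CS.:* t) CS.:- (CS.con (+ 5) CS.:* n CS.:+ CS.con (+ 5)) CS.:* (w CS.:* (CS.:- CS.con (+ 1)))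
                     CS.:= (CS.:- (CS.con (+ 5) CS.:* (CS.con (+ 1) CS.:+ t))) CS.:* ((CS.con (+ 1) CS.:+ n) CS.:* ((CS.:- CS.con (+ 1)) CS.:* w)) CS.:+ t CS.:* ((CS.:- CS.con (+ 1)) CS.:* w)) K.refl (N m) (w m) z′)
                   (K.+-congʳ (K.*-congˡ (K.*-congʳ (K.sym (fromℕ-suc m))))))) tri-exp₄ (e⁻-≥ 2))
         refl)))))
        (trans (+-cong (*-congʳ q⁰) (+-cong (*-congʳ q¹) (+-cong (*-cong (q^ 3) (*-congˡ (V-cong γ₅)))
                 (+-cong (*-cong q¹ (+-congʳ (*-congʳ (const-neg u₁)))) (+-cong (*-cong q⁰ (+-congʳ (*-congʳ (const-neg u₀)))) refl)))))
        (trans (solve 14 (λ c₀ c₁ c₂ d z x y x′ y′ X Y X′ Y′ qg →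
             con (+ 1) :* (c₀ :* x :+ z :* y) :+ (qg :* (c₁ :* X :+ d :* Y) :+ (c₂ :+ (qg :* ((:- c₁) :* X′ :+ d :* Y′) :+ (con (+ 1) :* ((:- c₀) :* x′ :+ z :* y′) :+ con (+ 0)))))
             := (c₀ :* (x :- x′) :+ z :* (y :+ y′)) :+ ((c₁ :* (qg :* (X :- X′)) :+ d :* (qg :* (Y :+ Y′))) :+ c₂)) refl
             (const u₀) (const u₁) (q ^ 3 * (const u₂ * V (V (PE * PE * PE)))) (const v₁) (const z′)
             (V (mono nw (e⁺ 3))) (V (mono w (e⁺ 3))) (V (mono (λ m → nw (suc m)) (λ m → e⁺ 2 (suc m)))) (V (mono (λ m → w (suc m)) (λ m → e⁺ 2 (suc m))))
             (V (mono nw (e⁺ 4))) (V (mono w (e⁺ 4))) (V (mono (λ m → nw (suc m)) (λ m → e⁺ 1 (suc m)))) (V (mono (λ m → w (suc m)) (λ m → e⁺ 1 (suc m)))) q)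
        (+-cong (+-cong (*-congˡ (V-diff PB-L₂)) (*-congˡ (sym VPB)))
          (+-cong (+-cong (*-congˡ (trans (*-congˡ (V-diff PA-L₁)) (sym (S.*-assoc _ _ _)))) (*-congˡ (*-congˡ (sym VPA))))
            (solve 3 (λ q c e → q :* (c :* e) := c :* (q :* e)) refl (q ^ 3) (const u₂) (V (V (PE * PE * PE))))))))))
        where
        V-diff : ∀ {f g x y} → f * g ≋ x - y → V x - V y ≋ V f * V g
        V-diff {f} {g} {x} {y} p = sym (trans (sym (V-* f g)) (trans (V-cong p) (trans (V-+ x (- y)) (+-congˡ (V-neg y)))))
        γ₅ : mono γ (λ m → tri (suc m) ℕ.* 5) ≋ V (PE * PE * PE)
        γ₅ = sym (trans (V-cong PE³) (trans (V-sum∞ (λ m → monomial-small _ (ℕₚ.m≤m+n m _))) (Sum.∞-cong λ m → V-monomial (γ m) (tri (suc m)))))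

    Θ′-dissection : Θ z z′ zz′≈1 * (lambert z 1 1 - lambert z′ 1 1) ≋
      const (fromℤ (+ 3) K.* s₁ K.+ s₂) * (b * V L₂) + const (fromℤ (+ 2) K.* s₁ K.- s₂) * (a * V L₁)
      + const s₁ * a - const (s₁ K.+ fromℤ (+ 2) K.* s₂) * q³E
    Θ′-dissection = cancel-unit (begin
      c * (θ * (l - l′))
        ≈⟨ solve 5 (λ c w θ l l′ → c :* (θ :* (l :- l′)) := w :* θ :- (w :* θ :+ c :* (θ :* (l′ :- l)))) refl c (const z′) θ l l′ ⟩
      const z′ * θ - (const z′ * θ + c * (θ * (l′ - l)))
        ≈⟨ +-cong (*-congˡ Θ-dissection) (S.-‿cong (trans (+-congˡ (*-congʳ (const-sub K.1# z′))) Θ′-dissection₀)) ⟩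
      const z′ * (b + const η′ * a) - ((const u₀ * B + const z′ * b) + ((const u₁ * A + const v₁ * a) + const u₂ * q³E))
        ≈⟨ solve 10 (λ w b h a u₀ B u₁ A v₁ u₂E → w :* (b :+ h :* a) :- ((u₀ :* B :+ w :* b) :+ ((u₁ :* A :+ v₁ :* a) :+ u₂E))
             := (:- u₀) :* B :+ (:- u₁) :* A :+ (w :* h :- v₁) :* a :- u₂E) refl (const z′) b (const η′) a (const u₀) B (const u₁) A (const v₁) (const u₂ * q³E) ⟩
      - const u₀ * B + - const u₁ * A + (const z′ * const η′ - const v₁) * a - const u₂ * q³E
        ≈⟨ +-cong (+-cong (+-cong (*-congʳ (pull (const-neg u₀) u₀-rel)) (*-congʳ (pull (const-neg u₁) u₁-rel)))
             (*-congʳ (pull (trans (const-sub _ v₁) (+-congʳ (sym (const-*-const z′ η′)))) v₁-rel))) (S.-‿cong (*-congʳ (pull refl u₂-rel))) ⟩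
      (c * k₁) * B + (c * k₂) * A + (c * const s₁) * a - (c * k₃) * q³E
        ≈⟨ solve 9 (λ c x B y A s a t e → (c :* x) :* B :+ (c :* y) :* A :+ (c :* s) :* a :- (c :* t) :* e := c :* (x :* B :+ y :* A :+ s :* a :- t :* e))
             refl c k₁ B k₂ A (const s₁) a k₃ q³E ⟩
      c * (k₁ * B + k₂ * A + const s₁ * a - k₃ * q³E) ∎)
      where
      c = const (K.1# K.- z′)
      θ = Θ z z′ zz′≈1
      l = lambert z 1 1
      l′ = lambert z′ 1 1
      A = a * V L₁
      B = b * V L₂
      k₁ = const (fromℤ (+ 3) K.* s₁ K.+ s₂)
      k₂ = const (fromℤ (+ 2) K.* s₁ K.- s₂)
      k₃ = const (s₁ K.+ fromℤ (+ 2) K.* s₂)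
      pull : ∀ {x y f} → const y ≋ f → (K.1# K.- z′) K.* x K.≈ y → f ≋ c * const x
      pull {x} p r = trans (sym p) (trans (const-cong (K.sym r)) (sym (const-*-const _ x)))

    private
      η′s₁ : η′ K.* s₁ K.≈ K.- (s₁ K.+ s₂)
      η′s₁ = K.trans (CS.solve 2 (λ z t → (z CS.:* z CS.:+ t CS.:* t) CS.:* (z CS.:- t) CS.:=
          (z CS.:* (z CS.:* z) CS.:- z CS.:* (z CS.:* t)) CS.:+ ((z CS.:* t) CS.:* t CS.:- t CS.:* (t CS.:* t))) K.refl z z′)
        (K.trans (K.+-cong (K.+-cong z³≈z′² (K.-‿cong (K.trans (K.*-congˡ zz′≈1) (K.*-identityʳ z))))
                           (K.+-cong (K.trans (K.*-congʳ zz′≈1) (K.*-identityˡ z′)) (K.-‿cong z′³≈z²)))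
          (CS.solve 2 (λ z t → (t CS.:* t CS.:- z) CS.:+ (t CS.:- z CS.:* z) CS.:= CS.:- ((z CS.:- t) CS.:+ (z CS.:* z CS.:- t CS.:* t))) K.refl z z′))

      η′s₂ : η′ K.* s₂ K.≈ K.- s₁
      η′s₂ = K.trans (CS.solve 2 (λ z t → (z CS.:* z CS.:+ t CS.:* t) CS.:* (z CS.:* z CS.:- t CS.:* t) CS.:=
          z CS.:* (z CS.:* (z CS.:* z)) CS.:- t CS.:* (t CS.:* (t CS.:* t))) K.refl z z′)
        (K.trans (K.+-cong (z⁴ zz′≈1 z³≈z′²) (K.-‿cong (z⁴ z′z≈1 z′³≈z²)))
          (CS.solve 2 (λ z t → t CS.:- z CS.:= CS.:- (z CS.:- t)) K.refl z z′))

    z³≈ : z K.* (z K.* z) K.≈ z′ K.* z′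
    z³≈ = z³≈z′²

    z⁴≈ : z K.* (z K.* (z K.* z)) K.≈ z′
    z⁴≈ = z⁴ zz′≈1 z³≈z′²

    z′³≈ : z′ K.* (z′ K.* z′) K.≈ z K.* z
    z′³≈ = z′³≈z²

    z′⁴≈ : z′ K.* (z′ K.* (z′ K.* z′)) K.≈ z
    z′⁴≈ = z⁴ z′z≈1 z′³≈z²

    lambert-difference : lambert z 1 1 - lambert z′ 1 1 ≋ const s₁ * L₁ + const s₂ * L₂
    lambert-difference = trans (+-cong (lambert-root z³≈ z⁴≈ z⁵≈1)
        (S.-‿cong (lambert-root z′³≈z² (z⁴ z′z≈1 z′³≈z²) z′⁵≈1)))
      (trans (solve 9 (λ z z² t t² l₁ l₂ l₃ l₄ l₅ →
          (z :* l₁ :+ (z² :* l₂ :+ (t² :* l₃ :+ (t :* l₄ :+ l₅)))) :- (t :* l₁ :+ (t² :* l₂ :+ (z² :* l₃ :+ (z :* l₄ :+ l₅))))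
          := (z :- t) :* (l₁ :- l₄) :+ (z² :- t²) :* (l₂ :- l₃)) refl
          (const z) (const (z K.* z)) (const z′) (const (z′ K.* z′)) (lambert K.1# 1 5) (lambert K.1# 2 5) (lambert K.1# 3 5) (lambert K.1# 4 5) (lambert K.1# 5 5))
        (+-cong (*-congʳ (sym (const-sub z z′))) (*-congʳ (sym (const-sub (z K.* z) (z′ K.* z′))))))

    s₁F+s₂G≋0 : const s₁ * F + const s₂ * G ≋ 0#
    s₁F+s₂G≋0 = begin
      σ₁ * F + σ₂ * G
        ≈⟨ solve 9 (λ s₁ s₂ a b l₁ l₂ m₁ m₂ e →
             s₁ :* (b :* l₁ :- a :* (l₁ :+ l₂) :- (b :* m₂ :+ b :* m₂ :+ b :* m₂) :- (a :* m₁ :+ a :* m₁) :- a :+ e) :+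
             s₂ :* (b :* l₂ :- a :* l₁ :- b :* m₂ :+ a :* m₁ :+ (e :+ e)) :=
             b :* (s₁ :* l₁ :+ s₂ :* l₂) :+ a :* ((:- (s₁ :+ s₂)) :* l₁ :+ (:- s₁) :* l₂) :-
             ((s₁ :+ s₁ :+ s₁ :+ s₂) :* (b :* m₂) :+ (s₁ :+ s₁ :- s₂) :* (a :* m₁) :+ s₁ :* a :- (s₁ :+ (s₂ :+ s₂)) :* e))
             refl σ₁ σ₂ a b L₁ L₂ (V L₁) (V L₂) q³E ⟩
      b * D + a * (- (σ₁ + σ₂) * L₁ + - σ₁ * L₂) - ((σ₁ + σ₁ + σ₁ + σ₂) * (b * V L₂) + (σ₁ + σ₁ - σ₂) * (a * V L₁) + σ₁ * a - (σ₁ + (σ₂ + σ₂)) * q³E)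
        ≈⟨ +-cong (+-congˡ (*-congˡ (+-cong (*-congʳ h₁) (*-congʳ h₂))))
             (S.-‿cong (+-cong (+-congʳ (+-cong (*-congʳ (sym k₁)) (*-congʳ (sym k₂)))) (S.-‿cong (*-congʳ (sym k₃))))) ⟩
      b * D + a * ((H * σ₁) * L₁ + (H * σ₂) * L₂) - rhs
        ≈⟨ +-congʳ (solve 7 (λ b a h s₁ s₂ l₁ l₂ → b :* (s₁ :* l₁ :+ s₂ :* l₂) :+ a :* ((h :* s₁) :* l₁ :+ (h :* s₂) :* l₂)
             := (b :+ h :* a) :* (s₁ :* l₁ :+ s₂ :* l₂)) refl b a H σ₁ σ₂ L₁ L₂) ⟩
      (b + H * a) * D - rhs
        ≈⟨ +-congʳ (*-cong (sym Θ-dissection) (sym lambert-difference)) ⟩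
      Θ z z′ zz′≈1 * (lambert z 1 1 - lambert z′ 1 1) - rhs
        ≈⟨ +-congʳ Θ′-dissection ⟩
      rhs - rhs
        ≈⟨ S.-‿inverseʳ rhs ⟩
      0# ∎
      where
      σ₁ = const s₁
      σ₂ = const s₂
      H = const η′
      D = σ₁ * L₁ + σ₂ * L₂
      rhs = const (fromℤ (+ 3) K.* s₁ K.+ s₂) * (b * V L₂) + const (fromℤ (+ 2) K.* s₁ K.- s₂) * (a * V L₁)
            + const s₁ * a - const (s₁ K.+ fromℤ (+ 2) K.* s₂) * q³E
      h₁ : - (σ₁ + σ₂) ≋ H * σ₁
      h₁ = trans (S.-‿cong (const-+ s₁ s₂)) (trans (sym (const-neg _)) (trans (const-cong (K.sym η′s₁)) (sym (const-*-const _ _))))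
      h₂ : - σ₁ ≋ H * σ₂
      h₂ = trans (sym (const-neg _)) (trans (const-cong (K.sym η′s₂)) (sym (const-*-const _ _)))
      k₁ : const (fromℤ (+ 3) K.* s₁ K.+ s₂) ≋ σ₁ + σ₁ + σ₁ + σ₂
      k₁ = trans (const-cong (CS.solve 2 (λ x y → CS.con (+ 3) CS.:* x CS.:+ y CS.:= x CS.:+ x CS.:+ x CS.:+ y) K.refl s₁ s₂))
        (trans (sym (const-+ _ s₂)) (+-congʳ (trans (sym (const-+ _ s₁)) (+-congʳ (sym (const-+ s₁ s₁))))))
      k₂ : const (fromℤ (+ 2) K.* s₁ K.- s₂) ≋ σ₁ + σ₁ - σ₂
      k₂ = trans (const-cong (CS.solve 2 (λ x y → CS.con (+ 2) CS.:* x CS.:- y CS.:= x CS.:+ x CS.:- y) K.refl s₁ s₂))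
        (trans (const-sub _ s₂) (+-congʳ (sym (const-+ s₁ s₁))))
      k₃ : const (s₁ K.+ fromℤ (+ 2) K.* s₂) ≋ σ₁ + (σ₂ + σ₂)
      k₃ = trans (const-cong (CS.solve 2 (λ x y → x CS.:+ CS.con (+ 2) CS.:* y CS.:= x CS.:+ (y CS.:+ y)) K.refl s₁ s₂))
        (trans (sym (const-+ s₁ _)) (+-congˡ (sym (const-+ s₂ s₂))))

    private
      z+z′ : K.Carrier
      z+z′ = z K.+ z′

      sum≈-1 : z+z′ K.+ η′ K.≈ K.- K.1#
      sum≈-1 = K.trans (CS.solve 2 (λ z t → (z CS.:+ t) CS.:+ (z CS.:* z CS.:+ t CS.:* t) CS.:=
          (CS.con (+ 1) CS.:+ z CS.:+ t CS.:+ z CS.:* z CS.:+ t CS.:* t) CS.:- CS.con (+ 1)) K.refl z z′)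
        (K.trans (K.+-congʳ cyclotomic) (K.+-identityˡ _))

      product≈-1 : z+z′ K.* η′ K.≈ K.- K.1#
      product≈-1 = K.trans (CS.solve 2 (λ z t → (z CS.:+ t) CS.:* (z CS.:* z CS.:+ t CS.:* t) CS.:=
          (z CS.:* (z CS.:* z) CS.:+ (z CS.:* t) CS.:* t) CS.:+ ((t CS.:* z) CS.:* z CS.:+ t CS.:* (t CS.:* t))) K.refl z z′)
        (K.trans (K.+-cong (K.+-cong z³≈z′² (K.trans (K.*-congʳ zz′≈1) (K.*-identityˡ z′)))
                           (K.+-cong (K.trans (K.*-congʳ z′z≈1) (K.*-identityˡ z)) z′³≈z²))
        (K.trans (CS.solve 2 (λ z t → (t CS.:* t CS.:+ t) CS.:+ (z CS.:+ z CS.:* z) CS.:=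
          (CS.con (+ 1) CS.:+ z CS.:+ t CS.:+ z CS.:* z CS.:+ t CS.:* t) CS.:- CS.con (+ 1)) K.refl z z′)
        (K.trans (K.+-congʳ cyclotomic) (K.+-identityˡ _))))

      const-1 : ∀ {x} → x K.≈ K.- K.1# → const x ≋ - 1#
      const-1 p = trans (const-cong p) (const-neg K.1#)

    z+z′+η′ : const (z K.+ z′) + const η′ ≋ - 1#
    z+z′+η′ = trans (const-+ _ _) (const-1 sum≈-1)

    [z+z′]η′ : const (z K.+ z′) * const η′ ≋ - 1#
    [z+z′]η′ = trans (const-*-const _ _) (const-1 product≈-1)

    private
      five-factors : ∀ x → (1# - const z * x) * (1# - const z′ * x) * ((1# - const (z K.* z) * x) * (1# - const (z′ K.* z′) * x)) * (1# - x) ≋ 1# - x ^ 5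
      five-factors x = begin
        (1# - Z * x) * (1# - Z′ * x) * ((1# - Z² * x) * (1# - Z′² * x)) * (1# - x)
          ≈⟨ solve 5 (λ z t z² t² x → (con (+ 1) :- z :* x) :* (con (+ 1) :- t :* x) :* ((con (+ 1) :- z² :* x) :* (con (+ 1) :- t² :* x)) :* (con (+ 1) :- x)
               := (con (+ 1) :- (z :+ t) :* x :+ (z :* t) :* (x :* x)) :* (con (+ 1) :- (z² :+ t²) :* x :+ (z² :* t²) :* (x :* x)) :* (con (+ 1) :- x)) refl Z Z′ Z² Z′² x ⟩
        (1# - (Z + Z′) * x + (Z * Z′) * (x * x)) * (1# - (Z² + Z′²) * x + (Z² * Z′²) * (x * x)) * (1# - x)
          ≈⟨ *-congʳ (*-cong (+-cong (+-congˡ (S.-‿cong (*-congʳ (const-+ z z′)))) (trans (*-congʳ (one zz′≈1)) (S.*-identityˡ _)))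
                             (+-cong (+-congˡ (S.-‿cong (*-congʳ (const-+ _ _)))) (trans (*-congʳ (one z²z′²≈1)) (S.*-identityˡ _)))) ⟩
        (1# - H * x + x * x) * (1# - H′ * x + x * x) * (1# - x)
          ≈⟨ solve 3 (λ h h′ x → (con (+ 1) :- h :* x :+ x :* x) :* (con (+ 1) :- h′ :* x :+ x :* x) :* (con (+ 1) :- x)
               := (con (+ 1) :- (h :+ h′) :* (x :+ x :* x :* x) :+ (h :* h′ :+ con (+ 2)) :* (x :* x) :+ x :* x :* x :* x) :* (con (+ 1) :- x)) refl H H′ x ⟩
        (1# - (H + H′) * (x + x * x * x) + (H * H′ + IM.fromℤ (+ 2)) * (x * x) + x * x * x * x) * (1# - x)
          ≈⟨ *-congʳ (+-congʳ (+-cong (+-congˡ (S.-‿cong (*-congʳ z+z′+η′))) (*-congʳ (+-congʳ [z+z′]η′)))) ⟩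
        (1# - (- 1#) * (x + x * x * x) + (- 1# + IM.fromℤ (+ 2)) * (x * x) + x * x * x * x) * (1# - x)
          ≈⟨ solve 1 (λ x → (con (+ 1) :- (:- con (+ 1)) :* (x :+ x :* x :* x) :+ (:- con (+ 1) :+ con (+ 2)) :* (x :* x) :+ x :* x :* x :* x) :* (con (+ 1) :- x)
               := con (+ 1) :- x :* (x :* (x :* (x :* (x :* con (+ 1)))))) refl x ⟩
        1# - x ^ 5 ∎
        where
        module IM = IntegerMultiples commutativeRing using (fromℤ)
        Z   = const z
        Z′  = const z′
        Z²  = const (z K.* z)
        Z′² = const (z′ K.* z′)
        H   = const (z K.+ z′)
        H′  = const η′
        one : ∀ {x y} → x K.* y K.≈ K.1# → const x * const y ≋ 1#
        one p = trans (const-*-const _ _) (const-cong p)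
        z²z′²≈1 : (z K.* z) K.* (z′ K.* z′) K.≈ K.1#
        z²z′²≈1 = K.trans (CS.solve 2 (λ z t → (z CS.:* z) CS.:* (t CS.:* t) CS.:= (z CS.:* t) CS.:* (z CS.:* t)) K.refl z z′)
          (K.trans (K.*-cong zz′≈1 zz′≈1) (K.*-identityˡ _))

    qProd-five : qProd z 1 1 * qProd z′ 1 1 * (qProd (z K.* z) 1 1 * qProd (z′ K.* z′) 1 1) * PE ≋ qProd K.1# 5 5
    qProd-five = trans (sym (trans (Prod.∞-⊛ (Prod.Small-⊛ (Prod.Small-⊛ (sm z) (sm z′)) (Prod.Small-⊛ (sm _) (sm _))) (sm K.1#))
        (*-congʳ (trans (Prod.∞-⊛ (Prod.Small-⊛ (sm z) (sm z′)) (Prod.Small-⊛ (sm _) (sm _)))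
          (*-cong (Prod.∞-⊛ (sm z) (sm z′)) (Prod.∞-⊛ (sm _) (sm _)))))))
      (Prod.∞-cong λ n → trans (*-cong (*-cong (*-cong (f z n) (f z′ n)) (*-cong (f _ n) (f _ n))) refl)
        (trans (five-factors (monomial K.1# (1 ℕ.+ 1 ℕ.* n))) (+-congˡ (S.-‿cong (trans (monomial-^ (1 ℕ.+ 1 ℕ.* n) 5)
          (monomial-exp K.1# (Nat.solve 1 (λ n → (Nat.con 1 Nat.:+ Nat.con 1 Nat.:* n) Nat.:* Nat.con 5 Nat.:= Nat.con 5 Nat.:+ Nat.con 5 Nat.:* n) ≡.refl n)))))))
      where
      module Nat = +-*-Solver using (_:*_; _:+_; _:=_; con; solve)
      sm : ∀ x → Prod.Small (qFactor x 1 1)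
      sm x = qFactor-small x 1 1
      f : ∀ x n → qFactor x 1 1 n ≋ 1# - const x * monomial K.1# (1 ℕ.+ 1 ℕ.* n)
      f x n = +-congˡ (S.-‿cong (sym (trans (const-* x _) (trans (∙-monomial x K.1# (1 ℕ.+ 1 ℕ.* n)) (monomial-cong _ (K.*-identityʳ x))))))

record RingHom (R K : CommutativeRing 0ℓ 0ℓ) : Set where
  private
    module R = CommutativeRing R using (_*_; _+_; _-_; _≈_; -_; 0#; 1#; Carrier)
    module K = CommutativeRing K using (_*_; _+_; _-_; _≈_; -_; 0#; 1#; Carrier)
  field
    φ      : R.Carrier → K.Carrier
    φ-cong : ∀ {x y} → x R.≈ y → φ x K.≈ φ y
    φ-+    : ∀ x y → φ (x R.+ y) K.≈ φ x K.+ φ y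
    φ-*    : ∀ x y → φ (x R.* y) K.≈ φ x K.* φ y
    φ-neg  : ∀ x → φ (R.- x) K.≈ K.- φ x
    φ-0    : φ R.0# K.≈ K.0#
    φ-1    : φ R.1# K.≈ K.1#

module SeriesHom {R K : CommutativeRing 0ℓ 0ℓ} (h : RingHom R K) where
  open RingHom h
  private
    module R = CommutativeRing R using (_*_; +-commutativeMonoid; 1#; semiring)
    module K = CommutativeRing K using (_*_; _≈_; *-cong; +-commutativeMonoid; 1#; refl; semiring; trans)
    module PR = PowerSeries R using (_*_; _+_; _-_; _^_; _at_; _‼_; _≋_; *-commutativeMonoid; +-commutativeMonoid; -_; 0#; 1#; Series; const; monomial; monomial≋shiftBy; prod∞; q; shift; shiftBy; sum∞; tail)
    module TR = TripleProduct R using (qProd)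
    module LR = Lambert R using (lambert)
    module QR = QuinticSections R using (V)
    module ER = SemiringExp R.semiring using (_^_)
    module EK = SemiringExp K.semiring using (_^_)
    module KS = CommutativeRing (PowerSeries.commutativeRing K) using (-‿cong)
  open PowerSeries K using (module Prod; module Sum; _*_; _+_; _-_; _^_; _at_; _‼_; _≋_; *-commutativeMonoid; *-congˡ; +-commutativeMonoid; +-cong; +-congˡ; -_; 0#; 1#; Series; const; const-cong; monomial; monomial-cong; monomial≋shiftBy; pointwise; prod∞; q; shift; shift-cong; shiftBy; sum∞; sym; trans)
  open TripleProduct K using (qProd)
  open Lambert K using (lambert)
  open QuinticSections K using (V; V-cong′)

  mapS : PR.Series → Series
  mapS f ‼ n = φ (f PR.‼ n)

  mapS-cong : ∀ {f g} → f PR.≋ g → mapS f ≋ mapS g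
  mapS-cong p at n = φ-cong (p PR.at n)

  mapS-+ : ∀ f g → mapS (f PR.+ g) ≋ mapS f + mapS g
  mapS-+ f g = pointwise λ _ → φ-+ _ _

  mapS-neg : ∀ f → mapS (PR.- f) ≋ - mapS f
  mapS-neg f = pointwise λ _ → φ-neg _

  mapS-- : ∀ f g → mapS (f PR.- g) ≋ mapS f - mapS g
  mapS-- f g = trans (mapS-+ f _) (+-congˡ (mapS-neg g))

  mapS-* : ∀ f g → mapS (f PR.* g) ≋ mapS f * mapS g
  mapS-* f g at n = K.trans (FoldHom.fold-homo R.+-commutativeMonoid K.+-commutativeMonoid φ φ-0 φ-+
      (λ i → f PR.‼ i R.* g PR.‼ (n ∸ i)) (suc n))
    (FiniteFold.fold-cong K.+-commutativeMonoid {g = λ i → mapS f ‼ i K.* mapS g ‼ (n ∸ i)} (suc n) λ i → φ-* _ _)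

  mapS-const : ∀ c → mapS (PR.const c) ≋ const (φ c)
  mapS-const c = pointwise λ { zero → K.refl ; (suc n) → φ-0 }

  mapS-0 : mapS PR.0# ≋ 0#
  mapS-0 = pointwise λ _ → φ-0

  mapS-1 : mapS PR.1# ≋ 1#
  mapS-1 = trans (mapS-const R.1#) (const-cong φ-1)

  mapS-shift : ∀ f → mapS (PR.shift f) ≋ shift (mapS f)
  mapS-shift f = pointwise λ { zero → φ-0 ; (suc n) → K.refl }

  mapS-q : mapS PR.q ≋ q
  mapS-q = trans (mapS-shift _) (shift-cong mapS-1)

  mapS-^ : ∀ f n → mapS (f PR.^ n) ≋ mapS f ^ n
  mapS-^ f zero    = mapS-1
  mapS-^ f (suc n) = trans (mapS-* f _) (*-congˡ (mapS-^ f n))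

  mapS-monomial : ∀ c e → mapS (PR.monomial c e) ≋ monomial (φ c) e
  mapS-monomial c e = trans (mapS-cong (PR.monomial≋shiftBy c e)) (trans (go e) (sym (monomial≋shiftBy (φ c) e)))
    where
    go : ∀ e → mapS (PR.shiftBy e (PR.const c)) ≋ shiftBy e (const (φ c))
    go zero    = mapS-const c
    go (suc e) = trans (mapS-shift _) (shift-cong (go e))

  mapS-sum∞ : ∀ f → mapS (PR.sum∞ f) ≋ sum∞ (λ k → mapS (f k))
  mapS-sum∞ f at n = FoldHom.fold-homo PR.+-commutativeMonoid +-commutativeMonoid mapS mapS-0 mapS-+ f (suc n) at n

  mapS-prod∞ : ∀ f → mapS (PR.prod∞ f) ≋ prod∞ (λ k → mapS (f k))
  mapS-prod∞ f at n = FoldHom.fold-homo PR.*-commutativeMonoid *-commutativeMonoid mapS mapS-1 mapS-* f (suc n) at n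

  mapS-qProd : ∀ a d → mapS (TR.qProd R.1# a d) ≋ qProd K.1# a d
  mapS-qProd a d = trans (mapS-prod∞ _) (Prod.∞-cong λ n → trans (mapS-- _ _) (+-cong mapS-1
    (KS.-‿cong (trans (mapS-monomial _ (a ℕ.+ d ℕ.* n)) (monomial-cong _ φ-1)))))

  mapS-lambert : ∀ a d → mapS (LR.lambert R.1# a d) ≋ lambert K.1# a d
  mapS-lambert a d = trans (mapS-sum∞ _) (Sum.∞-cong λ n → trans (mapS-sum∞ _) (Sum.∞-cong λ k →
    trans (mapS-monomial _ _) (monomial-cong _ (1^ (suc k)))))
    where
    1^ : ∀ n → φ (R.1# ER.^ n) K.≈ K.1# EK.^ n
    1^ zero    = φ-1
    1^ (suc n) = K.trans (φ-* _ _) (K.*-cong φ-1 (1^ n))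

  mapS-V : ∀ f → mapS (QR.V f) ≋ V (mapS f)
  mapS-V f = pointwise (go f)
    where
    go : ∀ f n → φ (QR.V f PR.‼ n) K.≈ V (mapS f) ‼ n
    go f 0 = K.refl
    go f 1 = φ-0
    go f 2 = φ-0
    go f 3 = φ-0
    go f 4 = φ-0
    go f (suc (suc (suc (suc (suc n))))) = K.trans (go (PR.tail f) n) (V-cong′ (pointwise λ k → K.refl) n)

_∘ₕ_ : ∀ {R K L} → RingHom K L → RingHom R K → RingHom R L
_∘ₕ_ {R} {K} {L} g f = record
  { φ = λ x → G.φ (F.φ x)
  ; φ-cong = λ p → G.φ-cong (F.φ-cong p)
  ; φ-+ = λ x y → L.trans (G.φ-cong (F.φ-+ x y)) (G.φ-+ _ _)
  ; φ-* = λ x y → L.trans (G.φ-cong (F.φ-* x y)) (G.φ-* _ _)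
  ; φ-neg = λ x → L.trans (G.φ-cong (F.φ-neg x)) (G.φ-neg _)
  ; φ-0 = L.trans (G.φ-cong F.φ-0) G.φ-0
  ; φ-1 = L.trans (G.φ-cong F.φ-1) G.φ-1 }
  where
  module F = RingHom f
  module G = RingHom g
  module L = CommutativeRing L using (trans)

module Embedding (R : CommutativeRing 0ℓ 0ℓ) (α β : CommutativeRing.Carrier R) where
  open CommutativeRing R using (_*_; _+_; _≈_; +-identityˡ; 0#; refl; sym)
  open QuadraticExtension R α β using (_+θ_; re; im; _,_) renaming (commutativeRing to K)
  private module K = CommutativeRing K using (_*_; refl)
  open IntegerSolver R using (_:*_; _:+_; _:-_; _:=_; :-_; con; solve)

  embed : RingHom R K
  embed = record
    { φ = λ x → x +θ 0#
    ; φ-cong = λ p → p , refl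
    ; φ-+ = λ x y → refl , sym (+-identityˡ 0#)
    ; φ-* = λ x y → solve 3 (λ b x y → x :* y := x :* y :+ b :* (con (+ 0) :* con (+ 0))) refl β x y
                  , solve 3 (λ a x y → con (+ 0) := (x :* con (+ 0) :+ con (+ 0) :* y) :+ a :* (con (+ 0) :* con (+ 0))) refl α x y
    ; φ-neg = λ x → refl , solve 0 (con (+ 0) := :- con (+ 0)) refl
    ; φ-0 = K.refl
    ; φ-1 = K.refl }

  re-*-embed : ∀ k x → re (k K.* (x +θ 0#)) ≈ re k * x
  re-*-embed k x = solve 4 (λ b r i x → r :* x :+ b :* (i :* con (+ 0)) := r :* x) refl β (re k) (im k) x

  im-*-embed : ∀ k x → im (k K.* (x +θ 0#)) ≈ im k * x
  im-*-embed k x = solve 4 (λ a r i x → (r :* con (+ 0) :+ i :* x) :+ a :* (i :* con (+ 0)) := i :* x) refl α (re k) (im k) x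

module LambertSections (K : CommutativeRing 0ℓ 0ℓ) where
  open PowerSeries K using (module Prod; module Sum; _*_; _+_; _^_; _≋_; *-cong; +-commutativeMonoid; +-cong; +-congˡ; 0#; agree-mono; agree-refl; agree-trans; commutativeRing; monomial-cong; monomial-exp; pointwise; prod∞; refl; sum∞; sym; trans; ≋⇒agree)
  open TripleProduct K using (qFactor; qFactor-small; qProd)
  open QuinticSections K using (U; U-+; U-agree; U-cong; U-monomial-5; U-monomial-∤; U-sum∞; V; V-+; V-1; V-monomial; V-neg; V-prod∞)
  open Lambert K using (lambert; geometric; geoTerm; geoTerm-small; geoTerm-small′)
  open SemiringExp (CommutativeRing.semiring K) using () renaming (_^_ to _^ᴷ_)
  private
    module K = CommutativeRing K using (_≈_; *-identityˡ; 1#; refl; sym; trans)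
    module S = CommutativeRing commutativeRing using (*-identityʳ; -‿cong)
    module N = +-*-Solver using (_:*_; _:+_; _:=_; con; solve)

    5-prime : Prime 5
    5-prime = from-yes (prime? 5)

    5∤ : ∀ {r n} → 0 < r → r < 5 → 5 ∣ n ℕ.* 5 ℕ.+ r → ⊥
    5∤ {r} {n} 0<r r<5 5∣ = ℕₚ.<⇒≱ r<5 (∣⇒≤ {{ℕ.>-nonZero 0<r}} (∣m+n∣m⇒∣n 5∣ (n∣m*n n)))

    1^ : ∀ n → K.1# ^ᴷ n K.≈ K.1#
    1^ zero    = K.refl
    1^ (suc n) = K.trans (K.*-identityˡ _) (1^ n)

  U-geometric : ∀ e .{{_ : ℕ.NonZero e}} → (5 ∣ e → ⊥) → U 0 (geometric K.1# e) ≋ geometric K.1# e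
  U-geometric e 5∤e = trans (U-cong 0 (Sum.∞-blocks 5 (geoTerm-small K.1# e)))
    (trans (FoldHom.fold-homo +-commutativeMonoid +-commutativeMonoid (U 0) (pointwise λ _ → K.refl) (U-+ 0)
        (λ r → sum∞ (λ m → geoTerm K.1# e (m ℕ.* 5 ℕ.+ r))) 5)
    (trans (+-cong (vanish 0 (s≤s z≤n)) (+-cong (vanish 1 (s≤s (s≤s z≤n))) (+-cong (vanish 2 (s≤s (s≤s (s≤s z≤n))))
        (+-cong (vanish 3 (s≤s (s≤s (s≤s (s≤s z≤n))))) (+-cong survive refl)))))
      (solve 1 (λ x → con (+ 0) :+ (con (+ 0) :+ (con (+ 0) :+ (con (+ 0) :+ (x :+ con (+ 0))))) := x) refl _)))
    where
    open IntegerSolver commutativeRing using (_:+_; _:=_; con; solve)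
    small : ∀ r → Sum.Small (λ m → geoTerm K.1# e (m ℕ.* 5 ℕ.+ r))
    small r = Sum.Small-sub (λ m → m ℕ.* 5 ℕ.+ r) (λ m → ℕₚ.≤-trans (ℕₚ.m≤m*n m 5) (ℕₚ.m≤m+n _ r)) (geoTerm-small K.1# e)
    vanish : ∀ r → r < 4 → U 0 (sum∞ (λ m → geoTerm K.1# e (m ℕ.* 5 ℕ.+ r))) ≋ 0#
    vanish r r<4 = trans (U-sum∞ (small r) (λ m → ≋⇒agree (zero-term m))) (trans (Sum.∞-cong zero-term)
      (sym (Sum.∞-unique {f = λ _ → 0#} (λ _ → agree-refl) λ N → ≋⇒agree (sym (Sum.F.fold-ε N λ _ _ → refl)))))
      where
      zero-term : ∀ m → U 0 (geoTerm K.1# e (m ℕ.* 5 ℕ.+ r)) ≋ 0#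
      zero-term m = U-monomial-∤ _ _ λ 5∣ → [ 5∤e , (λ d → 5∤ {suc r} {m} (s≤s z≤n) (s≤s r<4) (≡.subst (5 ∣_) (≡.sym (ℕₚ.+-suc (m ℕ.* 5) r)) d)) ]′
        (euclidsLemma e (suc (m ℕ.* 5 ℕ.+ r)) 5-prime 5∣)
    survive : U 0 (sum∞ (λ m → geoTerm K.1# e (m ℕ.* 5 ℕ.+ 4))) ≋ geometric K.1# e
    survive = trans (U-sum∞ (small 4) (Sum.Small-cong (λ m → sym (term m)) (geoTerm-small K.1# e))) (Sum.∞-cong term)
      where
      term : ∀ m → U 0 (geoTerm K.1# e (m ℕ.* 5 ℕ.+ 4)) ≋ geoTerm K.1# e m
      term m = trans (U-cong 0 (trans (monomial-cong _ (K.trans (1^ (suc (m ℕ.* 5 ℕ.+ 4))) (K.sym (1^ (suc m)))))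
        (monomial-exp _ (N.solve 2 (λ e m → e N.:* (N.con 1 N.:+ (m N.:* N.con 5 N.:+ N.con 4)) N.:= (e N.:* (N.con 1 N.:+ m)) N.:* N.con 5) ≡.refl e m))))
        (U-monomial-5 _ _)

  U-lambert : ∀ r → .{{_ : ℕ.NonZero r}} → r < 5 → U 0 (lambert K.1# r 5) ≋ lambert K.1# r 5
  U-lambert r r<5 = trans (U-sum∞ (Lambert.lambert-small K K.1# r 5) (λ n → agree-trans
      (U-agree (agree-mono (ℕₚ.≤-trans (ℕₚ.≤-reflexive (ℕₚ.*-comm n 5)) (ℕₚ.m≤n+m (5 ℕ.* n) r)) (Sum.∞-small (geoTerm-small′ K.1# (r ℕ.+ 5 ℕ.* n)))))
      (≋⇒agree (pointwise λ _ → K.refl))))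
    (Sum.∞-cong λ n → U-geometric (r ℕ.+ 5 ℕ.* n) {{nonZero n}} (λ d → 5∤ {r} {n} (ℕ.>-nonZero⁻¹ r) r<5
      (≡.subst (5 ∣_) (≡.trans (ℕₚ.+-comm r _) (≡.cong (ℕ._+ r) (ℕₚ.*-comm 5 n))) d)))
    where
    nonZero : ∀ n → ℕ.NonZero (r ℕ.+ 5 ℕ.* n)
    nonZero n = ℕ.>-nonZero (ℕₚ.≤-trans (ℕ.>-nonZero⁻¹ r) (ℕₚ.m≤m+n r _))

  qProd-sections : qProd K.1# 1 1 ≋ qProd K.1# 1 5 * (qProd K.1# 2 5 * (qProd K.1# 3 5 * (qProd K.1# 4 5 * qProd K.1# 5 5)))
  qProd-sections = trans (Prod.∞-blocks 5 (qFactor-small K.1# 1 1)) (*-cong (s 0) (*-cong (s 1) (*-cong (s 2) (*-cong (s 3) (trans (S.*-identityʳ _) (s 4))))))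
    where
    s : ∀ r → prod∞ (λ m → qFactor K.1# 1 1 (m ℕ.* 5 ℕ.+ r)) ≋ qProd K.1# (suc r) 5
    s r = Prod.∞-cong λ m → +-congˡ (S.-‿cong (monomial-exp K.1#
      (N.solve 2 (λ r m → N.con 1 N.:+ N.con 1 N.:* (m N.:* N.con 5 N.:+ r) N.:= N.con 1 N.:+ r N.:+ N.con 5 N.:* m) ≡.refl r m)))

  V-qProd : V (qProd K.1# 1 1) ≋ qProd K.1# 5 5
  V-qProd = trans (V-prod∞ (qFactor-small K.1# 1 1)) (Prod.∞-cong λ n → trans (V-+ _ _) (+-cong V-1
    (trans (V-neg _) (S.-‿cong (trans (V-monomial _ _) (monomial-exp K.1#
      (N.solve 1 (λ n → (N.con 1 N.:+ N.con 1 N.:* n) N.:* N.con 5 N.:= N.con 5 N.:+ N.con 5 N.:* n) ≡.refl n)))))))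

module ConstantMultiples (R : CommutativeRing 0ℓ 0ℓ) where
  open CommutativeRing R using (1#)
  open PowerSeries R using (_≋_; const; const-0; const-+; const-neg; refl; sym; trans; +-congʳ; commutativeRing)
  private module S = CommutativeRing commutativeRing using (-‿cong)

  const-fromℕ : ∀ n → const (IntegerMultiples.fromℕ R n) ≋ IntegerMultiples.fromℕ commutativeRing n
  const-fromℕ 0             = const-0
  const-fromℕ 1             = refl
  const-fromℕ (suc (suc n)) = trans (sym (const-+ _ 1#)) (+-congʳ (const-fromℕ (suc n)))

  const-fromℤ : ∀ i → const (IntegerMultiples.fromℤ R i) ≋ IntegerMultiples.fromℤ commutativeRing i
  const-fromℤ (+ n)    = const-fromℕ n
  const-fromℤ -[1+ n ] = trans (const-neg _) (S.-‿cong (const-fromℕ (suc n)))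

record CyclotomicExtension (R : CommutativeRing 0ℓ 0ℓ) : Set₁ where
  private module R = CommutativeRing R using (Carrier; _≈_; _+_; _*_; 0#)
  field
    extension : CommutativeRing 0ℓ 0ℓ
    ι         : RingHom R extension
  private module K = CommutativeRing extension using (Carrier; _≈_; _+_; _*_; _-_; 0#; 1#)
  open RingHom ι using (φ) public
  open IntegerMultiples R using (fromℤ)
  field
    ζ ζ′ unit₁ unit₂ : K.Carrier
    ζζ′≈1      : ζ K.* ζ′ K.≈ K.1#
    ζ′³≈ζ²     : ζ′ K.* (ζ′ K.* ζ′) K.≈ ζ K.* ζ
    cyclotomic : K.1# K.+ ζ K.+ ζ′ K.+ ζ K.* ζ K.+ ζ′ K.* ζ′ K.≈ K.0#
    isUnit₁    : unit₁ K.* (K.1# K.- ζ′) K.≈ K.1#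
    isUnit₂    : unit₂ K.* (K.1# K.- ζ′ K.* ζ′) K.≈ K.1#
    ι-injective : ∀ {x y} → φ x K.≈ φ y → x R.≈ y
    independent : ∀ x y → (ζ K.- ζ′) K.* φ x K.+ (ζ K.* ζ K.- ζ′ K.* ζ′) K.* φ y K.≈ K.0# → x R.≈ R.0# × y R.≈ R.0#
    -- The R-linear functional ζᵐ ↦ m for |m| ≤ 2.
    coord      : K.Carrier → R.Carrier
    coord-cong : ∀ {x y} → x K.≈ y → coord x R.≈ coord y
    coord-+    : ∀ x y → coord (x K.+ y) R.≈ coord x R.+ coord y
    coord-ι*   : ∀ x k → coord (φ x K.* k) R.≈ x R.* coord k
    coord-1    : coord K.1# R.≈ fromℤ (+ 0)
    coord-ζ    : coord ζ R.≈ fromℤ (+ 1)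
    coord-ζ²   : coord (ζ K.* ζ) R.≈ fromℤ (+ 2)
    coord-ζ′²  : coord (ζ′ K.* ζ′) R.≈ fromℤ -[1+ 1 ]
    coord-ζ′   : coord ζ′ R.≈ fromℤ -[1+ 0 ]

module Descent {R : CommutativeRing 0ℓ 0ℓ} (ext : CyclotomicExtension R) where
  open CyclotomicExtension ext renaming (extension to K)
  private
    module R = CommutativeRing R using (_≈_; _*_; _+_; 0#; 1#; trans; sym; refl; +-cong; *-comm; *-congʳ; +-commutativeMonoid; zeroˡ)
    module K = CommutativeRing K using (Carrier; _≈_; _*_; _+_; _-_; 0#; 1#; trans; sym; refl; *-comm; *-assoc; *-congˡ; *-congʳ; *-identityˡ; *-identityʳ; +-cong; +-comm; +-commutativeMonoid; distribʳ; zeroˡ)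
    module Q = PowerSeries R using (_*_; _+_; _-_; _at_; _‼_; _≋_; *-comm; *-congʳ; *-congˡ; +-cong; -_; 0#; Series; commutativeRing; const-*; pointwise; q; refl; sym; trans)
    module T = ThetaDissection R using (PE; L₁; L₂; a; b; q³E; F; G)
    module PK = PowerSeries K using (_*_; _+_; _-_; _at_; _‼_; _≋_; *-cong; *-congʳ; *-congˡ; +-cong; +-congʳ; +-congˡ; -_; Series; ^-congˡ; commutativeRing; const; const-*; const-cong; pointwise; refl; sym; trans)
    module TK = ThetaDissection K using (F; G; L₁; L₂; PE; a; b; lambert-root; q³E)
    module VQ = QuinticSections R using (V)
    module VK = QuinticSections K using (V; V-cong)
    module LQ = Lambert R using (lambert)
    module LK = Lambert K using (lambert)
    module S = CommutativeRing Q.commutativeRing using (-‿cong)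
    module KS = CommutativeRing PK.commutativeRing using (-‿cong; *-identityˡ)

    square-inverse : (ζ K.* ζ) K.* (ζ′ K.* ζ′) K.≈ K.1#
    square-inverse = K.trans (solve 2 (λ z t → (z :* z) :* (t :* t) := (z :* t) :* (z :* t)) K.refl ζ ζ′)
      (K.trans (K.*-congʳ ζζ′≈1) (K.trans (K.*-identityˡ _) ζζ′≈1))
      where open IntegerSolver K

    module ζ-theta = ThetaDissection.FifthRoot K ζ ζ′ unit₁ ζζ′≈1 ζ′³≈ζ² cyclotomic isUnit₁ using (η′; s₁; s₂; z³≈; z⁴≈; z⁵≈1; z′³≈; z′⁴≈; z′⁵≈1; z+z′+η′; [z+z′]η′; Θ-dissection; qProd-five; s₁F+s₂G≋0; const-*-const)

    ζ²ζ²≈ζ′ : (ζ K.* ζ) K.* (ζ K.* ζ) K.≈ ζ′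
    ζ²ζ²≈ζ′ = K.trans (K.*-assoc ζ ζ _) ζ-theta.z⁴≈

    ζ′²ζ′²≈ζ : (ζ′ K.* ζ′) K.* (ζ′ K.* ζ′) K.≈ ζ
    ζ′²ζ′²≈ζ = K.trans (K.*-assoc ζ′ ζ′ _) ζ-theta.z′⁴≈

    square-relation : (ζ′ K.* ζ′) K.* ((ζ′ K.* ζ′) K.* (ζ′ K.* ζ′)) K.≈ (ζ K.* ζ) K.* (ζ K.* ζ)
    square-relation = K.trans (solve 1 (λ t → (t :* t) :* ((t :* t) :* (t :* t)) := t :* (t :* (t :* (t :* (t :* t))))) K.refl ζ′)
      (K.trans (K.*-congˡ ζ-theta.z′⁵≈1) (K.trans (K.*-identityʳ ζ′) (K.sym ζ²ζ²≈ζ′)))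
      where open IntegerSolver K

    square-cyclotomic : K.1# K.+ ζ K.* ζ K.+ ζ′ K.* ζ′ K.+ (ζ K.* ζ) K.* (ζ K.* ζ) K.+ (ζ′ K.* ζ′) K.* (ζ′ K.* ζ′) K.≈ K.0#
    square-cyclotomic = K.trans (K.+-cong (K.+-cong K.refl ζ²ζ²≈ζ′) ζ′²ζ′²≈ζ)
      (K.trans (solve 4 (λ x y z t → con (+ 1) :+ x :+ y :+ t :+ z := con (+ 1) :+ z :+ t :+ x :+ y) K.refl (ζ K.* ζ) (ζ′ K.* ζ′) ζ ζ′) cyclotomic)
      where open IntegerSolver K

    module ζ²-theta = ThetaDissection.FifthRoot K (ζ K.* ζ) (ζ′ K.* ζ′) unit₂ square-inverse square-relation square-cyclotomic isUnit₂ using (Θ-dissection)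

  open SeriesHom ι using (mapS; mapS-*; mapS-+; mapS--; mapS-V; mapS-^; mapS-lambert; mapS-q; mapS-qProd)
  open ConstantMultiples R using (const-fromℤ)
  open IntegerMultiples R using () renaming (fromℤ to fromℤᴿ; fromℤ-+ to fromℤ-+)
  open IntegerMultiples Q.commutativeRing using (fromℤ)
  open PK using (_≋_; _+_; _*_; _-_; _at_; const; const-cong; pointwise; trans; sym; refl; +-cong; *-cong; *-congˡ; *-congʳ; +-congˡ; +-congʳ)
  open ζ-theta using (η′; s₁; s₂; z³≈; z⁴≈; z⁵≈1; z′³≈; z′⁴≈; z′⁵≈1) public
  open IntegerSolver PK.commutativeRing using (_:*_; _:+_; _:-_; _:=_; :-_; con; solve)

  infixl 6 _⊕ₘ_ _⊖ₘ_
  infixl 7 _⊛ₘ_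
  _⊕ₘ_ : ∀ {f g f′ g′} → mapS f ≋ f′ → mapS g ≋ g′ → mapS (f Q.+ g) ≋ f′ + g′
  p ⊕ₘ q = trans (mapS-+ _ _) (+-cong p q)
  _⊖ₘ_ : ∀ {f g f′ g′} → mapS f ≋ f′ → mapS g ≋ g′ → mapS (f Q.- g) ≋ f′ - g′
  p ⊖ₘ q = trans (mapS-- _ _) (+-cong p (KS.-‿cong q))
  _⊛ₘ_ : ∀ {f g f′ g′} → mapS f ≋ f′ → mapS g ≋ g′ → mapS (f Q.* g) ≋ f′ * g′
  p ⊛ₘ q = trans (mapS-* _ _) (*-cong p q)

  mapS-V′ : ∀ {f f′} → mapS f ≋ f′ → mapS (VQ.V f) ≋ VK.V f′
  mapS-V′ p = trans (mapS-V _) (VK.V-cong p)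

  PE↦ : mapS T.PE ≋ TK.PE
  PE↦ = mapS-qProd 1 1

  a↦ : mapS T.a ≋ TK.a
  a↦ = mapS-q ⊛ₘ mapS-V′ (mapS-qProd 4 5 ⊛ₘ mapS-qProd 1 5 ⊛ₘ mapS-qProd 5 5)

  b↦ : mapS T.b ≋ TK.b
  b↦ = mapS-V′ (mapS-qProd 3 5 ⊛ₘ mapS-qProd 2 5 ⊛ₘ mapS-qProd 5 5)

  L₁↦ : mapS T.L₁ ≋ TK.L₁
  L₁↦ = mapS-lambert 1 5 ⊖ₘ mapS-lambert 4 5

  L₂↦ : mapS T.L₂ ≋ TK.L₂
  L₂↦ = mapS-lambert 2 5 ⊖ₘ mapS-lambert 3 5

  q³E↦ : mapS T.q³E ≋ TK.q³E
  q³E↦ = trans (mapS-^ Q.q 3) (PK.^-congˡ 3 mapS-q) ⊛′ mapS-V′ (mapS-V′ (PE↦ ⊛ₘ PE↦ ⊛ₘ PE↦))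
    where
    _⊛′_ : ∀ {f g f′ g′} → mapS f ≋ f′ → mapS g ≋ g′ → mapS (f Q.* g) ≋ f′ * g′
    _⊛′_ = _⊛ₘ_

  F↦ : mapS T.F ≋ TK.F
  F↦ = b↦ ⊛ₘ L₁↦ ⊖ₘ a↦ ⊛ₘ (L₁↦ ⊕ₘ L₂↦) ⊖ₘ (bm ⊕ₘ bm ⊕ₘ bm) ⊖ₘ (am ⊕ₘ am) ⊖ₘ a↦ ⊕ₘ q³E↦
    where
    bm = b↦ ⊛ₘ mapS-V′ L₂↦
    am = a↦ ⊛ₘ mapS-V′ L₁↦

  G↦ : mapS T.G ≋ TK.G
  G↦ = b↦ ⊛ₘ L₂↦ ⊖ₘ a↦ ⊛ₘ L₁↦ ⊖ₘ b↦ ⊛ₘ mapS-V′ L₂↦ ⊕ₘ a↦ ⊛ₘ mapS-V′ L₁↦ ⊕ₘ (q³E↦ ⊕ₘ q³E↦)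

  private
    relation : ∀ n → s₁ K.* φ (T.F Q.‼ n) K.+ s₂ K.* φ (T.G Q.‼ n) K.≈ K.0#
    relation n = K.trans (K.sym (+-cong (PK.const-* s₁ (mapS T.F)) (PK.const-* s₂ (mapS T.G)) at n))
      (trans (+-cong (*-congˡ F↦) (*-congˡ G↦)) ζ-theta.s₁F+s₂G≋0 at n)

  F≋0 : T.F Q.≋ Q.0#
  F≋0 = Q.pointwise λ n → proj₁ (independent (T.F Q.‼ n) (T.G Q.‼ n) (relation n))

  G≋0 : T.G Q.≋ Q.0#
  G≋0 = Q.pointwise λ n → proj₂ (independent (T.F Q.‼ n) (T.G Q.‼ n) (relation n))

  mapS-injective : ∀ {f g} → mapS f ≋ mapS g → f Q.≋ g
  mapS-injective p = Q.pointwise λ n → ι-injective (p at n)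

  private
    conj : K.Carrier
    conj = ζ K.+ ζ′

    norm : ∀ a b → (b + const η′ * a) * (b + const conj * a) ≋ b * b - a * b - a * a
    norm a b = trans (solve 4 (λ a b h s → (b :+ h :* a) :* (b :+ s :* a) := b :* b :+ (s :+ h) :* (a :* b) :+ (s :* h) :* (a :* a)) refl a b (const η′) (const conj))
      (trans (+-cong (+-congˡ (*-congʳ ζ-theta.z+z′+η′)) (*-congʳ ζ-theta.[z+z′]η′))
        (solve 2 (λ a b → b :* b :+ (:- con (+ 1)) :* (a :* b) :+ (:- con (+ 1)) :* (a :* a) := b :* b :- a :* b :- a :* a) refl a b))

    Δ↦ : mapS (T.b Q.* T.b Q.- T.a Q.* T.b Q.- T.a Q.* T.a) ≋ TK.b * TK.b - TK.a * TK.b - TK.a * TK.a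
    Δ↦ = b↦ ⊛ₘ b↦ ⊖ₘ a↦ ⊛ₘ b↦ ⊖ₘ a↦ ⊛ₘ a↦

    Θ₁ Θ₂ : PK.Series
    Θ₁ = DifferentiatedTripleProduct.Θ K ζ ζ′ ζζ′≈1
    Θ₂ = DifferentiatedTripleProduct.Θ K (ζ K.* ζ) (ζ′ K.* ζ′) square-inverse

  open TripleProduct K using (qProd)

  PE*P₅ : T.PE Q.* TripleProduct.qProd R R.1# 5 5 Q.≋ T.b Q.* T.b Q.- T.a Q.* T.b Q.- T.a Q.* T.a
  PE*P₅ = mapS-injective (trans (PE↦ ⊛ₘ mapS-qProd 5 5) (trans (*-congˡ (sym ζ-theta.qProd-five))
    (trans (solve 5 (λ e p p′ r r′ → e :* (p :* p′ :* (r :* r′) :* e) := (p :* p′ :* e) :* (r :* r′ :* e)) refl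
             TK.PE (qProd ζ 1 1) (qProd ζ′ 1 1) (qProd (ζ K.* ζ) 1 1) (qProd (ζ′ K.* ζ′) 1 1))
    (trans (*-cong ζ-theta.Θ-dissection ζ²-theta.Θ-dissection)
    (trans (*-congˡ (+-congˡ (*-congʳ (const-cong (K.trans (K.+-cong ζ²ζ²≈ζ′ ζ′²ζ′²≈ζ) (K.+-comm ζ′ ζ)))))) (trans (norm TK.a TK.b) (sym Δ↦)))))))

  coordS : PK.Series → Q.Series
  coordS f Q.‼ n = coord (f PK.‼ n)

  coordS-cong : ∀ {f g} → f ≋ g → coordS f Q.≋ coordS g
  coordS-cong p = Q.pointwise λ n → coord-cong (p at n)

  coordS-+ : ∀ f g → coordS (f + g) Q.≋ coordS f Q.+ coordS g
  coordS-+ f g = Q.pointwise λ n → coord-+ (f PK.‼ n) (g PK.‼ n)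

  coord-0 : coord K.0# R.≈ R.0#
  coord-0 = R.trans (coord-cong (K.sym (K.trans (K.*-congʳ (RingHom.φ-0 ι)) (K.zeroˡ K.0#)))) (R.trans (coord-ι* R.0# K.0#) (R.zeroˡ _))

  coordS-mapS* : ∀ f g → coordS (mapS f * g) Q.≋ f Q.* coordS g
  coordS-mapS* f g = Q.pointwise λ n → R.trans
    (FoldHom.fold-homo K.+-commutativeMonoid R.+-commutativeMonoid coord coord-0 coord-+ (λ i → φ (f Q.‼ i) K.* g PK.‼ (n ∸ i)) (suc n))
    (FiniteFold.fold-cong R.+-commutativeMonoid {g = λ i → f Q.‼ i R.* coord (g PK.‼ (n ∸ i))} (suc n) λ i → coord-ι* (f Q.‼ i) (g PK.‼ (n ∸ i)))

  coordS-const* : ∀ {k} i → coord k R.≈ fromℤᴿ i → ∀ f → coordS (const k * mapS f) Q.≋ fromℤ i Q.* f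
  coordS-const* {k} i p f = Q.trans (Q.pointwise λ n → R.trans (coord-cong (K.trans (PK.const-* k (mapS f) at n) (K.*-comm k _)))
    (R.trans (coord-ι* (f Q.‼ n) k) (R.trans (R.*-comm _ _) (R.trans (R.*-congʳ p) (R.sym (Q.const-* (fromℤᴿ i) f Q.at n))))))
    (Q.*-congʳ (const-fromℤ i))

  private
    Λ : ℕ → Q.Series
    Λ r = LQ.lambert R.1# r 5

    combination : ∀ {k₁ k₂ k₃ k₄ k₅} i₁ i₂ i₃ i₄ i₅ → coord k₁ R.≈ fromℤᴿ i₁ → coord k₂ R.≈ fromℤᴿ i₂ → coord k₃ R.≈ fromℤᴿ i₃ →
      coord k₄ R.≈ fromℤᴿ i₄ → coord k₅ R.≈ fromℤᴿ i₅ →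
      coordS (const k₁ * LK.lambert K.1# 1 5 + (const k₂ * LK.lambert K.1# 2 5 + (const k₃ * LK.lambert K.1# 3 5 +
        (const k₄ * LK.lambert K.1# 4 5 + const k₅ * LK.lambert K.1# 5 5)))) Q.≋
      fromℤ i₁ Q.* Λ 1 Q.+ (fromℤ i₂ Q.* Λ 2 Q.+ (fromℤ i₃ Q.* Λ 3 Q.+ (fromℤ i₄ Q.* Λ 4 Q.+ fromℤ i₅ Q.* Λ 5)))
    combination i₁ i₂ i₃ i₄ i₅ p₁ p₂ p₃ p₄ p₅ = t 1 i₁ p₁ ⊕ (t 2 i₂ p₂ ⊕ (t 3 i₃ p₃ ⊕ (t 4 i₄ p₄ ⊕ t 5 i₅ p₅)))
      where
      infixr 6 _⊕_
      _⊕_ : ∀ {f g f′ g′} → coordS f Q.≋ f′ → coordS g Q.≋ g′ → coordS (f + g) Q.≋ f′ Q.+ g′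
      p ⊕ r = Q.trans (coordS-+ _ _) (Q.+-cong p r)
      t : ∀ {k} r i → coord k R.≈ fromℤᴿ i → coordS (const k * LK.lambert K.1# r 5) Q.≋ fromℤ i Q.* Λ r
      t r i p = Q.trans (coordS-cong (*-congˡ (sym (mapS-lambert r 5)))) (coordS-const* i p (Λ r))

    lam : PK.Series
    lam = LK.lambert ζ 1 1

    lam-root : lam ≋ const ζ * LK.lambert K.1# 1 5 + (const (ζ K.* ζ) * LK.lambert K.1# 2 5 + (const (ζ′ K.* ζ′) * LK.lambert K.1# 3 5 +
      (const ζ′ * LK.lambert K.1# 4 5 + const K.1# * LK.lambert K.1# 5 5)))
    lam-root = trans (TK.lambert-root z³≈ z⁴≈ z⁵≈1) (+-congˡ (+-congˡ (+-congˡ (+-congˡ (sym (KS.*-identityˡ _))))))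

    module QS = IntegerSolver Q.commutativeRing using (_:*_; _:+_; _:-_; _:=_; :-_; con; solve)

    coord-sum : ∀ {k x y} i j → k K.≈ x K.+ y → coord x R.≈ fromℤᴿ i → coord y R.≈ fromℤᴿ j → coord k R.≈ fromℤᴿ (i ℤ.+ j)
    coord-sum i j p r s = R.trans (coord-cong p) (R.trans (coord-+ _ _) (R.trans (R.+-cong r s) (R.sym (fromℤ-+ i j))))

    conj-ζ : coord (conj K.* ζ) R.≈ fromℤᴿ (+ 2)
    conj-ζ = coord-sum (+ 2) (+ 0) (K.trans (K.distribʳ ζ ζ ζ′) (K.+-cong K.refl (K.trans (K.*-comm ζ′ ζ) ζζ′≈1))) coord-ζ² coord-1

    conj-ζ² : coord (conj K.* (ζ K.* ζ)) R.≈ fromℤᴿ -[1+ 0 ]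
    conj-ζ² = coord-sum -[1+ 1 ] (+ 1) (K.trans (K.distribʳ _ ζ ζ′) (K.+-cong z³≈ (K.trans (K.sym (K.*-assoc ζ′ ζ ζ))
      (K.trans (K.*-congʳ (K.trans (K.*-comm ζ′ ζ) ζζ′≈1)) (K.*-identityˡ ζ))))) coord-ζ′² coord-ζ

    conj-ζ′² : coord (conj K.* (ζ′ K.* ζ′)) R.≈ fromℤᴿ (+ 1)
    conj-ζ′² = coord-sum -[1+ 0 ] (+ 2) (K.trans (K.distribʳ _ ζ ζ′) (K.+-cong (K.trans (K.sym (K.*-assoc ζ ζ′ ζ′))
      (K.trans (K.*-congʳ ζζ′≈1) (K.*-identityˡ ζ′))) z′³≈)) coord-ζ′ coord-ζ²

    conj-ζ′ : coord (conj K.* ζ′) R.≈ fromℤᴿ -[1+ 1 ]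
    conj-ζ′ = coord-sum (+ 0) -[1+ 1 ] (K.trans (K.distribʳ ζ′ ζ ζ′) (K.+-cong ζζ′≈1 K.refl)) coord-1 coord-ζ′²

    conj-1 : coord (conj K.* K.1#) R.≈ fromℤᴿ (+ 0)
    conj-1 = coord-sum (+ 1) -[1+ 0 ] (K.*-identityʳ conj) coord-ζ coord-ζ′

  coordS-lam : coordS lam Q.≋ T.L₁ Q.+ (T.L₂ Q.+ T.L₂)
  coordS-lam = Q.trans (coordS-cong lam-root)
    (Q.trans (combination (+ 1) (+ 2) -[1+ 1 ] -[1+ 0 ] (+ 0) coord-ζ coord-ζ² coord-ζ′² coord-ζ′ coord-1)
    (QS.solve 5 (λ l₁ l₂ l₃ l₄ l₅ → QS.con (+ 1) QS.:* l₁ QS.:+ (QS.con (+ 2) QS.:* l₂ QS.:+ (QS.con -[1+ 1 ] QS.:* l₃ QS.:+ (QS.con -[1+ 0 ] QS.:* l₄ QS.:+ QS.con (+ 0) QS.:* l₅)))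
      QS.:= (l₁ QS.:- l₄) QS.:+ ((l₂ QS.:- l₃) QS.:+ (l₂ QS.:- l₃))) Q.refl (Λ 1) (Λ 2) (Λ 3) (Λ 4) (Λ 5)))

  coordS-conj-lam : coordS (const conj * lam) Q.≋ T.L₁ Q.+ T.L₁ Q.- T.L₂
  coordS-conj-lam = Q.trans (coordS-cong (trans (*-congˡ lam-root)
      (trans (solve 11 (λ k z z² t² t u l₁ l₂ l₃ l₄ l₅ → k :* (z :* l₁ :+ (z² :* l₂ :+ (t² :* l₃ :+ (t :* l₄ :+ u :* l₅)))) :=
         (k :* z) :* l₁ :+ ((k :* z²) :* l₂ :+ ((k :* t²) :* l₃ :+ ((k :* t) :* l₄ :+ (k :* u) :* l₅)))) refl
         (const conj) (const ζ) (const (ζ K.* ζ)) (const (ζ′ K.* ζ′)) (const ζ′) (const K.1#) (l 1) (l 2) (l 3) (l 4) (l 5))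
       (+-cong (*-congʳ (cc _)) (+-cong (*-congʳ (cc _)) (+-cong (*-congʳ (cc _)) (+-cong (*-congʳ (cc _)) (*-congʳ (cc _)))))))))
    (Q.trans (combination (+ 2) -[1+ 0 ] (+ 1) -[1+ 1 ] (+ 0) conj-ζ conj-ζ² conj-ζ′² conj-ζ′ conj-1)
    (QS.solve 5 (λ l₁ l₂ l₃ l₄ l₅ → QS.con (+ 2) QS.:* l₁ QS.:+ (QS.con -[1+ 0 ] QS.:* l₂ QS.:+ (QS.con (+ 1) QS.:* l₃ QS.:+ (QS.con -[1+ 1 ] QS.:* l₄ QS.:+ QS.con (+ 0) QS.:* l₅)))
      QS.:= (l₁ QS.:- l₄) QS.:+ (l₁ QS.:- l₄) QS.:- (l₂ QS.:- l₃)) Q.refl (Λ 1) (Λ 2) (Λ 3) (Λ 4) (Λ 5)))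
    where
    l : ℕ → PK.Series
    l r = LK.lambert K.1# r 5
    cc : ∀ y → const conj * const y ≋ const (conj K.* y)
    cc y = ζ-theta.const-*-const conj y

  -- I is the ε-part of the generating function of three-coloured partitions weighted by (ζ + ζε)^#π¹ ζ^-#π².
  coordS-generating : ∀ {I} → I * Θ₁ ≋ lam →
    coordS I Q.* (T.b Q.* T.b Q.- T.a Q.* T.b Q.- T.a Q.* T.a) Q.≋
    T.b Q.* (T.L₁ Q.+ (T.L₂ Q.+ T.L₂)) Q.+ T.a Q.* (T.L₁ Q.+ T.L₁ Q.- T.L₂)
  coordS-generating {I} p = Q.trans (Q.*-comm _ _) (Q.trans (Q.sym (coordS-mapS* _ I)) (Q.trans (coordS-cong step)
    (Q.trans (coordS-+ _ _) (Q.+-cong (Q.trans (coordS-mapS* T.b lam) (Q.*-congˡ coordS-lam))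
      (Q.trans (coordS-mapS* T.a _) (Q.*-congˡ coordS-conj-lam))))))
    where
    step : mapS (T.b Q.* T.b Q.- T.a Q.* T.b Q.- T.a Q.* T.a) * I ≋ mapS T.b * lam + mapS T.a * (const conj * lam)
    step = trans (*-congʳ (trans Δ↦ (trans (sym (norm TK.a TK.b)) (*-congʳ (sym ζ-theta.Θ-dissection)))))
      (trans (solve 5 (λ t b s a i → (t :* (b :+ s :* a)) :* i := b :* (i :* t) :+ a :* (s :* (i :* t))) refl Θ₁ TK.b (const conj) TK.a I)
        (+-cong (*-cong (sym b↦) p) (*-cong (sym a↦) (*-congˡ p))))

module ListSum (M : CommutativeMonoid 0ℓ 0ℓ) where
  open CommutativeMonoid M using (_∙_; _≈_; Carrier; assoc; identityˡ; refl; sym; trans; ε; ∙-cong; ∙-congˡ)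
  open FiniteFold M using (fold)

  listSum : {A : Set} → (A → Carrier) → List A → Carrier
  listSum f []       = ε
  listSum f (x ∷ xs) = f x ∙ listSum f xs

  listSum-cong : {A : Set} {f g : A → Carrier} (xs : List A) → (∀ x → f x ≈ g x) → listSum f xs ≈ listSum g xs
  listSum-cong []       p = refl
  listSum-cong (x ∷ xs) p = ∙-cong (p x) (listSum-cong xs p)

  listSum-++ : {A : Set} (f : A → Carrier) (xs ys : List A) → listSum f (xs ++ ys) ≈ listSum f xs ∙ listSum f ys
  listSum-++ f []       ys = sym (identityˡ _)
  listSum-++ f (x ∷ xs) ys = trans (∙-congˡ (listSum-++ f xs ys)) (sym (assoc _ _ _))

  listSum-map : {A B : Set} (f : B → Carrier) (h : A → B) (xs : List A) → listSum f (map h xs) ≡ listSum (λ x → f (h x)) xs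
  listSum-map f h []       = ≡.refl
  listSum-map f h (x ∷ xs) = ≡.cong (f (h x) ∙_) (listSum-map f h xs)

  listSum-concatMap : {A B : Set} (f : B → Carrier) (h : A → List B) (xs : List A) →
                      listSum f (concatMap h xs) ≈ listSum (λ x → listSum f (h x)) xs
  listSum-concatMap f h []       = refl
  listSum-concatMap f h (x ∷ xs) = trans (listSum-++ f (h x) _) (∙-congˡ (listSum-concatMap f h xs))

  listSum-filter : {A : Set} {P : A → Set} (P? : ∀ x → Dec (P x)) (f : A → Carrier) (xs : List A) →
                   listSum f (filter P? xs) ≈ listSum (λ x → if does (P? x) then f x else ε) xs
  listSum-filter P? f []       = refl
  listSum-filter P? f (x ∷ xs) with does (P? x)
  ... | true  = ∙-congˡ (listSum-filter P? f xs)
  ... | false = trans (listSum-filter P? f xs) (sym (identityˡ _))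

  listSum-upTo : (f : ℕ → Carrier) (n : ℕ) → listSum f (upTo n) ≡ fold f n
  listSum-upTo f n = go (λ i → i) n
    where
    go : ∀ g n → listSum f (applyUpTo g n) ≡ fold (λ i → f (g i)) n
    go g zero    = ≡.refl
    go g (suc n) = ≡.cong (f (g 0) ∙_) (go (λ i → g (suc i)) n)

module ListSumHom (M N : CommutativeMonoid 0ℓ 0ℓ) where
  private
    module M = CommutativeMonoid M using (_∙_; Carrier; ε)
    module N = CommutativeMonoid N using (_∙_; _≈_; Carrier; trans; ε; ∙-congˡ)
    module SM = ListSum M using (listSum)
    module SN = ListSum N using (listSum)

  listSum-homo : (φ : M.Carrier → N.Carrier) → φ M.ε N.≈ N.ε → (∀ x y → φ (x M.∙ y) N.≈ φ x N.∙ φ y) →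
                 {A : Set} (f : A → M.Carrier) (xs : List A) → φ (SM.listSum f xs) N.≈ SN.listSum (λ a → φ (f a)) xs
  listSum-homo φ φ-ε φ-∙ f []       = φ-ε
  listSum-homo φ φ-ε φ-∙ f (a ∷ xs) = N.trans (φ-∙ _ _) (N.∙-congˡ (listSum-homo φ φ-ε φ-∙ f xs))

module PartitionGeneratingFunction (K : CommutativeRing 0ℓ 0ℓ) where
  open PowerSeries K using (module Prod; module Sum; _*_; _+_; _-_; _^_; _at_; _‼_; _≋_; *-comm; *-cong; *-congʳ; *-congˡ; *-sum∞; +-cong; +-congˡ; -_; 1#; Agree; Series; agree; agree-*; agree-*0; agree-+; agree-trans; agree⇒≋; below; commutativeRing; fold-coeff; monomial; monomial-*; monomial-*-shiftBy; monomial-exp; monomial-small; monomial≋shiftBy; pointwise; q; refl; shiftBy; shiftBy-small; sum∞; sym; trans; ≋⇒agree)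
  open TripleProduct K using (qFactor; qFactor-small; qProd)
  private
    module K = CommutativeRing K using (_*_; _≈_; +-commutativeMonoid; +-congˡ; +-identityʳ; 0#; 1#; Carrier; distribʳ; distribˡ; refl; reflexive; semiring; sym; trans; zeroʳ; zeroˡ)
    module S = CommutativeRing commutativeRing using (*-assoc; *-identityˡ; +-identityʳ; -‿cong)
  open SemiringExp K.semiring using (^-homo-*) renaming (_^_ to _^ᴷ_)
  open ListSum K.+-commutativeMonoid using (listSum; listSum-concatMap; listSum-cong; listSum-filter; listSum-map; listSum-upTo)
  open IntegerSolver commutativeRing using (_:*_; _:+_; _:-_; _:=_; :-_; con; solve)

  shiftBy-above : ∀ e f {n} → e ≤ n → shiftBy e f ‼ n ≡ f ‼ (n ∸ e)
  shiftBy-above zero    f _         = ≡.refl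
  shiftBy-above (suc e) f (s≤s e≤n) = shiftBy-above e f e≤n

  monomial-*-coeff : ∀ X e f n → (monomial X e * f) ‼ n K.≈ (if does (e ℕ.≤? n) then X K.* f ‼ (n ∸ e) else K.0#)
  monomial-*-coeff X e f n = [ above , under ]′ (ℕₚ.≤-<-connex e n)
    where
    decided : ∀ {t} → does (e ℕ.≤? n) ≡ t → (if t then X K.* f ‼ (n ∸ e) else K.0#) ≡ (if does (e ℕ.≤? n) then X K.* f ‼ (n ∸ e) else K.0#)
    decided p = ≡.cong (λ t → if t then X K.* f ‼ (n ∸ e) else K.0#) (≡.sym p)
    above : e ≤ n → _
    above e≤n = K.trans (monomial-*-shiftBy X e f at n) (K.trans (K.reflexive (shiftBy-above e _ e≤n))
      (K.reflexive (decided (dec-true (e ℕ.≤? n) e≤n))))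
    under : n < e → _
    under n<e = K.trans (monomial-*-shiftBy X e f at n) (K.trans (below (shiftBy-small e _) n n<e)
      (K.reflexive (decided (dec-false (e ℕ.≤? n) (ℕₚ.<⇒≱ n<e)))))

  module _ (x : K.Carrier) where
    weight : List ℕ → K.Carrier
    weight π = x ^ᴷ length π

    bounded : ℕ → Series
    bounded b ‼ n = listSum weight (partsLe n b)

    partitionSeries : Series
    partitionSeries ‼ n = listSum weight (partitions n)

    private
      weight-++ : ∀ c s π → weight (replicate c s ++ π) K.≈ x ^ᴷ c K.* weight π
      weight-++ c s π = K.trans (K.reflexive (≡.cong (x ^ᴷ_) (≡.trans (length-++ (replicate c s))
        (≡.cong (ℕ._+ length π) (length-replicate c))))) (^-homo-* x c (length π))

      listSum-* : ∀ {A : Set} y (f : A → K.Carrier) xs → listSum (λ a → y K.* f a) xs K.≈ y K.* listSum f xs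
      listSum-* y f []       = K.sym (K.zeroʳ y)
      listSum-* y f (a ∷ xs) = K.trans (K.+-congˡ (listSum-* y f xs)) (K.sym (K.distribˡ y _ _))

      multiples : ℕ → ℕ → Series
      multiples s c = monomial (x ^ᴷ c) (c ℕ.* suc s)

      multiples-small : ∀ s → Sum.Small (multiples s)
      multiples-small s c = monomial-small _ (ℕₚ.m≤m*n c (suc s))

      partsLe-suc : ∀ n b → partsLe n (suc b) ≡
        concatMap (λ c → map (replicate c (suc b) ++_) (partsLe (n ∸ c ℕ.* suc b) b))
                  (filter (λ c → c ℕ.* suc b ℕ.≤? n) (upTo (suc n)))
      partsLe-suc zero    b = ≡.refl
      partsLe-suc (suc n) b = ≡.refl

      bounded-suc : ∀ b → bounded (suc b) ≋ sum∞ (multiples b) * bounded b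
      bounded-suc b = trans (pointwise coeff) (trans (sym (*-sum∞ (bounded b) (multiples-small b))) (*-comm _ _))
        where
        coeff : ∀ n → bounded (suc b) ‼ n K.≈ sum∞ (λ c → bounded b * multiples b c) ‼ n
        coeff n = K.trans (K.reflexive (≡.cong (listSum weight) (partsLe-suc n b)))
          (K.trans (listSum-concatMap weight choose (filter fits? (upTo (suc n))))
          (K.trans (listSum-filter fits? (λ c → listSum weight (choose c)) (upTo (suc n)))
          (K.trans (listSum-cong {g = λ c → (bounded b * multiples b c) ‼ n} (upTo (suc n)) term)
          (K.trans (K.reflexive (listSum-upTo (λ c → (bounded b * multiples b c) ‼ n) (suc n)))
                   (K.sym (fold-coeff (λ c → bounded b * multiples b c) (suc n) n))))))
          where
          fits? : ∀ c → Dec (c ℕ.* suc b ≤ n)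
          fits? c = c ℕ.* suc b ℕ.≤? n
          choose : ℕ → List (List ℕ)
          choose c = map (replicate c (suc b) ++_) (partsLe (n ∸ c ℕ.* suc b) b)
          term : ∀ c → (if does (c ℕ.* suc b ℕ.≤? n) then listSum weight (map (replicate c (suc b) ++_) (partsLe (n ∸ c ℕ.* suc b) b)) else K.0#)
                 K.≈ (bounded b * multiples b c) ‼ n
          term c = K.trans (lemma (does (c ℕ.* suc b ℕ.≤? n))) (K.sym (K.trans (*-comm (bounded b) (multiples b c) at n) (monomial-*-coeff (x ^ᴷ c) (c ℕ.* suc b) (bounded b) n)))
            where
            lemma : ∀ t → (if t then listSum weight (map (replicate c (suc b) ++_) (partsLe (n ∸ c ℕ.* suc b) b)) else K.0#)
                    K.≈ (if t then x ^ᴷ c K.* bounded b ‼ (n ∸ c ℕ.* suc b) else K.0#)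
            lemma true  = K.trans (K.reflexive (listSum-map weight _ (partsLe (n ∸ c ℕ.* suc b) b)))
              (K.trans (listSum-cong (partsLe (n ∸ c ℕ.* suc b) b) (weight-++ c (suc b))) (listSum-* (x ^ᴷ c) weight (partsLe (n ∸ c ℕ.* suc b) b)))
            lemma false = K.refl

      multiples-inverse : ∀ b → (1# - monomial x (suc b)) * sum∞ (multiples b) ≋ 1#
      multiples-inverse b = trans (solve 2 (λ m g → (con (+ 1) :- m) :* g := g :- m :* g) refl (monomial x (suc b)) (sum∞ (multiples b)))
        (trans (+-cong step refl) (solve 1 (λ s → (con (+ 1) :+ s) :- s := con (+ 1)) refl (monomial x (suc b) * sum∞ (multiples b))))
        where
        step : sum∞ (multiples b) ≋ 1# + monomial x (suc b) * sum∞ (multiples b)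
        step = trans (Sum.∞-first (multiples-small b)) (+-cong (monomial≋shiftBy K.1# 0)
          (sym (trans (*-sum∞ (monomial x (suc b)) (multiples-small b)) (Sum.∞-cong λ c → monomial-* x _ (suc b) (c ℕ.* suc b)))))

      bounded-step : ∀ b → (1# - monomial x (suc b)) * bounded (suc b) ≋ bounded b
      bounded-step b = trans (*-congˡ (bounded-suc b)) (trans (sym (S.*-assoc _ _ _))
        (trans (*-congʳ (multiples-inverse b)) (S.*-identityˡ _)))

      bounded-0 : bounded 0 ≋ 1#
      bounded-0 = pointwise λ { zero → K.+-identityʳ _ ; (suc n) → K.refl }

      bounded-product : ∀ b → Prod.F.fold (qFactor x 1 1) b * bounded b ≋ 1#
      bounded-product zero    = trans (S.*-identityˡ _) bounded-0
      bounded-product (suc b) = trans (*-congʳ (Prod.F.fold-snoc (qFactor x 1 1) b)) (trans (S.*-assoc _ _ _)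
        (trans (*-congˡ (trans (*-congʳ (+-congˡ (S.-‿cong (monomial-exp x (≡.cong suc (ℕₚ.+-identityʳ b)))))) (bounded-step b)))
          (bounded-product b)))

      bounded-agree : ∀ b → Agree (suc b) (bounded (suc b)) (bounded b)
      bounded-agree b = agree-trans (≋⇒agree (solve 2 (λ g m → g := (con (+ 1) :- m) :* g :+ g :* m) refl (bounded (suc b)) (monomial x (suc b))))
        (agree-trans (agree-+ (≋⇒agree (bounded-step b)) (agree-*0 (bounded (suc b)) (monomial-small x ℕₚ.≤-refl))) (≋⇒agree (S.+-identityʳ _)))

      bounded-stable : ∀ n k → bounded (k ℕ.+ n) ‼ n K.≈ bounded n ‼ n
      bounded-stable n zero    = K.refl
      bounded-stable n (suc k) = K.trans (below (bounded-agree (k ℕ.+ n)) n (s≤s (ℕₚ.m≤n+m n k))) (bounded-stable n k)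

    partitionSeries-* : qProd x 1 1 * partitionSeries ≋ 1#
    partitionSeries-* = agree⇒≋ λ N → agree-trans
      (agree-* (Prod.∞-agree (qFactor-small x 1 1) ℕₚ.≤-refl) (agree λ n n<N → K.sym (K.trans
        (K.reflexive (≡.cong (λ b → bounded b ‼ n) (≡.sym (ℕₚ.m∸n+n≡m (ℕₚ.<⇒≤ n<N))))) (bounded-stable n (N ∸ n)))))
      (≋⇒agree (bounded-product N))

  colourWeight : ∀ {k} → Vec K.Carrier k → Vec (List ℕ) k → K.Carrier
  colourWeight []       []       = K.1#
  colourWeight (x ∷ xs) (π ∷ πs) = weight x π K.* colourWeight xs πs

  colouredSeries : ∀ {k} → Vec K.Carrier k → Series
  colouredSeries {k} xs ‼ n = listSum (colourWeight xs) (coloredPartitions k n)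

  colouredSeries-[] : colouredSeries [] ≋ 1#
  colouredSeries-[] = pointwise λ { zero → K.+-identityʳ _ ; (suc n) → K.refl }

  colouredSeries-∷ : ∀ {k} x (xs : Vec K.Carrier k) → colouredSeries (x ∷ xs) ≋ partitionSeries x * colouredSeries xs
  colouredSeries-∷ {k} x xs = pointwise λ n →
    K.trans (listSum-concatMap (colourWeight (x ∷ xs)) (λ i → concatMap (extend n i) (partitions i)) (upTo (suc n)))
    (K.trans (listSum-cong {g = λ i → partitionSeries x ‼ i K.* colouredSeries xs ‼ (n ∸ i)} (upTo (suc n)) λ i →
      K.trans (listSum-concatMap (colourWeight (x ∷ xs)) (extend n i) (partitions i))
      (K.trans (listSum-cong {g = λ π → weight x π K.* colouredSeries xs ‼ (n ∸ i)} (partitions i) λ π →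
          K.trans (K.reflexive (listSum-map (colourWeight (x ∷ xs)) (π ∷_) (coloredPartitions k (n ∸ i))))
            (listSum-*ˡ (weight x π) (colourWeight xs) (coloredPartitions k (n ∸ i))))
        (listSum-*ʳ (weight x) (colouredSeries xs ‼ (n ∸ i)) (partitions i))))
    (K.reflexive (listSum-upTo (λ i → partitionSeries x ‼ i K.* colouredSeries xs ‼ (n ∸ i)) (suc n))))
    where
    extend : ℕ → ℕ → List ℕ → List (Vec (List ℕ) (suc k))
    extend n i π = map (π ∷_) (coloredPartitions k (n ∸ i))
    listSum-*ˡ : ∀ {A : Set} y (f : A → K.Carrier) zs → listSum (λ a → y K.* f a) zs K.≈ y K.* listSum f zs
    listSum-*ˡ y f []       = K.sym (K.zeroʳ y)
    listSum-*ˡ y f (a ∷ zs) = K.trans (K.+-congˡ (listSum-*ˡ y f zs)) (K.sym (K.distribˡ y _ _))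
    listSum-*ʳ : ∀ {A : Set} (f : A → K.Carrier) y zs → listSum (λ a → f a K.* y) zs K.≈ listSum f zs K.* y
    listSum-*ʳ f y []       = K.sym (K.zeroˡ y)
    listSum-*ʳ f y (a ∷ zs) = K.trans (K.+-congˡ (listSum-*ʳ f y zs)) (K.sym (K.distribʳ y _ _))

  colouredSeries-3 : ∀ x y z → colouredSeries (x ∷ y ∷ z ∷ []) * (qProd x 1 1 * qProd y 1 1 * qProd z 1 1) ≋ 1#
  colouredSeries-3 x y z = trans (*-congʳ (trans (colouredSeries-∷ x _) (*-congˡ (trans (colouredSeries-∷ y _) (*-congˡ (trans (colouredSeries-∷ z _) (*-congˡ colouredSeries-[])))))))
    (trans (solve 6 (λ p q r p′ q′ r′ → (p :* (q :* (r :* con (+ 1)))) :* (p′ :* q′ :* r′) := (p′ :* p) :* ((q′ :* q) :* (r′ :* r))) refl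
       (partitionSeries x) (partitionSeries y) (partitionSeries z) (qProd x 1 1) (qProd y 1 1) (qProd z 1 1))
    (trans (*-cong (partitionSeries-* x) (*-cong (partitionSeries-* y) (partitionSeries-* z))) (solve 0 (con (+ 1) :* (con (+ 1) :* con (+ 1)) := con (+ 1)) refl)))

module DifferentiatedGeneratingFunction (K : CommutativeRing 0ℓ 0ℓ) (x y : CommutativeRing.Carrier K) where
  private module K = CommutativeRing K using (_*_; _+_; _≈_; *-cong; *-congʳ; *-congˡ; *-identityˡ; +-commutativeMonoid; +-cong; +-identityʳ; 0#; 1#; refl; semiring; sym; trans; zeroˡ)
  open PowerSeries K using (_*_; _+_; _-_; _^_; _≋_; *-cong; *-congʳ; *-congˡ; +-cong; -_; 0#; commutativeRing; const; const-0; q; refl; sym; trans)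
  open TripleProduct K using (qProd)
  open Lambert K using (lambert)
  open DualSeries K using (module D; module DR; module L; module LT; imS-*D; imS-qProd; reS-*D; reS-qProd)
  open IntegerMultiples K using (fromℕ; fromℕ-suc)
  open SemiringExp K.semiring using () renaming (_^_ to _^ᴷ_)
  private
    module S = CommutativeRing commutativeRing using (*-identityˡ; -‿cong)
    module QS = QuadraticSeries K K.0# K.0# using (imS; imS-cong; imS-const; reS; reS-cong; reS-const)
    module G = PartitionGeneratingFunction D.commutativeRing using (colourWeight; colouredSeries; colouredSeries-3)
    module DExp = SemiringExp DR.semiring using (_^_)
    module CS = IntegerSolver K using (_:*_; _:+_; _:=_; con; solve)
    module LD = ListSum DR.+-commutativeMonoid using (listSum)
  open ListSum K.+-commutativeMonoid using (listSum)
  open QS using (reS; imS)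
  open D using (_+θ_; re; im)
  open IntegerSolver commutativeRing using (_:*_; _:+_; _:-_; _:=_; :-_; con; solve)

  private
    X Y : D.Carrier
    X = x +θ x
    Y = y +θ K.0#

  weights : Vec D.Carrier 3
  weights = X ∷ Y ∷ DR.1# ∷ []

  generating : L.Series
  generating = G.colouredSeries weights

  imS-generating : imS generating * (qProd x 1 1 * qProd y 1 1 * qProd K.1# 1 1) ≋ lambert x 1 1
  imS-generating = trans (*-congˡ (sym re-W)) (trans (solve 4 (λ i r w v → i :* w := (r :* v :+ i :* w) :- r :* v) refl I R (reS W) (imS W))
    (trans (+-cong (trans (sym (imS-*D generating W)) (trans (QS.imS-cong (G.colouredSeries-3 X Y DR.1#)) (trans (QS.imS-const _) const-0)))
                   (S.-‿cong (*-congˡ im-W)))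
    (trans (solve 3 (λ r t l → con (+ 0) :- r :* (:- (t :* l)) := (r :* t) :* l) refl R θ (lambert x 1 1))
    (trans (*-congʳ (trans (*-congˡ (sym re-W)) (trans (sym (reS-*D generating W)) (trans (QS.reS-cong (G.colouredSeries-3 X Y DR.1#)) (QS.reS-const _)))))
      (S.*-identityˡ _)))))
    where
    θ = qProd x 1 1 * qProd y 1 1 * qProd K.1# 1 1
    W = LT.qProd X 1 1 L.* LT.qProd Y 1 1 L.* LT.qProd DR.1# 1 1
    I = imS generating
    R = reS generating
    0s : ∀ z → K.0# K.≈ K.0# K.* z
    0s z = K.sym (K.zeroˡ z)
    re-x : reS (LT.qProd X 1 1) ≋ qProd x 1 1
    re-x = reS-qProd X x K.1# K.refl (K.sym (K.*-identityˡ x)) 1 1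
    re-y : reS (LT.qProd Y 1 1) ≋ qProd y 1 1
    re-y = reS-qProd Y y K.0# K.refl (0s y) 1 1
    re-1 : reS (LT.qProd DR.1# 1 1) ≋ qProd K.1# 1 1
    re-1 = reS-qProd DR.1# K.1# K.0# K.refl (0s _) 1 1
    im-x : imS (LT.qProd X 1 1) ≋ - (qProd x 1 1 * lambert x 1 1)
    im-x = trans (imS-qProd X x K.1# K.refl (K.sym (K.*-identityˡ x)) 1 1) (S.-‿cong (S.*-identityˡ _))
    im-0 : ∀ {f} → - (const K.0# * f) ≋ 0#
    im-0 {f} = trans (S.-‿cong (*-congʳ const-0)) (solve 1 (λ f → :- (con (+ 0) :* f) := con (+ 0)) refl f)
    im-y : imS (LT.qProd Y 1 1) ≋ 0#
    im-y = trans (imS-qProd Y y K.0# K.refl (0s y) 1 1) im-0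
    im-1 : imS (LT.qProd DR.1# 1 1) ≋ 0#
    im-1 = trans (imS-qProd DR.1# K.1# K.0# K.refl (0s _) 1 1) im-0
    re-W : reS W ≋ θ
    re-W = trans (reS-*D _ _) (*-cong (trans (reS-*D _ _) (*-cong re-x re-y)) re-1)
    im-W : imS W ≋ - (θ * lambert x 1 1)
    im-W = trans (imS-*D _ _) (trans (+-cong (*-cong (trans (reS-*D _ _) (*-cong re-x re-y)) im-1)
        (*-cong (trans (imS-*D _ _) (+-cong (*-cong re-x im-y) (*-cong im-x re-y))) re-1))
      (solve 4 (λ p q e l → (p :* q) :* con (+ 0) :+ (p :* con (+ 0) :+ (:- (p :* l)) :* q) :* e := :- ((p :* q :* e) :* l)) refl
        (qProd x 1 1) (qProd y 1 1) (qProd K.1# 1 1) (lambert x 1 1)))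

  private
    re-^ : ∀ Z n → re (Z DExp.^ n) K.≈ re Z ^ᴷ n
    re-^ Z zero    = K.refl
    re-^ Z (suc n) = K.trans (K.+-cong (K.*-congˡ (re-^ Z n)) (K.zeroˡ _)) (K.+-identityʳ _)

    im-X^ : ∀ n → im (X DExp.^ n) K.≈ fromℕ n K.* x ^ᴷ n
    im-X^ zero    = K.sym (K.zeroˡ _)
    im-X^ (suc n) = K.trans (K.+-cong (K.+-cong (K.*-congˡ (im-X^ n)) (K.*-congˡ (re-^ X n))) (K.zeroˡ _))
      (K.trans (CS.solve 3 (λ x n p → (x CS.:* (n CS.:* p) CS.:+ x CS.:* p) CS.:+ CS.con (+ 0) CS.:= (CS.con (+ 1) CS.:+ n) CS.:* (x CS.:* p)) K.refl x (fromℕ n) (x ^ᴷ n))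
        (K.*-congʳ (K.sym (fromℕ-suc n))))

    im-0^ : ∀ Z n → im Z K.≈ K.0# → im (Z DExp.^ n) K.≈ K.0#
    im-0^ Z zero    p = K.refl
    im-0^ Z (suc n) p = K.trans (K.+-cong (K.+-cong (K.*-congˡ (im-0^ Z n p)) (K.*-congʳ p)) (K.zeroˡ _))
      (CS.solve 2 (λ a b → (a CS.:* CS.con (+ 0) CS.:+ CS.con (+ 0) CS.:* b) CS.:+ CS.con (+ 0) CS.:= CS.con (+ 0)) K.refl _ _)

    1^ : ∀ n → K.1# ^ᴷ n K.≈ K.1#
    1^ zero    = K.refl
    1^ (suc n) = K.trans (K.*-identityˡ _) (1^ n)

  im-colourWeight : ∀ π₁ π₂ π₃ → im (G.colourWeight weights (π₁ ∷ π₂ ∷ π₃ ∷ [])) K.≈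
    fromℕ (length π₁) K.* (x ^ᴷ length π₁ K.* y ^ᴷ length π₂)
  im-colourWeight π₁ π₂ π₃ = K.trans (K.+-cong (K.+-cong (K.*-congˡ im-rest) (K.*-cong (im-X^ (length π₁)) re-rest)) (K.zeroˡ _))
    (CS.solve 4 (λ r n p q → (r CS.:* CS.con (+ 0) CS.:+ (n CS.:* p) CS.:* q) CS.:+ CS.con (+ 0) CS.:= n CS.:* (p CS.:* q)) K.refl _ (fromℕ (length π₁)) (x ^ᴷ length π₁) (y ^ᴷ length π₂))
    where
    T : D.Carrier
    T = DR.1# DExp.^ length π₃ DR.* DR.1#
    T≈1 : T DR.≈ DR.1#
    T≈1 = DR.trans (DR.*-identityʳ _) (go (length π₃))
      where
      go : ∀ n → DR.1# DExp.^ n DR.≈ DR.1#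
      go zero    = DR.refl
      go (suc n) = DR.trans (DR.*-identityˡ _) (go n)
    rest : Y DExp.^ length π₂ DR.* T DR.≈ Y DExp.^ length π₂
    rest = DR.trans (DR.*-congˡ T≈1) (DR.*-identityʳ _)
    re-rest : re (Y DExp.^ length π₂ DR.* T) K.≈ y ^ᴷ length π₂
    re-rest = K.trans (D.re≈ rest) (re-^ Y (length π₂))
    im-rest : im (Y DExp.^ length π₂ DR.* T) K.≈ K.0#
    im-rest = K.trans (D.im≈ rest) (im-0^ Y (length π₂) K.refl)

  im-listSum : ∀ {A : Set} (f : A → D.Carrier) xs → im (LD.listSum f xs) ≡ listSum (λ a → im (f a)) xs
  im-listSum f []       = ≡.refl
  im-listSum f (a ∷ xs) = ≡.cong (im (f a) K.+_) (im-listSum f xs)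

ℚ-ring : CommutativeRing 0ℓ 0ℓ
ℚ-ring = ℚₚ.+-*-commutativeRing

module PowerResidues (K : CommutativeRing 0ℓ 0ℓ) (c : CommutativeRing.Carrier K → ℚ)
  (c-cong : ∀ {x y} → CommutativeRing._≈_ K x y → c x ≡ c y) (t : ℕ → ℚ) where
  open CommutativeRing K using (_*_; _≈_; *-congʳ; *-congˡ; *-identityʳ; *-identityˡ; 1#; refl; semiring; trans)
  open SemiringExp semiring using (_^_)
  open IntegerSolver K using (solve; _:=_; _:*_)

  power-residue : ∀ {x y₂ y₃ y₄} → x * x ≈ y₂ → x * (x * x) ≈ y₃ → x * (x * (x * x)) ≈ y₄ → x * (x * (x * (x * x))) ≈ 1# →
    c 1# ≡ t 0 → c x ≡ t 1 → c y₂ ≡ t 2 → c y₃ ≡ t 3 → c y₄ ≡ t 4 → ∀ n → c (x ^ n) ≡ t (n ℕ.% 5)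
  power-residue {x} x² x³ x⁴ x⁵ t₀ t₁ t₂ t₃ t₄ = go
    where
    go : ∀ n → c (x ^ n) ≡ t (n ℕ.% 5)
    go 0 = t₀
    go 1 = ≡.trans (c-cong (*-identityʳ x)) t₁
    go 2 = ≡.trans (c-cong (trans (*-congˡ (*-identityʳ x)) x²)) t₂
    go 3 = ≡.trans (c-cong (trans (*-congˡ (*-congˡ (*-identityʳ x))) x³)) t₃
    go 4 = ≡.trans (c-cong (trans (*-congˡ (*-congˡ (*-congˡ (*-identityʳ x)))) x⁴)) t₄
    go (suc (suc (suc (suc (suc n))))) = ≡.trans
      (c-cong (trans (solve 2 (λ x y → x :* (x :* (x :* (x :* (x :* y)))) := (x :* (x :* (x :* (x :* x)))) :* y) refl x (x ^ n))
        (trans (*-congʳ x⁵) (*-identityˡ _))))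
      (≡.trans (go n) (≡.cong t (≡.sym (≡.trans (≡.cong (ℕ._% 5) (ℕₚ.+-comm 5 n)) (DivMod.[m+n]%n≡m%n n 5)))))

χ : ℕ → ℚ
χ 1 = 1ℚ
χ 2 = 1ℚ ℚ.+ 1ℚ
χ 3 = ℚ.- (1ℚ ℚ.+ 1ℚ)
χ 4 = ℚ.- 1ℚ
χ _ = 0ℚ

module CrankResidues (ext : CyclotomicExtension ℚ-ring) where
  open CyclotomicExtension ext renaming (extension to K)
  open SemiringExp (CommutativeRing.semiring K) using () renaming (_^_ to _^ᴷ_)
  open Descent ext using (z³≈; z⁴≈; z⁵≈1; z′³≈; z′⁴≈; z′⁵≈1)
  private
    module K = CommutativeRing K using (_≈_; _*_; trans; refl; *-congʳ; *-identityˡ; *-identityʳ)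
    module PR = PowerResidues K coord coord-cong

    ζ-power : ∀ n → coord (ζ ^ᴷ n) ≡ χ (n ℕ.% 5)
    ζ-power = PR.power-residue χ K.refl z³≈ z⁴≈ z⁵≈1
      coord-1 coord-ζ coord-ζ² coord-ζ′² coord-ζ′

    opposite : ℕ → ℕ
    opposite zero      = 0
    opposite r@(suc _) = 5 ∸ r

    neg-% : ∀ n → -[1+ n ] %ℕ 5 ≡ opposite (suc n ℕ.% 5)
    neg-% n with suc n ℕ.% 5
    ... | zero  = ≡.refl
    ... | suc _ = ≡.refl

    ζ′-power : ∀ n → coord (ζ′ ^ᴷ n) ≡ χ (opposite (n ℕ.% 5))
    ζ′-power = PR.power-residue (λ n → χ (opposite n)) K.refl z′³≈ z′⁴≈ z′⁵≈1
      coord-1 coord-ζ′ coord-ζ′² coord-ζ² coord-ζ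

    cancel-step : ∀ a b → ζ ^ᴷ suc a K.* ζ′ ^ᴷ suc b K.≈ ζ ^ᴷ a K.* ζ′ ^ᴷ b
    cancel-step a b = K.trans (solve 4 (λ z t p r → (z :* p) :* (t :* r) := (z :* t) :* (p :* r)) K.refl ζ ζ′ (ζ ^ᴷ a) (ζ′ ^ᴷ b))
      (K.trans (K.*-congʳ ζζ′≈1) (K.*-identityˡ _))
      where open IntegerSolver K

    ⊖-residue : ∀ a b → coord (ζ ^ᴷ a K.* ζ′ ^ᴷ b) ≡ χ ((a ℤ.⊖ b) %ℕ 5)
    ⊖-residue zero zero = ≡.trans (coord-cong (K.*-identityˡ _)) coord-1
    ⊖-residue zero (suc b) = ≡.trans (coord-cong (K.*-identityˡ _)) (≡.trans (ζ′-power (suc b)) (≡.cong χ (≡.sym (neg-% b))))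
    ⊖-residue (suc a) zero = ≡.trans (coord-cong (K.*-identityʳ _)) (ζ-power (suc a))
    ⊖-residue (suc a) (suc b) = ≡.trans (coord-cong (cancel-step a b)) (≡.trans (⊖-residue a b)
      (≡.cong (λ i → χ (i %ℕ 5)) (≡.sym (ℤₚ.[1+m]⊖[1+n]≡m⊖n a b))))

  coord-crank : ∀ a b → coord (ζ ^ᴷ a K.* ζ′ ^ᴷ b) ≡ χ ((+ a ℤ.- + b) %ℕ 5)
  coord-crank a b = ≡.trans (⊖-residue a b) (≡.cong (λ i → χ (i %ℕ 5)) (≡.sym (ℤₚ.m-n≡m⊖n a b)))

ℕ→ℚ-+ : ∀ m n → ℕ→ℚ (m ℕ.+ n) ≡ ℕ→ℚ m ℚ.+ ℕ→ℚ n
ℕ→ℚ-+ m n = ℚₚ.toℚᵘ-injective (ℚᵘₚ.≃-trans (numeral (m ℕ.+ n)) (ℚᵘₚ.≃-sym (ℚᵘₚ.≃-trans (ℚₚ.toℚᵘ-homo-+ (ℕ→ℚ m) (ℕ→ℚ n))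
    (ℚᵘₚ.≃-trans (ℚᵘₚ.+-cong (numeral m) (numeral n)) (ℚᵘ.*≡* (≡.cong (ℤ._* + 1) (≡.cong₂ ℤ._+_ (ℤₚ.*-identityʳ (+ m)) (ℤₚ.*-identityʳ (+ n)))))))))
  where
  numeral : ∀ n → ℚ.toℚᵘ (ℕ→ℚ n) ℚᵘ.≃ ℚᵘ.mkℚᵘ (+ n) 0
  numeral n = ℚₚ.toℚᵘ-fromℚᵘ (ℚᵘ.mkℚᵘ (+ n) 0)

regroup : (R : CommutativeRing 0ℓ 0ℓ) (let open CommutativeRing R) → ∀ i₁ i₄ i₂ i₃ n two s₁ s₄ s₂ s₃ →
  (i₁ * n + s₁) - (i₄ * n + s₄) + two * (i₂ * n + s₂) - two * (i₃ * n + s₃) ≈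
  n * (i₁ - i₄ + two * i₂ - two * i₃) + (s₁ - s₄ + two * s₂ - two * s₃)
regroup R = solve 10 (λ i₁ i₄ i₂ i₃ n two s₁ s₄ s₂ s₃ →
  (i₁ :* n :+ s₁) :- (i₄ :* n :+ s₄) :+ two :* (i₂ :* n :+ s₂) :- two :* (i₃ :* n :+ s₃) :=
  n :* (i₁ :- i₄ :+ two :* i₂ :- two :* i₃) :+ (s₁ :- s₄ :+ two :* s₂ :- two :* s₃)) (CommutativeRing.refl R)
  where open IntegerSolver R

module CrankSums where
  open ListSum (CommutativeRing.+-commutativeMonoid ℚ-ring) using (listSum)

  indicator : ℕ → ℕ → ℚ
  indicator m c = if does (c ℕ.≟ m) then 1ℚ else 0ℚ

  module _ {A : Set} (c f : A → ℕ) where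
    selected : ℕ → List A → ℚ
    selected m xs = ℕ→ℚ (foldr ℕ._+_ 0 (map f (filter (λ a → c a ℕ.≟ m) xs)))

    selected-sum : ∀ m xs → selected m xs ≡ listSum (λ a → indicator m (c a) ℚ.* ℕ→ℚ (f a)) xs
    selected-sum m []       = ≡.refl
    selected-sum m (a ∷ xs) with does (c a ℕ.≟ m)
    ... | true  = ≡.trans (ℕ→ℚ-+ (f a) _) (≡.cong₂ ℚ._+_ (≡.sym (ℚₚ.*-identityˡ (ℕ→ℚ (f a)))) (selected-sum m xs))
    ... | false = ≡.trans (selected-sum m xs) (≡.sym (≡.trans (≡.cong (ℚ._+ rest) (ℚₚ.*-zeroˡ (ℕ→ℚ (f a)))) (ℚₚ.+-identityˡ rest)))
      where rest = listSum (λ a → indicator m (c a) ℚ.* ℕ→ℚ (f a)) xs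

    χ-indicators : ∀ k → χ k ≡ indicator 1 k ℚ.- indicator 4 k ℚ.+ ℕ→ℚ 2 ℚ.* indicator 2 k ℚ.- ℕ→ℚ 2 ℚ.* indicator 3 k
    χ-indicators 0 = ≡.refl
    χ-indicators 1 = ≡.refl
    χ-indicators 2 = ≡.refl
    χ-indicators 3 = ≡.refl
    χ-indicators 4 = ≡.refl
    χ-indicators (suc (suc (suc (suc (suc k))))) = ≡.refl

    combination : ∀ xs → selected 1 xs ℚ.- selected 4 xs ℚ.+ ℕ→ℚ 2 ℚ.* selected 2 xs ℚ.- ℕ→ℚ 2 ℚ.* selected 3 xs ≡
                  listSum (λ a → ℕ→ℚ (f a) ℚ.* χ (c a)) xs
    combination xs = ≡.trans (≡.cong₂ (λ s t → s ℚ.- ℕ→ℚ 2 ℚ.* t) (≡.cong₂ (λ s t → s ℚ.+ ℕ→ℚ 2 ℚ.* t)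
        (≡.cong₂ ℚ._-_ (selected-sum 1 xs) (selected-sum 4 xs)) (selected-sum 2 xs)) (selected-sum 3 xs)) (go xs)
      where
      term : ℕ → A → ℚ
      term m a = indicator m (c a) ℚ.* ℕ→ℚ (f a)
      go : ∀ xs → listSum (term 1) xs ℚ.- listSum (term 4) xs ℚ.+ ℕ→ℚ 2 ℚ.* listSum (term 2) xs ℚ.- ℕ→ℚ 2 ℚ.* listSum (term 3) xs
           ≡ listSum (λ a → ℕ→ℚ (f a) ℚ.* χ (c a)) xs
      go []       = ≡.refl
      go (a ∷ xs) = ≡.trans (regroup ℚ-ring
          (indicator 1 (c a)) (indicator 4 (c a)) (indicator 2 (c a)) (indicator 3 (c a)) (ℕ→ℚ (f a)) (ℕ→ℚ 2)
          (listSum (term 1) xs) (listSum (term 4) xs) (listSum (term 2) xs) (listSum (term 3) xs))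
        (≡.cong₂ ℚ._+_ (≡.cong (ℕ→ℚ (f a) ℚ.*_) (≡.sym (χ-indicators (c a)))) (go xs))

module CrankGeneratingFunction (ext : CyclotomicExtension ℚ-ring) where
  open CyclotomicExtension ext renaming (extension to K)
  open CrankSums using (combination; selected)
  open ListSum (CommutativeRing.+-commutativeMonoid ℚ-ring) using (listSum; listSum-cong)
  open RingHom ι using (φ-cong; φ-+; φ-0; φ-1)
  open IntegerMultiples K using (fromℕ; fromℕ-suc)
  open SemiringExp (CommutativeRing.semiring K) using () renaming (_^_ to _^ᴷ_)
  private
    module K = CommutativeRing K using (Carrier; _≈_; _*_; 0#; trans; sym; refl; *-congʳ; +-cong; +-congˡ; +-commutativeMonoid)
    module Q = PowerSeries ℚ-ring using (Series; _≋_; _+_; _*_; _-_; _‼_)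
    module T = ThetaDissection ℚ-ring using (a; b; L₁; L₂)
    module DG = DifferentiatedGeneratingFunction K ζ ζ′
    module QS = QuadraticSeries K (CommutativeRing.0# K) (CommutativeRing.0# K) using (imS)
    module DK = DualSeries K using (module D)
    module G = PartitionGeneratingFunction DK.D.commutativeRing using (colourWeight)
  open Descent ext using (coordS; coordS-generating; coord-0)
  open CrankResidues ext
  open ListSumHom K.+-commutativeMonoid (CommutativeRing.+-commutativeMonoid ℚ-ring)

  crankSeries : Q.Series
  crankSeries = coordS (QS.imS DG.generating)

  crankSeries-* : crankSeries Q.* (T.b Q.* T.b Q.- T.a Q.* T.b Q.- T.a Q.* T.a) Q.≋
    T.b Q.* (T.L₁ Q.+ (T.L₂ Q.+ T.L₂)) Q.+ T.a Q.* (T.L₁ Q.+ T.L₁ Q.- T.L₂)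
  crankSeries-* = coordS-generating DG.imS-generating

  private
    fromℕ≈φ : ∀ n → fromℕ n K.≈ φ (ℕ→ℚ n)
    fromℕ≈φ zero    = K.sym φ-0
    fromℕ≈φ (suc n) = K.trans (fromℕ-suc n) (K.trans (K.+-congˡ (fromℕ≈φ n))
      (K.trans (K.trans (K.+-cong (K.sym φ-1) K.refl) (K.sym (φ-+ 1ℚ (ℕ→ℚ n)))) (φ-cong (≡.sym (ℕ→ℚ-+ 1 n)))))

    φ-weight : ∀ n k → coord (fromℕ n K.* k) ≡ ℕ→ℚ n ℚ.* coord k
    φ-weight n k = ≡.trans (coord-cong (K.*-congʳ (fromℕ≈φ n))) (coord-ι* (ℕ→ℚ n) k)

    term : ∀ (π : Vec (List ℕ) 3) → coord (DK.D.im (G.colourWeight DG.weights π)) ≡ ℕ→ℚ (firstCount π) ℚ.* χ (crank π %ℕ 5)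
    term (π₁ ∷ π₂ ∷ π₃ ∷ []) = ≡.trans (coord-cong (DG.im-colourWeight π₁ π₂ π₃))
      (≡.trans (φ-weight (length π₁) κ) (≡.cong (ℕ→ℚ (length π₁) ℚ.*_) (coord-crank (length π₁) (length π₂))))
      where
      κ : K.Carrier
      κ = ζ ^ᴷ length π₁ K.* ζ′ ^ᴷ length π₂

  private
    coloured : ℕ → List (Vec (List ℕ) 3)
    coloured n = coloredPartitions 3 n

    weightOf : Vec (List ℕ) 3 → K.Carrier
    weightOf π = DK.D.im (G.colourWeight DG.weights π)

    residue : Vec (List ℕ) 3 → ℕ
    residue π = crank π %ℕ 5

    crankSeries-coeff : ∀ n → crankSeries Q.‼ n ≡ listSum (λ π → ℕ→ℚ (firstCount π) ℚ.* χ (residue π)) (coloured n)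
    crankSeries-coeff n = ≡.trans (≡.cong coord (DG.im-listSum (G.colourWeight DG.weights) (coloured n)))
      (≡.trans (listSum-homo coord coord-0 coord-+ weightOf (coloured n)) (listSum-cong (coloured n) term))

    NB-sum : ∀ m n → NB 1 m 5 n ≡ foldr ℕ._+_ 0 (map firstCount (filter (λ π → residue π ℕ.≟ m) (coloured n)))
    NB-sum m n = ≡.refl

    NB-selected : ∀ m n → ℕ→ℚ (NB 1 m 5 n) ≡ selected residue firstCount m (coloured n)
    NB-selected m n = ≡.cong ℕ→ℚ (NB-sum m n)

    LHS-unfold : ∀ n → LHS n ≡ ℕ→ℚ (NB 1 1 5 (5 ℕ.* n)) ℚ.- ℕ→ℚ (NB 1 4 5 (5 ℕ.* n))
      ℚ.+ ℕ→ℚ 2 ℚ.* ℕ→ℚ (NB 1 2 5 (5 ℕ.* n)) ℚ.- ℕ→ℚ 2 ℚ.* ℕ→ℚ (NB 1 3 5 (5 ℕ.* n))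
    LHS-unfold n = ≡.refl

    combine : ∀ {x₁ y₁ x₄ y₄ x₂ y₂ x₃ y₃ : ℚ} → x₁ ≡ y₁ → x₄ ≡ y₄ → x₂ ≡ y₂ → x₃ ≡ y₃ → ∀ two →
      x₁ ℚ.- x₄ ℚ.+ two ℚ.* x₂ ℚ.- two ℚ.* x₃ ≡ y₁ ℚ.- y₄ ℚ.+ two ℚ.* y₂ ℚ.- two ℚ.* y₃
    combine ≡.refl ≡.refl ≡.refl ≡.refl two = ≡.refl

    combination-at : ∀ n → selected residue firstCount 1 (coloured n) ℚ.- selected residue firstCount 4 (coloured n) ℚ.+ ℕ→ℚ 2 ℚ.* selected residue firstCount 2 (coloured n) ℚ.- ℕ→ℚ 2 ℚ.* selected residue firstCount 3 (coloured n) ≡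
      listSum (λ π → ℕ→ℚ (firstCount π) ℚ.* χ (residue π)) (coloured n)
    combination-at n = combination residue firstCount (coloured n)

  LHS-crankSeries : ∀ n → LHS n ≡ crankSeries Q.‼ (5 ℕ.* n)
  LHS-crankSeries n = ≡.trans (LHS-unfold n) (≡.trans
    (combine (NB-selected 1 (5 ℕ.* n)) (NB-selected 4 (5 ℕ.* n)) (NB-selected 2 (5 ℕ.* n)) (NB-selected 3 (5 ℕ.* n)) (ℕ→ℚ 2))
    (≡.trans (combination-at (5 ℕ.* n)) (≡.sym (crankSeries-coeff (5 ℕ.* n)))))

module QuinticAlgebra (R : CommutativeRing 0ℓ 0ℓ) where
  open PowerSeries R using (module Prod; _*_; _+_; _-_; _^_; _‼_; _≋_; *-congʳ; *-congˡ; *-inv; +-cong; +-congʳ; +-congˡ; -_; 0#; 1#; Series; below; cancelˡ; commutativeRing; head-*; inv; monomial-small; pointwise; q; q*-shift; q-cancel; refl; sym; trans)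
  open TripleProduct R using (1-small; qProd)
  open QuinticSections R using (U; U-+; U-V; U-V*; U-cong; U-shift; U-shift-0; V; V-1)
  open ThetaDissection R using (F; G; L₁; L₂; PA; PB; PE; a; b; q³E)
  open LambertSections R using (U-lambert)
  private
    module R = CommutativeRing R using (_≈_; *-cong; *-identityˡ; 1#; refl; reflexive; trans)
    module S = CommutativeRing commutativeRing using (*-identityʳ; *-identityˡ; +-identityʳ; +-identityˡ; -‿cong; distribˡ; zeroʳ)
  open IntegerSolver commutativeRing using (_:*_; _:+_; _:-_; _:=_; _:^_; :-_; Polynomial; con; solve)
  open IntegerMultiples commutativeRing using (fromℤ)

  qProd-head : ∀ X a d .{{_ : ℕ.NonZero a}} → qProd X a d ‼ 0 R.≈ R.1#
  qProd-head X a d = below (Prod.∞-small λ k → 1-small (monomial-small X {1} (ℕₚ.≤-trans (ℕ.>-nonZero⁻¹ a) (ℕₚ.m≤m+n a (d ℕ.* k))))) 0 (s≤s z≤n)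

  *-head : ∀ f g → f ‼ 0 R.≈ R.1# → g ‼ 0 R.≈ R.1# → (f * g) ‼ 0 R.≈ R.1#
  *-head f g p r = R.trans (head-* f g) (R.trans (R.*-cong p r) (R.*-identityˡ _))

  α β ε P₅ κ φ Δ : Series
  α = PA
  β = PB
  P₅ = qProd R.1# 5 5
  ε = PE
  κ = V (PE * PE * PE)
  φ = 1# + (L₁ + L₁ + L₁) + L₂
  Δ = β ^ 10 - fromℤ (+ 11) * (q * (α ^ 5 * β ^ 5)) - q * (q * α ^ 10)

  α-head : α ‼ 0 R.≈ R.1#
  α-head = *-head (qProd R.1# 4 5 * qProd R.1# 1 5) (qProd R.1# 5 5)
    (*-head (qProd R.1# 4 5) (qProd R.1# 1 5) (qProd-head R.1# 4 5) (qProd-head R.1# 1 5)) (qProd-head R.1# 5 5)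

  β-head : β ‼ 0 R.≈ R.1#
  β-head = *-head (qProd R.1# 3 5 * qProd R.1# 2 5) (qProd R.1# 5 5)
    (*-head (qProd R.1# 3 5) (qProd R.1# 2 5) (qProd-head R.1# 3 5) (qProd-head R.1# 2 5)) (qProd-head R.1# 5 5)

  U-0# : ∀ r → U r 0# ≋ 0#
  U-0# r = pointwise λ _ → R.refl

  U-q-suc : ∀ r f → U (suc r) (q * f) ≋ U r f
  U-q-suc r f = trans (U-cong (suc r) (q*-shift f)) (U-shift r f)

  U-q-0 : ∀ f → U 0 (q * f) ≋ q * U 4 f
  U-q-0 f = trans (U-cong 0 (q*-shift f)) (trans (U-shift-0 f) (sym (q*-shift (U 4 f))))

  U-V-suc : ∀ r → suc r < 5 → ∀ f → U (suc r) (V f) ≋ 0#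
  U-V-suc r r<5 f = trans (U-cong (suc r) (sym (S.*-identityʳ (V f)))) (trans (U-V* r<5 f 1#)
    (trans (*-congˡ (pointwise λ n → R.reflexive (≡.cong (1# ‼_) (ℕₚ.+-suc (n ℕ.* 5) r)))) (S.zeroʳ f)))

  private
    1<5 : 1 < 5
    1<5 = s≤s (s≤s z≤n)
    2<5 : 2 < 5
    2<5 = s≤s (s≤s (s≤s z≤n))
    3<5 : 3 < 5
    3<5 = s≤s (s≤s (s≤s (s≤s z≤n)))
    4<5 : 4 < 5
    4<5 = s≤s (s≤s (s≤s (s≤s (s≤s z≤n))))

  U-b : ∀ {r} → r < 5 → ∀ f → U r (b * f) ≋ β * U r f
  U-b r<5 f = U-V* r<5 β f

  U-a-suc : ∀ {r} → suc r < 5 → ∀ f → U (suc r) (a * f) ≋ α * U r f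
  U-a-suc {r} r<5 f = trans (U-cong (suc r) (solve 3 (λ q v f → (q :* v) :* f := v :* (q :* f)) refl q (V α) f))
    (trans (U-V* r<5 α (q * f)) (*-congˡ (U-q-suc r f)))

  U-a-0 : ∀ f → U 0 (a * f) ≋ q * (α * U 4 f)
  U-a-0 f = trans (U-cong 0 (solve 3 (λ q v f → (q :* v) :* f := v :* (q :* f)) refl q (V α) f))
    (trans (U-V* (s≤s z≤n) α (q * f)) (trans (*-congˡ (U-q-0 f)) (solve 3 (λ a q u → a :* (q :* u) := q :* (a :* u)) refl α q (U 4 f))))

  private
    a≋a1 : a ≋ a * 1#
    a≋a1 = sym (S.*-identityʳ a)

    q³κ : q³E ≋ q * (q * (q * V κ))
    q³κ = solve 2 (λ q v → (q :* (q :* (q :* con (+ 1)))) :* v := q :* (q :* (q :* v))) refl q (V κ)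

    *0 : ∀ f → f * 0# ≋ 0#
    *0 = S.zeroʳ

    U₀bV : U 0 (b * V L₂) ≋ β * L₂
    U₀bV = trans (U-b (s≤s z≤n) (V L₂)) (*-congˡ (U-V L₂))
    UᵣbV : ∀ r → suc r < 5 → U (suc r) (b * V L₂) ≋ 0#
    UᵣbV r p = trans (U-b p (V L₂)) (trans (*-congˡ (U-V-suc r p L₂)) (*0 β))
    U₀aV : ∀ f → U 0 (a * V f) ≋ 0#
    U₀aV f = trans (U-a-0 (V f)) (trans (*-congˡ (trans (*-congˡ (U-V-suc 3 4<5 f)) (*0 α))) (*0 q))
    U₁aV : ∀ f → U 1 (a * V f) ≋ α * f
    U₁aV f = trans (U-a-suc 1<5 (V f)) (*-congˡ (U-V f))
    UᵣaV : ∀ r → suc (suc r) < 5 → ∀ f → U (suc (suc r)) (a * V f) ≋ 0#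
    UᵣaV r p f = trans (U-a-suc p (V f)) (trans (*-congˡ (U-V-suc r (ℕₚ.<⇒≤ p) f)) (*0 α))
    a≋ : a ≋ a * V 1#
    a≋ = trans a≋a1 (*-congˡ (sym V-1))
    U₀a : U 0 a ≋ 0#
    U₀a = trans (U-cong 0 a≋) (U₀aV 1#)
    U₁a : U 1 a ≋ α
    U₁a = trans (U-cong 1 a≋) (trans (U₁aV 1#) (S.*-identityʳ α))
    Uᵣa : ∀ r → suc (suc r) < 5 → U (suc (suc r)) a ≋ 0#
    Uᵣa r p = trans (U-cong _ a≋) (UᵣaV r p 1#)
    U₀E : U 0 q³E ≋ 0#
    U₀E = trans (U-cong 0 q³κ) (trans (U-q-0 _) (trans (*-congˡ (trans (U-q-suc 3 _) (trans (U-q-suc 2 _) (U-V-suc 1 2<5 κ)))) (*0 q)))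
    U₁E : U 1 q³E ≋ 0#
    U₁E = trans (U-cong 1 q³κ) (trans (U-q-suc 0 _) (trans (U-q-0 _) (trans (*-congˡ (trans (U-q-suc 3 _) (U-V-suc 2 3<5 κ))) (*0 q))))
    U₂E : U 2 q³E ≋ 0#
    U₂E = trans (U-cong 2 q³κ) (trans (U-q-suc 1 _) (trans (U-q-suc 0 _) (trans (U-q-0 _) (trans (*-congˡ (U-V-suc 3 4<5 κ)) (*0 q)))))
    U₃E : U 3 q³E ≋ κ
    U₃E = trans (U-cong 3 q³κ) (trans (U-q-suc 2 _) (trans (U-q-suc 1 _) (trans (U-q-suc 0 _) (U-V κ))))
    U₄E : U 4 q³E ≋ 0#
    U₄E = trans (U-cong 4 q³κ) (trans (U-q-suc 3 _) (trans (U-q-suc 2 _) (trans (U-q-suc 1 _) (U-V-suc 0 1<5 κ))))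

  U₀L₁ : U 0 L₁ ≋ L₁
  U₀L₁ = trans (pointwise λ _ → R.refl) (+-cong (U-lambert 1 1<5) (S.-‿cong (U-lambert 4 4<5)))
  U₀L₂ : U 0 L₂ ≋ L₂
  U₀L₂ = trans (pointwise λ _ → R.refl) (+-cong (U-lambert 2 2<5) (S.-‿cong (U-lambert 3 3<5)))

  private
    moved : ∀ {e x y} → e ≋ 0# → x ≋ e + y → x ≋ y
    moved {y = y} e≋0 p = trans p (trans (+-congʳ e≋0) (S.+-identityˡ y))

  m n : ℕ → Series
  m r = U r L₁
  n r = U r L₂

  private
    U-a-sum : ∀ r → suc r < 5 → U (suc r) (a * (L₁ + L₂)) ≋ α * (m r + n r)
    U-a-sum r r<5 = trans (U-a-suc r<5 (L₁ + L₂)) (*-congˡ (U-+ r L₁ L₂))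

  module Relations (F≋0 : F ≋ 0#) (G≋0 : G ≋ 0#) (norm : ε * P₅ ≋ b * b - a * b - a * a)
                   (cancel-3 : ∀ {f g} → fromℤ (+ 3) * f ≋ fromℤ (+ 3) * g → f ≋ g) where
    private
      U-F : ∀ r {x₁ x₂ x₃ x₄ x₅ x₆} → U r (b * L₁) ≋ x₁ → U r (a * (L₁ + L₂)) ≋ x₂ → U r (b * V L₂) ≋ x₃ → U r (a * V L₁) ≋ x₄ →
            U r a ≋ x₅ → U r q³E ≋ x₆ → x₁ - x₂ - (x₃ + x₃ + x₃) - (x₄ + x₄) - x₅ + x₆ ≋ 0#
      U-F r p₁ p₂ p₃ p₄ p₅ p₆ = trans (sym (+-cong (+-cong (+-cong (+-cong (+-cong p₁ (S.-‿cong p₂)) (S.-‿cong (+-cong (+-cong p₃ p₃) p₃)))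
        (S.-‿cong (+-cong p₄ p₄))) (S.-‿cong p₅)) p₆)) (trans (pointwise λ _ → R.refl) (trans (U-cong r F≋0) (U-0# r)))

      U-G : ∀ r {x₁ x₂ x₃ x₄ x₆} → U r (b * L₂) ≋ x₁ → U r (a * L₁) ≋ x₂ → U r (b * V L₂) ≋ x₃ → U r (a * V L₁) ≋ x₄ →
            U r q³E ≋ x₆ → x₁ - x₂ - x₃ + x₄ + (x₆ + x₆) ≋ 0#
      U-G r p₁ p₂ p₃ p₄ p₆ = trans (sym (+-cong (+-cong (+-cong (+-cong p₁ (S.-‿cong p₂)) (S.-‿cong p₃)) p₄) (+-cong p₆ p₆)))
        (trans (pointwise λ _ → R.refl) (trans (U-cong r G≋0) (U-0# r)))

    βm₁ : β * m 1 ≋ α * φ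
    βm₁ = moved (U-F 1 (U-b 1<5 L₁) (trans (U-a-sum 0 1<5) (*-congˡ (+-cong U₀L₁ U₀L₂))) (UᵣbV 0 1<5) (U₁aV L₁) U₁a U₁E)
      (solve 5 (λ β m α l₁ l₂ → β :* m := (β :* m :- α :* (l₁ :+ l₂) :- (o :+ o :+ o) :- (α :* l₁ :+ α :* l₁) :- α :+ o)
         :+ α :* (con (+ 1) :+ (l₁ :+ l₁ :+ l₁) :+ l₂)) refl β (m 1) α L₁ L₂)
      where
      o : ∀ {n} → Polynomial n
      o = con (+ 0)

    n₁≋0 : n 1 ≋ 0#
    n₁≋0 = cancelˡ β-head (trans (moved (U-G 1 (U-b 1<5 L₂) (trans (U-a-suc 1<5 L₁) (*-congˡ U₀L₁)) (UᵣbV 0 1<5) (U₁aV L₁) U₁E)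
      (solve 4 (λ β n α l₁ → β :* n := (β :* n :- α :* l₁ :- con (+ 0) :+ α :* l₁ :+ (con (+ 0) :+ con (+ 0))) :+ con (+ 0)) refl β (n 1) α L₁)) (sym (*0 β)))

    private
      F-step : ∀ {β m α x o₁ o₂} → β * m - α * x - (0# + 0# + 0#) - (0# + 0#) - 0# + o₁ ≋ 0# → o₂ ≋ α * x - o₁ → β * m ≋ o₂
      F-step {β} {m} {α} {x} {o₁} p r = trans (moved p (solve 4 (λ w α x o₁ → w := (w :- α :* x :- (con (+ 0) :+ con (+ 0) :+ con (+ 0)) :- (con (+ 0) :+ con (+ 0)) :- con (+ 0) :+ o₁)
        :+ (α :* x :- o₁)) refl (β * m) α x o₁)) (sym r)

      G-step : ∀ {β n α x o₁ o₂} → β * n - α * x - 0# + 0# + (o₁ + o₁) ≋ 0# → o₂ ≋ α * x - (o₁ + o₁) → β * n ≋ o₂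
      G-step {β} {n} {α} {x} {o₁} p r = trans (moved p (solve 4 (λ w α x o₁ → w := (w :- α :* x :- con (+ 0) :+ con (+ 0) :+ (o₁ :+ o₁)) :+ (α :* x :- (o₁ :+ o₁))) refl (β * n) α x o₁)) (sym r)

      sub-0 : ∀ f → f ≋ f - 0#
      sub-0 f = solve 1 (λ f → f := f :- con (+ 0)) refl f

      sub-00 : ∀ f → f ≋ f - (0# + 0#)
      sub-00 f = solve 1 (λ f → f := f :- (con (+ 0) :+ con (+ 0))) refl f

    βm₂ : β * m 2 ≋ α * m 1
    βm₂ = F-step (U-F 2 (U-b 2<5 L₁) (U-a-sum 1 2<5) (UᵣbV 1 2<5) (UᵣaV 0 2<5 L₁) (Uᵣa 0 2<5) U₂E)
      (trans (*-congˡ (trans (sym (S.+-identityʳ _)) (+-congˡ (sym n₁≋0)))) (sub-0 _))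

    βn₂ : β * n 2 ≋ α * m 1
    βn₂ = G-step (U-G 2 (U-b 2<5 L₂) (U-a-suc 2<5 L₁) (UᵣbV 1 2<5) (UᵣaV 0 2<5 L₁) U₂E) (sub-00 _)

    βm₃ : β * m 3 ≋ α * (m 2 + n 2) - κ
    βm₃ = F-step (U-F 3 (U-b 3<5 L₁) (U-a-sum 2 3<5) (UᵣbV 2 3<5) (UᵣaV 1 3<5 L₁) (Uᵣa 1 3<5) U₃E) refl

    βn₃ : β * n 3 ≋ α * m 2 - (κ + κ)
    βn₃ = G-step (U-G 3 (U-b 3<5 L₂) (U-a-suc 3<5 L₁) (UᵣbV 2 3<5) (UᵣaV 1 3<5 L₁) U₃E) refl

    βm₄ : β * m 4 ≋ α * (m 3 + n 3)
    βm₄ = F-step (U-F 4 (U-b 4<5 L₁) (U-a-sum 3 4<5) (UᵣbV 3 4<5) (UᵣaV 2 4<5 L₁) (Uᵣa 2 4<5) U₄E) (sub-0 _)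

    βn₄ : β * n 4 ≋ α * m 3
    βn₄ = G-step (U-G 4 (U-b 4<5 L₂) (U-a-suc 4<5 L₁) (UᵣbV 3 4<5) (UᵣaV 2 4<5 L₁) U₄E) (sub-00 _)

    m₄≋0 : m 4 ≋ 0#
    m₄≋0 = cancelˡ α-head (trans (q-cancel (trans
      (solve 2 (λ x y → y := :- (x :- y :- x :+ con (+ 0) :+ (con (+ 0) :+ con (+ 0)))) refl (β * L₂) (q * (α * m 4)))
      (trans (S.-‿cong (U-G 0 (trans (U-b (s≤s z≤n) L₂) (*-congˡ U₀L₂)) (U-a-0 L₁) U₀bV (U₀aV L₁) U₀E))
        (solve 1 (λ q → :- con (+ 0) := q :* con (+ 0)) refl q)))) (sym (*0 α)))

    βφ₂ : β * (L₁ - (L₂ + L₂ + L₂)) ≋ q * (α * n 4)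
    βφ₂ = trans (moved (U-F 0 (trans (U-b (s≤s z≤n) L₁) (*-congˡ U₀L₁)) (U-a-0 (L₁ + L₂)) U₀bV (U₀aV L₁) U₀a U₀E)
      (solve 5 (λ β l₁ l₂ y y′ → β :* (l₁ :- (l₂ :+ l₂ :+ l₂)) :=
         (β :* l₁ :- y :- (β :* l₂ :+ β :* l₂ :+ β :* l₂) :- (con (+ 0) :+ con (+ 0)) :- con (+ 0) :+ con (+ 0)) :+ y) refl β L₁ L₂ (q * (α * U 4 (L₁ + L₂))) 0#))
      (*-congˡ (*-congˡ (trans (U-+ 4 L₁ L₂) (trans (+-congʳ m₄≋0) (S.+-identityˡ (n 4))))))

    ψ : Series
    ψ = φ * (inv β * (inv β * (inv β * inv β)))

    φ≋ : φ ≋ β ^ 4 * ψ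
    φ≋ = sym (trans (solve 3 (λ β i φ → β :^ 4 :* (φ :* (i :* (i :* (i :* i)))) := (β :* i) :* ((β :* i) :* ((β :* i) :* ((β :* i) :* φ)))) refl β (inv β) φ)
      (trans (step _) (trans (step _) (trans (step _) (step φ)))))
      where
      step : ∀ f → (β * inv β) * f ≋ f
      step f = trans (*-congʳ (*-inv β β-head)) (S.*-identityˡ f)

    m₁ : m 1 ≋ α * β ^ 3 * ψ
    m₁ = cancelˡ β-head (trans βm₁ (trans (*-congˡ φ≋) (solve 3 (λ α β ψ → α :* (β :^ 4 :* ψ) := β :* (α :* β :^ 3 :* ψ)) refl α β ψ)))

    m₂ : m 2 ≋ α ^ 2 * β ^ 2 * ψ
    m₂ = cancelˡ β-head (trans βm₂ (trans (*-congˡ m₁) (solve 3 (λ α β ψ → α :* (α :* β :^ 3 :* ψ) := β :* (α :^ 2 :* β :^ 2 :* ψ)) refl α β ψ)))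

    n₂ : n 2 ≋ α ^ 2 * β ^ 2 * ψ
    n₂ = cancelˡ β-head (trans βn₂ (trans (*-congˡ m₁) (solve 3 (λ α β ψ → α :* (α :* β :^ 3 :* ψ) := β :* (α :^ 2 :* β :^ 2 :* ψ)) refl α β ψ)))

    m₃+n₃≋0 : m 3 + n 3 ≋ 0#
    m₃+n₃≋0 = cancelˡ α-head (trans (sym βm₄) (trans (*-congˡ m₄≋0) (trans (*0 β) (sym (*0 α)))))

    κ≋ : κ ≋ α ^ 3 * β ^ 2 * ψ
    κ≋ = cancel-3 (trans
      (solve 4 (λ α x y k → con (+ 3) :* k := (α :* (x :+ y) :+ α :* x) :- ((α :* (x :+ y) :- k) :+ (α :* x :- (k :+ k)))) refl α (m 2) (n 2) κ)
      (trans (+-cong (+-cong (*-congˡ (+-cong m₂ n₂)) (*-congˡ m₂)) (S.-‿cong (trans (sym (trans (S.distribˡ β (m 3) (n 3)) (+-cong βm₃ βn₃))) (trans (*-congˡ m₃+n₃≋0) (*0 β)))))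
        (solve 3 (λ α β ψ → α :* (α :^ 2 :* β :^ 2 :* ψ :+ α :^ 2 :* β :^ 2 :* ψ) :+ α :* (α :^ 2 :* β :^ 2 :* ψ) :- con (+ 0) := con (+ 3) :* (α :^ 3 :* β :^ 2 :* ψ)) refl α β ψ)))

    m₃ : m 3 ≋ α ^ 3 * β * ψ
    m₃ = cancelˡ β-head (trans βm₃ (trans (+-cong (*-congˡ (+-cong m₂ n₂)) (S.-‿cong κ≋))
      (solve 3 (λ α β ψ → α :* (α :^ 2 :* β :^ 2 :* ψ :+ α :^ 2 :* β :^ 2 :* ψ) :- α :^ 3 :* β :^ 2 :* ψ := β :* (α :^ 3 :* β :* ψ)) refl α β ψ)))

    n₃ : n 3 ≋ - (α ^ 3 * β * ψ)
    n₃ = trans (solve 2 (λ m n → n := (m :+ n) :- m) refl (m 3) (n 3)) (trans (+-cong m₃+n₃≋0 (S.-‿cong m₃)) (S.+-identityˡ _))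

    n₄ : n 4 ≋ α ^ 4 * ψ
    n₄ = cancelˡ β-head (trans βn₄ (trans (*-congˡ m₃) (solve 3 (λ α β ψ → α :* (α :^ 3 :* β :* ψ) := β :* (α :^ 4 :* ψ)) refl α β ψ)))

    φ₂ : Series
    φ₂ = L₁ - (L₂ + L₂ + L₂)

    βφ₂≋ : β * φ₂ ≋ q * (α ^ 5 * ψ)
    βφ₂≋ = trans βφ₂ (*-congˡ (trans (*-congˡ n₄) (solve 2 (λ α ψ → α :* (α :^ 4 :* ψ) := α :^ 5 :* ψ) refl α ψ)))

    -- Eliminating x₁, …, x₄ from the five sections of the equation for X: multiply the r-th one
    -- by the cofactor below and add.
    module _ (X : Series) (X-equation : X * (b * b - a * b - a * a) ≋ b * (L₁ + (L₂ + L₂)) + a * (L₁ + L₁ - L₂)) where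
      private
        x : ℕ → Series
        x r = U r X

        split : b * (b * X) - a * (b * X) - a * (a * X) ≋ b * (L₁ + (L₂ + L₂)) + a * (L₁ + L₁ - L₂)
        split = trans (solve 3 (λ a b x → b :* (b :* x) :- a :* (b :* x) :- a :* (a :* x) := x :* (b :* b :- a :* b :- a :* a)) refl a b X) X-equation

        take : ∀ r {l₁ l₂ l₃ r₁ r₂} → U r (b * (b * X)) ≋ l₁ → U r (a * (b * X)) ≋ l₂ → U r (a * (a * X)) ≋ l₃ →
               U r (b * (L₁ + (L₂ + L₂))) ≋ r₁ → U r (a * (L₁ + L₁ - L₂)) ≋ r₂ → l₁ - l₂ - l₃ ≋ r₁ + r₂
        take r p₁ p₂ p₃ s₁ s₂ = trans (sym (+-cong (+-cong p₁ (S.-‿cong p₂)) (S.-‿cong p₃)))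
          (trans (trans (pointwise λ _ → R.refl) (trans (U-cong r split) (pointwise λ _ → R.refl))) (+-cong s₁ s₂))

        U-b₁ : ∀ {r} → r < 5 → U r (b * (b * X)) ≋ β * (β * x r)
        U-b₁ p = trans (U-b p _) (*-congˡ (U-b p X))

        U-b₂ : ∀ {r y z} → r < 5 → m r ≋ y → n r ≋ z → U r (b * (L₁ + (L₂ + L₂))) ≋ β * (y + (z + z))
        U-b₂ p s t = trans (U-b p _) (*-congˡ (trans (pointwise λ _ → R.refl) (+-cong s (+-cong t t))))

        U-a₂ : ∀ {r y z} → suc r < 5 → m r ≋ y → n r ≋ z → U (suc r) (a * (L₁ + L₁ - L₂)) ≋ α * (y + y - z)
        U-a₂ p s t = trans (U-a-suc p _) (*-congˡ (trans (pointwise λ _ → R.refl) (+-cong (+-cong s s) (S.-‿cong t))))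

        equation₀ : β * (β * x 0) - q * (α * (β * x 4)) - q * (α * (α * x 3)) ≋ β * (L₁ + (L₂ + L₂)) + q * (α * (0# + 0# - α ^ 4 * ψ))
        equation₀ = take 0 (U-b₁ (s≤s z≤n)) (trans (U-a-0 _) (*-congˡ (*-congˡ (U-b 4<5 X)))) (trans (U-a-0 _) (*-congˡ (*-congˡ (U-a-suc 4<5 X))))
          (U-b₂ (s≤s z≤n) U₀L₁ U₀L₂) (trans (U-a-0 _) (*-congˡ (*-congˡ (trans (pointwise λ _ → R.refl) (+-cong (+-cong m₄≋0 m₄≋0) (S.-‿cong n₄))))))

        equation₁ : β * (β * x 1) - α * (β * x 0) - α * (q * (α * x 4)) ≋ β * (α * β ^ 3 * ψ + (0# + 0#)) + α * (L₁ + L₁ - L₂)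
        equation₁ = take 1 (U-b₁ 1<5) (trans (U-a-suc 1<5 _) (*-congˡ (U-b (s≤s z≤n) X))) (trans (U-a-suc 1<5 _) (*-congˡ (U-a-0 X)))
          (U-b₂ 1<5 m₁ n₁≋0) (U-a₂ 1<5 U₀L₁ U₀L₂)

        equation₂ : β * (β * x 2) - α * (β * x 1) - α * (α * x 0) ≋ β * (α ^ 2 * β ^ 2 * ψ + (α ^ 2 * β ^ 2 * ψ + α ^ 2 * β ^ 2 * ψ)) + α * (α * β ^ 3 * ψ + α * β ^ 3 * ψ - 0#)
        equation₂ = take 2 (U-b₁ 2<5) (trans (U-a-suc 2<5 _) (*-congˡ (U-b 1<5 X))) (trans (U-a-suc 2<5 _) (*-congˡ (U-a-suc 1<5 X)))
          (U-b₂ 2<5 m₂ n₂) (U-a₂ 2<5 m₁ n₁≋0)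

        equation₃ : β * (β * x 3) - α * (β * x 2) - α * (α * x 1) ≋ β * (α ^ 3 * β * ψ + (- (α ^ 3 * β * ψ) + - (α ^ 3 * β * ψ))) + α * (α ^ 2 * β ^ 2 * ψ + α ^ 2 * β ^ 2 * ψ - α ^ 2 * β ^ 2 * ψ)
        equation₃ = take 3 (U-b₁ 3<5) (trans (U-a-suc 3<5 _) (*-congˡ (U-b 2<5 X))) (trans (U-a-suc 3<5 _) (*-congˡ (U-a-suc 2<5 X)))
          (U-b₂ 3<5 m₃ n₃) (U-a₂ 3<5 m₂ n₂)

        equation₄ : β * (β * x 4) - α * (β * x 3) - α * (α * x 2) ≋ β * (0# + (α ^ 4 * ψ + α ^ 4 * ψ)) + α * (α ^ 3 * β * ψ + α ^ 3 * β * ψ - - (α ^ 3 * β * ψ))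
        equation₄ = take 4 (U-b₁ 4<5) (trans (U-a-suc 4<5 _) (*-congˡ (U-b 3<5 X))) (trans (U-a-suc 4<5 _) (*-congˡ (U-a-suc 3<5 X)))
          (U-b₂ 4<5 m₄≋0 n₄) (U-a₂ 4<5 m₃ n₃)

        w₀ w₁ w₂ w₃ w₄ : Series
        w₀ = β ^ 8 - fromℤ (+ 3) * (q * (α ^ 5 * β ^ 3))
        w₁ = fromℤ (+ 5) * (q * (α ^ 4 * β ^ 4))
        w₂ = q * (fromℤ (+ 3) * (α ^ 3 * β ^ 5) + q * α ^ 8)
        w₃ = q * (fromℤ (+ 2) * (α ^ 2 * β ^ 6) - q * (α ^ 7 * β))
        w₄ = q * (α * β ^ 7 + fromℤ (+ 2) * (q * (α ^ 6 * β ^ 2)))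

      U₀X-equation : U 0 X * Δ ≋ (L₁ + (L₂ + L₂)) * (β ^ 9 - fromℤ (+ 3) * (q * (α ^ 5 * β ^ 4))) + (L₁ + L₁ - L₂) * (fromℤ (+ 5) * (q * (α ^ 5 * β ^ 4)))
        + ψ * (fromℤ (+ 24) * (q * (α ^ 5 * β ^ 8)) + fromℤ (+ 18) * (q * (q * (α ^ 10 * β ^ 3))))
      U₀X-equation = trans
        (solve 8 (λ q a b x₀ x₁ x₂ x₃ x₄ →
          x₀ :* (b :^ 10 :- con (+ 11) :* (q :* (a :^ 5 :* b :^ 5)) :- q :* (q :* a :^ 10)) :=
          (b :^ 8 :- con (+ 3) :* (q :* (a :^ 5 :* b :^ 3))) :* (b :* (b :* x₀) :- q :* (a :* (b :* x₄)) :- q :* (a :* (a :* x₃))) :+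
          (con (+ 5) :* (q :* (a :^ 4 :* b :^ 4))) :* (b :* (b :* x₁) :- a :* (b :* x₀) :- a :* (q :* (a :* x₄))) :+
          (q :* (con (+ 3) :* (a :^ 3 :* b :^ 5) :+ q :* a :^ 8)) :* (b :* (b :* x₂) :- a :* (b :* x₁) :- a :* (a :* x₀)) :+
          (q :* (con (+ 2) :* (a :^ 2 :* b :^ 6) :- q :* (a :^ 7 :* b))) :* (b :* (b :* x₃) :- a :* (b :* x₂) :- a :* (a :* x₁)) :+
          (q :* (a :* b :^ 7 :+ con (+ 2) :* (q :* (a :^ 6 :* b :^ 2)))) :* (b :* (b :* x₄) :- a :* (b :* x₃) :- a :* (a :* x₂)))
          refl q α β (x 0) (x 1) (x 2) (x 3) (x 4))
        (trans (+-cong (+-cong (+-cong (+-cong (*-congˡ {w₀} equation₀) (*-congˡ {w₁} equation₁)) (*-congˡ {w₂} equation₂)) (*-congˡ {w₃} equation₃)) (*-congˡ {w₄} equation₄))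
        (solve 6 (λ q a b p l k →
          (b :^ 8 :- con (+ 3) :* (q :* (a :^ 5 :* b :^ 3))) :* (b :* (l :+ (k :+ k)) :+ q :* (a :* (con (+ 0) :+ con (+ 0) :- a :^ 4 :* p))) :+
          (con (+ 5) :* (q :* (a :^ 4 :* b :^ 4))) :* (b :* (a :* b :^ 3 :* p :+ (con (+ 0) :+ con (+ 0))) :+ a :* (l :+ l :- k)) :+
          (q :* (con (+ 3) :* (a :^ 3 :* b :^ 5) :+ q :* a :^ 8)) :* (b :* (a :^ 2 :* b :^ 2 :* p :+ (a :^ 2 :* b :^ 2 :* p :+ a :^ 2 :* b :^ 2 :* p)) :+ a :* (a :* b :^ 3 :* p :+ a :* b :^ 3 :* p :- con (+ 0))) :+
          (q :* (con (+ 2) :* (a :^ 2 :* b :^ 6) :- q :* (a :^ 7 :* b))) :* (b :* (a :^ 3 :* b :* p :+ (:- (a :^ 3 :* b :* p) :+ :- (a :^ 3 :* b :* p))) :+ a :* (a :^ 2 :* b :^ 2 :* p :+ a :^ 2 :* b :^ 2 :* p :- a :^ 2 :* b :^ 2 :* p)) :+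
          (q :* (a :* b :^ 7 :+ con (+ 2) :* (q :* (a :^ 6 :* b :^ 2)))) :* (b :* (con (+ 0) :+ (a :^ 4 :* p :+ a :^ 4 :* p)) :+ a :* (a :^ 3 :* b :* p :+ a :^ 3 :* b :* p :- :- (a :^ 3 :* b :* p))) :=
          (l :+ (k :+ k)) :* (b :^ 9 :- con (+ 3) :* (q :* (a :^ 5 :* b :^ 4))) :+ (l :+ l :- k) :* (con (+ 5) :* (q :* (a :^ 5 :* b :^ 4)))
          :+ p :* (con (+ 24) :* (q :* (a :^ 5 :* b :^ 8)) :+ con (+ 18) :* (q :* (q :* (a :^ 10 :* b :^ 3)))))
          refl q α β ψ L₁ L₂))

module ModularRelation (R : CommutativeRing 0ℓ 0ℓ) where
  open PowerSeries R using (_*_; _+_; _-_; _^_; _at_; _‼_; _≋_; *-comm; *-cong; *-congʳ; *-congˡ; +-cong; +-congʳ; +-congˡ; -_; 0#; 1#; Series; ^-congˡ; cancelˡ; commutativeRing; q; q*-shift; q-cancel; refl; setoid; shift-cong; shiftBy; shiftBy-cong; sym; trans)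
  open TripleProduct R using (qProd)
  open QuinticSections R using (U; V; V-*; V-+; V-0; V-1; V-cong; V-injective; V-neg; V-shift; sections)
  open ThetaDissection R using (F; G; L₁; L₂; a; b)
  open LambertSections R using (V-qProd; qProd-sections)
  open QuinticAlgebra R using (*-head; P₅; U₀L₁; U₀L₂; n; qProd-head; Δ; α; β; ε; κ; φ)
  private
    module R = CommutativeRing R using (_≈_; 1#; refl; trans)
    module S = CommutativeRing commutativeRing using (*-identityʳ; *-identityˡ; -‿cong)
  open IntegerSolver commutativeRing using (_:*_; _:+_; _:-_; _:=_; _:^_; :-_; Polynomial; con; solve)
  open IntegerMultiples commutativeRing using (fromℤ)
  open SetoidReasoning setoid

  V-^ : ∀ f n → V (f ^ n) ≋ V f ^ n
  V-^ f zero    = V-1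
  V-^ f (suc n) = trans (V-* f _) (*-congˡ (V-^ f n))

  V-q : V q ≋ q ^ 5
  V-q = trans (V-shift 1#) (trans (shiftBy-cong 5 V-1) (lift 5))
    where
    lift : ∀ n → shiftBy n 1# ≋ q ^ n
    lift zero    = refl
    lift (suc n) = trans (shift-cong (lift n)) (sym (q*-shift (q ^ n)))

  V-sub : ∀ f g → V (f - g) ≋ V f - V g
  V-sub f g = trans (V-+ f (- g)) (+-congˡ (V-neg g))

  V-fromℕ : ∀ n → V (IntegerMultiples.fromℕ commutativeRing n) ≋ IntegerMultiples.fromℕ commutativeRing n
  V-fromℕ 0             = V-0
  V-fromℕ 1             = V-1
  V-fromℕ (suc (suc n)) = trans (V-+ _ 1#) (+-cong (V-fromℕ (suc n)) V-1)

  sections-q : ∀ f → f ≋ V (U 0 f) + q * (V (U 1 f) + q * (V (U 2 f) + q * (V (U 3 f) + q * V (U 4 f))))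
  sections-q f = trans (sections f) (+-congˡ (trans (sym (q*-shift _)) (*-congˡ (+-congˡ (trans (sym (q*-shift _)) (*-congˡ (+-congˡ
    (trans (sym (q*-shift _)) (*-congˡ (+-congˡ (sym (q*-shift _))))))))))))

  A B e : Series
  A = qProd R.1# 1 5 * qProd R.1# 4 5
  B = qProd R.1# 2 5 * qProd R.1# 3 5
  e = P₅

  α≋ : α ≋ A * e
  α≋ = *-congʳ (*-comm _ _)

  β≋ : β ≋ B * e
  β≋ = *-congʳ (*-comm _ _)

  ε≋ : ε ≋ A * B * e
  ε≋ = trans qProd-sections (solve 5 (λ x y z w e → x :* (y :* (z :* (w :* e))) := (x :* w) :* (y :* z) :* e) refl
    (qProd R.1# 1 5) (qProd R.1# 2 5) (qProd R.1# 3 5) (qProd R.1# 4 5) P₅)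

  αβ≋εe : α * β ≋ ε * e
  αβ≋εe = trans (*-cong α≋ β≋) (trans (solve 3 (λ A B e → (A :* e) :* (B :* e) := (A :* B :* e) :* e) refl A B e) (*-congʳ (sym ε≋)))

  κ≋e³ : κ ≋ e ^ 3
  κ≋e³ = trans (V-* _ _) (trans (*-cong (trans (V-* _ _) (*-cong V-qProd V-qProd)) V-qProd) (solve 1 (λ e → e :* e :* e := e :^ 3) refl e))

  A-head : A ‼ 0 R.≈ R.1#
  A-head = *-head (qProd R.1# 1 5) (qProd R.1# 4 5) (qProd-head R.1# 1 5) (qProd-head R.1# 4 5)

  B-head : B ‼ 0 R.≈ R.1#
  B-head = *-head (qProd R.1# 2 5) (qProd R.1# 3 5) (qProd-head R.1# 2 5) (qProd-head R.1# 3 5)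

  e-head : e ‼ 0 R.≈ R.1#
  e-head = qProd-head R.1# 5 5

  ^-head : ∀ f → f ‼ 0 R.≈ R.1# → ∀ n → (f ^ n) ‼ 0 R.≈ R.1#
  ^-head f p zero    = R.refl
  ^-head f p (suc n) = *-head f (f ^ n) p (^-head f p n)

  module Evaluation (F≋0 : F ≋ 0#) (G≋0 : G ≋ 0#) (norm : ε * P₅ ≋ b * b - a * b - a * a)
                    (cancel-3 : ∀ {f g} → fromℤ (+ 3) * f ≋ fromℤ (+ 3) * g → f ≋ g) where
    open QuinticAlgebra.Relations R F≋0 G≋0 norm cancel-3

    private
      ψ′ α′ : Series
      ψ′ = V ψ
      α′ = V α

      expansion : ∀ {f f₀ f₁ f₂ f₃ f₄} → U 0 f ≋ f₀ → U 1 f ≋ f₁ → U 2 f ≋ f₂ → U 3 f ≋ f₃ → U 4 f ≋ f₄ →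
        f ≋ V f₀ + q * (V f₁ + q * (V f₂ + q * (V f₃ + q * V f₄)))
      expansion {f} p₀ p₁ p₂ p₃ p₄ = trans (sections-q f) (+-cong (V-cong p₀) (*-congˡ (+-cong (V-cong p₁) (*-congˡ (+-cong (V-cong p₂)
        (*-congˡ (+-cong (V-cong p₃) (*-congˡ (V-cong p₄)))))))))

      V₁ : V (α * β ^ 3 * ψ) ≋ α′ * b ^ 3 * ψ′
      V₁ = trans (V-* _ _) (*-congʳ (trans (V-* _ _) (*-congˡ (V-^ β 3))))
      V₂ : V (α ^ 2 * β ^ 2 * ψ) ≋ α′ ^ 2 * b ^ 2 * ψ′
      V₂ = trans (V-* _ _) (*-congʳ (trans (V-* _ _) (*-cong (V-^ α 2) (V-^ β 2))))
      V₃ : V (α ^ 3 * β * ψ) ≋ α′ ^ 3 * b * ψ′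
      V₃ = trans (V-* _ _) (*-congʳ (trans (V-* _ _) (*-congʳ (V-^ α 3))))
      V₄ : V (α ^ 4 * ψ) ≋ α′ ^ 4 * ψ′
      V₄ = trans (V-* _ _) (*-congʳ (V-^ α 4))

      L₁-expansion : L₁ ≋ V L₁ + (a * b ^ 3 + a ^ 2 * b ^ 2 + a ^ 3 * b) * ψ′
      L₁-expansion = trans (expansion U₀L₁ m₁ m₂ m₃ m₄≋0)
        (trans (+-congˡ (*-congˡ (+-cong V₁ (*-congˡ (+-cong V₂ (*-congˡ (+-cong V₃ (*-congˡ V-0))))))))
          (solve 5 (λ l q a b p → l :+ q :* (a :* b :^ 3 :* p :+ q :* (a :^ 2 :* b :^ 2 :* p :+ q :* (a :^ 3 :* b :* p :+ q :* con (+ 0))))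
            := l :+ ((q :* a) :* b :^ 3 :+ (q :* a) :^ 2 :* b :^ 2 :+ (q :* a) :^ 3 :* b) :* p) refl (V L₁) q α′ b ψ′))

      L₂-expansion : L₂ ≋ V L₂ + (a ^ 2 * b ^ 2 - a ^ 3 * b + a ^ 4) * ψ′
      L₂-expansion = trans (expansion U₀L₂ n₁≋0 n₂ n₃ n₄)
        (trans (+-congˡ (*-congˡ (+-cong V-0 (*-congˡ (+-cong V₂ (*-congˡ (+-cong (trans (V-neg _) (S.-‿cong V₃)) (*-congˡ V₄))))))))
          (solve 5 (λ l q a b p → l :+ q :* (con (+ 0) :+ q :* (a :^ 2 :* b :^ 2 :* p :+ q :* (:- (a :^ 3 :* b :* p) :+ q :* (a :^ 4 :* p))))
            := l :+ ((q :* a) :^ 2 :* b :^ 2 :- (q :* a) :^ 3 :* b :+ (q :* a) :^ 4) :* p) refl (V L₂) q α′ b ψ′))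

      Vφ : 1# + (V L₁ + V L₁ + V L₁) + V L₂ ≋ b ^ 4 * ψ′
      Vφ = trans (sym (trans (V-+ _ L₂) (+-congʳ (trans (V-+ 1# _) (+-cong V-1 (trans (V-+ _ L₁) (+-congʳ (V-+ L₁ L₁))))))))
        (trans (V-cong φ≋) (trans (V-* _ ψ) (*-congʳ (V-^ β 4))))

      bVφ₂ : b * (V L₁ - (V L₂ + V L₂ + V L₂)) ≋ a ^ 5 * ψ′
      bVφ₂ = trans (sym (trans (V-* β φ₂) (*-congˡ (trans (V-sub L₁ _) (+-congˡ (S.-‿cong (trans (V-+ _ L₂) (+-congʳ (V-+ L₂ L₂)))))))))
        (trans (V-cong βφ₂≋) (trans (V-* q _) (trans (*-cong V-q (trans (V-* _ ψ) (*-congʳ (V-^ α 5))))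
          (solve 3 (λ q a p → q :^ 5 :* (a :^ 5 :* p) := (q :* a) :^ 5 :* p) refl q α′ ψ′))))

      φ-expansion : φ ≋ ψ′ * (b ^ 4 + fromℤ (+ 3) * (a * b ^ 3) + fromℤ (+ 4) * (a ^ 2 * b ^ 2) + fromℤ (+ 2) * (a ^ 3 * b) + a ^ 4)
      φ-expansion = trans (+-cong (+-congˡ (+-cong (+-cong L₁-expansion L₁-expansion) L₁-expansion)) L₂-expansion)
        (trans (solve 5 (λ l k a b p → con (+ 1) :+ ((l :+ x a b p) :+ (l :+ x a b p) :+ (l :+ x a b p)) :+ (k :+ y a b p) :=
            (con (+ 1) :+ (l :+ l :+ l) :+ k) :+ (x a b p :+ x a b p :+ x a b p :+ y a b p)) refl (V L₁) (V L₂) a b ψ′)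
        (trans (+-congʳ Vφ) (solve 3 (λ a b p → b :^ 4 :* p :+ (x a b p :+ x a b p :+ x a b p :+ y a b p) :=
           p :* (b :^ 4 :+ con (+ 3) :* (a :* b :^ 3) :+ con (+ 4) :* (a :^ 2 :* b :^ 2) :+ con (+ 2) :* (a :^ 3 :* b) :+ a :^ 4)) refl a b ψ′)))
        where
        x y : ∀ {n} → Polynomial n → Polynomial n → Polynomial n → Polynomial n
        x a b p = (a :* b :^ 3 :+ a :^ 2 :* b :^ 2 :+ a :^ 3 :* b) :* p
        y a b p = (a :^ 2 :* b :^ 2 :- a :^ 3 :* b :+ a :^ 4) :* p

      bφ₂-expansion : b * φ₂ ≋ ψ′ * (a * (b ^ 4 - fromℤ (+ 2) * (a * b ^ 3) + fromℤ (+ 4) * (a ^ 2 * b ^ 2) - fromℤ (+ 3) * (a ^ 3 * b) + a ^ 4))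
      bφ₂-expansion = trans (*-congˡ (+-cong L₁-expansion (S.-‿cong (+-cong (+-cong L₂-expansion L₂-expansion) L₂-expansion))))
        (trans (solve 5 (λ l k a b p → b :* ((l :+ x a b p) :- ((k :+ y a b p) :+ (k :+ y a b p) :+ (k :+ y a b p))) :=
            b :* (l :- (k :+ k :+ k)) :+ b :* (x a b p :- (y a b p :+ y a b p :+ y a b p))) refl (V L₁) (V L₂) a b ψ′)
        (trans (+-congʳ bVφ₂) (solve 3 (λ a b p → a :^ 5 :* p :+ b :* (x a b p :- (y a b p :+ y a b p :+ y a b p)) :=
           p :* (a :* (b :^ 4 :- con (+ 2) :* (a :* b :^ 3) :+ con (+ 4) :* (a :^ 2 :* b :^ 2) :- con (+ 3) :* (a :^ 3 :* b) :+ a :^ 4))) refl a b ψ′)))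
        where
        x y : ∀ {n} → Polynomial n → Polynomial n → Polynomial n → Polynomial n
        x a b p = (a :* b :^ 3 :+ a :^ 2 :* b :^ 2 :+ a :^ 3 :* b) :* p
        y a b p = (a :^ 2 :* b :^ 2 :- a :^ 3 :* b :+ a :^ 4) :* p

      bφφ₂-norm : (b * (φ * φ₂)) * (ε * e) ≋ (ψ′ * ψ′) * (a * (b ^ 10 - fromℤ (+ 11) * (a ^ 5 * b ^ 5) - a ^ 10))
      bφφ₂-norm = trans (solve 4 (λ b f g w → (b :* (f :* g)) :* w := f :* (b :* g) :* w) refl b φ φ₂ (ε * e))
        (trans (*-cong (*-cong φ-expansion bφ₂-expansion) norm)
        (solve 3 (λ a b p → p :* (b :^ 4 :+ con (+ 3) :* (a :* b :^ 3) :+ con (+ 4) :* (a :^ 2 :* b :^ 2) :+ con (+ 2) :* (a :^ 3 :* b) :+ a :^ 4) :*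
            (p :* (a :* (b :^ 4 :- con (+ 2) :* (a :* b :^ 3) :+ con (+ 4) :* (a :^ 2 :* b :^ 2) :- con (+ 3) :* (a :^ 3 :* b) :+ a :^ 4))) :*
            (b :* b :- a :* b :- a :* a) := (p :* p) :* (a :* (b :^ 10 :- con (+ 11) :* (a :^ 5 :* b :^ 5) :- a :^ 10))) refl a b ψ′))

      αβφφ₂ : (α * β) * (φ * φ₂) ≋ q * (κ * κ)
      αβφφ₂ = trans (solve 4 (λ a b f g → (a :* b) :* (f :* g) := a :* (f :* (b :* g))) refl α β φ φ₂)
        (trans (*-congˡ (*-cong φ≋ βφ₂≋)) (trans (solve 4 (λ q a b p → a :* (b :^ 4 :* p :* (q :* (a :^ 5 :* p))) :=
           q :* ((a :^ 3 :* b :^ 2 :* p) :* (a :^ 3 :* b :^ 2 :* p))) refl q α β ψ) (*-congˡ (*-cong (sym κ≋) (sym κ≋)))))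

      VΔ : V Δ ≋ b ^ 10 - fromℤ (+ 11) * (a ^ 5 * b ^ 5) - a ^ 10
      VΔ = trans (V-sub _ _) (trans (+-cong (trans (V-sub _ _) (+-cong (V-^ β 10) (S.-‿cong (trans (V-* _ _) (*-cong (V-fromℕ 11)
            (trans (V-* q _) (*-cong V-q (trans (V-* _ _) (*-cong (V-^ α 5) (V-^ β 5)))))))))) (S.-‿cong (trans (V-* q _) (*-cong V-q (trans (V-* q _) (*-cong V-q (V-^ α 10)))))))
        (solve 3 (λ q a b → b :^ 10 :- con (+ 11) :* (q :^ 5 :* (a :^ 5 :* b :^ 5)) :- q :^ 5 :* (q :^ 5 :* a :^ 10) :=
           b :^ 10 :- con (+ 11) :* ((q :* a) :^ 5 :* b :^ 5) :- (q :* a) :^ 10) refl q α′ b))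

    -- Ramanujan's identity 1/r⁵ − 11 − r⁵ = E₁⁶/(qE₅⁶), r⁵ = qA⁵/B⁵.
    βε⁶ : β * ((ε * ε * ε) * (ε * ε * ε)) ≋ (ψ * ψ) * (α * Δ)
    βε⁶ = V-injective (trans (V-* β _) (trans (*-congˡ (V-* _ _)) (trans core (sym (trans (V-* _ _) (*-cong (V-* ψ ψ) (V-* α Δ)))))))
      where
      core : b * (κ * κ) ≋ (ψ′ * ψ′) * (α′ * V Δ)
      core = q-cancel (cancelˡ {ε * e} (*-head ε e (qProd-head R.1# 1 1) e-head) (begin
        (ε * e) * (q * (b * (κ * κ)))                  ≈⟨ solve 4 (λ w q b k → w :* (q :* (b :* k)) := (b :* (q :* k)) :* w) refl (ε * e) q b (κ * κ) ⟩
        (b * (q * (κ * κ))) * (ε * e)                  ≈⟨ *-congʳ (*-congˡ (sym αβφφ₂)) ⟩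
        (b * ((α * β) * (φ * φ₂))) * (ε * e)           ≈⟨ solve 4 (λ b w f v → (b :* (w :* f)) :* v := w :* ((b :* f) :* v)) refl b (α * β) (φ * φ₂) (ε * e) ⟩
        (α * β) * ((b * (φ * φ₂)) * (ε * e))           ≈⟨ *-cong αβ≋εe (trans bφφ₂-norm (*-congˡ (*-congˡ (sym VΔ)))) ⟩
        (ε * e) * ((ψ′ * ψ′) * (a * V Δ))              ≈⟨ *-congˡ (solve 4 (λ p q a d → p :* ((q :* a) :* d) := q :* (p :* (a :* d))) refl (ψ′ * ψ′) q α′ (V Δ)) ⟩
        (ε * e) * (q * ((ψ′ * ψ′) * (α′ * V Δ)))       ∎))

    Δ≋ : Δ ≋ A ^ 11 * B ^ 11 * e ^ 10
    Δ≋ = cancelˡ {e ^ 6} (^-head e e-head 6) (begin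
      e ^ 6 * Δ                                                ≈⟨ *-congʳ (trans (solve 1 (λ e → e :^ 6 := e :^ 3 :* e :^ 3) refl e) (*-cong (sym κ≋e³) (sym κ≋e³))) ⟩
      (κ * κ) * Δ                                              ≈⟨ *-congʳ (*-cong κ≋ κ≋) ⟩
      ((α ^ 3 * β ^ 2 * ψ) * (α ^ 3 * β ^ 2 * ψ)) * Δ          ≈⟨ solve 4 (λ a b p d → ((a :^ 3 :* b :^ 2 :* p) :* (a :^ 3 :* b :^ 2 :* p)) :* d := (a :^ 5 :* b :^ 4) :* ((p :* p) :* (a :* d))) refl α β ψ Δ ⟩
      (α ^ 5 * β ^ 4) * ((ψ * ψ) * (α * Δ))                    ≈⟨ *-congˡ (sym βε⁶) ⟩
      (α ^ 5 * β ^ 4) * (β * ((ε * ε * ε) * (ε * ε * ε)))      ≈⟨ *-cong (*-cong (^-congˡ 5 α≋) (^-congˡ 4 β≋)) (*-cong β≋ (*-cong ε³ ε³)) ⟩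
      ((A * e) ^ 5 * (B * e) ^ 4) * ((B * e) * ((w * w * w) * (w * w * w)))
        ≈⟨ solve 3 (λ A B e → ((A :* e) :^ 5 :* (B :* e) :^ 4) :* ((B :* e) :* ((A :* B :* e) :* (A :* B :* e) :* (A :* B :* e) :* ((A :* B :* e) :* (A :* B :* e) :* (A :* B :* e))))
             := e :^ 6 :* (A :^ 11 :* B :^ 11 :* e :^ 10)) refl A B e ⟩
      e ^ 6 * (A ^ 11 * B ^ 11 * e ^ 10)                       ∎)
      where
      w = A * B * e
      ε³ : ε * ε * ε ≋ w * w * w
      ε³ = *-cong (*-cong ε≋ ε≋) ε≋

    ψ-inverse : (A ^ 3 * B ^ 2 * e ^ 2) * ψ ≋ 1#
    ψ-inverse = cancelˡ {e ^ 3} (^-head e e-head 3) (begin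
      e ^ 3 * ((A ^ 3 * B ^ 2 * e ^ 2) * ψ)      ≈⟨ solve 4 (λ A B e p → e :^ 3 :* ((A :^ 3 :* B :^ 2 :* e :^ 2) :* p) := (A :* e) :^ 3 :* (B :* e) :^ 2 :* p) refl A B e ψ ⟩
      (A * e) ^ 3 * (B * e) ^ 2 * ψ              ≈⟨ *-congʳ (*-cong (^-congˡ 3 (sym α≋)) (^-congˡ 2 (sym β≋))) ⟩
      α ^ 3 * β ^ 2 * ψ                          ≈⟨ sym κ≋ ⟩
      κ                                          ≈⟨ trans κ≋e³ (sym (S.*-identityʳ _)) ⟩
      e ^ 3 * 1#                                 ∎)

    A³φ : A ^ 3 * φ ≋ B ^ 2 * e ^ 2
    A³φ = begin
      A ^ 3 * φ                                          ≈⟨ *-congˡ (trans φ≋ (*-congʳ (^-congˡ 4 β≋))) ⟩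
      A ^ 3 * ((B * e) ^ 4 * ψ)                          ≈⟨ solve 4 (λ A B e p → A :^ 3 :* ((B :* e) :^ 4 :* p) := (B :^ 2 :* e :^ 2) :* ((A :^ 3 :* B :^ 2 :* e :^ 2) :* p)) refl A B e ψ ⟩
      (B ^ 2 * e ^ 2) * ((A ^ 3 * B ^ 2 * e ^ 2) * ψ)    ≈⟨ *-congˡ ψ-inverse ⟩
      (B ^ 2 * e ^ 2) * 1#                               ≈⟨ S.*-identityʳ _ ⟩
      B ^ 2 * e ^ 2                                      ∎

    B³φ₂ : B ^ 3 * φ₂ ≋ q * (A ^ 2 * e ^ 2)
    B³φ₂ = cancelˡ {e} e-head (begin
      e * (B ^ 3 * φ₂)                                                 ≈⟨ solve 3 (λ B e f → e :* (B :^ 3 :* f) := B :^ 2 :* ((B :* e) :* f)) refl B e φ₂ ⟩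
      B ^ 2 * ((B * e) * φ₂)                                           ≈⟨ *-congˡ (*-congʳ (sym β≋)) ⟩
      B ^ 2 * (β * φ₂)                                                 ≈⟨ *-congˡ (trans βφ₂≋ (*-congˡ (*-congʳ (^-congˡ 5 α≋)))) ⟩
      B ^ 2 * (q * ((A * e) ^ 5 * ψ))                                  ≈⟨ solve 5 (λ q A B e p → B :^ 2 :* (q :* ((A :* e) :^ 5 :* p)) := (e :* (q :* (A :^ 2 :* e :^ 2))) :* ((A :^ 3 :* B :^ 2 :* e :^ 2) :* p)) refl q A B e ψ ⟩
      (e * (q * (A ^ 2 * e ^ 2))) * ((A ^ 3 * B ^ 2 * e ^ 2) * ψ)      ≈⟨ trans (*-congˡ ψ-inverse) (S.*-identityʳ _) ⟩
      e * (q * (A ^ 2 * e ^ 2))                                        ∎)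

    private
      M₁ M₂ M₃ M₄ M₅ : Series
      M₁ = φ * β ^ 9
      M₂ = A ^ 2 * B ^ 6 * e ^ 11
      M₃ = A ^ 7 * B * e ^ 11
      M₄ = B ^ 9 * e ^ 9
      M₅ = A ^ 5 * B ^ 4 * e ^ 9

      φα⁵β⁴ : φ * (α ^ 5 * β ^ 4) ≋ M₂
      φα⁵β⁴ = trans (*-congˡ (*-cong (^-congˡ 5 α≋) (^-congˡ 4 β≋)))
        (trans (solve 4 (λ A B e f → f :* ((A :* e) :^ 5 :* (B :* e) :^ 4) := (A :^ 3 :* f) :* (A :^ 2 :* B :^ 4 :* e :^ 9)) refl A B e φ)
        (trans (*-congʳ A³φ) (solve 3 (λ A B e → (B :^ 2 :* e :^ 2) :* (A :^ 2 :* B :^ 4 :* e :^ 9) := A :^ 2 :* B :^ 6 :* e :^ 11) refl A B e)))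

      φ₂β⁹ : φ₂ * β ^ 9 ≋ q * M₂
      φ₂β⁹ = trans (*-congˡ (^-congˡ 9 β≋)) (trans (solve 3 (λ B e f → f :* (B :* e) :^ 9 := (B :^ 3 :* f) :* (B :^ 6 :* e :^ 9)) refl B e φ₂)
        (trans (*-congʳ B³φ₂) (solve 4 (λ q A B e → (q :* (A :^ 2 :* e :^ 2)) :* (B :^ 6 :* e :^ 9) := q :* (A :^ 2 :* B :^ 6 :* e :^ 11)) refl q A B e)))

      φ₂α⁵β⁴ : φ₂ * (α ^ 5 * β ^ 4) ≋ q * M₃
      φ₂α⁵β⁴ = trans (*-congˡ (*-cong (^-congˡ 5 α≋) (^-congˡ 4 β≋)))
        (trans (solve 4 (λ A B e f → f :* ((A :* e) :^ 5 :* (B :* e) :^ 4) := (B :^ 3 :* f) :* (A :^ 5 :* B :* e :^ 9)) refl A B e φ₂)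
        (trans (*-congʳ B³φ₂) (solve 4 (λ q A B e → (q :* (A :^ 2 :* e :^ 2)) :* (A :^ 5 :* B :* e :^ 9) := q :* (A :^ 7 :* B :* e :^ 11)) refl q A B e)))

      ψα⁵β⁸ : ψ * (α ^ 5 * β ^ 8) ≋ M₂
      ψα⁵β⁸ = trans (*-congˡ (*-cong (^-congˡ 5 α≋) (^-congˡ 8 β≋)))
        (trans (solve 4 (λ A B e p → p :* ((A :* e) :^ 5 :* (B :* e) :^ 8) := ((A :^ 3 :* B :^ 2 :* e :^ 2) :* p) :* (A :^ 2 :* B :^ 6 :* e :^ 11)) refl A B e ψ)
        (trans (*-congʳ ψ-inverse) (S.*-identityˡ _)))

      ψα¹⁰β³ : ψ * (α ^ 10 * β ^ 3) ≋ M₃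
      ψα¹⁰β³ = trans (*-congˡ (*-cong (^-congˡ 10 α≋) (^-congˡ 3 β≋)))
        (trans (solve 4 (λ A B e p → p :* ((A :* e) :^ 10 :* (B :* e) :^ 3) := ((A :^ 3 :* B :^ 2 :* e :^ 2) :* p) :* (A :^ 7 :* B :* e :^ 11)) refl A B e ψ)
        (trans (*-congʳ ψ-inverse) (S.*-identityˡ _)))

      α⁵β⁴ : α ^ 5 * β ^ 4 ≋ M₅
      α⁵β⁴ = trans (*-cong (^-congˡ 5 α≋) (^-congˡ 4 β≋)) (solve 3 (λ A B e → (A :* e) :^ 5 :* (B :* e) :^ 4 := A :^ 5 :* B :^ 4 :* e :^ 9) refl A B e)

      β⁹ : β ^ 9 ≋ M₄
      β⁹ = trans (^-congˡ 9 β≋) (solve 2 (λ B e → (B :* e) :^ 9 := B :^ 9 :* e :^ 9) refl B e)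

    module _ (X : Series) (X-equation : X * (b * b - a * b - a * a) ≋ b * (L₁ + (L₂ + L₂)) + a * (L₁ + L₁ - L₂))
             {t₁ t₂ t₃ t₄ t₅ t₆ σ : Series}
             (t₁-def : A ^ 3 * t₁ ≋ B * e) (t₂-def : (ε ^ 5 * A ^ 3) * t₂ ≋ B * e ^ 2)
             (t₃-def : (ε ^ 6 * A ^ 2) * t₃ ≋ B * e ^ 2) (t₄-def : (ε ^ 6 * A ^ 3) * t₄ ≋ B * e ^ 7)
             (t₅-def : B ^ 5 * t₅ ≋ A ^ 5) (t₆-def : (ε ^ 6 * B) * t₆ ≋ e ^ 5) (σ-def : σ ≋ β * L₂) where
      private
        doubled : U 0 X * Δ + U 0 X * Δ ≋ M₁ - M₄ - q * M₂ + fromℤ (+ 50) * (q * M₂) + fromℤ (+ 44) * (q * (q * M₃)) - fromℤ (+ 2) * (q * M₅)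
        doubled = trans (+-cong (U₀X-equation X X-equation) (U₀X-equation X X-equation))
          (trans (solve 6 (λ q a b p l k →
              ((l :+ (k :+ k)) :* (b :^ 9 :- con (+ 3) :* (q :* (a :^ 5 :* b :^ 4))) :+ (l :+ l :- k) :* (con (+ 5) :* (q :* (a :^ 5 :* b :^ 4)))
              :+ p :* (con (+ 24) :* (q :* (a :^ 5 :* b :^ 8)) :+ con (+ 18) :* (q :* (q :* (a :^ 10 :* b :^ 3)))))
              :+ ((l :+ (k :+ k)) :* (b :^ 9 :- con (+ 3) :* (q :* (a :^ 5 :* b :^ 4))) :+ (l :+ l :- k) :* (con (+ 5) :* (q :* (a :^ 5 :* b :^ 4)))
              :+ p :* (con (+ 24) :* (q :* (a :^ 5 :* b :^ 8)) :+ con (+ 18) :* (q :* (q :* (a :^ 10 :* b :^ 3))))) :=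
              f l k :* b :^ 9 :- b :^ 9 :- g l k :* b :^ 9 :+ con (+ 2) :* (q :* (f l k :* (a :^ 5 :* b :^ 4))) :+ con (+ 8) :* (q :* (g l k :* (a :^ 5 :* b :^ 4)))
              :- con (+ 2) :* (q :* (a :^ 5 :* b :^ 4)) :+ con (+ 48) :* (q :* (p :* (a :^ 5 :* b :^ 8))) :+ con (+ 36) :* (q :* (q :* (p :* (a :^ 10 :* b :^ 3)))))
            refl q α β ψ L₁ L₂)
          (trans (+-cong (+-cong (+-cong (+-cong (+-cong (+-cong (+-congˡ (S.-‿cong β⁹)) (S.-‿cong φ₂β⁹)) (*-congˡ (*-congˡ φα⁵β⁴))) (*-congˡ (*-congˡ φ₂α⁵β⁴)))
              (S.-‿cong (*-congˡ (*-congˡ α⁵β⁴)))) (*-congˡ (*-congˡ ψα⁵β⁸))) (*-congˡ (*-congˡ (*-congˡ ψα¹⁰β³))))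
          (solve 6 (λ q m₁ m₂ m₃ m₄ m₅ → m₁ :- m₄ :- q :* m₂ :+ con (+ 2) :* (q :* m₂) :+ con (+ 8) :* (q :* (q :* m₃)) :- con (+ 2) :* (q :* m₅) :+ con (+ 48) :* (q :* m₂) :+ con (+ 36) :* (q :* (q :* m₃))
             := m₁ :- m₄ :- q :* m₂ :+ con (+ 50) :* (q :* m₂) :+ con (+ 44) :* (q :* (q :* m₃)) :- con (+ 2) :* (q :* m₅)) refl q M₁ M₂ M₃ M₄ M₅)))
          where
          f g : ∀ {n} → Polynomial n → Polynomial n → Polynomial n
          f l k = con (+ 1) :+ (l :+ l :+ l) :+ k
          g l k = l :- (k :+ k :+ k)

        βt₁ : β * t₁ ≋ φ
        βt₁ = cancelˡ {A ^ 3} (^-head A A-head 3) (trans (trans (*-congˡ (*-congʳ β≋)) (solve 4 (λ A B e t → A :^ 3 :* ((B :* e) :* t) := (B :* e) :* (A :^ 3 :* t)) refl A B e t₁))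
          (trans (*-congˡ t₁-def) (trans (solve 2 (λ B e → (B :* e) :* (B :* e) := B :^ 2 :* e :^ 2) refl B e) (sym A³φ))))

        t₁Δ : t₁ * Δ ≋ M₁ - fromℤ (+ 11) * (q * M₂) - q * (q * M₃)
        t₁Δ = trans (solve 4 (λ t q a b → t :* (b :^ 10 :- con (+ 11) :* (q :* (a :^ 5 :* b :^ 5)) :- q :* (q :* a :^ 10)) :=
                (b :* t) :* b :^ 9 :- con (+ 11) :* (q :* ((b :* t) :* (a :^ 5 :* b :^ 4))) :- q :* (q :* (a :^ 10 :* t))) refl t₁ q α β)
          (+-cong (+-cong (*-congʳ βt₁) (S.-‿cong (*-congˡ (*-congˡ (trans (*-congʳ βt₁) φα⁵β⁴))))) (S.-‿cong (*-congˡ (*-congˡ α¹⁰t₁))))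
          where
          α¹⁰t₁ : α ^ 10 * t₁ ≋ M₃
          α¹⁰t₁ = trans (*-congʳ (^-congˡ 10 α≋)) (trans (solve 3 (λ A e t → (A :* e) :^ 10 :* t := (A :^ 7 :* e :^ 10) :* (A :^ 3 :* t)) refl A e t₁)
            (trans (*-congˡ t₁-def) (solve 3 (λ A B e → (A :^ 7 :* e :^ 10) :* (B :* e) := A :^ 7 :* B :* e :^ 11) refl A B e)))

        module _ where
          private
            -- Δ ≋ A¹¹B¹¹e¹⁰ is a multiple of every denominator.
            through : ∀ {d t n} c → Δ ≋ c * d → d * t ≋ n → t * Δ ≋ c * n
            through {d} {t} c p r = trans (*-congˡ p) (trans (solve 3 (λ t c d → t :* (c :* d) := c :* (d :* t)) refl t c d) (*-congˡ r))

            Δ-factor : ∀ {k l} c → A ^ 11 * B ^ 11 * e ^ 10 ≋ c * ((A * B * e) ^ k * l) → Δ ≋ c * (ε ^ k * l)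
            Δ-factor {k} c p = trans Δ≋ (trans p (*-congˡ (*-congʳ (^-congˡ k (sym ε≋)))))

          t₂Δ : t₂ * Δ ≋ (A ^ 3 * B ^ 6 * e ^ 5) * (B * e ^ 2)
          t₂Δ = through _ (Δ-factor {5} (A ^ 3 * B ^ 6 * e ^ 5) (solve 3 (λ A B e → A :^ 11 :* B :^ 11 :* e :^ 10 := (A :^ 3 :* B :^ 6 :* e :^ 5) :* ((A :* B :* e) :^ 5 :* A :^ 3)) refl A B e)) t₂-def

          t₃Δ : t₃ * Δ ≋ (A ^ 3 * B ^ 5 * e ^ 4) * (B * e ^ 2)
          t₃Δ = through _ (Δ-factor {6} (A ^ 3 * B ^ 5 * e ^ 4) (solve 3 (λ A B e → A :^ 11 :* B :^ 11 :* e :^ 10 := (A :^ 3 :* B :^ 5 :* e :^ 4) :* ((A :* B :* e) :^ 6 :* A :^ 2)) refl A B e)) t₃-def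

          t₄Δ : t₄ * Δ ≋ (A ^ 2 * B ^ 5 * e ^ 4) * (B * e ^ 7)
          t₄Δ = through _ (Δ-factor {6} (A ^ 2 * B ^ 5 * e ^ 4) (solve 3 (λ A B e → A :^ 11 :* B :^ 11 :* e :^ 10 := (A :^ 2 :* B :^ 5 :* e :^ 4) :* ((A :* B :* e) :^ 6 :* A :^ 3)) refl A B e)) t₄-def

          t₆Δ : t₆ * Δ ≋ (A ^ 5 * B ^ 4 * e ^ 4) * e ^ 5
          t₆Δ = through _ (Δ-factor {6} (A ^ 5 * B ^ 4 * e ^ 4) (solve 3 (λ A B e → A :^ 11 :* B :^ 11 :* e :^ 10 := (A :^ 5 :* B :^ 4 :* e :^ 4) :* ((A :* B :* e) :^ 6 :* B)) refl A B e)) t₆-def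

        t₃σΔ : fromℤ (+ 10) * ((t₃ * σ) * Δ) ≋ M₄ - A ^ 3 * B ^ 7 * e ^ 7 - fromℤ (+ 3) * (q * M₅)
        t₃σΔ = begin
          fromℤ (+ 10) * ((t₃ * σ) * Δ)
            ≈⟨ *-congˡ (trans (solve 3 (λ t s d → (t :* s) :* d := (t :* d) :* s) refl t₃ σ Δ) (*-cong t₃Δ (trans σ-def (*-congʳ β≋)))) ⟩
          fromℤ (+ 10) * (((A ^ 3 * B ^ 5 * e ^ 4) * (B * e ^ 2)) * ((B * e) * L₂))
            ≈⟨ solve 5 (λ A B e l k → con (+ 10) :* (((A :^ 3 :* B :^ 5 :* e :^ 4) :* (B :* e :^ 2)) :* ((B :* e) :* k)) :=
                 (A :^ 3 :* (con (+ 1) :+ (l :+ l :+ l) :+ k)) :* (B :^ 7 :* e :^ 7) :- A :^ 3 :* B :^ 7 :* e :^ 7 :-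
                 con (+ 3) :* ((B :^ 3 :* (l :- (k :+ k :+ k))) :* (A :^ 3 :* B :^ 4 :* e :^ 7))) refl A B e L₁ L₂ ⟩
          (A ^ 3 * φ) * (B ^ 7 * e ^ 7) - A ^ 3 * B ^ 7 * e ^ 7 - fromℤ (+ 3) * ((B ^ 3 * φ₂) * (A ^ 3 * B ^ 4 * e ^ 7))
            ≈⟨ +-cong (+-congʳ (*-congʳ A³φ)) (S.-‿cong (*-congˡ (*-congʳ B³φ₂))) ⟩
          (B ^ 2 * e ^ 2) * (B ^ 7 * e ^ 7) - A ^ 3 * B ^ 7 * e ^ 7 - fromℤ (+ 3) * ((q * (A ^ 2 * e ^ 2)) * (A ^ 3 * B ^ 4 * e ^ 7))
            ≈⟨ solve 4 (λ q A B e → (B :^ 2 :* e :^ 2) :* (B :^ 7 :* e :^ 7) :- A :^ 3 :* B :^ 7 :* e :^ 7 :- con (+ 3) :* ((q :* (A :^ 2 :* e :^ 2)) :* (A :^ 3 :* B :^ 4 :* e :^ 7)) :=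
                 B :^ 9 :* e :^ 9 :- A :^ 3 :* B :^ 7 :* e :^ 7 :- con (+ 3) :* (q :* (A :^ 5 :* B :^ 4 :* e :^ 9))) refl q A B e ⟩
          M₄ - A ^ 3 * B ^ 7 * e ^ 7 - fromℤ (+ 3) * (q * M₅) ∎

        t₄t₅Δ : ((q * t₄) * (fromℤ (+ 4) + fromℤ (+ 3) * (q * t₅))) * Δ ≋ fromℤ (+ 4) * (q * M₂) + fromℤ (+ 3) * (q * (q * M₃))
        t₄t₅Δ = begin
          ((q * t₄) * (fromℤ (+ 4) + fromℤ (+ 3) * (q * t₅))) * Δ
            ≈⟨ solve 4 (λ q t s d → ((q :* t) :* (con (+ 4) :+ con (+ 3) :* (q :* s))) :* d := (q :* (t :* d)) :* (con (+ 4) :+ con (+ 3) :* (q :* s))) refl q t₄ t₅ Δ ⟩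
          (q * (t₄ * Δ)) * (fromℤ (+ 4) + fromℤ (+ 3) * (q * t₅))
            ≈⟨ *-congʳ (*-congˡ t₄Δ) ⟩
          (q * ((A ^ 2 * B ^ 5 * e ^ 4) * (B * e ^ 7))) * (fromℤ (+ 4) + fromℤ (+ 3) * (q * t₅))
            ≈⟨ solve 5 (λ q A B e t → (q :* ((A :^ 2 :* B :^ 5 :* e :^ 4) :* (B :* e :^ 7))) :* (con (+ 4) :+ con (+ 3) :* (q :* t)) :=
                 con (+ 4) :* (q :* (A :^ 2 :* B :^ 6 :* e :^ 11)) :+ con (+ 3) :* (q :* (q :* ((B :^ 5 :* t) :* (A :^ 2 :* B :* e :^ 11))))) refl q A B e t₅ ⟩
          fromℤ (+ 4) * (q * M₂) + fromℤ (+ 3) * (q * (q * ((B ^ 5 * t₅) * (A ^ 2 * B * e ^ 11))))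
            ≈⟨ +-congˡ (*-congˡ (*-congˡ (*-congˡ (trans (*-congʳ t₅-def) (solve 3 (λ A B e → A :^ 5 :* (A :^ 2 :* B :* e :^ 11) := A :^ 7 :* B :* e :^ 11) refl A B e))))) ⟩
          fromℤ (+ 4) * (q * M₂) + fromℤ (+ 3) * (q * (q * M₃)) ∎

      evaluation : U 0 X + U 0 X ≋ t₁ - t₂ - fromℤ (+ 10) * (t₃ * σ) + fromℤ (+ 15) * ((q * t₄) * (fromℤ (+ 4) + fromℤ (+ 3) * (q * t₅))) - fromℤ (+ 5) * (q * t₆)
      evaluation = cancelˡ {Δ} Δ-head (begin
        Δ * (U 0 X + U 0 X)       ≈⟨ solve 2 (λ d x → d :* (x :+ x) := x :* d :+ x :* d) refl Δ (U 0 X) ⟩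
        U 0 X * Δ + U 0 X * Δ     ≈⟨ doubled ⟩
        M₁ - M₄ - q * M₂ + fromℤ (+ 50) * (q * M₂) + fromℤ (+ 44) * (q * (q * M₃)) - fromℤ (+ 2) * (q * M₅)
          ≈⟨ solve 9 (λ q A B e m₁ m₂ m₃ m₄ m₅ → m₁ :- m₄ :- q :* m₂ :+ con (+ 50) :* (q :* m₂) :+ con (+ 44) :* (q :* (q :* m₃)) :- con (+ 2) :* (q :* m₅) :=
               (m₁ :- con (+ 11) :* (q :* m₂) :- q :* (q :* m₃)) :- (A :^ 3 :* B :^ 6 :* e :^ 5) :* (B :* e :^ 2) :- (m₄ :- A :^ 3 :* B :^ 7 :* e :^ 7 :- con (+ 3) :* (q :* m₅))
               :+ con (+ 15) :* (con (+ 4) :* (q :* m₂) :+ con (+ 3) :* (q :* (q :* m₃))) :- con (+ 5) :* (q :* m₅)) refl q A B e M₁ M₂ M₃ M₄ M₅ ⟩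
        (M₁ - fromℤ (+ 11) * (q * M₂) - q * (q * M₃)) - (A ^ 3 * B ^ 6 * e ^ 5) * (B * e ^ 2) - (M₄ - A ^ 3 * B ^ 7 * e ^ 7 - fromℤ (+ 3) * (q * M₅))
          + fromℤ (+ 15) * (fromℤ (+ 4) * (q * M₂) + fromℤ (+ 3) * (q * (q * M₃))) - fromℤ (+ 5) * (q * M₅)
          ≈⟨ +-cong (+-cong (+-cong (+-cong (sym t₁Δ) (S.-‿cong (sym t₂Δ))) (S.-‿cong (sym t₃σΔ))) (*-congˡ (sym t₄t₅Δ))) (S.-‿cong (*-congˡ (*-congˡ (sym t₆Δ′)))) ⟩
        t₁ * Δ - t₂ * Δ - fromℤ (+ 10) * ((t₃ * σ) * Δ) + fromℤ (+ 15) * (((q * t₄) * (fromℤ (+ 4) + fromℤ (+ 3) * (q * t₅))) * Δ) - fromℤ (+ 5) * (q * (t₆ * Δ))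
          ≈⟨ solve 7 (λ q d t₁ t₂ s u t₆ → t₁ :* d :- t₂ :* d :- con (+ 10) :* (s :* d) :+ con (+ 15) :* (u :* d) :- con (+ 5) :* (q :* (t₆ :* d)) :=
               d :* (t₁ :- t₂ :- con (+ 10) :* s :+ con (+ 15) :* u :- con (+ 5) :* (q :* t₆))) refl q Δ t₁ t₂ (t₃ * σ) ((q * t₄) * (fromℤ (+ 4) + fromℤ (+ 3) * (q * t₅))) t₆ ⟩
        Δ * (t₁ - t₂ - fromℤ (+ 10) * (t₃ * σ) + fromℤ (+ 15) * ((q * t₄) * (fromℤ (+ 4) + fromℤ (+ 3) * (q * t₅))) - fromℤ (+ 5) * (q * t₆)) ∎)
        where
        t₆Δ′ : t₆ * Δ ≋ M₅
        t₆Δ′ = trans t₆Δ (solve 3 (λ A B e → (A :^ 5 :* B :^ 4 :* e :^ 4) :* e :^ 5 := A :^ 5 :* B :^ 4 :* e :^ 9) refl A B e)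
        Δ-head : Δ ‼ 0 R.≈ R.1#
        Δ-head = R.trans (Δ≋ at 0) (*-head (A ^ 11 * B ^ 11) (e ^ 10) (*-head (A ^ 11) (B ^ 11) (^-head A A-head 11) (^-head B B-head 11)) (^-head e e-head 10))

neg-neg : (R : CommutativeRing 0ℓ 0ℓ) (let open CommutativeRing R) → ∀ x → (- 1#) * ((- 1#) * x) ≈ x
neg-neg R = solve 1 (λ x → (:- con (+ 1)) :* ((:- con (+ 1)) :* x) := x) (CommutativeRing.refl R)
  where open IntegerSolver R

*-neg : (R : CommutativeRing 0ℓ 0ℓ) (let open CommutativeRing R) → ∀ x y → x * - y ≈ - (y * x)
*-neg R = solve 2 (λ x y → x :* (:- y) := :- (y :* x)) (CommutativeRing.refl R)
  where open IntegerSolver R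

module Interpretation where
  open PowerSeries ℚ-ring using (module Prod; module Sum; _*_; _+_; _-_; _^_; _at_; _‼_; _≋_; *-cong; *-congʳ; *-congˡ; *-inv; +-cong; -_; Series; ^-congˡ; commutativeRing; const; fold-coeff; inv; monomial; monomial-cong; monomial-hit; monomial-miss; pointwise; q; q*-shift; refl; sum∞; sym; trans)
  open TripleProduct ℚ-ring using (-‿monomial; qProd)
  private
    module T = ThetaDissection ℚ-ring using (PB; L₂; PB-L₂)
    module S = CommutativeRing commutativeRing using (*-identityˡ; -‿cong)
    module Fℚ = FiniteFold (CommutativeRing.+-commutativeMonoid ℚ-ring) using (fold-cong; fold-extend; foldr-upTo)

  to : Defs.Series → Series
  to f ‼ n = f n

  to-⊛ : ∀ f g → to (f Defs.⊛ g) ≋ to f * to g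
  to-⊛ f g = pointwise λ n → Fℚ.foldr-upTo (λ i → f i ℚ.* g (n ∸ i)) (suc n)

  to-const : ∀ c → to (Defs.const c) ≋ const c
  to-const c = pointwise λ { zero → ≡.refl ; (suc n) → ≡.refl }

  to-^ : ∀ f n → to (f Defs.^S n) ≋ to f ^ n
  to-^ f zero    = to-const 1ℚ
  to-^ f (suc n) = trans (to-⊛ f _) (*-congˡ (to-^ f n))

  to-qS : ∀ f → to (Defs.qS f) ≋ q * to f
  to-qS f = trans (pointwise λ { zero → ≡.refl ; (suc n) → ≡.refl }) (sym (q*-shift (to f)))

  monomial-if : ∀ c e n → monomial c e ‼ n ≡ (if does (n ℕ.≟ e) then c else 0ℚ)
  monomial-if c e n = [ hit , miss ]′ (ℕ≟-cases n e)
    where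
    ℕ≟-cases : ∀ n e → n ≡ e ⊎ (n ≡ e → ⊥)
    ℕ≟-cases n e with n ℕ.≟ e
    ... | yes p = inj₁ p
    ... | no  p = inj₂ p
    decided : ∀ {t} → does (n ℕ.≟ e) ≡ t → (if t then c else 0ℚ) ≡ (if does (n ℕ.≟ e) then c else 0ℚ)
    decided p = ≡.cong (λ t → if t then c else 0ℚ) (≡.sym p)
    hit : n ≡ e → monomial c e ‼ n ≡ (if does (n ℕ.≟ e) then c else 0ℚ)
    hit p = ≡.trans (≡.trans (≡.cong (monomial c e ‼_) p) (monomial-hit c e)) (decided (dec-true (n ℕ.≟ e) p))
    miss : (n ≡ e → ⊥) → monomial c e ‼ n ≡ (if does (n ℕ.≟ e) then c else 0ℚ)
    miss p = ≡.trans (monomial-miss c e n p) (decided (dec-false (n ℕ.≟ e) p))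

  to-mono : ∀ e → to (Defs.mono e) ≋ monomial 1ℚ e
  to-mono e = pointwise λ n → ≡.sym (monomial-if 1ℚ e n)

  to-⊖ : ∀ f g → to (f Defs.⊖ g) ≋ to f - to g
  to-⊖ f g = pointwise λ _ → ≡.refl

  to-prodS : ∀ (g : ℕ → Defs.Series) n → to (Defs.prodS (map g (upTo n))) ≋ Prod.F.fold (λ i → to (g i)) n
  to-prodS g n = go (λ i → i) n
    where
    go : ∀ h n → to (Defs.prodS (map g (applyUpTo h n))) ≋ Prod.F.fold (λ i → to (g (h i))) n
    go h zero    = to-const 1ℚ
    go h (suc n) = trans (to-⊛ _ _) (*-congˡ (go (λ i → h (suc i)) n))

  to-qPoch : ∀ a d → to (Defs.qPoch a d) ≋ qProd 1ℚ a d
  to-qPoch a d = pointwise λ n → trans (to-prodS (λ i → Defs.oneS Defs.⊖ Defs.mono (a ℕ.+ d ℕ.* i)) (suc n))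
    (Prod.F.fold-cong (suc n) λ i → trans (to-⊖ Defs.oneS _) (+-cong (to-const 1ℚ) (S.-‿cong (to-mono (a ℕ.+ d ℕ.* i))))) at n

  to-invS : ∀ f → to (Defs.invS f) ≋ inv (to f)
  to-invS f = trans (pointwise λ n → ≡.trans (Fℚ.foldr-upTo (λ k → ((Defs.oneS Defs.⊖ f) Defs.^S k) n) (suc n))
      (≡.sym (fold-coeff (λ k → to ((Defs.oneS Defs.⊖ f) Defs.^S k)) (suc n) n)))
    (Sum.∞-cong λ k → trans (to-^ (Defs.oneS Defs.⊖ f) k) (^-congˡ k (trans (to-⊖ Defs.oneS f) (+-cong (to-const 1ℚ) refl))))

  divide : ∀ {f d} → to f ≋ d → d ‼ 0 ≡ 1ℚ → ∀ {g n} → to g ≋ n → d * to (g Defs.⊛ Defs.invS f) ≋ n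
  divide {f} {d} p h {g} {n} r = trans (*-congˡ (trans (to-⊛ g _) (*-cong r (to-invS f))))
    (trans (solve 3 (λ d n i → d :* (n :* i) := (d :* i) :* n) refl d n (inv (to f)))
    (trans (*-congʳ (trans (*-congʳ (sym p)) (*-inv (to f) (≡.trans (p at 0) h)))) (S.*-identityˡ n)))
    where open IntegerSolver commutativeRing

  private
    w : ℕ → ℚ
    w m = SemiringExp._^_ (CommutativeRing.semiring ℚ-ring) (ℚ.- 1ℚ) m

    fromℕ : ℕ → ℚ
    fromℕ = IntegerMultiples.fromℕ ℚ-ring

    sign-w : ∀ n → Defs.signℤ (+ n) ≡ w n
    sign-w zero          = ≡.refl
    sign-w (suc zero)    = ≡.refl
    sign-w (suc (suc n)) = ≡.trans (≡.cong (λ k → if does (k ℕ.≟ 0) then 1ℚ else ℚ.- 1ℚ)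
        (≡.trans (≡.cong (ℕ._% 2) (ℕₚ.+-comm 2 n)) (DivMod.[m+n]%n≡m%n n 2)))
      (≡.trans (sign-w n) (negate-twice (w n)))
      where
      negate-twice : ∀ x → x ≡ (ℚ.- 1ℚ) ℚ.* ((ℚ.- 1ℚ) ℚ.* x)
      negate-twice x = ≡.sym (neg-neg ℚ-ring x)

    ℕ→ℚ-fromℕ : ∀ n → Defs.ℕ→ℚ n ≡ fromℕ n
    ℕ→ℚ-fromℕ zero    = ≡.refl
    ℕ→ℚ-fromℕ (suc n) = ≡.trans (ℕ→ℚ-+ 1 n) (≡.trans (≡.cong (1ℚ ℚ.+_) (ℕ→ℚ-fromℕ n)) (≡.sym (IntegerMultiples.fromℕ-suc ℚ-ring n)))

    tri-double : ∀ n → 2 ℕ.* tri n ℕ.+ n ≡ n ℕ.* n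
    tri-double zero    = ≡.refl
    tri-double (suc n) = ≡.trans (N.solve 2 (λ n t → N.con 2 N.:* (n N.:+ t) N.:+ (N.con 1 N.:+ n) N.:= (N.con 2 N.:* t N.:+ n) N.:+ (n N.:+ n N.:+ N.con 1)) ≡.refl n (tri n))
      (≡.trans (≡.cong (ℕ._+ (n ℕ.+ n ℕ.+ 1)) (tri-double n)) (N.solve 1 (λ n → n N.:* n N.:+ (n N.:+ n N.:+ N.con 1) N.:= (N.con 1 N.:+ n) N.:* (N.con 1 N.:+ n)) ≡.refl n))
      where module N = +-*-Solver

    exponent⁺ : ∀ n → n ℕ.* (5 ℕ.* n ℕ.+ 1) ≡ 2 ℕ.* (5 ℕ.* tri n ℕ.+ 3 ℕ.* n)
    exponent⁺ n = ≡.trans (N.solve 1 (λ n → n N.:* (N.con 5 N.:* n N.:+ N.con 1) N.:= N.con 5 N.:* (n N.:* n) N.:+ n) ≡.refl n)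
      (≡.trans (≡.cong (λ s → 5 ℕ.* s ℕ.+ n) (≡.sym (tri-double n)))
        (N.solve 2 (λ n t → N.con 5 N.:* (N.con 2 N.:* t N.:+ n) N.:+ n N.:= N.con 2 N.:* (N.con 5 N.:* t N.:+ N.con 3 N.:* n)) ≡.refl n (tri n)))
      where module N = +-*-Solver

    exponent⁻ : ∀ n → suc n ℕ.* (5 ℕ.* n ℕ.+ 4) ≡ 2 ℕ.* (5 ℕ.* tri (suc n) ℕ.+ 2 ℕ.* suc n)
    exponent⁻ n = ≡.trans (N.solve 1 (λ n → (N.con 1 N.:+ n) N.:* (N.con 5 N.:* n N.:+ N.con 4) N.:= N.con 5 N.:* (n N.:* n) N.:+ (N.con 9 N.:* n N.:+ N.con 4)) ≡.refl n)
      (≡.trans (≡.cong (λ s → 5 ℕ.* s ℕ.+ (9 ℕ.* n ℕ.+ 4)) (≡.sym (tri-double n)))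
        (N.solve 2 (λ n t → N.con 5 N.:* (N.con 2 N.:* t N.:+ n) N.:+ (N.con 9 N.:* n N.:+ N.con 4) N.:= N.con 2 N.:* (N.con 5 N.:* (n N.:+ t) N.:+ N.con 2 N.:* (N.con 1 N.:+ n))) ≡.refl n (tri n)))
      where module N = +-*-Solver

    square⁺ : ∀ n → + n ℤ.* (+ 5 ℤ.* + n ℤ.+ + 1) ≡ + (2 ℕ.* (5 ℕ.* tri n ℕ.+ 3 ℕ.* n))
    square⁺ n = ≡.trans (≡.sym (≡.trans (ℤₚ.pos-* n (5 ℕ.* n ℕ.+ 1)) (≡.cong (λ i → + n ℤ.* (i ℤ.+ + 1)) (ℤₚ.pos-* 5 n)))) (≡.cong +_ (exponent⁺ n))

    square⁻ : ∀ n → -[1+ n ] ℤ.* (+ 5 ℤ.* -[1+ n ] ℤ.+ + 1) ≡ + (2 ℕ.* (5 ℕ.* tri (suc n) ℕ.+ 2 ℕ.* suc n))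
    square⁻ n = ≡.trans (Z.solve 1 (λ x → (Z.:- (Z.con (+ 1) Z.:+ x)) Z.:* (Z.con (+ 5) Z.:* (Z.:- (Z.con (+ 1) Z.:+ x)) Z.:+ Z.con (+ 1)) Z.:=
        (Z.con (+ 1) Z.:+ x) Z.:* (Z.con (+ 5) Z.:* x Z.:+ Z.con (+ 4))) ≡.refl (+ n))
      (≡.trans (≡.sym (≡.trans (ℤₚ.pos-* (suc n) (5 ℕ.* n ℕ.+ 4)) (≡.cong (λ i → + suc n ℤ.* (i ℤ.+ + 4)) (ℤₚ.pos-* 5 n)))) (≡.cong +_ (exponent⁻ n)))
      where module Z = ℤSolver.+-*-Solver

    selected-exponent : ∀ {i e} N c → i ≡ + (2 ℕ.* e) → (if does (i ℤ.≟ + (2 ℕ.* N)) then c else 0ℚ) ≡ monomial c e ‼ N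
    selected-exponent {i} {e} N c p with i ℤ.≟ + (2 ℕ.* N)
    ... | yes r = ≡.sym (≡.trans (≡.cong (monomial c e ‼_) (ℕₚ.*-cancelˡ-≡ N e 2 (ℤₚ.+-injective (≡.trans (≡.sym r) p)))) (monomial-hit c e))
    ... | no ¬r = ≡.sym (monomial-miss c e N λ s → ¬r (≡.trans p (≡.cong (λ k → + (2 ℕ.* k)) (≡.sym s))))

    term⁺ term⁻ : ℕ → Series
    term⁺ m = monomial (fromℕ m ℚ.* w m) (5 ℕ.* tri m ℕ.+ 3 ℕ.* m)
    term⁻ m = monomial (fromℕ m ℚ.* w m) (5 ℕ.* tri m ℕ.+ 2 ℕ.* m)

    Sterm⁺ : ∀ N n → Defs.Sterm N (+ n) ≡ term⁺ n ‼ N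
    Sterm⁺ N n = ≡.trans (selected-exponent {e = 5 ℕ.* tri n ℕ.+ 3 ℕ.* n} N (Defs.signℤ (+ n) ℚ.* Defs.ℤ→ℚ (+ n)) (square⁺ n))
      (monomial-cong (5 ℕ.* tri n ℕ.+ 3 ℕ.* n) (≡.trans (≡.cong₂ ℚ._*_ (sign-w n) (ℕ→ℚ-fromℕ n)) (ℚₚ.*-comm (w n) (fromℕ n))) at N)

    Sterm⁻ : ∀ N n → Defs.Sterm N -[1+ n ] ≡ ℚ.- (term⁻ (suc n) ‼ N)
    Sterm⁻ N n = ≡.trans (selected-exponent {e = 5 ℕ.* tri (suc n) ℕ.+ 2 ℕ.* suc n} N (Defs.signℤ -[1+ n ] ℚ.* Defs.ℤ→ℚ -[1+ n ]) (square⁻ n))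
      (≡.trans (monomial-cong (5 ℕ.* tri (suc n) ℕ.+ 2 ℕ.* suc n) value at N)
        (≡.sym (-‿monomial (fromℕ (suc n) ℚ.* w (suc n)) (5 ℕ.* tri (suc n) ℕ.+ 2 ℕ.* suc n) at N)))
      where
      value : Defs.signℤ -[1+ n ] ℚ.* Defs.ℤ→ℚ -[1+ n ] ≡ ℚ.- (fromℕ (suc n) ℚ.* w (suc n))
      value = ≡.trans (≡.cong₂ (λ s t → s ℚ.* ℚ.- t) (sign-w (suc n)) (ℕ→ℚ-fromℕ (suc n))) (*-neg ℚ-ring (w (suc n)) (fromℕ (suc n)))

  to-S : to Defs.S ≋ T.PB * T.L₂
  to-S = trans (pointwise coefficient) (sym T.PB-L₂)
    where
    coefficient : ∀ N → Defs.S N ≡ (sum∞ term⁺ - sum∞ (λ m → term⁻ (suc m))) ‼ N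
    coefficient N = ≡.cong₂ ℚ._+_
      (≡.trans (Fℚ.foldr-upTo (λ i → Defs.Sterm N (+ i)) (suc N))
        (≡.trans (Fℚ.fold-cong (suc N) (Sterm⁺ N)) (≡.sym (fold-coeff term⁺ (suc N) N))))
      (≡.trans (Fℚ.foldr-upTo (λ i → Defs.Sterm N -[1+ i ]) N)
        (≡.trans (Fℚ.fold-cong N (Sterm⁻ N))
        (≡.trans (≡.sym (FoldHom.fold-homo (CommutativeRing.+-commutativeMonoid ℚ-ring) (CommutativeRing.+-commutativeMonoid ℚ-ring)
            ℚ.-_ ≡.refl ℚₚ.neg-distrib-+ (λ i → term⁻ (suc i) ‼ N) N))
        (≡.cong ℚ.-_ (≡.sym (≡.trans (fold-coeff (λ m → term⁻ (suc m)) (suc N) N)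
          (Fℚ.fold-extend {λ i → term⁻ (suc i) ‼ N} (ℕₚ.n≤1+n N) λ i N≤i → monomial-miss _ _ N λ s →
             ℕₚ.<⇒≢ (ℕₚ.≤-trans (s≤s N≤i) (ℕₚ.≤-trans (ℕₚ.m≤n*m (suc i) 2) (ℕₚ.m≤n+m _ (5 ℕ.* tri (suc i))))) s)))))))

halve : (R : CommutativeRing 0ℓ 0ℓ) (let open CommutativeRing R) (let open IntegerMultiples R using (fromℤ)) → ∀ h → h + h ≈ 1# → ∀ X x y z u v →
  X + X ≈ x - y - fromℤ (+ 10) * z + fromℤ (+ 15) * u - fromℤ (+ 5) * v →
  X ≈ h * x - h * y - fromℤ (+ 5) * z + (fromℤ (+ 15) * h) * u - (fromℤ (+ 5) * h) * v
halve R h h+h≈1 X x y z u v p = begin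
  X                 ≈⟨ *-identityˡ X ⟨
  1# * X            ≈⟨ *-congʳ h+h≈1 ⟨
  (h + h) * X       ≈⟨ solve 2 (λ h x → (h :+ h) :* x := h :* (x :+ x)) refl h X ⟩
  h * (X + X)       ≈⟨ *-congˡ p ⟩
  h * (x - y - fromℤ (+ 10) * z + fromℤ (+ 15) * u - fromℤ (+ 5) * v)
    ≈⟨ solve 6 (λ h x y z u v → h :* (x :- y :- con (+ 10) :* z :+ con (+ 15) :* u :- con (+ 5) :* v) :=
         h :* x :- h :* y :- (h :+ h) :* (con (+ 5) :* z) :+ (con (+ 15) :* h) :* u :- (con (+ 5) :* h) :* v) refl h x y z u v ⟩
  h * x - h * y - (h + h) * (fromℤ (+ 5) * z) + (fromℤ (+ 15) * h) * u - (fromℤ (+ 5) * h) * v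
    ≈⟨ +-congʳ (+-congʳ (+-congˡ (-‿cong (trans (*-congʳ h+h≈1) (*-identityˡ _))))) ⟩
  h * x - h * y - fromℤ (+ 5) * z + (fromℤ (+ 15) * h) * u - (fromℤ (+ 5) * h) * v ∎
  where
  open CommutativeRing R using (*-identityˡ; setoid; *-congʳ; *-congˡ; +-congʳ; +-congˡ; -‿cong; trans; refl; 1#; _+_; _*_; _-_)
  open IntegerMultiples R using (fromℤ)
  open IntegerSolver R
  open SetoidReasoning setoid

module Conclusion (ext : CyclotomicExtension ℚ-ring) where
  open PowerSeries ℚ-ring using (_*_; _+_; _-_; _^_; _at_; _‼_; _∙_; _≋_; *-cong; *-congʳ; *-congˡ; +-cong; +-congˡ; -_; 1#; Series; ^-congˡ; commutativeRing; const; const-*; pointwise; q; sym; trans; ∙-cong)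
  open Interpretation using (divide; to; to-S; to-^; to-const; to-qPoch; to-qS; to-⊛)
  open IntegerMultiples commutativeRing using (fromℤ)
  private
    module S = CommutativeRing commutativeRing using (*-assoc; *-identityʳ; *-identityˡ; -‿cong)
    module D = Descent ext using (F≋0; G≋0; PE*P₅)
    module CGF = CrankGeneratingFunction ext using (crankSeries; crankSeries-*; LHS-crankSeries)
    module VQ = QuinticSections ℚ-ring using (U)
    module M = ModularRelation ℚ-ring using (A; A-head; B; B-head; ^-head; e)
    module QA = QuinticAlgebra ℚ-ring using (*-head; qProd-head; ε)
    module IQ = IntegerMultiples ℚ-ring using (fromℤ)

    scale : ∀ k f → fromℤ k * f ≋ IQ.fromℤ k ∙ f
    scale k f = trans (*-congʳ (sym (ConstantMultiples.const-fromℤ ℚ-ring k))) (const-* (IQ.fromℤ k) f)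

    cancel-3 : ∀ {f g} → fromℤ (+ 3) * f ≋ fromℤ (+ 3) * g → f ≋ g
    cancel-3 {f} {g} p = trans (sym (third f)) (trans (*-congˡ p) (third g))
      where
      third : ∀ f → const (+ 1 / 3) * (fromℤ (+ 3) * f) ≋ f
      third f = trans (sym (S.*-assoc _ _ _)) (trans (*-congʳ (trans (const-* (+ 1 / 3) (fromℤ (+ 3)))
        (pointwise λ { zero → ≡.refl ; (suc n) → ≡.refl }))) (S.*-identityˡ f))

    A≋ : to Defs.A ≋ M.A
    A≋ = trans (to-⊛ (Defs.qPoch 1 5) (Defs.qPoch 4 5)) (*-cong (to-qPoch 1 5) (to-qPoch 4 5))

    B≋ : to Defs.B ≋ M.B
    B≋ = trans (to-⊛ (Defs.qPoch 2 5) (Defs.qPoch 3 5)) (*-cong (to-qPoch 2 5) (to-qPoch 3 5))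

    E₁≋ : to Defs.E₁ ≋ QA.ε
    E₁≋ = to-qPoch 1 1

    E₅≋ : to Defs.E₅ ≋ M.e
    E₅≋ = to-qPoch 5 5

    ε-head : QA.ε ‼ 0 ≡ 1ℚ
    ε-head = QA.qProd-head 1ℚ 1 1

    power : ∀ {f g} n → to f ≋ g → to (f Defs.^S n) ≋ g ^ n
    power {f} n p = trans (to-^ f n) (^-congˡ n p)

    times : ∀ {f g f′ g′} → to f ≋ f′ → to g ≋ g′ → to (f Defs.⊛ g) ≋ f′ * g′
    times {f} {g} p r = trans (to-⊛ f g) (*-cong p r)

    εA-head : ∀ k l → (QA.ε ^ k * M.A ^ l) ‼ 0 ≡ 1ℚ
    εA-head k l = QA.*-head (QA.ε ^ k) (M.A ^ l) (M.^-head QA.ε ε-head k) (M.^-head M.A M.A-head l)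

    S₁ S₂ S₃ S₄ S₅ S₆ : Defs.Series
    S₁ = Defs.B Defs.⊛ Defs.E₅ Defs.⊛ Defs.invS (Defs.A Defs.^S 3)
    S₂ = Defs.B Defs.⊛ (Defs.E₅ Defs.^S 2) Defs.⊛ Defs.invS ((Defs.E₁ Defs.^S 5) Defs.⊛ (Defs.A Defs.^S 3))
    S₃ = Defs.B Defs.⊛ (Defs.E₅ Defs.^S 2) Defs.⊛ Defs.invS ((Defs.E₁ Defs.^S 6) Defs.⊛ (Defs.A Defs.^S 2))
    S₄ = Defs.B Defs.⊛ (Defs.E₅ Defs.^S 7) Defs.⊛ Defs.invS ((Defs.E₁ Defs.^S 6) Defs.⊛ (Defs.A Defs.^S 3))
    S₅ = (Defs.A Defs.^S 5) Defs.⊛ Defs.invS (Defs.B Defs.^S 5)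
    S₆ = (Defs.E₅ Defs.^S 5) Defs.⊛ Defs.invS ((Defs.E₁ Defs.^S 6) Defs.⊛ Defs.B)

    factor₄ : Defs.Series
    factor₄ = ((+ 4 / 1) Defs.· Defs.oneS) Defs.⊕ ((+ 3 / 1) Defs.· Defs.qS S₅)

    S₁-def : M.A ^ 3 * to S₁ ≋ M.B * M.e
    S₁-def = divide (power 3 A≋) (M.^-head M.A M.A-head 3) (times B≋ E₅≋)

    S₂-def : (QA.ε ^ 5 * M.A ^ 3) * to S₂ ≋ M.B * M.e ^ 2
    S₂-def = divide (times (power 5 E₁≋) (power 3 A≋)) (εA-head 5 3) (times B≋ (power 2 E₅≋))

    S₃-def : (QA.ε ^ 6 * M.A ^ 2) * to S₃ ≋ M.B * M.e ^ 2
    S₃-def = divide (times (power 6 E₁≋) (power 2 A≋)) (εA-head 6 2) (times B≋ (power 2 E₅≋))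

    S₄-def : (QA.ε ^ 6 * M.A ^ 3) * to S₄ ≋ M.B * M.e ^ 7
    S₄-def = divide (times (power 6 E₁≋) (power 3 A≋)) (εA-head 6 3) (times B≋ (power 7 E₅≋))

    S₅-def : M.B ^ 5 * to S₅ ≋ M.A ^ 5
    S₅-def = divide (power 5 B≋) (M.^-head M.B M.B-head 5) (power 5 A≋)

    S₆-def : (QA.ε ^ 6 * M.B) * to S₆ ≋ M.e ^ 5
    S₆-def = divide (times (power 6 E₁≋) B≋) (QA.*-head (QA.ε ^ 6) M.B (M.^-head QA.ε ε-head 6) M.B-head) (power 5 E₅≋)

    X : Series
    X = CGF.crankSeries

    doubled : VQ.U 0 X + VQ.U 0 X ≋ to S₁ - to S₂ - fromℤ (+ 10) * (to S₃ * to Defs.S)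
      + fromℤ (+ 15) * ((q * to S₄) * (fromℤ (+ 4) + fromℤ (+ 3) * (q * to S₅))) - fromℤ (+ 5) * (q * to S₆)
    doubled = ModularRelation.Evaluation.evaluation ℚ-ring D.F≋0 D.G≋0 D.PE*P₅ cancel-3 X CGF.crankSeries-*
      S₁-def S₂-def S₃-def S₄-def S₅-def S₆-def to-S

    third-term : fromℤ (+ 10) * (to S₃ * to Defs.S) ≋ IQ.fromℤ (+ 10) ∙ to (S₃ Defs.⊛ Defs.S)
    third-term = trans (scale (+ 10) _) (∙-cong ≡.refl (sym (to-⊛ S₃ Defs.S)))

    factor₄≋ : to factor₄ ≋ fromℤ (+ 4) + fromℤ (+ 3) * (q * to S₅)
    factor₄≋ = trans (pointwise λ _ → ≡.refl) (+-cong
      (trans (trans (∙-cong {d = + 4 / 1} ≡.refl (to-const 1ℚ)) (sym (scale (+ 4) 1#))) (S.*-identityʳ _))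
      (trans (∙-cong {d = + 3 / 1} ≡.refl (to-qS S₅)) (sym (scale (+ 3) (q * to S₅)))))

    fourth-term : fromℤ (+ 15) * ((q * to S₄) * (fromℤ (+ 4) + fromℤ (+ 3) * (q * to S₅))) ≋ IQ.fromℤ (+ 15) ∙ to (Defs.qS S₄ Defs.⊛ factor₄)
    fourth-term = trans (scale (+ 15) _) (∙-cong ≡.refl (sym (trans (to-⊛ (Defs.qS S₄) factor₄) (*-cong (to-qS S₄) factor₄≋))))

    fifth-term : fromℤ (+ 5) * (q * to S₆) ≋ IQ.fromℤ (+ 5) ∙ to (Defs.qS S₆)
    fifth-term = trans (scale (+ 5) _) (∙-cong ≡.refl (sym (to-qS S₆)))

    doubled-coeff : ∀ n → VQ.U 0 X ‼ n ℚ.+ VQ.U 0 X ‼ n ≡ S₁ n ℚ.- S₂ n ℚ.- IQ.fromℤ (+ 10) ℚ.* (S₃ Defs.⊛ Defs.S) n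
      ℚ.+ IQ.fromℤ (+ 15) ℚ.* (Defs.qS S₄ Defs.⊛ factor₄) n ℚ.- IQ.fromℤ (+ 5) ℚ.* Defs.qS S₆ n
    doubled-coeff n = trans doubled (+-cong (+-cong (+-congˡ (S.-‿cong third-term)) fourth-term) (S.-‿cong fifth-term)) at n

  section-RHS : ∀ n → VQ.U 0 X ‼ n ≡ Defs.RHS n
  section-RHS n = halve ℚ-ring (+ 1 / 2) ≡.refl (VQ.U 0 X ‼ n) (S₁ n) (S₂ n) ((S₃ Defs.⊛ Defs.S) n) ((Defs.qS S₄ Defs.⊛ factor₄) n) (Defs.qS S₆ n) (doubled-coeff n)

  LHS-RHS : ∀ n → Defs.LHS n ≡ Defs.RHS n
  LHS-RHS n = ≡.trans (CGF.LHS-crankSeries n)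
    (≡.trans (≡.cong (X ‼_) (≡.trans (ℕₚ.*-comm 5 n) (≡.sym (ℕₚ.+-identityʳ (n ℕ.* 5))))) (section-RHS n))

unitriangular : (R : CommutativeRing 0ℓ 0ℓ) (let open CommutativeRing R) (x y : Carrier) →
  0# * x + - 1# * y ≈ 0# → - 1# * x + 1# * y ≈ 0# → x ≈ 0# × y ≈ 0#
unitriangular R x y p r = x≈0 , y≈0
  where
  open CommutativeRing R using (_≈_; +-cong; -‿cong; 0#; refl; trans)
  open IntegerSolver R using (_:*_; _:+_; _:-_; _:=_; :-_; con; solve)
  y≈0 : y ≈ 0#
  y≈0 = trans (solve 2 (λ x y → y := :- (con (+ 0) :* x :+ (:- con (+ 1)) :* y)) refl x y)
    (trans (-‿cong p) (solve 0 (:- con (+ 0) := con (+ 0)) refl))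
  x≈0 : x ≈ 0#
  x≈0 = trans (solve 2 (λ x y → x := y :- ((:- con (+ 1)) :* x :+ con (+ 1) :* y)) refl x y)
    (trans (+-cong y≈0 (-‿cong r)) (solve 0 (con (+ 0) :- con (+ 0) := con (+ 0)) refl))

-- ℚ(ζ) is built as ℚ(η)(ζ) with η = ζ + ζ⁻¹, η² = 1 − η and ζ² = ηζ − 1.
module FifthCyclotomicField where
  private
    module K₁ = QuadraticExtension ℚ-ring (ℚ.- 1ℚ) 1ℚ using (_+θ_; _,_; Carrier; commutativeRing; im; im≈; re; re≈)
    module K₁R = CommutativeRing K₁.commutativeRing using (-_; 1#)

    η : K₁.Carrier
    η = 0ℚ K₁.+θ 1ℚ

    module K₀ = QuadraticExtension K₁.commutativeRing η (K₁R.- K₁R.1#) using (_+θ_; _,_; Carrier; commutativeRing; im; im≈; re; re≈)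
    module K = CommutativeRing K₀.commutativeRing using (Carrier; _≈_; _+_; _*_; _-_; -_; 0#; 1#; trans; sym; refl; *-cong; *-congˡ; *-congʳ; *-comm; +-cong; +-congʳ; -‿cong)

    ι : RingHom ℚ-ring K₀.commutativeRing
    ι = Embedding.embed K₁.commutativeRing η (K₁R.- K₁R.1#) ∘ₕ Embedding.embed ℚ-ring (ℚ.- 1ℚ) 1ℚ

    ζ ζ′ ζ² ζ′² unit₁ unit₂ : K₀.Carrier
    ζ     = (0ℚ K₁.+θ 0ℚ) K₀.+θ (1ℚ K₁.+θ 0ℚ)
    ζ′    = (0ℚ K₁.+θ 1ℚ) K₀.+θ (ℚ.- 1ℚ K₁.+θ 0ℚ)
    ζ²    = (ℚ.- 1ℚ K₁.+θ 0ℚ) K₀.+θ (0ℚ K₁.+θ 1ℚ)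
    ζ′²   = (0ℚ K₁.+θ ℚ.- 1ℚ) K₀.+θ (0ℚ K₁.+θ ℚ.- 1ℚ)
    unit₁ = (+ 3 / 5 K₁.+θ + 1 / 5) K₀.+θ (-[1+ 2 ] / 5 K₁.+θ -[1+ 0 ] / 5)
    unit₂ = (+ 4 / 5 K₁.+θ -[1+ 1 ] / 5) K₀.+θ (+ 1 / 5 K₁.+θ -[1+ 2 ] / 5)

    pattern ok = (≡.refl K₁., ≡.refl) K₀., (≡.refl K₁., ≡.refl)

    ζζ≈ζ² : ζ K.* ζ K.≈ ζ²
    ζζ≈ζ² = ok

    ζ′ζ′≈ζ′² : ζ′ K.* ζ′ K.≈ ζ′²
    ζ′ζ′≈ζ′² = ok

    ζζ′≈1 : ζ K.* ζ′ K.≈ K.1#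
    ζζ′≈1 = ok

    ζ′ζ′²≈ζ² : ζ′ K.* ζ′² K.≈ ζ²
    ζ′ζ′²≈ζ² = ok

    ζ′³≈ζ² : ζ′ K.* (ζ′ K.* ζ′) K.≈ ζ K.* ζ
    ζ′³≈ζ² = K.trans (K.*-congˡ {ζ′} {ζ′ K.* ζ′} {ζ′²} ζ′ζ′≈ζ′²) (K.trans ζ′ζ′²≈ζ² (K.sym {ζ K.* ζ} {ζ²} ζζ≈ζ²))

    sum≈0 : K.1# K.+ ζ K.+ ζ′ K.+ ζ² K.+ ζ′² K.≈ K.0#
    sum≈0 = ok

    cyclotomic : K.1# K.+ ζ K.+ ζ′ K.+ ζ K.* ζ K.+ ζ′ K.* ζ′ K.≈ K.0#
    cyclotomic = K.trans (K.+-cong {K.1# K.+ ζ K.+ ζ′ K.+ ζ K.* ζ} {K.1# K.+ ζ K.+ ζ′ K.+ ζ²} {ζ′ K.* ζ′} {ζ′²}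
      (K.+-cong {K.1# K.+ ζ K.+ ζ′} {K.1# K.+ ζ K.+ ζ′} {ζ K.* ζ} {ζ²} K.refl ζζ≈ζ²) ζ′ζ′≈ζ′²) sum≈0

    isUnit₁ : unit₁ K.* (K.1# K.- ζ′) K.≈ K.1#
    isUnit₁ = ok

    difference : K.1# K.- ζ′ K.* ζ′ K.≈ K.1# K.- ζ′²
    difference = K.+-cong {K.1#} {K.1#} {K.- (ζ′ K.* ζ′)} {K.- ζ′²} K.refl (K.-‿cong {ζ′ K.* ζ′} {ζ′²} ζ′ζ′≈ζ′²)

    unit₂-value : unit₂ K.* (K.1# K.- ζ′²) K.≈ K.1#
    unit₂-value = ok

    isUnit₂ : unit₂ K.* (K.1# K.- ζ′ K.* ζ′) K.≈ K.1#
    isUnit₂ = K.trans (K.*-congˡ {unit₂} {K.1# K.- ζ′ K.* ζ′} {K.1# K.- ζ′²} difference) unit₂-value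

    open K₀ using (re; im)
    open RingHom ι using (φ)
    module E₀ = Embedding K₁.commutativeRing η (K₁R.- K₁R.1#) using (im-*-embed; re-*-embed)
    module E₁ = Embedding ℚ-ring (ℚ.- 1ℚ) 1ℚ using (im-*-embed; re-*-embed)
    open IntegerSolver ℚ-ring using (solve; _:=_; _:+_; _:*_)

    coord : K₀.Carrier → ℚ
    coord x = K₁.re (im x) ℚ.+ (K₁.im (im x) ℚ.+ K₁.im (im x))

    coord-cong : ∀ {x y} → x K.≈ y → coord x ≡ coord y
    coord-cong p = ≡.cong₂ (λ s t → s ℚ.+ (t ℚ.+ t)) (K₁.re≈ (K₀.im≈ p)) (K₁.im≈ (K₀.im≈ p))

    coord-+ : ∀ x y → coord (x K.+ y) ≡ coord x ℚ.+ coord y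
    coord-+ x y = solve 4 (λ a b c d → (a :+ c) :+ ((b :+ d) :+ (b :+ d)) := (a :+ (b :+ b)) :+ (c :+ (d :+ d))) ≡.refl
      (K₁.re (im x)) (K₁.im (im x)) (K₁.re (im y)) (K₁.im (im y))

    rere : ∀ k x → K₁.re (re (k K.* φ x)) ≡ K₁.re (re k) ℚ.* x
    rere k x = ≡.trans (K₁.re≈ (E₀.re-*-embed k (x K₁.+θ 0ℚ))) (E₁.re-*-embed (re k) x)

    imre : ∀ k x → K₁.im (re (k K.* φ x)) ≡ K₁.im (re k) ℚ.* x
    imre k x = ≡.trans (K₁.im≈ (E₀.re-*-embed k (x K₁.+θ 0ℚ))) (E₁.im-*-embed (re k) x)

    reim : ∀ k x → K₁.re (im (k K.* φ x)) ≡ K₁.re (im k) ℚ.* x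
    reim k x = ≡.trans (K₁.re≈ (E₀.im-*-embed k (x K₁.+θ 0ℚ))) (E₁.re-*-embed (im k) x)

    imim : ∀ k x → K₁.im (im (k K.* φ x)) ≡ K₁.im (im k) ℚ.* x
    imim k x = ≡.trans (K₁.im≈ (E₀.im-*-embed k (x K₁.+θ 0ℚ))) (E₁.im-*-embed (im k) x)

    coord-*ι : ∀ k x → coord (k K.* φ x) ≡ coord k ℚ.* x
    coord-*ι k x = ≡.trans (≡.cong₂ (λ s t → s ℚ.+ (t ℚ.+ t)) (reim k x) (imim k x))
      (solve 3 (λ r i x → r :* x :+ (i :* x :+ i :* x) := (r :+ (i :+ i)) :* x) ≡.refl (K₁.re (im k)) (K₁.im (im k)) x)

    coord-ι* : ∀ x k → coord (φ x K.* k) ≡ x ℚ.* coord k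
    coord-ι* x k = ≡.trans (coord-cong (K.*-comm (φ x) k)) (≡.trans (coord-*ι k x) (ℚₚ.*-comm _ x))

    s₂≈ : ζ K.* ζ K.- ζ′ K.* ζ′ K.≈ ζ² K.- ζ′²
    s₂≈ = K.+-cong {ζ K.* ζ} {ζ²} {K.- (ζ′ K.* ζ′)} {K.- ζ′²} ζζ≈ζ² (K.-‿cong {ζ′ K.* ζ′} {ζ′²} ζ′ζ′≈ζ′²)

    independent : ∀ x y → (ζ K.- ζ′) K.* φ x K.+ (ζ K.* ζ K.- ζ′ K.* ζ′) K.* φ y K.≈ K.0# → x ≡ 0ℚ × y ≡ 0ℚ
    independent x y p = unitriangular ℚ-ring x y
      (≡.trans (≡.sym (≡.cong₂ ℚ._+_ (rere (ζ K.- ζ′) x) (rere (ζ² K.- ζ′²) y))) (K₁.re≈ (K₀.re≈ r)))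
      (≡.trans (≡.sym (≡.cong₂ ℚ._+_ (imre (ζ K.- ζ′) x) (imre (ζ² K.- ζ′²) y))) (K₁.im≈ (K₀.re≈ r)))
      where
      r : (ζ K.- ζ′) K.* φ x K.+ (ζ² K.- ζ′²) K.* φ y K.≈ K.0#
      r = K.trans (K.+-cong {(ζ K.- ζ′) K.* φ x} {(ζ K.- ζ′) K.* φ x} {(ζ² K.- ζ′²) K.* φ y} {(ζ K.* ζ K.- ζ′ K.* ζ′) K.* φ y} K.refl
        (K.*-congʳ {φ y} {ζ² K.- ζ′²} {ζ K.* ζ K.- ζ′ K.* ζ′} (K.sym {ζ K.* ζ K.- ζ′ K.* ζ′} {ζ² K.- ζ′²} s₂≈))) p

    coord-ζ² : coord (ζ K.* ζ) ≡ 1ℚ ℚ.+ 1ℚ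
    coord-ζ² = coord-cong {ζ K.* ζ} {ζ²} ζζ≈ζ²

    coord-ζ′² : coord (ζ′ K.* ζ′) ≡ ℚ.- (1ℚ ℚ.+ 1ℚ)
    coord-ζ′² = coord-cong {ζ′ K.* ζ′} {ζ′²} ζ′ζ′≈ζ′²

  extension : CyclotomicExtension ℚ-ring
  extension = record
    { extension = K₀.commutativeRing ; ι = ι ; ζ = ζ ; ζ′ = ζ′ ; unit₁ = unit₁ ; unit₂ = unit₂
    ; ζζ′≈1 = ζζ′≈1 ; ζ′³≈ζ² = ζ′³≈ζ² ; cyclotomic = cyclotomic ; isUnit₁ = isUnit₁ ; isUnit₂ = isUnit₂
    ; ι-injective = λ p → K₁.re≈ (K₀.re≈ p) ; independent = independent
    ; coord = coord ; coord-cong = λ {x} {y} → coord-cong {x} {y} ; coord-+ = coord-+ ; coord-ι* = coord-ι*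
    ; coord-1 = ≡.refl ; coord-ζ = ≡.refl ; coord-ζ² = coord-ζ² ; coord-ζ′² = coord-ζ′² ; coord-ζ′ = ≡.refl }

open import Defs

theorem1p2 : (n : ℕ) → LHS n ≡ RHS n
theorem1p2 = Conclusion.LHS-RHS FifthCyclotomicField.extension
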